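{- Let $k \geq 2$ be an integer and let $G$ be a graph with $n := |G| \geq 4k$ vertices and $\sigma_2(G) \geq 6k-2$. Then $G$ does not contain $k$ vertex-disjoint chorded cycles if and only if $G \in \{G_1(n,k), G_2(k)\}$.
   Context: All graphs are finite and simple. For a non-complete graph $G$, $\sigma_2(G) := \min\{d_G(x)+d_G(y) : x,y \in V(G),\ x \neq y,\ xy \notin E(G)\}$ is the minimum degree-sum over pairs of distinct nonadjacent vertices. A chorded cycle is a cycle in $G$ together with at least one edge of $G$ joining two vertices of the cycle that are not consecutive on it. For $n \geq 6k-2$, $G_1(n,k) := K_{3k-1,\,n-3k+1}$ (complete bipartite graph); for $k \geq 2$, $G_2(k) := K_{3k-2,\,3k-2,\,1}$ (complete tripartite graph with parts of sizes $3k-2$, $3k-2$, $1$). -}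

module Defs where

open import Data.Nat using (ℕ; zero; suc; _+_; _*_; _∸_; _≤_; _<_)
open import Data.Nat.Properties using (_<?_)
open import Data.Bool using (Bool; true; false; if_then_else_; not)
open import Data.Fin using (Fin; toℕ; inject₁; fromℕ) renaming (zero to fzero; suc to fsuc)
open import Data.List using (map; allFin)
open import Data.Nat.ListAction using (sum)
open import Data.Product using (Σ; ∃; _×_; _,_)
open import Relation.Nullary using (¬_; does)
open import Relation.Binary.PropositionalEquality using (_≡_; _≢_; refl; cong)
import Data.Nat
open import Function.Definitions using (Injective)

record Graph (n : ℕ) : Set where
  field
    E      : Fin n → Fin n → Bool
    E-sym  : ∀ x y → E x y ≡ E y x
    E-irr  : ∀ x → E x x ≡ false

open Graph public

Adj : ∀ {n} → Graph n → Fin n → Fin n → Set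
Adj G x y = E G x y ≡ true

deg : ∀ {n} → Graph n → Fin n → ℕ
deg {n} G x = sum (map (λ y → if E G x y then 1 else 0) (allFin n))

-- σ₂(G) ≥ s : every pair of distinct nonadjacent vertices has degree sum ≥ s
-- (vacuous for complete graphs).
σ₂≥ : ∀ {n} → Graph n → ℕ → Set
σ₂≥ G s = ∀ x y → x ≢ y → E G x y ≡ false → s ≤ deg G x + deg G y

-- A chorded cycle of length suc m (m ≥ 2): distinct vertices
-- v 0, v 1, …, v m, with v i ~ v (i+1) and v m ~ v 0, plus a chord:
-- an edge between two positions that are not consecutive on the cycle.
record ChordedCycle {n : ℕ} (G : Graph n) : Set where
  field
    m      : ℕ
    long   : 2 ≤ m
    verts  : Fin (suc m) → Fin n
    inj    : Injective _≡_ _≡_ verts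
    path   : ∀ (i : Fin m) → Adj G (verts (inject₁ i)) (verts (fsuc i))
    close  : Adj G (verts (fromℕ m)) (verts fzero)
    chord  : Σ (Fin (suc m)) λ i → Σ (Fin (suc m)) λ j →
               (2 + toℕ i ≤ toℕ j) × ¬ (toℕ i ≡ 0 × toℕ j ≡ m) ×
               Adj G (verts i) (verts j)

open ChordedCycle public

HasDisjointChordedCycles : ∀ {n} → Graph n → ℕ → Set
HasDisjointChordedCycles G k =
  Σ (Fin k → ChordedCycle G) λ C →
    ∀ a b → a ≢ b → ∀ i j → verts (C a) i ≢ verts (C b) j

infix 4 _≅_
record _≅_ {n m : ℕ} (G : Graph n) (H : Graph m) : Set where
  field
    to      : Fin n → Fin m
    from    : Fin m → Fin n
    to-from : ∀ y → to (from y) ≡ y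
    from-to : ∀ x → from (to x) ≡ x
    pres    : ∀ x y → E G x y ≡ E H (to x) (to y)

≡ᵇ-sym : ∀ a b → (a Data.Nat.≡ᵇ b) ≡ (b Data.Nat.≡ᵇ a)
≡ᵇ-sym zero zero = refl
≡ᵇ-sym zero (suc b) = refl
≡ᵇ-sym (suc a) zero = refl
≡ᵇ-sym (suc a) (suc b) = ≡ᵇ-sym a b

≡ᵇ-refl : ∀ a → (a Data.Nat.≡ᵇ a) ≡ true
≡ᵇ-refl zero = refl
≡ᵇ-refl (suc a) = ≡ᵇ-refl a

multipartite : ∀ {n} → (Fin n → ℕ) → Graph n
multipartite {n} c = record
  { E = λ x y → not (c x Data.Nat.≡ᵇ c y)
  ; E-sym = λ x y → cong not (≡ᵇ-sym (c x) (c y))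
  ; E-irr = λ x → cong not (≡ᵇ-refl (c x)) }

-- G₁(n,k) = K_{3k-1, n-3k+1}: vertices with index < 3k-1 form one part.
G₁ : (n k : ℕ) → Graph n
G₁ n k = multipartite (λ x → if does (toℕ x <? 3 * k ∸ 1) then 0 else 1)

-- G₂(k) = K_{3k-2, 3k-2, 1} on 6k-3 vertices:
-- indices < 3k-2 | indices in [3k-2, 6k-4) | the index 6k-4.
G₂ : (k : ℕ) → Graph (6 * k ∸ 3)
G₂ k = multipartite (λ x → if does (toℕ x <? 3 * k ∸ 2) then 0
                            else if does (toℕ x <? 6 * k ∸ 4) then 1 else 2)

{-# OPTIONS --safe #-}
module Submission where

-- Suppose G has no k disjoint chorded cycles.  Adding edges, we may assume that a vertex colouring with k - 1 classes, each
-- containing a chorded cycle, leaves a remainder R of at least four vertices.  Among all such colourings take one that minimises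
-- the size of the classes, then maximises the edges inside them, then the length of a longest path of R, then the edges of R.
-- Minimality makes a vertex of R see at most three vertices of a class unless the class is K₄; comparing this with the degree
-- condition for nonadjacent vertices of R forces equality almost everywhere.  Equality excludes K₄, so the classes are K₃,₃ (or, once,
-- K₄ minus an edge) and all low vertices of R lie on one side; R itself is K₂,ₛ, and exchanging vertices between R and the
-- classes transports this information to all vertices, which identifies G.  A statement P is proved as ¬ ¬ P throughout, the two
-- graphs being recognised by a decidable property.

open import Defs
open import Data.Nat using (ℕ; zero; suc; _+_; _*_; _∸_; _≤_; _<_; z≤n; s≤s; _≤?_; _≡ᵇ_)
open import Data.Nat.Properties renaming (≤-reflexive to ≡⇒≤)
open import Data.Nat.ListAction using (sum)
open import Data.Nat.Tactic.RingSolver using (solve-∀)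
open import Data.Bool using (Bool; true; false; if_then_else_; not; _∧_; _∨_; _xor_)
import Data.Bool.Properties as Bool
open import Data.Fin using (Fin; toℕ; inject₁; fromℕ; lower₁; inject≤; fromℕ<; combine; remQuot) renaming (zero to fz; suc to fs)
import Data.Fin.Properties as Fin
import Data.Fin.Permutation.Components as PC
open import Data.List using (List; []; _∷_; _++_; reverse; length; map; allFin; filter; lookup; tabulate; upTo; cartesianProduct)
open import Data.List.Properties using (++-assoc; ++-identityʳ; length-++; unfold-reverse; reverse-++; length-reverse; length-tabulate; reverse-involutive; length-upTo; length-map)
open import Data.List.Membership.Propositional using (_∈_; _∉_)
open import Data.List.Membership.Propositional.Properties using (∈-++⁺ˡ; ∈-++⁺ʳ; ∈-++⁻; ∈-filter⁺; ∈-filter⁻; ∈-allFin; ∈-∃++; ∈-map⁻; ∈-lookup; ∈-tabulate⁺; ∈-upTo⁺; ∈-cartesianProduct⁺)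
open import Data.List.Relation.Unary.Any using (here; there; index)
open import Data.List.Relation.Unary.Any.Properties using (lookup-index)
open import Data.List.Relation.Unary.All using (All; []; _∷_) renaming (lookup to All-lookup; tabulate to All-tab)
import Data.List.Relation.Unary.All.Properties as All
open import Data.List.Relation.Unary.AllPairs using ([]; _∷_)
open import Data.List.Relation.Unary.Unique.Propositional using (Unique)
import Data.List.Relation.Unary.Unique.Propositional.Properties as Uniq
open import Data.List.Relation.Binary.Permutation.Propositional using (_↭_; ↭-sym; ↭-trans; prep; swap; refl) renaming (trans to ↭tr)
import Data.List.Relation.Binary.Permutation.Propositional.Properties as Perm
import Data.List.Membership.DecPropositional as DecMem
open import Data.Product using (Σ; _×_; _,_; Σ-syntax; ∃-syntax) renaming (proj₁ to fst; proj₂ to snd)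
open import Data.Sum using (_⊎_; inj₁; inj₂; [_,_]′)
open import Data.Empty using (⊥; ⊥-elim)
open import Data.Unit using (⊤; tt)
open import Data.Vec using (Vec; []; _∷_)
open import Relation.Nullary using (¬_; does; Dec; yes; no)
open import Relation.Nullary.Decidable using (_×-dec_; _→-dec_; _⊎-dec_; ¬?; decidable-stable)
open import Relation.Unary using (Decidable)
open import Relation.Binary.PropositionalEquality using (_≡_; _≢_; refl; cong; cong₂; sym; subst; subst₂)
open import Function using (_∘_; id; case_of_)
open import Function.Bundles using (_⇔_; mk⇔)

-- The number 6k - 2 is 6(k - 1) + 4. Two nonadjacent vertices of R that send at most three edges
-- each to every class therefore need degree sum 4 inside R, while an end of a longest path of R has
-- degree at most 2 there, since a third neighbour on the path would make it the hub of a chorded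
-- cycle. So there is no slack. The obstacle is a class K₄, to which one vertex of R may send four
-- edges. It is met by adding the inequality over several nonadjacent pairs, with multiplicities
-- under which a K₄ contributes no more than the bound for the other classes; this rests on
-- exchanging a vertex of R with one of the K₄, or on splitting K₄ and R into two chorded cycles.
-- When an added edge first creates k disjoint cycles, only one class contains a given end of it.
-- Dissolving that class leaves k - 1 cycles of the old graph and at least four further vertices. A
-- chorded cycle is represented by a hub and a path through three of its neighbours, so its
-- existence is a matter of counting neighbours along a path, and concrete instances can be checked
-- by evaluation.

pattern i1 = here refl
pattern i2 = there i1
pattern i3 = there i2
pattern i4 = there i3
pattern i5 = there i4

infix 4 _∈?_
_∈?_ : ∀ {n} (x : Fin n) (l : List (Fin n)) → Dec (x ∈ l)
_∈?_ = DecMem._∈?_ Fin._≟_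

infixr 2 _⨾_
_⨾_ : ∀ {ℓ} {A : Set ℓ} {x y z : A} → x ≡ y → y ≡ z → x ≡ z
refl ⨾ q = q

b2n : Bool → ℕ
b2n b = if b then 1 else 0

b2n≤1 : ∀ b → b2n b ≤ 1
b2n≤1 true = s≤s z≤n
b2n≤1 false = z≤n

true≢false : true ≢ false
true≢false ()

¬t→f : ∀ {b : Bool} → ¬ (b ≡ true) → b ≡ false
¬t→f {true} h = ⊥-elim (h refl)
¬t→f {false} h = refl

-- Counting along lists, and lists without repetition

module _ {A : Set} where

 cntL : (A → Bool) → List A → ℕ
 cntL p [] = 0
 cntL p (x ∷ l) = b2n (p x) + cntL p l

 cntL-++ : ∀ p l m → cntL p (l ++ m) ≡ cntL p l + cntL p m
 cntL-++ p [] m = refl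
 cntL-++ p (x ∷ l) m rewrite cntL-++ p l m = sym (+-assoc (b2n (p x)) _ _)

 cntL-↭ : ∀ p {l m} → l ↭ m → cntL p l ≡ cntL p m
 cntL-↭ p refl = refl
 cntL-↭ p (prep x h) = cong (b2n (p x) +_) (cntL-↭ p h)
 cntL-↭ p (swap {ys = ys} x y h) rewrite cntL-↭ p h =
  sym (+-assoc (b2n (p x)) (b2n (p y)) _) ⨾ cong (_+ cntL p ys) (+-comm (b2n (p x)) (b2n (p y))) ⨾ +-assoc (b2n (p y)) _ _
 cntL-↭ p (↭tr h k) = cntL-↭ p h ⨾ cntL-↭ p k

 cntL-reverse : ∀ p l → cntL p (reverse l) ≡ cntL p l
 cntL-reverse p l = cntL-↭ p (Perm.↭-reverse l)

 cntL≤length : ∀ p l → cntL p l ≤ length l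
 cntL≤length p [] = z≤n
 cntL≤length p (x ∷ l) = +-mono-≤ (b2n≤1 (p x)) (cntL≤length p l)

 cntL-zero : ∀ p l → (∀ {x} → x ∈ l → p x ≡ false) → cntL p l ≡ 0
 cntL-zero p [] h = refl
 cntL-zero p (x ∷ l) h rewrite h i1 = cntL-zero p l (h ∘ there)

 cntL-zero⁻ : ∀ p l → cntL p l ≡ 0 → ∀ {x} → x ∈ l → p x ≡ false
 cntL-zero⁻ p (x ∷ l) e m with p x in q
 cntL-zero⁻ p (x ∷ l) e i1 | false = q
 cntL-zero⁻ p (x ∷ l) e (there m) | false = cntL-zero⁻ p l e m

 cntL-cong : ∀ p q l → (∀ {x} → x ∈ l → p x ≡ q x) → cntL p l ≡ cntL q l
 cntL-cong p q [] h = refl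
 cntL-cong p q (x ∷ l) h = cong₂ _+_ (cong b2n (h i1)) (cntL-cong p q l (h ∘ there))

 cntL-mono : ∀ p q l → (∀ {x} → x ∈ l → p x ≡ true → q x ≡ true) → cntL p l ≤ cntL q l
 cntL-mono p q [] h = z≤n
 cntL-mono p q (x ∷ l) h = +-mono-≤ (f (p x) (q x) (h i1)) (cntL-mono p q l (h ∘ there))
  where f : ∀ a b → (a ≡ true → b ≡ true) → b2n a ≤ b2n b
        f true b g rewrite g refl = s≤s z≤n
        f false b g = z≤n

 cntL-first : ∀ p l → 1 ≤ cntL p l → Σ[ a ∈ List A ] Σ[ x ∈ A ] Σ[ b ∈ List A ]
  (l ≡ a ++ x ∷ b × p x ≡ true × cntL p a ≡ 0)
 cntL-first p (x ∷ l) h with p x in e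
 ... | true = [] , x , l , refl , e , refl
 ... | false with cntL-first p l h
 ... | a , y , b , refl , py , c = x ∷ a , y , b , refl , py , (cong (λ t → b2n t + cntL p a) e ⨾ c)

 cntL-any : ∀ p l → 1 ≤ cntL p l → Σ[ x ∈ A ] (x ∈ l × p x ≡ true)
 cntL-any p l h with cntL-first p l h
 ... | a , x , b , refl , px , _ = x , ∈-++⁺ʳ a i1 , px

 cntL-pos : ∀ p {l x} → x ∈ l → p x ≡ true → 1 ≤ cntL p l
 cntL-pos p {y ∷ l} i1 px rewrite px = s≤s z≤n
 cntL-pos p {y ∷ l} (there m) px = ≤-trans (cntL-pos p m px) (m≤n+m _ _)

 ∈-split : ∀ {x : A} {l} → x ∈ l → Σ[ a ∈ List A ] Σ[ b ∈ List A ] (l ≡ a ++ x ∷ b)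
 ∈-split m = ∈-∃++ m

 U-++ˡ : ∀ (l : List A) {m} → Unique (l ++ m) → Unique l
 U-++ˡ [] u = []
 U-++ˡ (x ∷ l) (h ∷ u) = All.++⁻ˡ l h ∷ U-++ˡ l u

 U-++ʳ : ∀ (l : List A) {m} → Unique (l ++ m) → Unique m
 U-++ʳ [] u = u
 U-++ʳ (x ∷ l) (h ∷ u) = U-++ʳ l u

 U-disj : ∀ (l : List A) {m} → Unique (l ++ m) → ∀ {x} → x ∈ l → x ∈ m → ⊥
 U-disj (y ∷ l) (h ∷ u) i1 q = All-lookup h (∈-++⁺ʳ l q) refl
 U-disj (y ∷ l) (h ∷ u) (there p) q = U-disj l u p q

 U-++ : ∀ {l m : List A} → Unique l → Unique m → (∀ {x} → x ∈ l → x ∈ m → ⊥) → Unique (l ++ m)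
 U-++ u v d = Uniq.++⁺ u v (λ (p , q) → d p q)

 U-↭ : ∀ {l m : List A} → l ↭ m → Unique l → Unique m
 U-↭ refl u = u
 U-↭ (prep x h) (a ∷ u) = All-tab (λ q e → All-lookup a (Perm.∈-resp-↭ (↭-sym h) q) e) ∷ U-↭ h u
 U-↭ (swap x y h) ((a ∷ b) ∷ c ∷ u) =
  ((λ e → a (sym e)) ∷ All-tab (λ q e → All-lookup c (Perm.∈-resp-↭ (↭-sym h) q) e))
  ∷ All-tab (λ q e → All-lookup b (Perm.∈-resp-↭ (↭-sym h) q) e) ∷ U-↭ h u
 U-↭ (↭tr h k) u = U-↭ k (U-↭ h u)

 U-rev : ∀ {l : List A} → Unique l → Unique (reverse l)
 U-rev {l} u = U-↭ (↭-sym (Perm.↭-reverse l)) u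

 U∉ : ∀ {x : A} {l} → Unique (x ∷ l) → x ∉ l
 U∉ (h ∷ _) m = All-lookup h m refl

 U-cons : ∀ {x : A} {l} → x ∉ l → Unique l → Unique (x ∷ l)
 U-cons h u = All-tab (λ {y} m e → h (subst (_∈ _) (sym e) m)) ∷ u

 U-same-↭ : ∀ {l m : List A} → Unique l → Unique m → (∀ {x} → x ∈ l → x ∈ m) → (∀ {x} → x ∈ m → x ∈ l) → l ↭ m
 U-same-↭ {[]} {[]} u v f g = refl
 U-same-↭ {[]} {x ∷ m} u v f g with g i1
 ... | ()
 U-same-↭ {x ∷ l} {m} (h ∷ u) v f g with ∈-split (f i1)
 ... | a , b , refl = ↭-trans (prep x (U-same-↭ u (U-tail v') f' g')) (↭-sym (Perm.shift x a b))
  where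
  v' : Unique (x ∷ a ++ b)
  v' = U-↭ (Perm.shift x a b) v
  U-tail : ∀ {y : A} {l} → Unique (y ∷ l) → Unique l
  U-tail (_ ∷ w) = w
  f' : ∀ {y} → y ∈ l → y ∈ a ++ b
  f' q with Perm.∈-resp-↭ (Perm.shift x a b) (f (there q))
  ... | here e = ⊥-elim (All-lookup h q (sym e))
  ... | there r = r
  g' : ∀ {y} → y ∈ a ++ b → y ∈ l
  g' q with g (Perm.∈-resp-↭ (↭-sym (Perm.shift x a b)) (there q))
  ... | here e = ⊥-elim (U∉ v' (subst (_∈ a ++ b) e q))
  ... | there r = r

 U-⊆-length : ∀ {l m : List A} → Unique l → (∀ {x} → x ∈ l → x ∈ m) → length l ≤ length m
 U-⊆-length {[]} u f = z≤n
 U-⊆-length {x ∷ l} {m} (h ∷ u) f with ∈-split (f i1)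
 ... | a , b , refl = ≤-trans (s≤s (U-⊆-length u f')) (≡⇒≤ (sym (Perm.↭-length (Perm.shift x a b))))
  where
  f' : ∀ {y} → y ∈ l → y ∈ a ++ b
  f' q with Perm.∈-resp-↭ (Perm.shift x a b) (f (there q))
  ... | here e = ⊥-elim (All-lookup h q (sym e))
  ... | there r = r

 cntL-⊆ : ∀ p {l m : List A} → Unique l → (∀ {x} → x ∈ l → x ∈ m) → cntL p l ≤ cntL p m
 cntL-⊆ p {[]} u f = z≤n
 cntL-⊆ p {x ∷ l} {m} (h ∷ u) f with ∈-split (f i1)
 ... | a , b , refl = ≤-trans (+-monoʳ-≤ (b2n (p x)) (cntL-⊆ p u f')) (≡⇒≤ (sym (cntL-↭ p (Perm.shift x a b))))
  where
  f' : ∀ {y} → y ∈ l → y ∈ a ++ b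
  f' q with Perm.∈-resp-↭ (Perm.shift x a b) (f (there q))
  ... | here e = ⊥-elim (All-lookup h q (sym e))
  ... | there r = r

 filter-cons-yes : ∀ {P : A → Set} (P? : Decidable P) x l → P x → filter P? (x ∷ l) ≡ x ∷ filter P? l
 filter-cons-yes P? x l px with P? x
 ... | yes _ = refl
 ... | no ¬p = ⊥-elim (¬p px)

 filter-cons-no : ∀ {P : A → Set} (P? : Decidable P) x l → ¬ P x → filter P? (x ∷ l) ≡ filter P? l
 filter-cons-no P? x l ¬px with P? x
 ... | yes p = ⊥-elim (¬px p)
 ... | no _ = refl

-- Sums over the classes and the case of equality

ΣF : ∀ {m} → (Fin m → ℕ) → ℕ
ΣF {zero} f = 0
ΣF {suc m} f = f fz + ΣF (f ∘ fs)

ΣF-cong : ∀ {m} {f g : Fin m → ℕ} → (∀ c → f c ≡ g c) → ΣF f ≡ ΣF g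
ΣF-cong {zero} h = refl
ΣF-cong {suc m} h = cong₂ _+_ (h fz) (ΣF-cong (h ∘ fs))

ΣF-mono : ∀ {m} {f g : Fin m → ℕ} → (∀ c → f c ≤ g c) → ΣF f ≤ ΣF g
ΣF-mono {zero} h = z≤n
ΣF-mono {suc m} h = +-mono-≤ (h fz) (ΣF-mono (h ∘ fs))

+-inter : ∀ a b c d → (a + b) + (c + d) ≡ (a + c) + (b + d)
+-inter = solve-∀

ΣF-+ : ∀ {m} (f g : Fin m → ℕ) → ΣF (λ c → f c + g c) ≡ ΣF f + ΣF g
ΣF-+ {zero} f g = refl
ΣF-+ {suc m} f g rewrite ΣF-+ (f ∘ fs) (g ∘ fs) = +-inter (f fz) (g fz) _ _

ΣF-* : ∀ {m} a (f : Fin m → ℕ) → ΣF (λ c → a * f c) ≡ a * ΣF f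
ΣF-* {zero} a f = sym (*-zeroʳ a)
ΣF-* {suc m} a f rewrite ΣF-* a (f ∘ fs) = sym (*-distribˡ-+ a (f fz) _)

ΣF-const : ∀ m a → ΣF {m} (λ _ → a) ≡ a * m
ΣF-const zero a = sym (*-zeroʳ a)
ΣF-const (suc m) a rewrite ΣF-const m a = sym (*-suc a m)

ΣF-upper : ∀ {m} {f : Fin m → ℕ} {K} → (∀ c → f c ≤ K) → ΣF f ≤ K * m
ΣF-upper {m} {f} {K} h = ≤-trans (ΣF-mono h) (≡⇒≤ (ΣF-const m K))

ΣF-strict : ∀ {m} {f : Fin m → ℕ} {K δ} → (∀ c → f c ≤ K) → ∀ c → f c + δ ≤ K → ΣF f + δ ≤ K * m
ΣF-strict {suc m} {f} {K} {δ} h fz s = begin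
 f fz + ΣF (f ∘ fs) + δ ≡⟨ lem (f fz) _ δ ⟩
 f fz + δ + ΣF (f ∘ fs) ≤⟨ +-mono-≤ s (ΣF-upper (h ∘ fs)) ⟩
 K + K * m ≡⟨ sym (*-suc K m) ⟩
 K * suc m ∎
 where open ≤-Reasoning
       lem : ∀ a b c → a + b + c ≡ a + c + b
       lem = solve-∀
ΣF-strict {suc m} {f} {K} {δ} h (fs c) s = begin
 f fz + ΣF (f ∘ fs) + δ ≡⟨ +-assoc (f fz) _ δ ⟩
 f fz + (ΣF (f ∘ fs) + δ) ≤⟨ +-mono-≤ (h fz) (ΣF-strict (h ∘ fs) c s) ⟩
 K + K * m ≡⟨ sym (*-suc K m) ⟩
 K * suc m ∎
 where open ≤-Reasoning

-- The degree condition supplies the lower bound for the sum; this turns an upper bound for each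
-- class into an exact value for each class.
ΣF-tight : ∀ {m} {f : Fin m → ℕ} {K} → (∀ c → f c ≤ K) → K * m ≤ ΣF f → ∀ c → f c ≡ K
ΣF-tight {m} {f} {K} h s c with K ≤? f c
... | yes q = ≤-antisym (h c) q
... | no ¬q = ⊥-elim (<-irrefl refl (≤-trans (≤-trans (s≤s s) (≡⇒≤ (+-comm 1 _))) (ΣF-strict {δ = 1} h c (≤-trans (≡⇒≤ (+-comm (f c) 1)) (≰⇒> ¬q)))))

-- Subtraction-free form of the change of a sum in one term: a recolouring alters the size and the
-- edges of a single class.
ΣF-replace : ∀ {m} {f g : Fin m → ℕ} c → (∀ d → d ≢ c → f d ≡ g d) → ΣF f + g c ≡ ΣF g + f c
ΣF-replace {suc m} {f} {g} fz h rewrite ΣF-cong {f = f ∘ fs} {g ∘ fs} (λ d → h (fs d) (λ ())) = lem (f fz) (ΣF (g ∘ fs)) (g fz)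
 where lem : ∀ a b c → a + b + c ≡ c + b + a
       lem = solve-∀
ΣF-replace {suc m} {f} {g} (fs c) h rewrite h fz (λ ()) = +-assoc (g fz) _ _ ⨾ cong (g fz +_) (ΣF-replace c (λ d ne → h (fs d) (ne ∘ Fin.suc-injective))) ⨾ sym (+-assoc (g fz) _ _)

cnt-classes : ∀ {A : Set} {m} (κ : A → Fin m) (p : A → Bool) l →
 cntL p l ≡ ΣF (λ c → cntL p (filter (λ y → κ y Fin.≟ c) l))
cnt-classes {m = m} κ p [] = sym (ΣF-zero m)
 where ΣF-zero : ∀ m → ΣF {m} (λ _ → 0) ≡ 0
       ΣF-zero zero = refl
       ΣF-zero (suc m) = ΣF-zero m
cnt-classes {m = m} κ p (x ∷ l) = lem (κ x) (λ c ne → cong (cntL p) (filter-cons-no (λ y → κ y Fin.≟ c) x l (λ e → ne (sym e))))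
 (cong (cntL p) (filter-cons-yes (λ y → κ y Fin.≟ κ x) x l refl))
 (cnt-classes κ p l)
 where
 lem : ∀ c {f g : Fin m → ℕ} → (∀ d → d ≢ c → f d ≡ g d) → f c ≡ b2n (p x) + g c → cntL p l ≡ ΣF g → b2n (p x) + cntL p l ≡ ΣF f
 lem c {f} {g} h e q = +-cancelʳ-≡ (g c) _ _ (cong (λ t → b2n (p x) + t + g c) q ⨾ l2 (b2n (p x)) (ΣF g) (g c) ⨾ sym (ΣF-replace c h ⨾ cong (ΣF g +_) e))
  where l2 : ∀ a b c → a + b + c ≡ b + (a + c)
        l2 = solve-∀

length≡cnt : ∀ {A : Set} (l : List A) → length l ≡ cntL (λ _ → true) l
length≡cnt [] = refl
length≡cnt (x ∷ l) = cong suc (length≡cnt l)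

deg≡cnt : ∀ {n} (G : Graph n) x → deg G x ≡ cntL (E G x) (allFin n)
deg≡cnt {n} G x = go (allFin n)
 where go : ∀ l → sum (map (λ y → if E G x y then 1 else 0) l) ≡ cntL (E G x) l
       go [] = refl
       go (y ∷ l) = cong (b2n (E G x y) +_) (go l)

-- `P` will speak about all optimal colourings and is not decidable, so a maximum is available only
-- in continuation form, under a goal `⊥`.
maximal : ∀ {A : Set} (P : A → Set) (f : A → ℕ) (B : ℕ) → (∀ a → P a → f a ≤ B) →
 ∀ a → P a → (∀ a → P a → (∀ a' → P a' → f a' ≤ f a) → ⊥) → ⊥
maximal {A} P f B bd a pa k = go B a pa (m≤m+n B (f a))
 where
 -- The number `m` bounds how far `f` can still rise above `f a`.
 go : ∀ m a → P a → B ≤ m + f a → ⊥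
 go m a pa le = k a pa λ a' pa' → case f a' ≤? f a of λ where
   (yes q) → q
   (no ¬q) → ⊥-elim (step m a' pa' (≰⇒> ¬q) le)
  where
  step : ∀ m a' → P a' → f a < f a' → B ≤ m + f a → ⊥
  step zero a' pa' lt le = <-irrefl refl (≤-trans lt (≤-trans (bd a' pa') le))
  step (suc m) a' pa' lt le = go m a' pa' (≤-trans le (≤-trans (≡⇒≤ (sym (+-suc m (f a)))) (+-monoʳ-≤ m lt)))

em⊥ : ∀ (P : Set) → (P ⊎ ¬ P → ⊥) → ⊥
em⊥ P k = k (inj₂ (λ p → k (inj₁ p)))

-- Walks, and chorded cycles in hub form

module Hub {n : ℕ} (G : Graph n) where

 V : Set
 V = Fin n

 e : V → V → Bool
 e = E G

 infix 4 _~_ _≁_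
 _~_ _≁_ : V → V → Set
 x ~ y = e x y ≡ true
 x ≁ y = e x y ≡ false

 adj-sym : ∀ {x y} → x ~ y → y ~ x
 adj-sym {x} {y} h = E-sym G y x ⨾ h

 nadj-sym : ∀ {x y} → x ≁ y → y ≁ x
 nadj-sym {x} {y} h = E-sym G y x ⨾ h

 adj-≢ : ∀ {x y} → x ~ y → x ≢ y
 adj-≢ {x} h refl with E-irr G x ⨾ refl
 ... | q = true≢false (sym h ⨾ q)

 data Walk : V → List V → V → Set where
  one : ∀ {a} → Walk a (a ∷ []) a
  _∷_ : ∀ {a b c l} → a ~ b → Walk b l c → Walk a (a ∷ l) c

 infixr 5 _∷_

 w-join : ∀ {a b c d l m} → Walk a l b → b ~ c → Walk c m d → Walk a (l ++ m) d
 w-join one h v = h ∷ v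
 w-join (g ∷ w) h v = g ∷ w-join w h v

 w-snoc : ∀ {a b c l} → Walk a l b → b ~ c → Walk a (l ++ c ∷ []) c
 w-snoc w h = w-join w h one

 w-rev : ∀ {a l b} → Walk a l b → Walk b (reverse l) a
 w-rev one = one
 w-rev {a} (_∷_ {l = l} g w) = subst (λ t → Walk _ t a) (sym (unfold-reverse a l)) (w-snoc (w-rev w) (adj-sym g))

 w-head : ∀ {a l b} → Walk a l b → ∃[ l' ] l ≡ a ∷ l'
 w-head one = [] , refl
 w-head (g ∷ w) = _ , refl

 w-last : ∀ {a l b} → Walk a l b → ∃[ l' ] l ≡ l' ++ b ∷ []
 w-last one = [] , refl
 w-last (_∷_ {a} g w) with w-last w
 ... | l' , refl = a ∷ l' , refl

 w-head∈ : ∀ {a l b} → Walk a l b → a ∈ l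
 w-head∈ one = here refl
 w-head∈ (g ∷ w) = here refl

 w-last∈ : ∀ {a l b} → Walk a l b → b ∈ l
 w-last∈ one = here refl
 w-last∈ (g ∷ w) = there (w-last∈ w)

 w-hd≡ : ∀ {a x l b} → Walk a (x ∷ l) b → a ≡ x
 w-hd≡ one = refl
 w-hd≡ (g ∷ w) = refl

 w-lst≡ : ∀ {a x b} l → Walk a (l ++ x ∷ []) b → b ≡ x
 w-lst≡ [] one = refl
 w-lst≡ (y ∷ []) (g ∷ w) = w-lst≡ [] w
 w-lst≡ (y ∷ z ∷ l) (g ∷ w) = w-lst≡ (z ∷ l) w

 w-suffix : ∀ {a b y m} l → Walk a (l ++ y ∷ m) b → Walk y (y ∷ m) b
 w-suffix [] w = subst (λ t → Walk t _ _) (w-hd≡ w) w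
 w-suffix (x ∷ []) (g ∷ w) = w-suffix [] w
 w-suffix (x ∷ z ∷ l) (g ∷ w) = w-suffix (z ∷ l) w

 w-upto : ∀ {a b y m} l → Walk a (l ++ y ∷ m) b → Walk a (l ++ y ∷ []) y
 w-upto [] one = one
 w-upto [] (g ∷ w) = one
 w-upto (x ∷ []) (g ∷ w) with w-hd≡ w
 ... | refl = g ∷ one
 w-upto (x ∷ z ∷ l) (g ∷ w) = g ∷ w-upto (z ∷ l) w

 w-prefix : ∀ {a b y m} x l → Walk a (x ∷ l ++ y ∷ m) b → Σ[ c ∈ V ] (Walk a (x ∷ l) c × c ~ y)
 w-prefix x [] (g ∷ w) with w-hd≡ w
 ... | refl = x , one , g
 w-prefix x (z ∷ l) (g ∷ w) with w-hd≡ w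
 ... | refl with w-prefix z l w
 ... | c , w' , h = c , (g ∷ w') , h

 w-2nd : ∀ {a b x y m} → Walk a (x ∷ y ∷ m) b → x ~ y × Walk y (y ∷ m) b
 w-2nd (g ∷ w) with w-hd≡ w
 ... | refl = g , w

 -- A chorded cycle in hub form: deleting the hub x from it leaves a path through the three
 -- cycle-or-chord neighbours of x.
 record CC : Set where
  constructor mkCC
  field
   {hub hd₀ tl₀} : V
   {Q} : List V
   cwk : Walk hd₀ Q tl₀
   cuq : Unique (hub ∷ Q)
   cnb : 3 ≤ cntL (e hub) Q
  vs : List V
  vs = hub ∷ Q
 open CC public

 record Trim : Set where
  constructor mkTrim
  field
   {th ty tz} : V
   {tM} : List V
   twk : Walk ty (ty ∷ tM ++ tz ∷ []) tz
   tuq : Unique (th ∷ ty ∷ tM ++ tz ∷ [])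
   ey : th ~ ty
   ez : th ~ tz
   eM : 1 ≤ cntL (e th) tM
  tvs : List V
  tvs = th ∷ ty ∷ tM ++ tz ∷ []
 open Trim public

 -- The path is cut at the first and at the last neighbour of the hub; a third neighbour remains
 -- strictly between them.
 trim : (C : CC) → Σ[ T ∈ Trim ] (∀ {x} → x ∈ tvs T → x ∈ vs C)
 trim (mkCC {hub = h} {Q = Q} wk uq nb) with cntL-first (e h) Q (≤-trans (s≤s z≤n) nb)
 ... | pre , y , rest , refl , ey , c0 = go
  where
  cr : 2 ≤ cntL (e h) rest
  cr = ≤-pred (≤-trans nb (≡⇒≤ (cntL-++ (e h) pre (y ∷ rest) ⨾ cong₂ _+_ c0 (cong (λ t → b2n t + cntL (e h) rest) ey))))
  go : Σ[ T ∈ Trim ] (∀ {x} → x ∈ tvs T → x ∈ h ∷ pre ++ y ∷ rest)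
  go with cntL-first (e h) (reverse rest) (≤-trans (s≤s z≤n) (≤-trans cr (≡⇒≤ (sym (cntL-reverse (e h) rest)))))
  ... | a , z , b , eq , ez , c1 = mkTrim {tM = reverse b} wk2 uq2 ey ez cM , sub
   where
   rest≡ : rest ≡ reverse b ++ z ∷ reverse a
   rest≡ = sym (reverse-involutive rest) ⨾ cong reverse eq ⨾ reverse-++ a (z ∷ b) ⨾ cong (_++ reverse a) (unfold-reverse z b) ⨾ ++-assoc (reverse b) (z ∷ []) (reverse a)
   wk1 : Walk y (y ∷ reverse b ++ z ∷ reverse a) _
   wk1 = subst (λ t → Walk y (y ∷ t) _) rest≡ (w-suffix pre wk)
   wk2 : Walk y (y ∷ reverse b ++ z ∷ []) z
   wk2 = w-upto (y ∷ reverse b) wk1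
   uq1 : Unique (h ∷ (y ∷ reverse b ++ z ∷ []) ++ reverse a)
   uq1 = mk uq
    where
    assoc' : y ∷ rest ≡ (y ∷ reverse b ++ z ∷ []) ++ reverse a
    assoc' = cong (y ∷_) (rest≡ ⨾ sym (++-assoc (reverse b) (z ∷ []) (reverse a)))
    mk : Unique (h ∷ pre ++ y ∷ rest) → Unique (h ∷ (y ∷ reverse b ++ z ∷ []) ++ reverse a)
    mk (hh ∷ u) = All.++⁻ʳ pre (subst (λ t → All (h ≢_) (pre ++ t)) assoc' hh) ∷ subst Unique assoc' (U-++ʳ pre u)
   uq2 : Unique (h ∷ y ∷ reverse b ++ z ∷ [])
   uq2 = U-++ˡ (h ∷ y ∷ reverse b ++ z ∷ []) uq1
   cM : 1 ≤ cntL (e h) (reverse b)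
   cM = ≤-trans (≤-pred (≤-trans cr (≡⇒≤ (sym (cntL-reverse (e h) rest) ⨾ cong (cntL (e h)) eq ⨾ cntL-++ (e h) a (z ∷ b) ⨾ cong₂ _+_ c1 (cong (λ t → b2n t + cntL (e h) b) ez)))))
    (≡⇒≤ (sym (cntL-reverse (e h) b)))
   sub : ∀ {x} → x ∈ h ∷ y ∷ reverse b ++ z ∷ [] → x ∈ h ∷ pre ++ y ∷ rest
   sub (here p) = here p
   sub {x} (there m) = there (∈-++⁺ʳ pre (subst (λ t → x ∈ y ∷ t) (sym rest≡) (subst (λ t → x ∈ y ∷ t) (++-assoc (reverse b) (z ∷ []) (reverse a)) (∈-++⁺ˡ m))))

 walk-lookup : ∀ {a b l} → Walk a (a ∷ l) b → ∀ (i : Fin (length l)) → e (lookup (a ∷ l) (inject₁ i)) (lookup (a ∷ l) (fs i)) ≡ true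
 walk-lookup {l = y ∷ l} (g ∷ w) fz with w-hd≡ w
 ... | refl = g
 walk-lookup {l = y ∷ l} (g ∷ w) (fs i) with w-hd≡ w
 ... | refl = walk-lookup w i

 walk-final : ∀ {a b} l → Walk a (a ∷ l) b → lookup (a ∷ l) (fromℕ (length l)) ≡ b
 walk-final [] one = refl
 walk-final (y ∷ l) (g ∷ w) with w-hd≡ w
 ... | refl = walk-final l w

 lookup-inj : ∀ {l : List V} → Unique l → ∀ i j → lookup l i ≡ lookup l j → i ≡ j
 lookup-inj (h ∷ u) fz fz q = refl
 lookup-inj {x ∷ l} (h ∷ u) fz (fs j) q = ⊥-elim (All-lookup h (∈-lookup {xs = l} j) q)
 lookup-inj {x ∷ l} (h ∷ u) (fs i) fz q = ⊥-elim (All-lookup h (∈-lookup {xs = l} i) (sym q))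
 lookup-inj (h ∷ u) (fs i) (fs j) q = cong fs (lookup-inj u i j q)

 inner-index : ∀ {w : V} (M : List V) z → w ∈ M → Σ[ j ∈ Fin (length (M ++ z ∷ [])) ] (lookup (M ++ z ∷ []) j ≡ w × suc (suc (toℕ j)) ≤ length (M ++ z ∷ []))
 inner-index (x ∷ M) z i1 = fz , refl , s≤s (len M)
  where len : ∀ (M : List V) → 1 ≤ length (M ++ z ∷ [])
        len [] = s≤s z≤n
        len (_ ∷ _) = s≤s z≤n
 inner-index (x ∷ M) z (there m) with inner-index M z m
 ... | j , q , le = fs j , q , s≤s le

 toChorded : (T : Trim) → Σ[ C ∈ ChordedCycle G ] (∀ i → verts C i ∈ tvs T)
 toChorded (mkTrim {h} {y} {z} {M} wk uq ey ez eM) with cntL-any (e h) M eM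
 ... | w , w∈ , ew with inner-index M z w∈
 ... | j , lj , le = record
  { m = length L'
  ; long = s≤s (≤-trans (s≤s z≤n) le)
  ; verts = lookup (h ∷ L')
  ; inj = λ {i} {j} → lookup-inj uq i j
  ; path = walk-lookup wk'
  ; close = subst (λ t → t ~ h) (sym (walk-final L' wk')) (adj-sym ez)
  -- The hub has position 0 and the start of the path position 1, so entry `j` of the rest has
  -- position `j + 2`; the bound `le` keeps it away from the last position, which is consecutive to
  -- the hub.
  ; chord = fz , fs (fs j) , s≤s (s≤s z≤n) , (λ { (_ , q) → <-irrefl (suc-injective q) le }) , subst (λ t → h ~ t) (sym lj) ew
  } , λ i → ∈-lookup {xs = h ∷ L'} i
  where
  L' : List V
  L' = y ∷ M ++ z ∷ []
  wk' : Walk h (h ∷ L') z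
  wk' = ey ∷ wk

 -- Deleting `x` from the cycle leaves the path `post ++ pre`, joined by the closing edge, so any
 -- vertex with three neighbours on a cycle can serve as hub.
 closed→CC : ∀ {a b l} → Walk a l b → b ~ a → Unique l → ∀ {x} → x ∈ l → 3 ≤ cntL (e x) l → Σ[ C ∈ CC ] (∀ {y} → y ∈ vs C → y ∈ l)
 closed→CC {a} {b} w ba u {x} x∈ c with ∈-split x∈
 ... | pre , post , refl = go pre post w u c
  where
  irr : ∀ pre post → cntL (e x) (pre ++ x ∷ post) ≡ cntL (e x) (post ++ pre)
  irr pre post = cntL-↭ (e x) (Perm.shift x pre post) ⨾ cong (λ t → b2n t + cntL (e x) (pre ++ post)) (E-irr G x) ⨾ cntL-↭ (e x) (Perm.++-comm pre post)
  go : ∀ pre post → Walk a (pre ++ x ∷ post) b → Unique (pre ++ x ∷ post) → 3 ≤ cntL (e x) (pre ++ x ∷ post) → Σ[ C ∈ CC ] (∀ {y} → y ∈ vs C → y ∈ pre ++ x ∷ post)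
  go pre post w u c with subst (3 ≤_) (irr pre post) c
  go pre post w u c | c' = mkCC (snd (snd (wk pre post w c'))) uq' c' , λ m → Perm.∈-resp-↭ (↭-trans (prep x (Perm.++-comm post pre)) (↭-sym (Perm.shift x pre post))) m
   where
   uq' : Unique (x ∷ post ++ pre)
   uq' = U-↭ (↭-trans (Perm.shift x pre post) (prep x (Perm.++-comm pre post))) u
   wk : ∀ pre post → Walk a (pre ++ x ∷ post) b → 3 ≤ cntL (e x) (post ++ pre) → Σ[ c ∈ V ] Σ[ d ∈ V ] Walk c (post ++ pre) d
   wk [] [] w ()
   wk [] (y ∷ post) w _ = _ , _ , subst (λ t → Walk y (y ∷ t) b) (sym (++-identityʳ post)) (snd (w-2nd w))
   wk (p ∷ pre) [] w _ = a , fst (w-prefix p pre w) , fst (snd (w-prefix p pre w))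
   wk (p ∷ pre) (y ∷ post) w _ = _ , _ , w-join (snd (w-2nd (w-suffix (p ∷ pre) w))) ba (fst (snd (w-prefix p pre w)))

 tab-walk : ∀ {m} (f : Fin (suc m) → V) → (∀ (i : Fin m) → e (f (inject₁ i)) (f (fs i)) ≡ true) → Walk (f fz) (tabulate f) (f (fromℕ m))
 tab-walk {zero} f h = one
 tab-walk {suc m} f h = h fz ∷ tab-walk (f ∘ fs) (h ∘ fs)

 three-cnt : ∀ (p : V → Bool) {l a b c} → a ≢ b → a ≢ c → b ≢ c → a ∈ l → b ∈ l → c ∈ l → p a ≡ true → p b ≡ true → p c ≡ true → 3 ≤ cntL p l
 three-cnt p {l} {a} {b} {c} ab ac bc a∈ b∈ c∈ pa pb pc =
  ≤-trans (≡⇒≤ (sym (cong₂ _+_ (cong b2n pa) (cong₂ _+_ (cong b2n pb) (cong (λ t → b2n t + 0) pc)))))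
  (cntL-⊆ p {a ∷ b ∷ c ∷ []} ((ab ∷ ac ∷ []) ∷ (bc ∷ []) ∷ [] ∷ []) λ { i1 → a∈ ; i2 → b∈ ; i3 → c∈ })

 -- An end of the chord becomes the hub: its predecessor, its successor and the other end of the
 -- chord are three distinct neighbours.
 fromChorded : (C : ChordedCycle G) → Σ[ D ∈ CC ] (∀ {y} → y ∈ vs D → Σ[ i ∈ Fin (suc (m C)) ] y ≡ verts C i)
 fromChorded C = fst D , λ q → tab⁻ (snd D q)
  where
  f = verts C
  l = tabulate f
  tab⁻ : ∀ {k} {g : Fin k → V} {y} → y ∈ tabulate g → Σ[ i ∈ Fin k ] y ≡ g i
  tab⁻ {suc k} (here q) = fz , q
  tab⁻ {suc k} (there q) with tab⁻ q
  ... | i , r = fs i , r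
  ne : ∀ {i j} → toℕ i ≢ toℕ j → f i ≢ f j
  ne h q = h (cong toℕ (inj C q))
  i = fst (chord C)
  j = fst (snd (chord C))
  ij : 2 + toℕ i ≤ toℕ j
  ij = fst (snd (snd (chord C)))
  nn = fst (snd (snd (snd (chord C))))
  eij = snd (snd (snd (snd (chord C))))
  j≤m : toℕ j ≤ m C
  j≤m = Fin.toℕ≤pred[n] j
  i≢m : m C ≢ toℕ i
  i≢m q = <-irrefl refl (≤-trans (s≤s (n≤1+n (toℕ i))) (≤-trans ij (≤-trans j≤m (≡⇒≤ q))))
  sx : Fin (m C)
  sx = lower₁ i i≢m
  succ : e (f i) (f (fs sx)) ≡ true
  succ = subst (λ t → e (f t) (f (fs sx)) ≡ true) (Fin.inject₁-lower₁ i i≢m) (path C sx)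
  sx≡ : toℕ (fs sx) ≡ suc (toℕ i)
  sx≡ = cong suc (sym (Fin.toℕ-inject₁ sx) ⨾ cong toℕ (Fin.inject₁-lower₁ i i≢m))
  -- The predecessor of position 0 is the last position. There `nn` separates it from `j`, and
  -- `long` separates it from the successor.
  mkp : ∀ i' sx' → i' ≡ i → sx' ≡ suc (toℕ i) → Σ[ p ∈ Fin (suc (m C)) ] ((f i') ~ (f p) × toℕ p ≢ sx' × toℕ p ≢ toℕ j)
  mkp fz sx' eqi q' = fromℕ (m C) , adj-sym (close C) ,
   (λ q → <-irrefl (sym (sym (Fin.toℕ-fromℕ (m C)) ⨾ q ⨾ q' ⨾ cong (suc ∘ toℕ) (sym eqi))) (long C)) ,
   (λ q → nn (cong toℕ (sym eqi) , sym (sym (Fin.toℕ-fromℕ (m C)) ⨾ q)))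
  mkp (fs i0) sx' eqi q' = inject₁ i0 , adj-sym (path C i0) ,
   (λ q → <-irrefl (sym (Fin.toℕ-inject₁ i0) ⨾ q ⨾ q' ⨾ cong (suc ∘ toℕ) (sym eqi)) (s≤s (n≤1+n _))) ,
   (λ q → <-irrefl (sym (Fin.toℕ-inject₁ i0) ⨾ q) (≤-trans (s≤s (≤-trans (n≤1+n _) (n≤1+n _))) (subst (λ t → 2 + toℕ t ≤ toℕ j) (sym eqi) ij)))
  pred : Σ[ p ∈ Fin (suc (m C)) ] ((f i) ~ (f p) × toℕ p ≢ toℕ (fs sx) × toℕ p ≢ toℕ j)
  pred = mkp i (toℕ (fs sx)) refl sx≡
  D : Σ[ D ∈ CC ] (∀ {y} → y ∈ vs D → y ∈ l)
  D = closed→CC (tab-walk f (path C)) (close C) (Uniq.tabulate⁺ {f = f} (inj C)) (∈-tabulate⁺ {f = f} i)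
   (three-cnt (e (f i)) {l} (ne (fst (snd (snd pred)))) (ne (snd (snd (snd pred))))
   (ne (λ q → <-irrefl (sym sx≡ ⨾ q) ij))
   (∈-tabulate⁺ {f = f} (fst pred)) (∈-tabulate⁺ {f = f} (fs sx)) (∈-tabulate⁺ {f = f} j) (fst (snd pred)) succ eij)

 -- Disjointness is built in by colouring all vertices, and moving vertices between the cycles
 -- becomes a recolouring.
 KCC : ∀ {k} → (V → Fin k) → Set
 KCC {k} κ = ∀ c → Σ[ C ∈ CC ] (∀ {y} → y ∈ vs C → κ y ≡ c)

 KCC→Has : ∀ {k} {κ : V → Fin k} → KCC κ → HasDisjointChordedCycles G k
 KCC→Has {k} {κ} h = (λ c → fst (C c)) , λ a b ne i j q → ne (sym (col a i) ⨾ cong κ q ⨾ col b j)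
  where
  C : ∀ c → Σ[ D ∈ ChordedCycle G ] (∀ i → verts D i ∈ tvs (fst (trim (fst (h c)))))
  C c = toChorded (fst (trim (fst (h c))))
  col : ∀ c i → κ (verts (fst (C c)) i) ≡ c
  col c i = snd (h c) (snd (trim (fst (h c))) (snd (C c) i))

cast∈ : ∀ {A : Set} {l m : List A} {y : A} → l ≡ m → y ∈ l → y ∈ m
cast∈ refl p = p

-- Verification of chorded cycles by evaluation

infix 4 _==_
_==_ : ℕ → ℕ → Bool
zero == zero = true
zero == suc _ = false
suc _ == zero = false
suc a == suc b = a == b

==-sound : ∀ a b → (a == b) ≡ true → a ≡ b
==-sound zero zero h = refl
==-sound (suc a) (suc b) h = cong suc (==-sound a b h)

∧-l : ∀ {a b} → a ∧ b ≡ true → a ≡ true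
∧-l {true} h = refl

∧-r : ∀ {a b} → a ∧ b ≡ true → b ≡ true
∧-r {true} h = h

∨-case : ∀ {a b} → a ∨ b ≡ true → a ≡ true ⊎ b ≡ true
∨-case {true} h = inj₁ refl
∨-case {false} h = inj₂ h

∧-i : ∀ {a b} → a ≡ true → b ≡ true → a ∧ b ≡ true
∧-i refl refl = refl

lt? : ℕ → ℕ → Bool
lt? a zero = false
lt? zero (suc b) = true
lt? (suc a) (suc b) = lt? a b

lt?-sound : ∀ a b → lt? a b ≡ true → a < b
lt?-sound zero (suc b) h = s≤s z≤n
lt?-sound (suc a) (suc b) h = s≤s (lt?-sound a b h)

memb : ℕ → List ℕ → Bool
memb i [] = false
memb i (j ∷ l) = (i == j) ∨ memb i l

distinct : List ℕ → Bool
distinct [] = true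
distinct (i ∷ l) = not (memb i l) ∧ distinct l

memb-complete : ∀ {i l} → i ∈ l → memb i l ≡ true
memb-complete {i} {j ∷ l} i1 = cong (_∨ memb i l) (r i)
 where r : ∀ i → (i == i) ≡ true
       r zero = refl
       r (suc i) = r i
memb-complete {i} {j ∷ l} (there m) with i == j
... | true = refl
... | false = memb-complete m

distinct-∉ : ∀ {i l} → distinct (i ∷ l) ≡ true → i ∉ l
distinct-∉ {i} {l} h m with memb i l | memb-complete m
distinct-∉ () m | .true | refl

-- The indices of a layout name pieces of disjoint paths ("atoms": single vertices, or paths whose inner
-- structure is irrelevant).  Which concatenations of atoms are paths, and which vertices are then hubs of
-- chorded cycles, is decided by evaluation from a table of known edges between ends of atoms.
data End : Set where
 hd tl : ℕ → End

infix 6 _-_!_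
pattern _-_!_ i j p = hd i , hd j , p

data SA : Set where
 fw bw : ℕ → SA

idx : SA → ℕ
idx (fw i) = i
idx (bw i) = i

start end : SA → End
start (fw i) = hd i
start (bw i) = tl i
end (fw i) = tl i
end (bw i) = hd i

eqE : End → End → Bool
eqE (hd i) (hd j) = i == j
eqE (tl i) (tl j) = i == j
eqE _ _ = false

eqE-sound : ∀ a b → eqE a b ≡ true → a ≡ b
eqE-sound (hd i) (hd j) h = cong hd (==-sound i j h)
eqE-sound (tl i) (tl j) h = cong tl (==-sound i j h)

module Engine {n : ℕ} (G : Graph n) where
 open Hub G

 data Seg : Set where
  vx : V → Seg
  seg : ∀ {a b l} → Walk a l b → Seg

 sL : Seg → List V
 sL (vx v) = v ∷ []
 sL (seg {l = l} _) = l

 sH sT : Seg → V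
 sH (vx v) = v
 sH (seg {a = a} _) = a
 sT (vx v) = v
 sT (seg {b = b} _) = b

 sW : ∀ s → Walk (sH s) (sL s) (sT s)
 sW (vx v) = one
 sW (seg w) = w

 isV : Seg → Bool
 isV (vx _) = true
 isV (seg _) = false

 at : Seg → List Seg → ℕ → Seg
 at d [] i = d
 at d (s ∷ l) zero = s
 at d (s ∷ l) (suc i) = at d l i

 -- The last piece is not followed by `++ []`, so for displayed atoms this reduces to the very list
 -- whose distinctness the caller has proved.
 flat : List Seg → List V
 flat [] = []
 flat (s ∷ []) = sL s
 flat (s ∷ t ∷ l) = sL s ++ flat (t ∷ l)

 at-∈-flat : ∀ d l i → i < length l → ∀ {y} → y ∈ sL (at d l i) → y ∈ flat l
 at-∈-flat d (s ∷ []) zero h m = m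
 at-∈-flat d (s ∷ []) (suc i) (s≤s ()) m
 at-∈-flat d (s ∷ t ∷ l) zero h m = ∈-++⁺ˡ m
 at-∈-flat d (s ∷ t ∷ l) (suc i) (s≤s h) m = ∈-++⁺ʳ (sL s) (at-∈-flat d (t ∷ l) i h m)

 at-U : ∀ d l i → i < length l → Unique (flat l) → Unique (sL (at d l i))
 at-U d (s ∷ []) zero h u = u
 at-U d (s ∷ []) (suc i) (s≤s ()) u
 at-U d (s ∷ t ∷ l) zero h u = U-++ˡ (sL s) u
 at-U d (s ∷ t ∷ l) (suc i) (s≤s h) u = at-U d (t ∷ l) i h (U-++ʳ (sL s) u)

 at-disj : ∀ d l i j → i < length l → j < length l → i ≢ j → Unique (flat l) → ∀ {y} → y ∈ sL (at d l i) → y ∈ sL (at d l j) → ⊥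
 at-disj d (s ∷ []) zero zero _ _ ne u p q = ne refl
 at-disj d (s ∷ []) (suc i) _ (s≤s ()) _ ne u p q
 at-disj d (s ∷ []) zero (suc j) _ (s≤s ()) ne u p q
 at-disj d (s ∷ t ∷ l) zero zero _ _ ne u p q = ne refl
 at-disj d (s ∷ t ∷ l) zero (suc j) _ (s≤s hj) ne u p q = U-disj (sL s) u p (at-∈-flat d (t ∷ l) j hj q)
 at-disj d (s ∷ t ∷ l) (suc i) zero (s≤s hi) _ ne u p q = U-disj (sL s) u q (at-∈-flat d (t ∷ l) i hi p)
 at-disj d (s ∷ t ∷ l) (suc i) (suc j) (s≤s hi) (s≤s hj) ne u p q = at-disj d (t ∷ l) i j hi hj (ne ∘ cong suc) (U-++ʳ (sL s) u) p q

 module Layout (s0 : Seg) (ss : List Seg) (ful : Unique (flat (s0 ∷ ss))) where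

  segs : List Seg
  segs = s0 ∷ ss

  nth : ℕ → Seg
  nth = at s0 segs

  ev : End → V
  ev (hd i) = sH (nth i)
  ev (tl i) = sT (nth i)

  -- Head and tail of a single vertex coincide; one normal form lets an edge recorded at one of them
  -- be found at the other.
  norm : End → End
  norm (hd i) = hd i
  norm (tl i) = if isV (nth i) then hd i else tl i

  norm-ev : ∀ x → ev (norm x) ≡ ev x
  norm-ev (hd i) = refl
  norm-ev (tl i) = go (nth i) refl
   where go : ∀ s → nth i ≡ s → ev (if isV s then hd i else tl i) ≡ sT (nth i)
         go (vx v) q = cong sH q ⨾ sym (cong sT q)
         go (seg _) q = refl

  Fact : Set
  Fact = Σ[ x ∈ End ] Σ[ y ∈ End ] (ev x) ~ (ev y)

  module Facts (facts : List Fact) where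

   same : End → End → Fact → Bool
   same x y (a , b , _) = (eqE (norm x) (norm a) ∧ eqE (norm y) (norm b)) ∨ (eqE (norm x) (norm b) ∧ eqE (norm y) (norm a))

   look : List Fact → End → End → Bool
   look [] x y = false
   look (f ∷ fa) x y = same x y f ∨ look fa x y

   edge? : End → End → Bool
   edge? = look facts

   norm-eq : ∀ x a → eqE (norm x) (norm a) ≡ true → ev x ≡ ev a
   norm-eq x a h = sym (norm-ev x) ⨾ cong ev (eqE-sound (norm x) (norm a) h) ⨾ norm-ev a

   look-sound : ∀ fa x y → look fa x y ≡ true → (ev x) ~ (ev y)
   look-sound ((a , b , p) ∷ fa) x y h with ∨-case h
   ... | inj₂ q = look-sound fa x y q
   ... | inj₁ q with ∨-case q
   ... | inj₁ r = subst₂ (λ u v → u ~ v) (sym (norm-eq x a (∧-l r))) (sym (norm-eq y b (∧-r r))) p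
   ... | inj₂ r = subst₂ (λ u v → u ~ v) (sym (norm-eq x b (∧-l r))) (sym (norm-eq y a (∧-r r))) (adj-sym p)

   edge-sound : ∀ x y → edge? x y ≡ true → (ev x) ~ (ev y)
   edge-sound = look-sound facts

   dL : SA → List V
   dL (fw i) = sL (nth i)
   dL (bw i) = reverse (sL (nth i))

   dW : ∀ a → Walk (ev (start a)) (dL a) (ev (end a))
   dW (fw i) = sW (nth i)
   dW (bw i) = w-rev (sW (nth i))

   den : List SA → List V
   den [] = []
   den (a ∷ []) = dL a
   den (a ∷ b ∷ l) = dL a ++ den (b ∷ l)

   lastE : SA → List SA → End
   lastE a [] = end a
   lastE a (b ∷ l) = lastE b l

   wok : List SA → Bool
   wok [] = false
   wok (a ∷ []) = true
   wok (a ∷ b ∷ l) = edge? (end a) (start b) ∧ wok (b ∷ l)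

   wok-sound : ∀ a l → wok (a ∷ l) ≡ true → Walk (ev (start a)) (den (a ∷ l)) (ev (lastE a l))
   wok-sound a [] h = dW a
   wok-sound a (b ∷ l) h = w-join (dW a) (edge-sound _ _ (∧-l h)) (wok-sound b l (∧-r h))

   inR : List ℕ → Bool
   inR [] = true
   inR (i ∷ l) = lt? i (length segs) ∧ inR l

   inR-sound : ∀ {l i} → inR l ≡ true → i ∈ l → i < length segs
   inR-sound {j ∷ l} h i1 = lt?-sound j _ (∧-l h)
   inR-sound {j ∷ l} h (there m) = inR-sound {l} (∧-r {lt? j (length segs)} h) m

   dL-∈ : ∀ a {y} → y ∈ dL a → y ∈ sL (nth (idx a))
   dL-∈ (fw i) m = m
   dL-∈ (bw i) m = Perm.∈-resp-↭ (Perm.↭-reverse (sL (nth i))) m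

   den-cons : ∀ a l {y} → y ∈ den (a ∷ l) → y ∈ dL a ⊎ y ∈ den l
   den-cons a [] m = inj₁ m
   den-cons a (b ∷ l) m = ∈-++⁻ (dL a) m

   den-∈ : ∀ l {y} → y ∈ den l → Σ[ i ∈ ℕ ] (i ∈ map idx l × y ∈ sL (nth i))
   den-∈ (a ∷ l) m with den-cons a l m
   ... | inj₁ q = idx a , here refl , dL-∈ a q
   ... | inj₂ q with den-∈ l q
   ... | i , i∈ , r = i , there i∈ , r

   den-flat : ∀ l → inR (map idx l) ≡ true → ∀ {y} → y ∈ den l → y ∈ flat segs
   den-flat l h m with den-∈ l m
   ... | i , i∈ , q = at-∈-flat s0 segs i (inR-sound {map idx l} h i∈) q

   den-U : ∀ l → inR (map idx l) ≡ true → distinct (map idx l) ≡ true → Unique (den l)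
   den-U [] h d = []
   den-U (a ∷ l) h d = go l (inR-sound {map idx (a ∷ l)} h i1) refl
    where
    uA : ∀ a → idx a < length segs → Unique (dL a)
    uA (fw i) lt = at-U s0 segs i lt ful
    uA (bw i) lt = U-rev (at-U s0 segs i lt ful)
    go : ∀ m → idx a < length segs → m ≡ l → Unique (den (a ∷ m))
    go [] lt q = uA a lt
    go (b ∷ m) lt refl = U-++ (uA a lt) (den-U l (∧-r {lt? (idx a) (length segs)} h) (∧-r {not (memb (idx a) (map idx l))} d)) dj
     where
     dj : ∀ {y} → y ∈ dL a → y ∈ den l → ⊥
     dj p q with den-∈ l q
     ... | j , j∈ , r = at-disj s0 segs (idx a) j lt (inR-sound {map idx l} (∧-r {lt? (idx a) (length segs)} h) j∈)
      (λ { refl → distinct-∉ d j∈ }) ful (dL-∈ a p) r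

   den-disj : ∀ l m → inR (map idx l) ≡ true → inR (map idx m) ≡ true → distinct (map idx l ++ map idx m) ≡ true →
    ∀ {y} → y ∈ den l → y ∈ den m → ⊥
   den-disj l m hl hm d p q with den-∈ l p | den-∈ m q
   ... | i , i∈ , r | j , j∈ , s = at-disj s0 segs i j (inR-sound {map idx l} hl i∈) (inR-sound {map idx m} hm j∈) (ne (map idx l) d i∈) ful r s
    where
    ne : ∀ L → distinct (L ++ map idx m) ≡ true → i ∈ L → i ≢ j
    ne (k ∷ L) d i1 refl = distinct-∉ d (∈-++⁺ʳ L j∈)
    ne (k ∷ L) d (there x) r = ne L (∧-r {not (memb k (L ++ map idx m))} d) x r

   -- An atom counts at most once and only its two ends are inspected, so the result is a lower
   -- bound for the number of neighbours.
   hubs : End → List SA → ℕ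
   hubs h [] = 0
   hubs h (a ∷ l) = b2n (edge? h (start a) ∨ edge? h (end a)) + hubs h l

   end∈ : ∀ a → ev (start a) ∈ dL a × ev (end a) ∈ dL a
   end∈ a = w-head∈ (dW a) , w-last∈ (dW a)

   hubs-sound : ∀ h l → hubs h l ≤ cntL (e (ev h)) (den l)
   hubs-sound h [] = z≤n
   hubs-sound h (a ∷ l) = ≤-trans (+-mono-≤ one1 (hubs-sound h l)) (≡⇒≤ (sym (split l)))
    where
    split : ∀ l → cntL (e (ev h)) (den (a ∷ l)) ≡ cntL (e (ev h)) (dL a) + cntL (e (ev h)) (den l)
    split [] = sym (+-identityʳ _)
    split (b ∷ l) = cntL-++ (e (ev h)) (dL a) (den (b ∷ l))
    one1 : b2n (edge? h (start a) ∨ edge? h (end a)) ≤ cntL (e (ev h)) (dL a)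
    one1 with edge? h (start a) ∨ edge? h (end a) in q
    ... | false = z≤n
    ... | true with ∨-case q
    ... | inj₁ r = cntL-pos (e (ev h)) (fst (end∈ a)) (edge-sound h (start a) r)
    ... | inj₂ r = cntL-pos (e (ev h)) (snd (end∈ a)) (edge-sound h (end a) r)

   three≤ : ℕ → Bool
   three≤ (suc (suc (suc _))) = true
   three≤ _ = false

   three≤-sound : ∀ m → three≤ m ≡ true → 3 ≤ m
   three≤-sound (suc (suc (suc _))) h = s≤s (s≤s (s≤s z≤n))

   is : ℕ → List SA → List ℕ
   is h l = h ∷ map idx l

   -- h must name a single vertex
   okCC : ℕ → List SA → Bool
   okCC h l = isV (nth h) ∧ inR (is h l) ∧ distinct (is h l) ∧ wok l ∧ three≤ (hubs (hd h) l)

   vx-list : ∀ s → isV s ≡ true → sL s ≡ sH s ∷ []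
   vx-list (vx v) h = refl

   ccV : ℕ → List SA → List V
   ccV h l = ev (hd h) ∷ den l

   okCC-sound : ∀ h l → okCC h l ≡ true → Σ[ C ∈ CC ] vs C ≡ ccV h l
   okCC-sound h [] q = ⊥-elim (true≢false (sym (∧-l {wok []} {three≤ 0} (∧-r {distinct (h ∷ [])} (∧-r {inR (h ∷ [])} (∧-r {isV (nth h)} q))))))
   okCC-sound h l@(a ∷ l') q = mkCC (wok-sound a l' q4) uq (≤-trans (three≤-sound _ q5) (hubs-sound (hd h) l)) , refl
    where
    q1 : isV (nth h) ≡ true
    q1 = ∧-l q
    q2 : inR (is h l) ≡ true
    q2 = ∧-l (∧-r {isV (nth h)} q)
    q3 : distinct (is h l) ≡ true
    q3 = ∧-l (∧-r {inR (is h l)} (∧-r {isV (nth h)} q))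
    q45 : wok l ∧ three≤ (hubs (hd h) l) ≡ true
    q45 = ∧-r {distinct (is h l)} (∧-r {inR (is h l)} (∧-r {isV (nth h)} q))
    q4 : wok l ≡ true
    q4 = ∧-l q45
    q5 = ∧-r {wok l} q45
    uq : Unique (ev (hd h) ∷ den l)
    uq = subst (λ t → Unique (t ++ den l)) (vx-list (nth h) q1)
     (den-U (fw h ∷ l) q2 q3)

   ccV-flat : ∀ h l → okCC h l ≡ true → ∀ {y} → y ∈ ccV h l → y ∈ flat segs
   ccV-flat h l q i1 = at-∈-flat s0 segs h (lt?-sound h _ (∧-l (∧-l (∧-r {isV (nth h)} q)))) (w-head∈ (sW (nth h)))
   ccV-flat h l q (there m) = den-flat l (∧-r {lt? h (length segs)} (∧-l (∧-r {isV (nth h)} q))) m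

   one-CC : ∀ h l → okCC h l ≡ true → Σ[ C ∈ CC ] (∀ {y} → y ∈ vs C → y ∈ flat segs)
   one-CC h l q with okCC-sound h l q
   ... | C , eq = C , λ m → ccV-flat h l q (cast∈ eq m)

   allV : List SA → Bool
   allV [] = true
   allV (a ∷ l) = isV (nth (idx a)) ∧ allV l

   den-length : ∀ l → allV l ≡ true → length (den l) ≡ length l
   den-length [] h = refl
   den-length (a ∷ l) h = go l ⨾ cong suc (den-length l (∧-r {isV (nth (idx a))} h))
    where
    la' : ∀ a → isV (nth (idx a)) ≡ true → length (dL a) ≡ 1
    la' (fw i) h = cong length (vx-list (nth i) h)
    la' (bw i) h = length-reverse (sL (nth i)) ⨾ cong length (vx-list (nth i) h)
    la = la' a (∧-l h)
    go : ∀ l → length (den (a ∷ l)) ≡ suc (length (den l))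
    go [] = la
    go (b ∷ l) = length-++ (dL a) ⨾ cong (_+ length (den (b ∷ l))) la

   small-CC : ∀ h l → okCC h l ∧ allV l ≡ true → Σ[ C ∈ CC ] ((∀ {y} → y ∈ vs C → y ∈ flat segs) × length (vs C) ≡ suc (length l))
   small-CC h l q with okCC-sound h l (∧-l q)
   ... | C , eq = C , (λ m → ccV-flat h l (∧-l q) (cast∈ eq m)) , (cong length eq ⨾ cong suc (den-length l (∧-r {okCC h l} q)))

   two-CC : ∀ h l h' l' → okCC h l ∧ okCC h' l' ∧ distinct (is h l ++ is h' l') ≡ true →
    Σ[ C ∈ CC ] Σ[ D ∈ CC ] ((∀ {y} → y ∈ vs C → y ∈ flat segs) × (∀ {y} → y ∈ vs D → y ∈ flat segs) × (∀ {y} → y ∈ vs C → y ∈ vs D → ⊥))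
   two-CC h l h' l' q with okCC-sound h l (∧-l q) | okCC-sound h' l' (∧-l (∧-r {okCC h l} q))
   ... | C , eq | D , eq' = C , D , (λ m → ccV-flat h l (∧-l q) (cast∈ eq m)) , (λ m → ccV-flat h' l' (∧-l (∧-r {okCC h l} q)) (cast∈ eq' m)) , dj
    where
    p1 = ∧-l {okCC h l} q
    p2 = ∧-l {okCC h' l'} (∧-r {okCC h l} q)
    dj : ∀ {y} → y ∈ vs C → y ∈ vs D → ⊥
    dj a b = den-disj (fw h ∷ l) (fw h' ∷ l') (∧-l (∧-r {isV (nth h)} p1)) (∧-l (∧-r {isV (nth h')} p2)) (∧-r {okCC h' l'} (∧-r {okCC h l} q))
     (up h l (∧-l p1) (cast∈ eq a)) (up h' l' (∧-l p2) (cast∈ eq' b))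
     where
     up : ∀ h l → isV (nth h) ≡ true → ∀ {y} → y ∈ ccV h l → y ∈ den (fw h ∷ l)
     up h [] q i1 = w-head∈ (sW (nth h))
     up h (b ∷ l) q i1 = ∈-++⁺ˡ (w-head∈ (sW (nth h)))
     up h (b ∷ l) q (there m) = ∈-++⁺ʳ (sL (nth h)) m
     up h [] q (there ())

-- Colourings with a remainder, recolouring, optimality

-- Colour 0 is the remainder R, the other colours are the classes containing one chorded cycle each.
module Col {n : ℕ} (G : Graph n) (k' : ℕ) where
 open Hub G public

 K : Set
 K = Fin (suc k')

 -- Any two enumerations of a class are permutations of each other, so size, degrees and edges of
 -- the class can be computed on whichever list displays its structure.
 record Lst (κ : V → K) (c : K) (l : List V) : Set where
  constructor mkL
  field
   lu : Unique l
   l⇒ : ∀ {y} → y ∈ l → κ y ≡ c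
   l⇐ : ∀ {y} → κ y ≡ c → y ∈ l
 open Lst public

 cls : (V → K) → K → List V
 cls κ c = filter (λ y → κ y Fin.≟ c) (allFin n)

 cls-L : ∀ κ c → Lst κ c (cls κ c)
 cls-L κ c = mkL (Uniq.filter⁺ (λ y → κ y Fin.≟ c) (Uniq.allFin⁺ n))
  (λ m → snd (∈-filter⁻ (λ y → κ y Fin.≟ c) {xs = allFin n} m))
  (λ q → ∈-filter⁺ (λ y → κ y Fin.≟ c) (∈-allFin _) q)

 L-↭ : ∀ {κ c l m} → Lst κ c l → Lst κ c m → l ↭ m
 L-↭ p q = U-same-↭ (lu p) (lu q) (l⇐ q ∘ l⇒ p) (l⇐ p ∘ l⇒ q)

 L-perm : ∀ {κ c l m} → l ↭ m → Lst κ c l → Lst κ c m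
 L-perm h p = mkL (U-↭ h (lu p)) (l⇒ p ∘ Perm.∈-resp-↭ (↭-sym h)) (Perm.∈-resp-↭ h ∘ l⇐ p)

 d : (V → K) → K → V → ℕ
 d κ c v = cntL (e v) (cls κ c)

 d-L : ∀ {κ c l} → Lst κ c l → ∀ v → d κ c v ≡ cntL (e v) l
 d-L {κ} {c} p v = cntL-↭ (e v) (L-↭ (cls-L κ c) p)

 deg-split : ∀ κ v → deg G v ≡ d κ fz v + ΣF (λ c → d κ (fs c) v)
 deg-split κ v = deg≡cnt G v ⨾ cnt-classes κ (e v) (allFin n)

 size : (V → K) → K → ℕ
 size κ c = length (cls κ c)

 size-L : ∀ {κ c l} → Lst κ c l → size κ c ≡ length l
 size-L {κ} {c} p = Perm.↭-length (L-↭ (cls-L κ c) p)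

 -- The number of edges inside the list: each vertex is compared only with those after it.
 eL : List V → ℕ
 eL [] = 0
 eL (x ∷ l) = cntL (e x) l + eL l

 eL-↭ : ∀ {l m} → l ↭ m → eL l ≡ eL m
 eL-↭ refl = refl
 eL-↭ (prep x h) = cong₂ _+_ (cntL-↭ (e x) h) (eL-↭ h)
 eL-↭ (swap {xs} {ys} x y h) rewrite E-sym G x y | cntL-↭ (e x) h | cntL-↭ (e y) h | eL-↭ h = lem (b2n (e y x)) (cntL (e x) ys) (cntL (e y) ys) (eL ys)
  where lem : ∀ a b c d → a + b + (c + d) ≡ a + c + (b + d)
        lem = solve-∀
 eL-↭ (↭tr h k) = eL-↭ h ⨾ eL-↭ k

 eL≤² : ∀ l → eL l ≤ length l * length l
 eL≤² [] = z≤n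
 eL≤² (x ∷ l) = ≤-trans (+-mono-≤ (cntL≤length (e x) l) (eL≤² l)) (≤-trans (m≤m+n (suc (length l) * length l) (suc (length l))) (≡⇒≤ (lem (length l))))
  where lem : ∀ a → suc a * a + suc a ≡ suc a * suc a
        lem = solve-∀

 edges : (V → K) → K → ℕ
 edges κ c = eL (cls κ c)

 edges-L : ∀ {κ c l} → Lst κ c l → edges κ c ≡ eL l
 edges-L {κ} {c} p = eL-↭ (L-↭ (cls-L κ c) p)

 Config : (V → K) → Set
 Config κ = ∀ (c : Fin k') → Σ[ C ∈ CC ] (∀ {y} → y ∈ vs C → κ y ≡ fs c)

 N M : (V → K) → ℕ
 N κ = ΣF (λ c → size κ (fs c))
 M κ = ΣF (λ c → edges κ (fs c))

 N+R : ∀ κ → size κ fz + N κ ≡ n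
 N+R κ = sym (ΣF-cong (λ c → sym (length≡cnt (cls κ c)))) ⨾ sym (cnt-classes κ (λ _ → true) (allFin n)) ⨾ sym (length≡cnt (allFin n)) ⨾ length-tab n
  where
  length-tab : ∀ m → length (allFin m) ≡ m
  length-tab m = len-tabulate (λ (i : Fin m) → i)
   where len-tabulate : ∀ {m} {A : Set} (f : Fin m → A) → length (tabulate f) ≡ m
         len-tabulate {zero} f = refl
         len-tabulate {suc m} f = cong suc (len-tabulate (f ∘ fs))

 In : (V → K) → Fin k' → V → Set
 In κ c y = κ y ≡ fz ⊎ κ y ≡ fs c

 -- `X` becomes class `c`, and what else was in that class goes to the remainder. For `X` inside R
 -- and class `c` the other classes are untouched.
 recolor : List V → Fin k' → (V → K) → V → K
 recolor X c κ y with y ∈? X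
 ... | yes _ = fs c
 ... | no _ with κ y Fin.≟ fs c
 ... | yes _ = fz
 ... | no _ = κ y

 module _ {X : List V} {c : Fin k'} {κ : V → K} where

  r-in : ∀ {y} → y ∈ X → recolor X c κ y ≡ fs c
  r-in {y} m with y ∈? X
  ... | yes _ = refl
  ... | no ¬m = ⊥-elim (¬m m)

  r-out : ∀ {y} → y ∉ X → In κ c y → recolor X c κ y ≡ fz
  r-out {y} ¬m q with y ∈? X
  ... | yes m = ⊥-elim (¬m m)
  ... | no _ with κ y Fin.≟ fs c | q
  ... | yes _ | _ = refl
  ... | no _ | inj₁ z = z
  ... | no ¬e | inj₂ z = ⊥-elim (¬e z)

  r-c : ∀ {y} → recolor X c κ y ≡ fs c → y ∈ X
  r-c {y} q with y ∈? X
  ... | yes m = m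
  ... | no _ with κ y Fin.≟ fs c
  r-c {y} () | no _ | yes _
  ... | no ¬e = ⊥-elim (¬e q)

  r-0 : ∀ {y} → recolor X c κ y ≡ fz → y ∉ X × In κ c y
  r-0 {y} q with y ∈? X
  r-0 {y} () | yes _
  ... | no ¬m with κ y Fin.≟ fs c
  ... | yes z = ¬m , inj₂ z
  ... | no ¬e = ¬m , inj₁ q

  r-oth : (∀ {y} → y ∈ X → In κ c y) → ∀ {y x} → x ≢ c → κ y ≡ fs x → recolor X c κ y ≡ fs x
  r-oth h {y} {x} ne q with y ∈? X
  ... | yes m with h m
  ... | inj₁ z = ⊥-elim (Fin.0≢1+n (sym z ⨾ q))
  ... | inj₂ z = ⊥-elim (ne (Fin.suc-injective (sym q ⨾ z)))
  r-oth h {y} {x} ne q | no _ with κ y Fin.≟ fs c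
  ... | yes z = ⊥-elim (ne (Fin.suc-injective (sym q ⨾ z)))
  ... | no _ = q

  r-oth⁻ : ∀ {y x} → x ≢ c → recolor X c κ y ≡ fs x → κ y ≡ fs x
  r-oth⁻ {y} {x} ne q with y ∈? X
  ... | yes m = ⊥-elim (ne (Fin.suc-injective (sym q)))
  ... | no _ with κ y Fin.≟ fs c
  r-oth⁻ {y} {x} ne () | no _ | yes _
  ... | no _ = q

  r-L-oth : (∀ {y} → y ∈ X → In κ c y) → ∀ {x l} → x ≢ c → Lst κ (fs x) l → Lst (recolor X c κ) (fs x) l
  r-L-oth h ne p = mkL (lu p) (λ m → r-oth h ne (l⇒ p m)) (λ q → l⇐ p (r-oth⁻ ne q))

  r-L-c : Unique X → Lst (recolor X c κ) (fs c) X
  r-L-c u = mkL u r-in r-c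

  r-L-0 : ∀ {C R Y} → Lst κ (fs c) C → Lst κ fz R → X ++ Y ↭ C ++ R → Lst (recolor X c κ) fz Y
  r-L-0 {C} {R} {Y} pC pR h = mkL (U-++ʳ X uXY) f g
   where
   uXY : Unique (X ++ Y)
   uXY = U-↭ (↭-sym h) (U-++ (lu pC) (lu pR) (λ a b → Fin.0≢1+n (sym (l⇒ pR b) ⨾ l⇒ pC a)))
   f : ∀ {y} → y ∈ Y → recolor X c κ y ≡ fz
   f m with ∈-++⁻ C (Perm.∈-resp-↭ h (∈-++⁺ʳ X m))
   ... | inj₁ q = r-out (λ x → U-disj X uXY x m) (inj₂ (l⇒ pC q))
   ... | inj₂ q = r-out (λ x → U-disj X uXY x m) (inj₁ (l⇒ pR q))
   g : ∀ {y} → recolor X c κ y ≡ fz → y ∈ Y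
   g {y} q with r-0 q
   ... | ¬m , i with ∈-++⁻ X (Perm.∈-resp-↭ (↭-sym h) (k i))
    where k : In κ c y → y ∈ C ++ R
          k (inj₁ z) = ∈-++⁺ʳ C (l⇐ pR z)
          k (inj₂ z) = ∈-++⁺ˡ (l⇐ pC z)
   ... | inj₁ x = ⊥-elim (¬m x)
   ... | inj₂ y∈ = y∈

  r-Config : (∀ {y} → y ∈ X → In κ c y) → Config κ → Σ[ C ∈ CC ] (∀ {y} → y ∈ vs C → y ∈ X) → Config (recolor X c κ)
  r-Config h cf (C , C⊂) x with x Fin.≟ c
  ... | yes refl = C , λ m → r-in (C⊂ m)
  ... | no ne = fst (cf x) , λ m → r-oth h ne (snd (cf x) m)

  r-N : (∀ {y} → y ∈ X → In κ c y) → Unique X → N (recolor X c κ) + size κ (fs c) ≡ N κ + length X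
  r-N h u = ΣF-replace c (λ x ne → size-L (r-L-oth h ne (cls-L κ (fs x)))) ⨾ cong (N κ +_) (size-L (r-L-c u))

  r-M : (∀ {y} → y ∈ X → In κ c y) → Unique X → M (recolor X c κ) + edges κ (fs c) ≡ M κ + eL X
  r-M h u = ΣF-replace c (λ x ne → edges-L (r-L-oth h ne (cls-L κ (fs x)))) ⨾ cong (M κ +_) (edges-L (r-L-c u))

 record Opt (κ : V → K) : Set where
  constructor mkOpt
  field
   cfg : Config κ
   minN : ∀ κ' → Config κ' → N κ ≤ N κ'
   maxM : ∀ κ' → Config κ' → N κ' ≡ N κ → M κ' ≤ M κ
 open Opt public

 module NoK (noK : ∀ (κ : V → K) → KCC κ → ⊥) where

  noCC₀ : ∀ {κ} → Config κ → (C : CC) → (∀ {y} → y ∈ vs C → κ y ≡ fz) → ⊥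
  noCC₀ {κ} cf C h = noK κ λ { fz → C , h ; (fs c) → cf c }

  -- With the first cycle as the new class `c`, the second lies in the remainder and supplies the
  -- missing k-th class.
  two : ∀ {κ} → Config κ → ∀ c (C D : CC) → (∀ {y} → y ∈ vs C → In κ c y) → (∀ {y} → y ∈ vs D → In κ c y) →
   (∀ {y} → y ∈ vs C → y ∈ vs D → ⊥) → ⊥
  two {κ} cf c C D hC hD dj = noCC₀ (r-Config hC cf (C , λ m → m)) D λ m → r-out (λ x → dj x m) (hD m)

  module _ {κ : V → K} (o : Opt κ) (c : Fin k') where

   -- Otherwise `C` could replace the class, and `N` would drop.
   not-small : (C : CC) → (∀ {y} → y ∈ vs C → In κ c y) → size κ (fs c) ≤ length (vs C)
   not-small C h = +-cancelˡ-≤ (N κ) _ _ (≤-trans (+-monoˡ-≤ _ (minN o _ (r-Config h (cfg o) (C , λ m → m)))) (≡⇒≤ (r-N h (cuq C))))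

   swapM : ∀ {X} → Unique X → length X ≡ size κ (fs c) → (∀ {y} → y ∈ X → In κ c y) → Σ[ C ∈ CC ] (∀ {y} → y ∈ vs C → y ∈ X) → eL X ≤ edges κ (fs c)
   swapM {X} u len h CX = +-cancelˡ-≤ (M κ) _ _ (≤-trans (≡⇒≤ (sym (r-M {X = X} {κ = κ} h u))) (+-monoˡ-≤ _ (maxM o _ (r-Config h (cfg o) CX) (+-cancelʳ-≡ (size κ (fs c)) _ _ (r-N h u ⨾ cong (N κ +_) len)))))

   -- An exchange that keeps the size and loses no edge leads to another optimal colouring. All
   -- structural results then hold for it as well, which is how information spreads from R to the
   -- classes.
   swapO : ∀ {X} → Unique X → length X ≡ size κ (fs c) → (∀ {y} → y ∈ X → In κ c y) → Σ[ C ∈ CC ] (∀ {y} → y ∈ vs C → y ∈ X) →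
    edges κ (fs c) ≤ eL X → Opt (recolor X c κ)
   swapO {X} u len h CX le = mkOpt (r-Config h (cfg o) CX)
    (λ κ' cf → ≤-trans (≡⇒≤ Neq) (minN o κ' cf))
    (λ κ' cf q → ≤-trans (maxM o κ' cf (q ⨾ Neq)) Mle)
    where
    Neq : N (recolor X c κ) ≡ N κ
    Neq = +-cancelʳ-≡ (size κ (fs c)) _ _ (r-N h u ⨾ cong (N κ +_) len)
    Mle : M κ ≤ M (recolor X c κ)
    Mle = +-cancelʳ-≤ (edges κ (fs c)) _ _ (≤-trans (+-monoʳ-≤ (M κ) le) (≡⇒≤ (sym (r-M {X = X} {κ = κ} h u))))

  optimal : ∀ κ → Config κ → (∀ κ → Opt κ → N κ ≤ n → ⊥) → ⊥
  -- A minimum of `N` is taken as a maximum of `n ∸ N`; truncation does no harm because `N κ` never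
  -- exceeds `n`.
  optimal κ cf k = maximal Config (λ κ → n ∸ N κ) n (λ κ _ → m∸n≤m n (N κ)) κ cf λ κ₁ cf₁ mx₁ →
   maximal (λ κ → Config κ × N κ ≡ N κ₁) M (n * n * k') (λ κ q → Mbd {λ _ → ⊤} κ tt) κ₁ (cf₁ , refl) λ κ₂ (cf₂ , N₂) mx₂ →
   k κ₂ (mkOpt cf₂ (λ κ' cf' → ∸-cancel' (mx₁ κ' cf') (N≤n κ') (N≤n κ₁) (cong (n ∸_) N₂) N₂) (λ κ' cf' q → mx₂ κ' (cf' , (q ⨾ N₂)))) (N≤n κ₂)
   where
   N≤n : ∀ κ → N κ ≤ n
   N≤n κ = ≤-trans (m≤n+m (N κ) (size κ fz)) (≡⇒≤ (N+R κ))
   ∸-cancel' : ∀ {a b c} → n ∸ a ≤ n ∸ b → a ≤ n → b ≤ n → n ∸ c ≡ n ∸ b → c ≡ b → c ≤ a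
   ∸-cancel' {a} {b} h a≤ b≤ _ refl = ∸-cancelʳ-≤ b≤ h
   cls≤ : ∀ κ c → length (cls κ c) ≤ n
   cls≤ κ fz = ≤-trans (m≤m+n _ (N κ)) (≡⇒≤ (N+R κ))
   cls≤ κ (fs c) = ≤-trans (term≤Σ (λ c → size κ (fs c)) c) (N≤n κ)
    where term≤Σ : ∀ {m} (f : Fin m → ℕ) c → f c ≤ ΣF f
          term≤Σ f fz = m≤m+n _ _
          term≤Σ f (fs c) = ≤-trans (term≤Σ (f ∘ fs) c) (m≤n+m _ _)
   Mbd : ∀ {P : (V → K) → Set} κ → P κ → M κ ≤ n * n * k'
   Mbd κ _ = ΣF-upper (λ c → ≤-trans (eL≤² (cls κ (fs c))) (*-mono-≤ (cls≤ κ (fs c)) (cls≤ κ (fs c))))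

-- Exhaustive checks of adjacency patterns

allB : ∀ m → (Vec Bool m → Bool) → Bool
allB zero f = f []
allB (suc m) f = allB m (f ∘ (true ∷_)) ∧ allB m (f ∘ (false ∷_))

allB-sound : ∀ m f → allB m f ≡ true → ∀ bs → f bs ≡ true
allB-sound zero f h [] = h
allB-sound (suc m) f h (true ∷ bs) = allB-sound m _ (∧-l h) bs
allB-sound (suc m) f h (false ∷ bs) = allB-sound m _ (∧-r {allB m (f ∘ (true ∷_))} h) bs

infixr 4 _⇒b_
_⇒b_ : Bool → Bool → Bool
true ⇒b b = b
false ⇒b b = true

mp : ∀ {a b} → (a ⇒b b) ≡ true → a ≡ true → b ≡ true
mp h refl = h

le? : ℕ → ℕ → Bool
le? a b = lt? a (suc b)

le?-sound : ∀ a b → le? a b ≡ true → a ≤ b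
le?-sound a b h = ≤-pred (lt?-sound a (suc b) h)

le?-complete : ∀ {a b} → a ≤ b → le? a b ≡ true
le?-complete z≤n = refl
le?-complete (s≤s h) = le?-complete h

sumB : List Bool → ℕ
sumB = cntL id

-- What a vertex of R can see of a class

module Tools {n : ℕ} (G : Graph n) (k' : ℕ) where
 open Col G k' public
 open Engine G public

 module WithNoK (noK : ∀ (κ : V → K) → KCC κ → ⊥) where
  open NoK noK public

  two! : ∀ {κ} → Config κ → ∀ c s0 ss (u : Unique (flat (s0 ∷ ss))) → (∀ {y} → y ∈ flat (s0 ∷ ss) → In κ c y) →
   (fa : List (Layout.Fact s0 ss u)) → ∀ h l h' l' →
   (let open Layout.Facts s0 ss u fa in okCC h l ∧ okCC h' l' ∧ distinct (is h l ++ is h' l')) ≡ true → ⊥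
  two! cf c s0 ss u i fa h l h' l' q with Layout.Facts.two-CC s0 ss u fa h l h' l' q
  ... | C , D , hC , hD , dj = two cf c C D (i ∘ hC) (i ∘ hD) dj

  one! : ∀ {κ} → Config κ → ∀ s0 ss (u : Unique (flat (s0 ∷ ss))) → (∀ {y} → y ∈ flat (s0 ∷ ss) → κ y ≡ fz) →
   (fa : List (Layout.Fact s0 ss u)) → ∀ h l → Layout.Facts.okCC s0 ss u fa h l ≡ true → ⊥
  one! cf s0 ss u i fa h l q with Layout.Facts.one-CC s0 ss u fa h l q
  ... | C , hC = noCC₀ cf C (i ∘ hC)

  small! : ∀ {κ} → Opt κ → ∀ c s0 ss (u : Unique (flat (s0 ∷ ss))) → (∀ {y} → y ∈ flat (s0 ∷ ss) → In κ c y) →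
   (fa : List (Layout.Fact s0 ss u)) → ∀ h l → suc (suc (length l)) ≤ size κ (fs c) →
   (let open Layout.Facts s0 ss u fa in okCC h l ∧ allV l) ≡ true → ⊥
  small! o c s0 ss u i fa h l sz q with Layout.Facts.small-CC s0 ss u fa h l q
  ... | C , hC , len = <-irrefl refl (≤-trans (≤-trans (s≤s (≡⇒≤ len)) sz) (not-small o c C (i ∘ hC)))

  CC! : ∀ s0 ss (u : Unique (flat (s0 ∷ ss))) → (fa : List (Layout.Fact s0 ss u)) → ∀ h l → Layout.Facts.okCC s0 ss u fa h l ≡ true →
   Σ[ C ∈ CC ] (∀ {y} → y ∈ vs C → y ∈ flat (s0 ∷ ss))
  CC! s0 ss u fa h l q = Layout.Facts.one-CC s0 ss u fa h l q

  mixU : ∀ {κ c C R'} → Lst κ (fs c) C → Unique R' → (∀ {y} → y ∈ R' → κ y ≡ fz) → Unique (C ++ R')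
  mixU p u h = U-++ (lu p) u (λ a b → Fin.0≢1+n (sym (h b) ⨾ l⇒ p a))

  mixI : ∀ {κ c C R'} → Lst κ (fs c) C → (∀ {y} → y ∈ R' → κ y ≡ fz) → ∀ {y} → y ∈ C ++ R' → In κ c y
  mixI {C = C} p h m with ∈-++⁻ C m
  ... | inj₁ q = inj₂ (l⇒ p q)
  ... | inj₂ q = inj₁ (h q)

  in1 : ∀ {κ : V → K} {v} → κ v ≡ fz → ∀ {y} → y ∈ v ∷ [] → κ y ≡ fz
  in1 h i1 = h

  in2 : ∀ {κ : V → K} {v w} → κ v ≡ fz → κ w ≡ fz → ∀ {y} → y ∈ v ∷ w ∷ [] → κ y ≡ fz
  in2 h g i1 = h
  in2 h g i2 = g

  uq1 : ∀ {v : V} → Unique (v ∷ [])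
  uq1 = [] ∷ []

  uq2 : ∀ {v w : V} → v ≢ w → Unique (v ∷ w ∷ [])
  uq2 h = (h ∷ []) ∷ [] ∷ []

  -- With a third neighbour on `Q`, the vertex `v` and `Q` would carry a chorded cycle smaller than
  -- the class.
  smallv : ∀ {κ} → Opt κ → ∀ c {v} → κ v ≡ fz → ∀ {a Q b} → Walk a Q b → Unique Q → (∀ {y} → y ∈ Q → κ y ≡ fs c) →
   suc (suc (length Q)) ≤ size κ (fs c) → cntL (e v) Q ≤ 2
  smallv {κ} o c {v} kv {Q = Q} w u h sz with 3 ≤? cntL (e v) Q
  ... | no q = ≤-pred (≰⇒> q)
  ... | yes q = ⊥-elim (<-irrefl refl (≤-trans sz (not-small o c (mkCC w (U-cons (λ m → Fin.0≢1+n (sym kv ⨾ h m)) u) q)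
   λ { i1 → inj₁ kv ; (there m) → inj₂ (h m) })))

  record K33 (κ : V → K) (c : Fin k') : Set where
   constructor mk33
   field
    {a₁ a₂ a₃ b₁ b₂ b₃} : V
    l33 : Lst κ (fs c) (a₁ ∷ a₂ ∷ a₃ ∷ b₁ ∷ b₂ ∷ b₃ ∷ [])
    a33 : ∀ {a b} → a ∈ a₁ ∷ a₂ ∷ a₃ ∷ [] → b ∈ b₁ ∷ b₂ ∷ b₃ ∷ [] → a ~ b
   A B : List V
   A = a₁ ∷ a₂ ∷ a₃ ∷ []
   B = b₁ ∷ b₂ ∷ b₃ ∷ []

  -- `k4m` is K₄ without the edge αγ, and `k5` a 5-cycle with the chord xz. From six vertices on,
  -- only the bound 3 is kept and the fact that equality forces K₃,₃.
  data Kind (κ : V → K) (c : Fin k') : Set where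
   k4 : ∀ {w x y z} → Lst κ (fs c) (w ∷ x ∷ y ∷ z ∷ []) → w ~ x → w ~ y → w ~ z →
    x ~ y → x ~ z → y ~ z → Kind κ c
   k4m : ∀ {α β γ δ} → Lst κ (fs c) (α ∷ β ∷ γ ∷ δ ∷ []) → α ~ β → β ~ γ → γ ~ δ → δ ~ α →
    β ~ δ → α ≁ γ → Kind κ c
   k5 : ∀ {x y z w t} → Lst κ (fs c) (x ∷ y ∷ z ∷ w ∷ t ∷ []) → x ~ y → y ~ z → z ~ w → w ~ t →
    t ~ x → x ~ z → Kind κ c
   big : 6 ≤ size κ (fs c) → (∀ {v} → κ v ≡ fz → d κ (fs c) v ≤ 3) → (∀ {v} → κ v ≡ fz → d κ (fs c) v ≡ 3 → K33 κ c) → Kind κ c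

  -- A vertex of the class outside the trimmed cycle would make the cycle smaller than the class,
  -- against minimality of `N`.
  trim-L : ∀ {κ} → Opt κ → ∀ c → Σ[ T ∈ Trim ] Lst κ (fs c) (tvs T)
  trim-L {κ} o c with cfg o c
  ... | C , hC with trim C
  ... | T , sub = T , mkL (tuq T) (hC ∘ sub) back
   where
   D : CC
   D = mkCC (twk T) (tuq T) (≤-trans (s≤s (≤-trans (s≤s (eM T)) (≡⇒≤ (+-comm 1 (cntL (e (th T)) (tM T))))))
    (≡⇒≤ (cong₂ _+_ (sym (cong b2n (ey T))) (sym (cntL-++ (e (th T)) (tM T) (tz T ∷ []) ⨾ cong (λ t → cntL (e (th T)) (tM T) + (b2n t + 0)) (ez T))))))
   back : ∀ {y} → κ y ≡ fs c → y ∈ tvs T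
   back {y} q with y ∈? tvs T
   ... | yes m = m
   ... | no ¬m = ⊥-elim (<-irrefl refl (≤-trans (U-⊆-length (U-cons ¬m (tuq T)) f) (not-small o c D (inj₂ ∘ hC ∘ sub))))
    where f : ∀ {x} → x ∈ y ∷ tvs T → x ∈ cls κ (fs c)
          f i1 = l⇐ (cls-L κ (fs c)) q
          f (there m) = l⇐ (cls-L κ (fs c)) (hC (sub m))

  module _ {κ : V → K} (o : Opt κ) (c : Fin k') where

   record Cyc6 (c0 c1 c2 c3 c4 c5 : V) : Set where
    constructor cyc6
    field
     l6 : Lst κ (fs c) (c0 ∷ c1 ∷ c2 ∷ c3 ∷ c4 ∷ c5 ∷ [])
     e01 : c0 ~ c1
     e12 : c1 ~ c2
     e23 : c2 ~ c3
     e34 : c3 ~ c4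
     e45 : c4 ~ c5
     e50 : c5 ~ c0

   rot6 : ∀ {c0 c1 c2 c3 c4 c5} → Cyc6 c0 c1 c2 c3 c4 c5 → Cyc6 c1 c2 c3 c4 c5 c0
   rot6 {c0} (cyc6 l a b c d f g) = cyc6 (L-perm (Perm.++-comm (c0 ∷ []) _) l) b c d f g a

   private
    u7 : ∀ {c0 c1 c2 c3 c4 c5 v} → Cyc6 c0 c1 c2 c3 c4 c5 → κ v ≡ fz → Unique (c0 ∷ c1 ∷ c2 ∷ c3 ∷ c4 ∷ c5 ∷ v ∷ [])
    u7 y kv = mixU (Cyc6.l6 y) uq1 (in1 {κ} kv)
    i7 : ∀ {c0 c1 c2 c3 c4 c5 v} → Cyc6 c0 c1 c2 c3 c4 c5 → κ v ≡ fz → ∀ {x} → x ∈ c0 ∷ c1 ∷ c2 ∷ c3 ∷ c4 ∷ c5 ∷ v ∷ [] → In κ c x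
    i7 y kv = mixI {κ} (Cyc6.l6 y) (in1 {κ} kv)
    sz6 : ∀ {c0 c1 c2 c3 c4 c5} → Cyc6 c0 c1 c2 c3 c4 c5 → 6 ≤ size κ (fs c)
    sz6 y = ≡⇒≤ (sym (size-L (Cyc6.l6 y)))

   -- v sees c0, c2, c4: short chords would give a chorded cycle on 4 or 5 vertices
   no02 : ∀ {c0 c1 c2 c3 c4 c5 v} → (y : Cyc6 c0 c1 c2 c3 c4 c5) → κ v ≡ fz → v ~ c0 → v ~ c2 → c0 ~ c2 → ⊥
   no02 {c0} {c1} {c2} {c3} {c4} {c5} {v} y kv v0 v2 p = small! o c (vx c0) (vx c1 ∷ vx c2 ∷ vx c3 ∷ vx c4 ∷ vx c5 ∷ vx v ∷ []) (u7 y kv) (i7 y kv)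
    (0 - 1 ! e01 ∷ 1 - 2 ! e12 ∷ 6 - 0 ! v0 ∷ 6 - 2 ! v2 ∷ 0 - 2 ! p ∷ [])
    0 (fw 6 ∷ fw 2 ∷ fw 1 ∷ []) (≤-trans (n≤1+n 5) (sz6 y)) refl
    where open Cyc6 y

   no13 : ∀ {c0 c1 c2 c3 c4 c5 v} → (y : Cyc6 c0 c1 c2 c3 c4 c5) → κ v ≡ fz → v ~ c0 → v ~ c2 → c1 ~ c3 → ⊥
   no13 {c0} {c1} {c2} {c3} {c4} {c5} {v} y kv v0 v2 p = small! o c (vx c0) (vx c1 ∷ vx c2 ∷ vx c3 ∷ vx c4 ∷ vx c5 ∷ vx v ∷ []) (u7 y kv) (i7 y kv)
    (0 - 1 ! e01 ∷ 1 - 2 ! e12 ∷ 2 - 3 ! e23 ∷ 6 - 0 ! v0 ∷ 6 - 2 ! v2 ∷ 1 - 3 ! p ∷ [])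
    1 (fw 0 ∷ fw 6 ∷ fw 2 ∷ fw 3 ∷ []) (sz6 y) refl
    where open Cyc6 y

   -- If c1c4 were missing, c1 would have only the two neighbours c0 and c2 among the other five,
   -- while `v` has three; exchanging c1 for `v` would gain an edge.
   long14 : ∀ {c0 c1 c2 c3 c4 c5 v} → (y : Cyc6 c0 c1 c2 c3 c4 c5) → κ v ≡ fz → v ~ c0 → v ~ c2 → v ~ c4 →
    v ≁ c1 → v ≁ c3 → v ≁ c5 → c1 ~ c4
   long14 {c0} {c1} {c2} {c3} {c4} {c5} {v} y kv v0 v2 v4 v1 v3 v5 with e c1 c4 in e14
   ... | true = refl
   ... | false = ⊥-elim (absurd (≤-trans (swapM o c uX (sym (size-L (Cyc6.l6 y))) iX CX) (≡⇒≤ (edges-L (Cyc6.l6 y)))))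
    where
    open Cyc6 y
    y2 = rot6 (rot6 y)
    y4 = rot6 (rot6 y2)
    X : List V
    X = v ∷ c0 ∷ c2 ∷ c3 ∷ c4 ∷ c5 ∷ []
    perm : c0 ∷ c1 ∷ c2 ∷ c3 ∷ c4 ∷ c5 ∷ v ∷ [] ↭ c1 ∷ X
    perm = ↭-trans (swap c0 c1 refl) (prep c1 (Perm.++-comm (c0 ∷ c2 ∷ c3 ∷ c4 ∷ c5 ∷ []) (v ∷ [])))
    uX : Unique X
    uX = U-++ʳ (c1 ∷ []) (U-↭ perm (u7 y kv))
    iX : ∀ {x} → x ∈ X → In κ c x
    iX m = i7 y kv (Perm.∈-resp-↭ (↭-sym perm) (there m))
    CX : Σ[ C ∈ CC ] (∀ {x} → x ∈ vs C → x ∈ X)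
    CX = CC! (vx v) (vx c0 ∷ vx c2 ∷ vx c3 ∷ vx c4 ∷ vx c5 ∷ []) uX
     (0 - 1 ! v0 ∷ 0 - 2 ! v2 ∷ 0 - 4 ! v4 ∷ 2 - 3 ! e23 ∷ 3 - 4 ! e34 ∷ 4 - 5 ! e45 ∷ 5 - 1 ! e50 ∷ [])
     0 (fw 2 ∷ fw 3 ∷ fw 4 ∷ fw 5 ∷ fw 1 ∷ []) refl
    f02 : c0 ≁ c2
    f02 = ¬t→f (no02 y kv v0 v2)
    f24 : c2 ≁ c4
    f24 = ¬t→f (no02 y2 kv v2 v4)
    f40 : c4 ≁ c0
    f40 = ¬t→f (no02 y4 kv v4 v0)
    f13 : c1 ≁ c3
    f13 = ¬t→f (no13 y kv v0 v2)
    f35 : c3 ≁ c5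
    f35 = ¬t→f (no13 y2 kv v2 v4)
    f51 : c5 ≁ c1
    f51 = ¬t→f (no13 y4 kv v4 v0)
    absurd : eL X ≤ eL (c0 ∷ c1 ∷ c2 ∷ c3 ∷ c4 ∷ c5 ∷ []) → ⊥
    absurd le rewrite v0 | v2 | v3 | v4 | v5 | e01 | e12 | e23 | e34 | e45 | adj-sym e50 | f02 | f24 | nadj-sym f40 | f13 | f35 | nadj-sym f51 | e14
     with e c0 c3 | e c2 c5
    ... | true | true = <-irrefl refl le
    ... | true | false = <-irrefl refl le
    ... | false | true = <-irrefl refl le
    ... | false | false = <-irrefl refl le

   alt→33 : ∀ {c0 c1 c2 c3 c4 c5 v} → (y : Cyc6 c0 c1 c2 c3 c4 c5) → κ v ≡ fz → v ~ c0 → v ~ c2 → v ~ c4 →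
    v ≁ c1 → v ≁ c3 → v ≁ c5 → K33 κ c
   alt→33 {c0} {c1} {c2} {c3} {c4} {c5} {v} y kv v0 v2 v4 v1 v3 v5 = mk33 {a₁ = c0} {c2} {c4} {c1} {c3} {c5}
    (L-perm (prep c0 (↭-trans (swap c1 c2 refl) (prep c2 (↭-trans (prep c1 (swap c3 c4 refl)) (swap c1 c4 refl))))) l6) adj
    where
    open Cyc6 y
    y2 = rot6 (rot6 y)
    y4 = rot6 (rot6 y2)
    e14 = long14 y kv v0 v2 v4 v1 v3 v5
    e30 = long14 y2 kv v2 v4 v0 v3 v5 v1
    e52 = long14 y4 kv v4 v0 v2 v5 v1 v3
    adj : ∀ {a b} → a ∈ c0 ∷ c2 ∷ c4 ∷ [] → b ∈ c1 ∷ c3 ∷ c5 ∷ [] → a ~ b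
    adj i1 i1 = e01
    adj i1 i2 = adj-sym e30
    adj i1 i3 = adj-sym e50
    adj i2 i1 = adj-sym e12
    adj i2 i2 = e23
    adj i2 i3 = adj-sym e52
    adj i3 i1 = adj-sym e14
    adj i3 i2 = adj-sym e34
    adj i3 i3 = e45

   module Six {c0 c1 c2 c3 c4 c5 : V} (y : Cyc6 c0 c1 c2 c3 c4 c5) where
    open Cyc6 y

    drop : ∀ {c0 c1 c2 c3 c4 c5} → Cyc6 c0 c1 c2 c3 c4 c5 → ∀ {v} → κ v ≡ fz → cntL (e v) (c2 ∷ c3 ∷ c4 ∷ c5 ∷ []) ≤ 2
    drop y kv = smallv o c kv (Cyc6.e23 y ∷ Cyc6.e34 y ∷ Cyc6.e45 y ∷ one) (U-++ʳ (_ ∷ _ ∷ []) (lu (Cyc6.l6 y))) (λ m → l⇒ (Cyc6.l6 y) (there (there m))) (sz6 y)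

    -- One inequality for each pair of consecutive vertices: `smallv` applied to the four remaining
    -- vertices of the 6-cycle.
    cond : Vec Bool 6 → Bool
    cond (b0 ∷ b1 ∷ b2 ∷ b3 ∷ b4 ∷ b5 ∷ []) =
     le? (sumB (b2 ∷ b3 ∷ b4 ∷ b5 ∷ [])) 2 ∧ le? (sumB (b3 ∷ b4 ∷ b5 ∷ b0 ∷ [])) 2 ∧ le? (sumB (b4 ∷ b5 ∷ b0 ∷ b1 ∷ [])) 2 ∧
     le? (sumB (b5 ∷ b0 ∷ b1 ∷ b2 ∷ [])) 2 ∧ le? (sumB (b0 ∷ b1 ∷ b2 ∷ b3 ∷ [])) 2 ∧ le? (sumB (b1 ∷ b2 ∷ b3 ∷ b4 ∷ [])) 2

    concl alt : Vec Bool 6 → Bool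
    alt (b0 ∷ b1 ∷ b2 ∷ b3 ∷ b4 ∷ b5 ∷ []) = (b0 ∧ b2 ∧ b4 ∧ not b1 ∧ not b3 ∧ not b5) ∨ (not b0 ∧ not b2 ∧ not b4 ∧ b1 ∧ b3 ∧ b5)
    tot : Vec Bool 6 → ℕ
    tot (b0 ∷ b1 ∷ b2 ∷ b3 ∷ b4 ∷ b5 ∷ []) = sumB (b0 ∷ b1 ∷ b2 ∷ b3 ∷ b4 ∷ b5 ∷ [])
    concl bs = le? (tot bs) 3 ∧ (le? 3 (tot bs) ⇒b alt bs)

    bits : V → Vec Bool 6
    bits v = e v c0 ∷ e v c1 ∷ e v c2 ∷ e v c3 ∷ e v c4 ∷ e v c5 ∷ []

    holds : ∀ {v} → κ v ≡ fz → concl (bits v) ≡ true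
    holds {v} kv = mp (allB-sound 6 (λ bs → cond bs ⇒b concl bs) refl (bits v))
     (∧-i (le?-complete (drop y kv)) (∧-i (le?-complete (drop (rot6 y) kv)) (∧-i (le?-complete (drop (rot6 (rot6 y)) kv))
     (∧-i (le?-complete (drop (rot6 (rot6 (rot6 y))) kv)) (∧-i (le?-complete (drop (rot6 (rot6 (rot6 (rot6 y)))) kv)) (le?-complete (drop (rot6 (rot6 (rot6 (rot6 (rot6 y))))) kv)))))))

    not⁻ : ∀ {b} → not b ≡ true → b ≡ false
    not⁻ {false} h = refl

    kind6 : Kind κ c
    kind6 = big (sz6 y) (λ {v} kv → ≤-trans (≡⇒≤ (d-L l6 v)) (le?-sound (tot (bits v)) 3 (∧-l (holds kv)))) k33
     where
     k33 : ∀ {v} → κ v ≡ fz → d κ (fs c) v ≡ 3 → K33 κ c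
     k33 {v} kv q with ∨-case {e v c0 ∧ e v c2 ∧ e v c4 ∧ not (e v c1) ∧ not (e v c3) ∧ not (e v c5)} (mp (∧-r {le? (tot (bits v)) 3} (holds {v} kv)) (le?-complete (≡⇒≤ (sym q ⨾ d-L l6 v))))
     ... | inj₁ h = alt→33 y kv (∧-l h) (∧-l h2) (∧-l h3) (not⁻ (∧-l h4)) (not⁻ (∧-l h5)) (not⁻ (∧-r {not (e v c3)} h5))
      where h2 = ∧-r {e v c0} h
            h3 = ∧-r {e v c2} h2
            h4 = ∧-r {e v c4} h3
            h5 = ∧-r {not (e v c1)} h4
     ... | inj₂ h = alt→33 (rot6 y) kv (∧-l h4) (∧-l h5) (∧-r {e v c3} h5) (not⁻ (∧-l h2)) (not⁻ (∧-l h3)) (not⁻ (∧-l h))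
      where h2 = ∧-r {not (e v c0)} h
            h3 = ∧-r {not (e v c2)} h2
            h4 = ∧-r {not (e v c4)} h3
            h5 = ∧-r {e v c1} h4

   -- Deleting two consecutive vertices leaves a path with at most two neighbours of `v`. With three
   -- neighbours in all, each of the pairs c0c1, ..., c4c5 would contain one. At most two lie among
   -- c1, ..., c5, which forces c2 and c4; at most two lie among c0, ..., c4, which forces c1 and
   -- c3.
   kind7 : ∀ {c0 c1 c2 c3 c4 c5 s t S} → Lst κ (fs c) (c0 ∷ c1 ∷ c2 ∷ c3 ∷ c4 ∷ c5 ∷ S) →
    Walk c0 (c0 ∷ c1 ∷ c2 ∷ c3 ∷ c4 ∷ c5 ∷ []) c5 → c5 ~ s → Walk s S t → t ~ c0 → Kind κ c
   kind7 {c0} {c1} {c2} {c3} {c4} {c5} {s} {t} {S} L (e01 ∷ e12 ∷ e23 ∷ e34 ∷ e45 ∷ one) e5s wS et0 =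
    big (≤-trans (s≤s (s≤s (s≤s (s≤s (s≤s (s≤s z≤n)))))) (≡⇒≤ (sym (size-L L))))
    (λ {v} kv → ≤-trans (bd kv) (n≤1+n 2)) (λ kv q → ⊥-elim (<-irrefl refl (≤-trans (≡⇒≤ (sym q)) (bd kv))))
    where
    u = lu L
    f : ∀ pre post {A} → c0 ∷ c1 ∷ c2 ∷ c3 ∷ c4 ∷ c5 ∷ S ↭ pre ++ post ++ A → ∀ {y} → y ∈ post → κ y ≡ fs c
    f pre post {A} h m = l⇒ L (Perm.∈-resp-↭ (↭-sym h) (∈-++⁺ʳ pre (∈-++⁺ˡ m)))
    sv : ∀ {v} → κ v ≡ fz → ∀ x y Q → c0 ∷ c1 ∷ c2 ∷ c3 ∷ c4 ∷ c5 ∷ S ↭ x ∷ y ∷ Q → ∀ {a b} → Walk a Q b → cntL (e v) Q ≤ 2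
    sv kv x y Q h w = smallv o c kv w (U-++ʳ (x ∷ y ∷ []) (U-↭ h u)) (λ m → l⇒ L (Perm.∈-resp-↭ (↭-sym h) (there (there m))))
     (≡⇒≤ (sym (Perm.↭-length h) ⨾ sym (size-L L)))
    rotS : ∀ (A B : List V) → A ++ B ↭ B ++ A
    rotS = Perm.++-comm
    bd : ∀ {v} → κ v ≡ fz → d κ (fs c) v ≤ 2
    bd {v} kv with 3 ≤? d κ (fs c) v
    ... | no q = ≤-pred (≰⇒> q)
    ... | yes q = ⊥-elim (final (subst (3 ≤_) (d-L L v) q))
     where
     τ = cntL (e v) S
     D01 : cntL (e v) (c2 ∷ c3 ∷ c4 ∷ c5 ∷ S) ≤ 2
     D01 = sv kv c0 c1 _ refl (e23 ∷ e34 ∷ e45 ∷ e5s ∷ wS)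
     D12 : cntL (e v) ((c3 ∷ c4 ∷ c5 ∷ S) ++ c0 ∷ []) ≤ 2
     D12 = sv kv c1 c2 _ (rotS (c0 ∷ []) (c1 ∷ c2 ∷ c3 ∷ c4 ∷ c5 ∷ S)) (e34 ∷ e45 ∷ e5s ∷ w-snoc wS et0)
     D23 : cntL (e v) ((c4 ∷ c5 ∷ S) ++ c0 ∷ c1 ∷ []) ≤ 2
     D23 = sv kv c2 c3 _ (rotS (c0 ∷ c1 ∷ []) (c2 ∷ c3 ∷ c4 ∷ c5 ∷ S)) (e45 ∷ e5s ∷ w-join wS et0 (e01 ∷ one))
     D34 : cntL (e v) ((c5 ∷ S) ++ c0 ∷ c1 ∷ c2 ∷ []) ≤ 2
     D34 = sv kv c3 c4 _ (rotS (c0 ∷ c1 ∷ c2 ∷ []) (c3 ∷ c4 ∷ c5 ∷ S)) (e5s ∷ w-join wS et0 (e01 ∷ e12 ∷ one))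
     D45 : cntL (e v) (S ++ c0 ∷ c1 ∷ c2 ∷ c3 ∷ []) ≤ 2
     D45 = sv kv c4 c5 _ (rotS (c0 ∷ c1 ∷ c2 ∷ c3 ∷ []) (c4 ∷ c5 ∷ S)) (w-join wS et0 (e01 ∷ e12 ∷ e23 ∷ one))
     lenS : 1 ≤ length S
     lenS = l≥1 wS
      where l≥1 : ∀ {a l b} → Walk a l b → 1 ≤ length l
            l≥1 one = s≤s z≤n
            l≥1 (_ ∷ _) = s≤s z≤n
     szL : 6 + length S ≡ size κ (fs c)
     szL = sym (size-L L)
     E1 : cntL (e v) (c1 ∷ c2 ∷ c3 ∷ c4 ∷ c5 ∷ []) ≤ 2
     E1 = smallv o c kv (e12 ∷ e23 ∷ e34 ∷ e45 ∷ one) (U-++ˡ (c1 ∷ c2 ∷ c3 ∷ c4 ∷ c5 ∷ []) (U-++ʳ (c0 ∷ []) u)) (λ m → l⇒ L (there (∈-++⁺ˡ m))) (≤-trans (+-monoʳ-≤ 6 lenS) (≡⇒≤ szL))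
     E2 : cntL (e v) (c0 ∷ c1 ∷ c2 ∷ c3 ∷ c4 ∷ []) ≤ 2
     E2 = smallv o c kv (e01 ∷ e12 ∷ e23 ∷ e34 ∷ one) (U-++ˡ (c0 ∷ c1 ∷ c2 ∷ c3 ∷ c4 ∷ []) u) (λ m → l⇒ L (∈-++⁺ˡ {xs = c0 ∷ c1 ∷ c2 ∷ c3 ∷ c4 ∷ []} {ys = c5 ∷ S} m)) (≤-trans (+-monoʳ-≤ 6 lenS) (≡⇒≤ szL))
     b0 = b2n (e v c0)
     b1 = b2n (e v c1)
     b2 = b2n (e v c2)
     b3 = b2n (e v c3)
     b4 = b2n (e v c4)
     b5 = b2n (e v c5)
     final : 3 ≤ cntL (e v) (c0 ∷ c1 ∷ c2 ∷ c3 ∷ c4 ∷ c5 ∷ S) → ⊥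
     final h =
      go (e v c0) (e v c1) (e v c2) (e v c3) (e v c4) (e v c5) h D01
      (≤-trans (≡⇒≤ (r1 b3 b4 b5 τ b0)) D12') (≤-trans (≡⇒≤ (r2 b4 b5 τ b0 b1)) D23') (≤-trans (≡⇒≤ (r3 b5 τ b0 b1 b2)) D34')
      (≤-trans (≡⇒≤ (r4 τ b0 b1 b2 b3)) D45') E1 E2
      where
      D12' : b3 + (b4 + (b5 + (τ + (b0 + 0)))) ≤ 2
      D12' = subst (λ t → b3 + (b4 + (b5 + t)) ≤ 2) (cntL-++ (e v) S (c0 ∷ [])) D12
      D23' : b4 + (b5 + (τ + (b0 + (b1 + 0)))) ≤ 2
      D23' = subst (λ t → b4 + (b5 + t) ≤ 2) (cntL-++ (e v) S (c0 ∷ c1 ∷ [])) D23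
      D34' : b5 + (τ + (b0 + (b1 + (b2 + 0)))) ≤ 2
      D34' = subst (λ t → b5 + t ≤ 2) (cntL-++ (e v) S (c0 ∷ c1 ∷ c2 ∷ [])) D34
      D45' : τ + (b0 + (b1 + (b2 + (b3 + 0)))) ≤ 2
      D45' = subst (_≤ 2) (cntL-++ (e v) S (c0 ∷ c1 ∷ c2 ∷ c3 ∷ [])) D45
      r1 : ∀ a b c t z → z + (a + (b + (c + t))) ≡ a + (b + (c + (t + (z + 0))))
      r1 = solve-∀
      r2 : ∀ b c t z y → z + (y + (b + (c + t))) ≡ b + (c + (t + (z + (y + 0))))
      r2 = solve-∀
      r3 : ∀ c t z y x → z + (y + (x + (c + t))) ≡ c + (t + (z + (y + (x + 0))))
      r3 = solve-∀
      r4 : ∀ t z y x w → z + (y + (x + (w + t))) ≡ t + (z + (y + (x + (w + 0))))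
      r4 = solve-∀
      chk : Vec Bool 6 → Bool
      chk (x0 ∷ x1 ∷ x2 ∷ x3 ∷ x4 ∷ x5 ∷ []) = ((x0 ∨ x1) ∧ (x1 ∨ x2) ∧ (x2 ∨ x3) ∧ (x3 ∨ x4) ∧ (x4 ∨ x5) ∧
       le? (sumB (x1 ∷ x2 ∷ x3 ∷ x4 ∷ x5 ∷ [])) 2 ∧ le? (sumB (x0 ∷ x1 ∷ x2 ∷ x3 ∷ x4 ∷ [])) 2) ⇒b false
      pair : ∀ x y r → 3 ≤ b2n x + (b2n y + r) → r ≤ 2 → (x ∨ y) ≡ true
      pair true y r h a = refl
      pair false true r h a = refl
      pair false false r h a = ⊥-elim (<-irrefl refl (≤-trans h a))
      q1 : ∀ a b c r → a + (b + (c + r)) ≡ b + (c + (a + r))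
      q1 = solve-∀
      q2 : ∀ a b c d r → a + (b + (c + (d + r))) ≡ c + (d + (a + (b + r)))
      q2 = solve-∀
      q3 : ∀ a b c d f r → a + (b + (c + (d + (f + r)))) ≡ d + (f + (a + (b + (c + r))))
      q3 = solve-∀
      q4 : ∀ a b c d f g r → a + (b + (c + (d + (f + (g + r))))) ≡ f + (g + (a + (b + (c + (d + r)))))
      q4 = solve-∀
      go : ∀ x0 x1 x2 x3 x4 x5 → 3 ≤ b2n x0 + (b2n x1 + (b2n x2 + (b2n x3 + (b2n x4 + (b2n x5 + τ))))) →
       b2n x2 + (b2n x3 + (b2n x4 + (b2n x5 + τ))) ≤ 2 → b2n x0 + (b2n x3 + (b2n x4 + (b2n x5 + τ))) ≤ 2 →
       b2n x0 + (b2n x1 + (b2n x4 + (b2n x5 + τ))) ≤ 2 → b2n x0 + (b2n x1 + (b2n x2 + (b2n x5 + τ))) ≤ 2 →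
       b2n x0 + (b2n x1 + (b2n x2 + (b2n x3 + τ))) ≤ 2 → sumB (x1 ∷ x2 ∷ x3 ∷ x4 ∷ x5 ∷ []) ≤ 2 → sumB (x0 ∷ x1 ∷ x2 ∷ x3 ∷ x4 ∷ []) ≤ 2 → ⊥
      go x0 x1 x2 x3 x4 x5 h a1 a2 a3 a4 a5 a6 a7 = true≢false (sym (mp (allB-sound 6 chk refl (x0 ∷ x1 ∷ x2 ∷ x3 ∷ x4 ∷ x5 ∷ []))
       (∧-i (pair x0 x1 _ h a1) (∧-i (pair x1 x2 _ (≤-trans h (≡⇒≤ (q1 (b2n x0) (b2n x1) (b2n x2) _))) a2)
       (∧-i (pair x2 x3 _ (≤-trans h (≡⇒≤ (q2 (b2n x0) (b2n x1) (b2n x2) (b2n x3) _))) a3)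
       (∧-i (pair x3 x4 _ (≤-trans h (≡⇒≤ (q3 (b2n x0) (b2n x1) (b2n x2) (b2n x3) (b2n x4) _))) a4)
       (∧-i (pair x4 x5 _ (≤-trans h (≡⇒≤ (q4 (b2n x0) (b2n x1) (b2n x2) (b2n x3) (b2n x4) (b2n x5) _))) a5)
       (∧-i (le?-complete a6) (le?-complete a7)))))))))

-- The two target properties, and numerical lemmas

-- Decidable forms of G₁ and G₂, with `k'` standing for k - 1 from here on. The row `E G y` is the
-- indicator of one side, and adjacency is disagreement of indicators; in `IsTri` this holds away
-- from the dominating vertex `z`.
IsBip IsTri : ∀ {n} → Graph n → ℕ → Set
IsBip {n} G k' = Σ[ y ∈ Fin n ] ((∀ u w → E G u w ≡ E G y u xor E G y w) × deg G y ≡ 3 * k' + 2)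
IsTri {n} G k' = Σ[ z ∈ Fin n ] Σ[ y ∈ Fin n ] (y ≢ z × (∀ u → u ≢ z → E G z u ≡ true) × (∀ u w → u ≢ z → w ≢ z → E G u w ≡ E G y u xor E G y w) × deg G y ≡ 3 * k' + 2 × n ≡ 6 * k' + 3)

Ore : ∀ {n} → Graph n → ℕ → Set
Ore G k' = ∀ x y → x ≢ y → E G x y ≡ false → 6 * k' + 4 ≤ deg G x + deg G y

NoKCC : ∀ {n} → Graph n → ℕ → Set
NoKCC {n} G k' = ∀ (κ : Fin n → Fin (suc k')) → Hub.KCC G κ → ⊥

cnt3-all : ∀ {A : Set} (p : A → Bool) {x y z} → cntL p (x ∷ y ∷ z ∷ []) ≡ 3 → ∀ {a} → a ∈ x ∷ y ∷ z ∷ [] → p a ≡ true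
cnt3-all p {x} {y} {z} q m with p x in ex | p y in ey | p z in ez
cnt3-all p q i1 | true | true | true = ex
cnt3-all p q i2 | true | true | true = ey
cnt3-all p q i3 | true | true | true = ez
cnt3-all p () m | false | true | true
cnt3-all p () m | false | true | false
cnt3-all p () m | false | false | true
cnt3-all p () m | false | false | false
cnt3-all p () m | true | false | true
cnt3-all p () m | true | false | false
cnt3-all p () m | true | true | false

not₂ : ∀ a b → (a ≡ true → b ≡ true → ⊥) → not (a ∧ b) ≡ true
not₂ true true f = ⊥-elim (f refl refl)
not₂ true false f = refl
not₂ false b f = refl

not₃ : ∀ a b c → (a ≡ true → b ≡ true → c ≡ true → ⊥) → not (a ∧ b ∧ c) ≡ true
not₃ true b c f = not₂ b c (f refl)
not₃ false b c f = refl

-- neighbours of a vertex of R on a 5-cycle x y z w t with the chord x z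
house : Vec Bool 5 → Bool
house (x ∷ y ∷ z ∷ w ∷ t ∷ []) = (not (x ∧ y) ∧ not (y ∧ z) ∧ not (x ∧ z) ∧ not (x ∧ w ∧ t) ∧ not (z ∧ w ∧ t)) ⇒b
 (le? (sumB (x ∷ y ∷ z ∷ w ∷ t ∷ [])) 3 ∧ (le? 3 (sumB (x ∷ y ∷ z ∷ w ∷ t ∷ [])) ⇒b (w ∧ t)))

cntL-⊆' : ∀ {A : Set} (p : A → Bool) {l m : List A} → Unique l → (∀ {x} → x ∈ l → p x ≡ true → x ∈ m) → cntL p l ≤ cntL p m
cntL-⊆' p {[]} u f = z≤n
cntL-⊆' p {x ∷ l} {m} (h ∷ u) f with p x in px
... | false = cntL-⊆' p u (f ∘ there)
... | true with ∈-split (f i1 px)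
... | a , b , refl = ≤-trans (s≤s (cntL-⊆' p u f')) (≡⇒≤ (sym (cntL-↭ p (Perm.shift x a b) ⨾ cong (λ t → b2n t + cntL p (a ++ b)) px)))
 where
 f' : ∀ {y} → y ∈ l → p y ≡ true → y ∈ a ++ b
 f' q py with Perm.∈-resp-↭ (Perm.shift x a b) (f (there q) py)
 ... | here e = ⊥-elim (All-lookup h q (sym e))
 ... | there r = r

nots : ∀ {b} → (b ≡ true → ⊥) → not b ≡ true
nots {true} h = ⊥-elim (h refl)
nots {false} h = refl

∧2 : ∀ a b → a ∧ b ≡ true → a ≡ true × b ≡ true
∧2 true true h = refl , refl

∧3 : ∀ a b c → a ∧ b ∧ c ≡ true → a ≡ true × b ≡ true × c ≡ true
∧3 true true true h = refl , refl , refl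

∧4 : ∀ a b c d → a ∧ b ∧ c ∧ d ≡ true → a ≡ true × b ≡ true × c ≡ true × d ≡ true
∧4 true true true true h = refl , refl , refl , refl

t2 : ∀ {a b m n} → a ≤ m → b ≤ n → m + n ≤ a + b → a ≡ m × b ≡ n
t2 {a} {b} {m} {n} p q h = ≤-antisym p (+-cancelʳ-≤ n m a (≤-trans h (+-monoʳ-≤ a q))) , ≤-antisym q (+-cancelˡ-≤ m n b (≤-trans h (+-monoˡ-≤ b p)))

-- The rows are the adjacencies of `v`, `p`, `q` to the four vertices of a K₄. `c1` excludes
-- patterns in which an exchange would lengthen the longest path; `c2` excludes a pattern with two
-- disjoint chorded cycles.
c1 c2 : (v0 vy vz vw px py pz pw qx qy qz qw : Bool) → Bool
c1 v0 vy vz vw px py pz pw qx qy qz qw = not (vy ∧ vz ∧ vw ∧ px) ∧ not (vy ∧ vz ∧ vw ∧ qx) ∧ not ((py ∧ pz ∧ pw) ∧ qx ∧ v0)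
c2 v0 vy vz vw px py pz pw qx qy qz qw = not (le? 2 (sumB (vy ∷ vz ∷ vw ∷ [])) ∧ px ∧ qx)

hyp1 hyp2 : Vec Bool 12 → Bool
hyp1 (v0 ∷ vy ∷ vz ∷ vw ∷ px ∷ py ∷ pz ∷ pw ∷ qx ∷ qy ∷ qz ∷ qw ∷ []) =
 c1 v0 vy vz vw px py pz pw qx qy qz qw ∧ c1 vy vz vw v0 py pz pw px qy qz qw qx ∧ c1 vz vw v0 vy pz pw px py qz qw qx qy ∧ c1 vw v0 vy vz pw px py pz qw qx qy qz
hyp2 (v0 ∷ vy ∷ vz ∷ vw ∷ px ∷ py ∷ pz ∷ pw ∷ qx ∷ qy ∷ qz ∷ qw ∷ []) =
 c2 v0 vy vz vw px py pz pw qx qy qz qw ∧ c2 vy vz vw v0 py pz pw px qy qz qw qx ∧ c2 vz vw v0 vy pz pw px py qz qw qx qy ∧ c2 vw v0 vy vz pw px py pz qw qx qy qz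

-- The row of `v` counts twice because the degree condition is used for the two pairs `vp` and `vq`.
wt : Vec Bool 12 → ℕ
wt (v0 ∷ vy ∷ vz ∷ vw ∷ px ∷ py ∷ pz ∷ pw ∷ qx ∷ qy ∷ qz ∷ qw ∷ []) =
 (sumB (v0 ∷ vy ∷ vz ∷ vw ∷ []) + sumB (px ∷ py ∷ pz ∷ pw ∷ [])) + (sumB (v0 ∷ vy ∷ vz ∷ vw ∷ []) + sumB (qx ∷ qy ∷ qz ∷ qw ∷ []))


wt12 : ∀ bs → hyp1 bs ≡ true → wt bs ≤ 12
wt12 bs h = le?-sound (wt bs) 12 (mp {hyp1 bs} (allB-sound 12 (λ bs → hyp1 bs ⇒b le? (wt bs) 12) refl bs) h)

wt11 : ∀ bs → hyp1 bs ≡ true → hyp2 bs ≡ true → wt bs ≤ 11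
wt11 bs h h' = le?-sound (wt bs) 11 (mp {hyp2 bs} (mp {hyp1 bs} (allB-sound 12 (λ bs → hyp1 bs ⇒b hyp2 bs ⇒b le? (wt bs) 11) refl bs) h) h')

lem8 : ∀ k → 8 + 12 * k ≡ (6 * k + 4) + (6 * k + 4)
lem8 = solve-∀

-- Two nonadjacent pairs: `S` counts the edges to the classes, at most 12 for each, and `r` those
-- inside R, of which at least 8 are needed. The next two lemmas treat `r ≤ 8`.
arithA : ∀ m → m ≤ 6 → ∀ k r S → (6 * k + 4) + (6 * k + 4) ≤ r + S → r ≤ m → S ≤ 12 * k → ⊥
arithA m m≤ k r S h a b = <-irrefl {7 + 12 * k} refl (≤-trans (≡⇒≤ (lem8 k)) (≤-trans h (≤-trans (+-mono-≤ (≤-trans a m≤) b) (n≤1+n _))))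

arithB : ∀ k r S → (6 * k + 4) + (6 * k + 4) ≤ r + S → r ≤ 8 → S + 1 ≤ 12 * k → ⊥
arithB k r S h a b = <-irrefl {r + S} refl (≤-trans (≡⇒≤ (+-comm 1 (r + S) ⨾ +-assoc r S 1)) (≤-trans (+-mono-≤ a b) (≤-trans (≡⇒≤ (lem8 k)) h)))

arithC : ∀ k r S → (6 * k + 4) + (6 * k + 4) ≤ r + S → r ≤ 8 → S ≤ 12 * k → r ≡ 8 × S ≡ 12 * k
arithC k r S h a b = t2 a b (≤-trans (≡⇒≤ (lem8 k)) h)

tight3 : ∀ {m a b c} → a ≤ m → b ≤ m → c ≤ m → (a + b) + (a + c) ≡ (m + m) + (m + m) → a ≡ m × b ≡ m × c ≡ m
tight3 {m} {a} {b} {c} x y z h with t2 {a + b} {a + c} {m + m} {m + m} (+-mono-≤ x y) (+-mono-≤ x z) (≡⇒≤ (sym h))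
... | p , q with t2 x y (≡⇒≤ (sym p)) | t2 x z (≡⇒≤ (sym q))
... | r , s | _ , t = r , s , t

infix 4 _⊑_
data _⊑_ {A : Set} : List A → List A → Set where
 done : [] ⊑ []
 keep : ∀ {x l m} → l ⊑ m → x ∷ l ⊑ x ∷ m
 skip : ∀ {x l m} → l ⊑ m → l ⊑ x ∷ m

module _ {A : Set} where

 ⊑-refl : ∀ {l : List A} → l ⊑ l
 ⊑-refl {[]} = done
 ⊑-refl {x ∷ l} = keep ⊑-refl

 ⊑-pre : ∀ (l : List A) {m m'} → m ⊑ m' → l ++ m ⊑ l ++ m'
 ⊑-pre [] h = h
 ⊑-pre (x ∷ l) h = keep (⊑-pre l h)

 ⊑-drop : ∀ (l : List A) {m m'} → m ⊑ m' → m ⊑ l ++ m'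
 ⊑-drop [] h = h
 ⊑-drop (x ∷ l) h = skip (⊑-drop l h)

 ⊑-∈ : ∀ {l m : List A} → l ⊑ m → ∀ {x} → x ∈ l → x ∈ m
 ⊑-∈ (keep h) (here q) = here q
 ⊑-∈ (keep h) (there m) = there (⊑-∈ h m)
 ⊑-∈ (skip h) m = there (⊑-∈ h m)

 ⊑-U : ∀ {l m : List A} → l ⊑ m → Unique m → Unique l
 ⊑-U done u = []
 ⊑-U (keep h) (a ∷ u) = All-tab (λ m → All-lookup a (⊑-∈ h m)) ∷ ⊑-U h u
 ⊑-U (skip h) (a ∷ u) = ⊑-U h u

 split-cmp : ∀ (a : List A) {x b c y d} → a ++ x ∷ b ≡ c ++ y ∷ d →
  (Σ[ s ∈ List A ] (a ≡ c ++ y ∷ s × d ≡ s ++ x ∷ b)) ⊎ ((a ≡ c × x ≡ y × b ≡ d) ⊎ (Σ[ s ∈ List A ] (c ≡ a ++ x ∷ s × b ≡ s ++ y ∷ d)))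
 split-cmp [] {c = []} refl = inj₂ (inj₁ (refl , refl , refl))
 split-cmp [] {c = z ∷ c} refl = inj₂ (inj₂ (c , refl , refl))
 split-cmp (z ∷ a) {c = []} refl = inj₁ (a , refl , refl)
 split-cmp (z ∷ a) {c = w ∷ c} h with ∷-inj h
  where ∷-inj : ∀ {z w : A} {l m} → _≡_ {A = List A} (z ∷ l) (w ∷ m) → z ≡ w × l ≡ m
        ∷-inj refl = refl , refl
 ... | refl , q with split-cmp a q
 ... | inj₁ (s , refl , r) = inj₁ (s , refl , r)
 ... | inj₂ (inj₁ (refl , r , r')) = inj₂ (inj₁ (refl , r , r'))
 ... | inj₂ (inj₂ (s , refl , r)) = inj₂ (inj₂ (s , refl , r))

c≤1 : ∀ p q r s → (p ∧ q ∧ r ≡ true → ⊥) → (p ∧ q ∧ s ≡ true → ⊥) → (p ∧ r ∧ s ≡ true → ⊥) → (q ∧ r ∧ s ≡ true → ⊥) → b2n p + (b2n q + (b2n r + b2n s)) ≤ 2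
c≤1 p q r s h1 h2 h3 h4 = le?-sound _ 2 (mp {not (p ∧ q ∧ r) ∧ not (p ∧ q ∧ s) ∧ not (p ∧ r ∧ s) ∧ not (q ∧ r ∧ s)}
 (allB-sound 4 (λ { (p ∷ q ∷ r ∷ s ∷ []) → (not (p ∧ q ∧ r) ∧ not (p ∧ q ∧ s) ∧ not (p ∧ r ∧ s) ∧ not (q ∧ r ∧ s)) ⇒b le? (b2n p + (b2n q + (b2n r + b2n s))) 2 }) refl (p ∷ q ∷ r ∷ s ∷ []))
 (∧-i (nots h1) (∧-i (nots h2) (∧-i (nots h3) (nots h4)))))

cols4 : ∀ px py pz pw qx qy qz qw rx ry rz rw sx sy sz sw →
 (px + (qx + (rx + sx))) ≤ 2 → (py + (qy + (ry + sy))) ≤ 2 → (pz + (qz + (rz + sz))) ≤ 2 → (pw + (qw + (rw + sw))) ≤ 2 →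
 (px + (py + (pz + (pw + 0)))) + ((qx + (qy + (qz + (qw + 0)))) + ((rx + (ry + (rz + (rw + 0)))) + (sx + (sy + (sz + (sw + 0)))))) ≤ 8
cols4 px py pz pw qx qy qz qw rx ry rz rw sx sy sz sw a b c d =
 ≤-trans (≡⇒≤ (lem px py pz pw qx qy qz qw rx ry rz rw sx sy sz sw)) (+-mono-≤ (+-mono-≤ a b) (+-mono-≤ c d))
 where
 lem : ∀ px py pz pw qx qy qz qw rx ry rz rw sx sy sz sw →
  (px + (py + (pz + (pw + 0)))) + ((qx + (qy + (qz + (qw + 0)))) + ((rx + (ry + (rz + (rw + 0)))) + (sx + (sy + (sz + (sw + 0))))))
  ≡ ((px + (qx + (rx + sx))) + (py + (qy + (ry + sy)))) + ((pz + (qz + (rz + sz))) + (pw + (qw + (rw + sw))))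
 lem = solve-∀

-- Here `a` belongs to a vertex with many edges to a K₄, and the other three together with a fifth
-- vertex have at most 8. Hence at most 12, and equality leaves nothing for the fifth.
heavy12 : ∀ a b c d u → a ≤ 4 → b + (c + (d + u)) ≤ 8 → (a + b) + (c + d) ≤ 12 × ((a + b) + (c + d) ≡ 12 → u ≡ 0)
heavy12 a b c d u ha h = ≤-trans (m≤m+n _ u) tot , λ q → n≤0⇒n≡0 (+-cancelˡ-≤ 12 u 0 (≤-trans (≡⇒≤ (cong (_+ u) (sym q))) tot))
 where
 lem : ∀ a b c d u → (a + b) + (c + d) + u ≡ a + (b + (c + (d + u)))
 lem = solve-∀
 tot : (a + b) + (c + d) + u ≤ 12
 tot = ≤-trans (≡⇒≤ (lem a b c d u)) (+-mono-≤ ha h)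

light8 : ∀ {a b c d} (u : ℕ) → a ≤ 2 → b ≤ 2 → c ≤ 2 → d ≤ 2 → (a + b) + (c + d) ≤ 12 × ((a + b) + (c + d) ≡ 12 → u ≡ 0)
light8 {a} {b} {c} {d} u ha hb hc hd' = ≤-trans s8 (m≤m+n 8 4) , λ q → ⊥-elim (12≰8 (≤-trans (≡⇒≤ (sym q)) s8))
 where s8 : (a + b) + (c + d) ≤ 8
       s8 = +-mono-≤ (+-mono-≤ ha hb) (+-mono-≤ hc hd')
       12≰8 : 12 ≤ 8 → ⊥
       12≰8 (s≤s (s≤s (s≤s (s≤s (s≤s (s≤s (s≤s (s≤s ()))))))))

arithU : ∀ k r S → 6 * k + 4 ≤ r + S → r ≤ 5 → S + 2 ≤ 6 * k → ⊥
arithU k r S h a b = <-irrefl {r + S + 1} refl (≤-trans (≡⇒≤ (lem r S)) (≤-trans (+-mono-≤ a b) (≤-trans (≡⇒≤ (+-comm 5 (6 * k))) (≤-trans (≡⇒≤ (lem2 (6 * k))) (+-monoˡ-≤ 1 h)))))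
 where lem : ∀ r S → suc (r + S + 1) ≡ r + (S + 2)
       lem = solve-∀
       lem2 : ∀ k → k + 5 ≡ k + 4 + 1
       lem2 = solve-∀

sum3≥2 : ∀ a b c d → 3 ≤ b2n a + (b2n b + (b2n c + (b2n d + 0))) → 2 ≤ sumB (b ∷ c ∷ d ∷ [])
sum3≥2 true b c d h = ≤-pred h
sum3≥2 false b c d h = ≤-trans (n≤1+n 2) h

wtpaw : ∀ bs → hyp2 bs ≡ true → wt bs ≤ 12
wtpaw bs h = le?-sound (wt bs) 12 (mp {hyp2 bs} (allB-sound 12 (λ bs → hyp2 bs ⇒b le? (wt bs) 12) refl bs) h)

-- The most edges that two further vertices can send to the first vertex of a K₄, given the rows of
-- `p` and `q`.
βcol : Bool → Bool → Bool → Bool → Bool → Bool → Bool → Bool → ℕ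
βcol px py pz pw qx qy qz qw =
 if py ∧ pz ∧ pw ∧ qx then 0 else if le? 2 (sumB (py ∷ pz ∷ pw ∷ [])) ∧ qx then 1 else if le? 2 (sumB (qy ∷ qz ∷ qw ∷ [])) ∧ px then 1 else 2

-- The 24 stands for four pairs at six edges each; the pair `pq` is used twice, and the two mixed
-- pairs contribute `p` and `q` once more.
βsum : ∀ px py pz pw qx qy qz qw → let P = sumB (px ∷ py ∷ pz ∷ pw ∷ []) ; Q = sumB (qx ∷ qy ∷ qz ∷ qw ∷ []) in
 ((P + Q) + (P + Q)) + ((P + Q) + ((βcol px py pz pw qx qy qz qw + βcol py pz pw px qy qz qw qx) + (βcol pz pw px py qz qw qx qy + βcol pw px py pz qw qx qy qz))) ≤ 24
βsum px py pz pw qx qy qz qw = le?-sound _ 24 (allB-sound 8 (λ { (px ∷ py ∷ pz ∷ pw ∷ qx ∷ qy ∷ qz ∷ qw ∷ []) →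
 let P = sumB (px ∷ py ∷ pz ∷ pw ∷ []) ; Q = sumB (qx ∷ qy ∷ qz ∷ qw ∷ []) in
 le? (((P + Q) + (P + Q)) + ((P + Q) + ((βcol px py pz pw qx qy qz qw + βcol py pz pw px qy qz qw qx) + (βcol pz pw px py qz qw qx qy + βcol pw px py pz qw qx qy qz)))) 24 })
 refl (px ∷ py ∷ pz ∷ pw ∷ qx ∷ qy ∷ qz ∷ qw ∷ []))

βbound : ∀ px py pz pw qx qy qz qw a b → (py ∧ pz ∧ pw ∧ qx ≡ true → a ∨ b ≡ true → ⊥) →
 (le? 2 (sumB (py ∷ pz ∷ pw ∷ [])) ∧ qx ∧ a ∧ b ≡ true → ⊥) → (le? 2 (sumB (qy ∷ qz ∷ qw ∷ [])) ∧ px ∧ a ∧ b ≡ true → ⊥) →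
 b2n a + b2n b ≤ βcol px py pz pw qx qy qz qw
βbound px py pz pw qx qy qz qw a b h1 h2 h3 with py ∧ pz ∧ pw ∧ qx
... | true = f a b (h1 refl)
 where f : ∀ a b → (a ∨ b ≡ true → ⊥) → b2n a + b2n b ≤ 0
       f true b h = ⊥-elim (h refl)
       f false true h = ⊥-elim (h refl)
       f false false h = z≤n
... | false with le? 2 (sumB (py ∷ pz ∷ pw ∷ [])) | le? 2 (sumB (qy ∷ qz ∷ qw ∷ []))
... | false | false = +-mono-≤ (b2n≤1 a) (b2n≤1 b)
... | true | false = f qx a b h2
 where f : ∀ q a b → (q ∧ a ∧ b ≡ true → ⊥) → b2n a + b2n b ≤ (if q then 1 else 2)
       f true true true h = ⊥-elim (h refl)
       f true true false h = s≤s z≤n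
       f true false b h = b2n≤1 b
       f false a b h = +-mono-≤ (b2n≤1 a) (b2n≤1 b)
... | false | true = f px a b h3
 where f : ∀ q a b → (q ∧ a ∧ b ≡ true → ⊥) → b2n a + b2n b ≤ (if q then 1 else 2)
       f true true true h = ⊥-elim (h refl)
       f true true false h = s≤s z≤n
       f true false b h = b2n≤1 b
       f false a b h = +-mono-≤ (b2n≤1 a) (b2n≤1 b)
... | true | true = f qx px a b h2 h3
 where f : ∀ q p a b → (q ∧ a ∧ b ≡ true → ⊥) → (p ∧ a ∧ b ≡ true → ⊥) → b2n a + b2n b ≤ (if q then 1 else (if p then 1 else 2))
       f true p true true h _ = ⊥-elim (h refl)
       f true p true false h _ = s≤s z≤n
       f true p false b h _ = b2n≤1 b
       f false true true true _ h = ⊥-elim (h refl)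
       f false true true false _ h = s≤s z≤n
       f false true false b _ h = b2n≤1 b
       f false false a b _ _ = +-mono-≤ (b2n≤1 a) (b2n≤1 b)

arith24 : ∀ ax ay az aw bx by bz bω P Q βx βy βz βw → ax + bx ≤ βx → ay + by ≤ βy → az + bz ≤ βz → aw + bω ≤ βw →
 ((P + Q) + (P + Q)) + ((P + Q) + ((βx + βy) + (βz + βw))) ≤ 24 →
 ((P + Q) + (P + Q)) + ((P + (ax + (ay + (az + (aw + 0))))) + ((bx + (by + (bz + (bω + 0)))) + Q)) ≤ 24
arith24 ax ay az aw bx by bz bω P Q βx βy βz βw h1 h2 h3 h4 h =
 ≤-trans (≡⇒≤ (cong ((P + Q) + (P + Q) +_) (lem ax ay az aw bx by bz bω P Q))) (≤-trans (+-monoʳ-≤ ((P + Q) + (P + Q)) (+-monoʳ-≤ (P + Q) (+-mono-≤ (+-mono-≤ h1 h2) (+-mono-≤ h3 h4)))) h)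
 where
 lem : ∀ ax ay az aw bx by bz bω P Q → (P + (ax + (ay + (az + (aw + 0))))) + ((bx + (by + (bz + (bω + 0)))) + Q) ≡ (P + Q) + (((ax + bx) + (ay + by)) + ((az + bz) + (aw + bω)))
 lem = solve-∀

arithB0 : ∀ k r S → ((6 * k + 4) + (6 * k + 4)) + ((6 * k + 4) + (6 * k + 4)) ≤ r + S → r ≤ 15 → S ≤ 24 * k → ⊥
arithB0 k r S h a b = <-irrefl {15 + 24 * k} refl (≤-trans (≡⇒≤ (lem k)) (≤-trans h (+-mono-≤ a b)))
 where lem : ∀ k → suc (15 + 24 * k) ≡ ((6 * k + 4) + (6 * k + 4)) + ((6 * k + 4) + (6 * k + 4))
       lem = solve-∀

tri8 : ∀ a b c d → a ≤ 4 → b ≤ 4 → c ≤ 4 → d ≤ 4 → (3 ≤ a → c + (b + d) ≤ 4) → (3 ≤ c → a + (b + d) ≤ 4) → (3 ≤ b → d + (a + c) ≤ 4) → (3 ≤ d → b + (a + c) ≤ 4) →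
 (a + b) + (c + d) ≡ 12 → ⊥
tri8 a b c d ha hb hc hd' fa fc fb fd q = go (3 ≤? a) (3 ≤? b) (3 ≤? c) (3 ≤? d)
 where
 no12 : ∀ {m} → m ≡ 12 → m ≤ 8 → ⊥
 no12 refl (s≤s (s≤s (s≤s (s≤s (s≤s (s≤s (s≤s (s≤s ()))))))))
 la : ∀ a b c d → (a + b) + (c + d) ≡ a + (c + (b + d))
 la = solve-∀
 lc : ∀ a b c d → (a + b) + (c + d) ≡ c + (a + (b + d))
 lc = solve-∀
 lb : ∀ a b c d → (a + b) + (c + d) ≡ b + (d + (a + c))
 lb = solve-∀
 ld : ∀ a b c d → (a + b) + (c + d) ≡ d + (b + (a + c))
 ld = solve-∀
 go : Dec (3 ≤ a) → Dec (3 ≤ b) → Dec (3 ≤ c) → Dec (3 ≤ d) → ⊥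
 go (yes h) _ _ _ = no12 (sym (la a b c d) ⨾ q) (+-mono-≤ ha (fa h))
 go (no _) (yes h) _ _ = no12 (sym (lb a b c d) ⨾ q) (+-mono-≤ hb (fb h))
 go (no _) (no _) (yes h) _ = no12 (sym (lc a b c d) ⨾ q) (+-mono-≤ hc (fc h))
 go (no _) (no _) (no _) (yes h) = no12 (sym (ld a b c d) ⨾ q) (+-mono-≤ hd' (fd h))
 go (no r) (no s) (no t) (no u) = no12 q (+-mono-≤ (+-mono-≤ (≤-pred (≰⇒> r)) (≤-pred (≰⇒> s))) (+-mono-≤ (≤-pred (≰⇒> t)) (≤-pred (≰⇒> u))))


branch3 : ∀ a b c t → 1 ≤ a → 1 ≤ b → a + (t + b) ≤ 2 → a + (t + c) ≤ 2 → a + (b + (t + c)) ≤ 3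
branch3 a b c t ha hb p q = ≤-trans (≡⇒≤ (l2 a b t c)) (+-mono-≤ b≤1 q)
 where
 l2 : ∀ a b t c → a + (b + (t + c)) ≡ b + (a + (t + c))
 l2 = solve-∀
 l1 : ∀ a t b → a + (t + b) ≡ (a + b) + t
 l1 = solve-∀
 b≤1 : b ≤ 1
 b≤1 = ≤-pred (≤-trans (+-monoˡ-≤ b ha) (≤-trans (m≤m+n (a + b) t) (≤-trans (≡⇒≤ (sym (l1 a t b))) p)))

cols12 : ∀ A px py pz pw qx qy qz qw rx ry rz rw → A ≤ 4 →
 (px + (qx + rx)) ≤ 2 → (py + (qy + ry)) ≤ 2 → (pz + (qz + rz)) ≤ 2 → (pw + (qw + rw)) ≤ 2 →
 let S = A + ((px + (py + (pz + (pw + 0)))) + ((qx + (qy + (qz + (qw + 0)))) + (rx + (ry + (rz + (rw + 0)))))) in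
 S ≤ 12 × (S ≡ 12 → A ≡ 4 × px + (qx + rx) ≡ 2 × py + (qy + ry) ≡ 2 × pz + (qz + rz) ≡ 2 × pw + (qw + rw) ≡ 2)
cols12 A px py pz pw qx qy qz qw rx ry rz rw hA hx hy hz hw = ≤-trans (≡⇒≤ eq) (+-mono-≤ hA (+-mono-≤ (+-mono-≤ hx hy) (+-mono-≤ hz hw))) , tight
 where
 lem : ∀ px py pz pw qx qy qz qw rx ry rz rw →
  (px + (py + (pz + (pw + 0)))) + ((qx + (qy + (qz + (qw + 0)))) + (rx + (ry + (rz + (rw + 0)))))
  ≡ ((px + (qx + rx)) + (py + (qy + ry))) + ((pz + (qz + rz)) + (pw + (qw + rw)))
 lem = solve-∀
 eq = cong (A +_) (lem px py pz pw qx qy qz qw rx ry rz rw)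
 tight : A + ((px + (py + (pz + (pw + 0)))) + ((qx + (qy + (qz + (qw + 0)))) + (rx + (ry + (rz + (rw + 0)))))) ≡ 12 → A ≡ 4 × px + (qx + rx) ≡ 2 × py + (qy + ry) ≡ 2 × pz + (qz + rz) ≡ 2 × pw + (qw + rw) ≡ 2
 tight h = fst r , fst u , snd u , fst v , snd v
  where
  r = t2 {m = 4} {n = 8} hA (+-mono-≤ (+-mono-≤ hx hy) (+-mono-≤ hz hw)) (≡⇒≤ (sym h ⨾ eq))
  s = t2 {m = 4} {n = 4} (+-mono-≤ hx hy) (+-mono-≤ hz hw) (≡⇒≤ (sym (snd r)))
  u = t2 {m = 2} {n = 2} hx hy (≡⇒≤ (sym (fst s)))
  v = t2 {m = 2} {n = 2} hz hw (≡⇒≤ (sym (snd s)))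

b3≤2 : ∀ p q r → (p ∧ q ∧ r ≡ true → ⊥) → b2n p + (b2n q + b2n r) ≤ 2
b3≤2 true true true h = ⊥-elim (h refl)
b3≤2 true true false h = s≤s (s≤s z≤n)
b3≤2 true false r h = s≤s (b2n≤1 r)
b3≤2 false q r h = +-mono-≤ (b2n≤1 q) (b2n≤1 r)

all4 : ∀ p q r s → b2n p + (b2n q + (b2n r + (b2n s + 0))) ≡ 4 → p ≡ true × q ≡ true × r ≡ true × s ≡ true
all4 p q r s h = ∧4 p q r s (mp (allB-sound 4 (λ { (p ∷ q ∷ r ∷ s ∷ []) → le? 4 (sumB (p ∷ q ∷ r ∷ s ∷ [])) ⇒b (p ∧ q ∧ r ∧ s) }) refl (p ∷ q ∷ r ∷ s ∷ []))
 (le?-complete (≡⇒≤ (sym h))))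

outer2 : ∀ p q r → b2n p + (b2n q + b2n r) ≡ 2 → (p ≡ true → q ≡ true → r ≡ false → ⊥) → (q ≡ true → r ≡ true → p ≡ false → ⊥) → p ≡ true × q ≡ false × r ≡ true
outer2 true true true () f g
outer2 true true false h f g = ⊥-elim (f refl refl refl)
outer2 true false true h f g = refl , refl , refl
outer2 true false false () f g
outer2 false true true h f g = ⊥-elim (g refl refl refl)
outer2 false true false () f g
outer2 false false true () f g
outer2 false false false () f g

two-bits : ∀ p q → 2 ≤ b2n p + (b2n q + 0) → p ≡ true × q ≡ true
two-bits true true h = refl , refl
two-bits true false (s≤s ())
two-bits false true (s≤s ())
two-bits false false ()

colx14 : ∀ y z a b → (a ∧ y ≡ true → ⊥) → (a ∧ z ≡ true → ⊥) → (b ∧ y ≡ true → ⊥) → (b ∧ z ≡ true → ⊥) → 7 * (b2n y + b2n z) + 6 * (b2n a + b2n b) ≤ 14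
colx14 y z a b h1 h2 h3 h4 = le?-sound _ 14 (mp {not (a ∧ y) ∧ not (a ∧ z) ∧ not (b ∧ y) ∧ not (b ∧ z)}
 (allB-sound 4 (λ { (y ∷ z ∷ a ∷ b ∷ []) → (not (a ∧ y) ∧ not (a ∧ z) ∧ not (b ∧ y) ∧ not (b ∧ z)) ⇒b le? (7 * (b2n y + b2n z) + 6 * (b2n a + b2n b)) 14 }) refl (y ∷ z ∷ a ∷ b ∷ []))
 (∧-i (nots h1) (∧-i (nots h2) (∧-i (nots h3) (nots h4)))))

cola9 : ∀ b x y z → (b ∧ x ∧ y ≡ true → ⊥) → (b ∧ x ∧ z ≡ true → ⊥) → (b ∧ y ∧ z ≡ true → ⊥) → 6 * b2n b + 3 * (b2n x + (b2n y + b2n z)) ≤ 9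
cola9 b x y z h1 h2 h3 = le?-sound _ 9 (mp {not (b ∧ x ∧ y) ∧ not (b ∧ x ∧ z) ∧ not (b ∧ y ∧ z)}
 (allB-sound 4 (λ { (b ∷ x ∷ y ∷ z ∷ []) → (not (b ∧ x ∧ y) ∧ not (b ∧ x ∧ z) ∧ not (b ∧ y ∧ z)) ⇒b le? (6 * b2n b + 3 * (b2n x + (b2n y + b2n z))) 9 }) refl (b ∷ x ∷ y ∷ z ∷ []))
 (∧-i (nots h1) (∧-i (nots h2) (nots h3))))

-- the weights 7 and 6 separate a K₄ from the other classes
wtx : ∀ X y1 y2 y3 y4 z1 z2 z3 z4 a1 a2 a3 a4 b1 b2 b3 b4 → X ≤ 4 →
 7 * (y1 + z1) + 6 * (a1 + b1) ≤ 14 → 7 * (y2 + z2) + 6 * (a2 + b2) ≤ 14 → 7 * (y3 + z3) + 6 * (a3 + b3) ≤ 14 → 7 * (y4 + z4) + 6 * (a4 + b4) ≤ 14 →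
 7 * (X + ((y1 + (y2 + (y3 + (y4 + 0)))) + (z1 + (z2 + (z3 + (z4 + 0)))))) + 6 * ((a1 + (a2 + (a3 + (a4 + 0)))) + (b1 + (b2 + (b3 + (b4 + 0))))) ≤ 84
wtx X y1 y2 y3 y4 z1 z2 z3 z4 a1 a2 a3 a4 b1 b2 b3 b4 hX h1 h2 h3 h4 = ≤-trans (≡⇒≤ (lem X y1 y2 y3 y4 z1 z2 z3 z4 a1 a2 a3 a4 b1 b2 b3 b4)) (+-mono-≤ (*-monoʳ-≤ 7 hX) (+-mono-≤ (+-mono-≤ h1 h2) (+-mono-≤ h3 h4)))
 where
 lem : ∀ X y1 y2 y3 y4 z1 z2 z3 z4 a1 a2 a3 a4 b1 b2 b3 b4 →
  7 * (X + ((y1 + (y2 + (y3 + (y4 + 0)))) + (z1 + (z2 + (z3 + (z4 + 0)))))) + 6 * ((a1 + (a2 + (a3 + (a4 + 0)))) + (b1 + (b2 + (b3 + (b4 + 0)))))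
  ≡ 7 * X + (((7 * (y1 + z1) + 6 * (a1 + b1)) + (7 * (y2 + z2) + 6 * (a2 + b2))) + ((7 * (y3 + z3) + 6 * (a3 + b3)) + (7 * (y4 + z4) + 6 * (a4 + b4))))
 lem = solve-∀

wta : ∀ A b1 b2 b3 b4 x1 x2 x3 x4 y1 y2 y3 y4 z1 z2 z3 z4 → A ≤ 4 →
 6 * b1 + 3 * (x1 + (y1 + z1)) ≤ 9 → 6 * b2 + 3 * (x2 + (y2 + z2)) ≤ 9 → 6 * b3 + 3 * (x3 + (y3 + z3)) ≤ 9 → 6 * b4 + 3 * (x4 + (y4 + z4)) ≤ 9 →
 (x1 + (x2 + (x3 + (x4 + 0)))) ≤ 2 → (y1 + (y2 + (y3 + (y4 + 0)))) ≤ 2 → (z1 + (z2 + (z3 + (z4 + 0)))) ≤ 2 →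
 7 * ((x1 + (x2 + (x3 + (x4 + 0)))) + ((y1 + (y2 + (y3 + (y4 + 0)))) + (z1 + (z2 + (z3 + (z4 + 0)))))) + 6 * (A + (b1 + (b2 + (b3 + (b4 + 0))))) ≤ 84
wta A b1 b2 b3 b4 x1 x2 x3 x4 y1 y2 y3 y4 z1 z2 z3 z4 hA h1 h2 h3 h4 hx hy hz = ≤-trans (≡⇒≤ (lem A b1 b2 b3 b4 x1 x2 x3 x4 y1 y2 y3 y4 z1 z2 z3 z4))
 (+-mono-≤ (*-monoʳ-≤ 6 hA) (+-mono-≤ (+-mono-≤ (+-mono-≤ h1 h2) (+-mono-≤ h3 h4)) (*-monoʳ-≤ 4 (+-mono-≤ hx (+-mono-≤ hy hz)))))
 where
 lem : ∀ A b1 b2 b3 b4 x1 x2 x3 x4 y1 y2 y3 y4 z1 z2 z3 z4 →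
  7 * ((x1 + (x2 + (x3 + (x4 + 0)))) + ((y1 + (y2 + (y3 + (y4 + 0)))) + (z1 + (z2 + (z3 + (z4 + 0)))))) + 6 * (A + (b1 + (b2 + (b3 + (b4 + 0)))))
  ≡ 6 * A + ((((6 * b1 + 3 * (x1 + (y1 + z1))) + (6 * b2 + 3 * (x2 + (y2 + z2)))) + ((6 * b3 + 3 * (x3 + (y3 + z3))) + (6 * b4 + 3 * (x4 + (y4 + z4)))))
  + 4 * ((x1 + (x2 + (x3 + (x4 + 0)))) + ((y1 + (y2 + (y3 + (y4 + 0)))) + (z1 + (z2 + (z3 + (z4 + 0)))))))
 lem = solve-∀

-- The first three hypotheses add up to X + Y + Z ≥ 9k, so the weighted total is at least 63k + 36k
-- - 12 = 99k - 12, and a deficit of 15 is impossible. The computation is doubled to avoid halves.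
arithW : ∀ k X Y Z T → 6 * k ≤ X + Y → 6 * k ≤ X + Z → 6 * k ≤ Y + Z → 6 * k ≤ T + 2 → (7 * (X + (Y + Z)) + 6 * T) + 15 ≤ 99 * k → ⊥
arithW k X Y Z T h1 h2 h3 h4 h = <-irrefl {2 * (99 * k)} refl (≤-trans (≤-trans (≡⇒≤ (cong suc (l0 k))) (≤-trans (s≤s (+-mono-≤ (*-monoʳ-≤ 7 (+-mono-≤ h1 (+-mono-≤ h2 h3))) (*-monoʳ-≤ 12 h4))) (≤-trans (m≤m+n _ 5) (≡⇒≤ (l1 X Y Z T))))) (*-monoʳ-≤ 2 h))
 where
 l0 : ∀ k → 2 * (99 * k) ≡ 7 * (6 * k + (6 * k + 6 * k)) + 12 * (6 * k)
 l0 = solve-∀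
 l1 : ∀ X Y Z T → suc (7 * ((X + Y) + ((X + Z) + (Y + Z))) + 12 * (T + 2)) + 5 ≡ 2 * ((7 * (X + (Y + Z)) + 6 * T) + 15)
 l1 = solve-∀

mix3 : Vec Bool 12 → Bool
mix3 (a1 ∷ a2 ∷ a3 ∷ b1 ∷ b2 ∷ b3 ∷ c1 ∷ c2 ∷ c3 ∷ d1 ∷ d2 ∷ d3 ∷ []) =
 not ((a1 ∨ a2 ∨ a3) ∧ (b1 ∨ b2 ∨ b3)) ∧ not ((c1 ∨ c2 ∨ c3) ∧ (d1 ∨ d2 ∨ d3)) ∧ not ((a1 ∧ c1) ∨ (a2 ∧ c2) ∨ (a3 ∧ c3)) ∧
 not (le? 2 (sumB (b1 ∷ b2 ∷ b3 ∷ []))) ∧ not (le? 2 (sumB (d1 ∷ d2 ∷ d3 ∷ []))) ∧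
 not (le? 2 (sumB (c1 ∷ c2 ∷ c3 ∷ [])) ∧ (b1 ∨ b2 ∨ b3)) ∧ not (le? 2 (sumB (a1 ∷ a2 ∷ a3 ∷ [])) ∧ (d1 ∨ d2 ∨ d3))

tot12 : Vec Bool 12 → ℕ
tot12 (a1 ∷ a2 ∷ a3 ∷ b1 ∷ b2 ∷ b3 ∷ c1 ∷ c2 ∷ c3 ∷ d1 ∷ d2 ∷ d3 ∷ []) = sumB (a1 ∷ a2 ∷ a3 ∷ b1 ∷ b2 ∷ b3 ∷ []) + sumB (c1 ∷ c2 ∷ c3 ∷ d1 ∷ d2 ∷ d3 ∷ [])

-- The bits are the rows of two vertices of R towards the sides of a K₃,₃. The excluded patterns
-- leave three edges, where four will be required.
mix3≤3 : ∀ bs → mix3 bs ≡ true → tot12 bs ≤ 3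
mix3≤3 bs h = le?-sound (tot12 bs) 3 (mp {mix3 bs} (allB-sound 12 (λ bs → mix3 bs ⇒b le? (tot12 bs) 3) refl bs) h)

or3 : ∀ p q r → p ∨ q ∨ r ≡ true → p ≡ true ⊎ q ≡ true ⊎ r ≡ true
or3 true q r h = inj₁ refl
or3 false true r h = inj₂ (inj₁ refl)
or3 false false true h = inj₂ (inj₂ refl)

two-of-three : ∀ p q r → 2 ≤ sumB (p ∷ q ∷ r ∷ []) → (p ≡ true × q ≡ true) ⊎ (p ≡ true × r ≡ true) ⊎ (q ≡ true × r ≡ true)
two-of-three true true r h = inj₁ (refl , refl)
two-of-three true false true h = inj₂ (inj₁ (refl , refl))
two-of-three true false false (s≤s ())
two-of-three false true true h = inj₂ (inj₂ (refl , refl))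
two-of-three false true false (s≤s ())
two-of-three false false true (s≤s ())
two-of-three false false false ()

choose : ∀ {m} {P Q : Fin m → Set} → (∀ c → P c ⊎ Q c) → (∀ c → P c) ⊎ (Σ[ c ∈ Fin m ] Q c)
choose {zero} h = inj₁ λ ()
choose {suc m} {P} {Q} h = go (h fz) (choose (h ∘ fs))
 where
 go : P fz ⊎ Q fz → (∀ c → P (fs c)) ⊎ (Σ[ c ∈ Fin m ] Q (fs c)) → (∀ c → P c) ⊎ (Σ[ c ∈ Fin (suc m) ] Q c)
 go (inj₂ q) _ = inj₂ (fz , q)
 go (inj₁ p) (inj₂ (c , q)) = inj₂ (fs c , q)
 go (inj₁ p) (inj₁ f) = inj₁ λ { fz → p ; (fs c) → f c }

-- Kinds of classes and exchanges

record Setting : Set where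
 field
  {n} : ℕ
  G : Graph n
  k' : ℕ
  noK : NoKCC G k'
  σ : Ore G k'
  c₀ : Fin k'

module Main (setting : Setting) where
 open Setting setting
 open Tools G k' public
 open WithNoK noK public

 private
  module _ {κ : V → K} (o : Opt κ) (c : Fin k') {h y z : V} (ey : h ~ y) (ez : h ~ z) where

   kind4 : ∀ {m} → Walk y (y ∷ m ∷ z ∷ []) z → h ~ m → Lst κ (fs c) (h ∷ y ∷ m ∷ z ∷ []) → Kind κ c
   kind4 {m} (a ∷ b ∷ one) em L with e y z in eyz
   ... | true = k4 L ey em ez a eyz b
   ... | false = k4m (L-perm (↭-trans (swap h y refl) (prep y (prep h (swap m z refl)))) L) (adj-sym ey) ez (adj-sym b) (adj-sym a) em eyz

   kind5 : ∀ {m m'} → Walk y (y ∷ m ∷ m' ∷ z ∷ []) z → 1 ≤ cntL (e h) (m ∷ m' ∷ []) → Lst κ (fs c) (h ∷ y ∷ m ∷ m' ∷ z ∷ []) → Kind κ c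
   kind5 {m} {m'} (a ∷ b ∷ d ∷ one) eM L with e h m in em | e h m' in em'
   ... | true | _ = k5 L ey a b d (adj-sym ez) em
   ... | false | true = k5 (L-perm (prep h (Perm.↭-reverse (z ∷ m' ∷ m ∷ y ∷ []))) L) ez (adj-sym d) (adj-sym b) (adj-sym a) (adj-sym ey) em'
   kind5 (a ∷ b ∷ d ∷ one) () L | false | false

   kind≥6 : ∀ m m' m'' M → Walk y (y ∷ m ∷ m' ∷ m'' ∷ M ++ z ∷ []) z → Lst κ (fs c) (h ∷ y ∷ m ∷ m' ∷ m'' ∷ M ++ z ∷ []) → Kind κ c
   kind≥6 m m' m'' [] (a ∷ b ∷ d ∷ f ∷ one) L = Six.kind6 o c (cyc6 L ey a b d f (adj-sym ez))
   kind≥6 m m' m'' (m4 ∷ M) w L with w-2nd w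
   ... | a , w1 with w-2nd w1
   ... | b , w2 with w-2nd w2
   ... | d , w3 with w-2nd w3
   ... | f , w4 = last M w4 L
    where
    last : ∀ M → Walk m4 (m4 ∷ M ++ z ∷ []) z → Lst κ (fs c) (h ∷ y ∷ m ∷ m' ∷ m'' ∷ m4 ∷ M ++ z ∷ []) → Kind κ c
    last [] w L = kind7 o c L (ey ∷ a ∷ b ∷ d ∷ f ∷ one) (fst (w-2nd w)) (snd (w-2nd w)) (adj-sym ez)
    last (x ∷ M) w L = kind7 o c L (ey ∷ a ∷ b ∷ d ∷ f ∷ one) (fst (w-2nd w)) (snd (w-2nd w)) (adj-sym ez)

 kind : ∀ {κ} → Opt κ → ∀ c → Kind κ c
 kind {κ} o c with trim-L o c
 ... | T , L = go (tM T) (twk T) (eM T) L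
  where
  go : ∀ M → Walk (ty T) (ty T ∷ M ++ tz T ∷ []) (tz T) → 1 ≤ cntL (e (th T)) M → Lst κ (fs c) (th T ∷ ty T ∷ M ++ tz T ∷ []) → Kind κ c
  go [] w () L
  go (m ∷ []) w h L with e (th T) m in em
  ... | true = kind4 o c (ey T) (ez T) w em L
  go (m ∷ []) w () L | false
  go (m ∷ m' ∷ []) w h L = kind5 o c (ey T) (ez T) w h L
  go (m ∷ m' ∷ m'' ∷ M) w h L = kind≥6 o c (ey T) (ez T) m m' m'' M w L

 record Swapped (κ : V → K) (c : Fin k') (x v : V) (C' R' : List V) : Set where
  field
   κ' : V → K
   opt' : Opt κ'
   LC : Lst κ' (fs c) (v ∷ C')
   LR : Lst κ' fz (x ∷ R')
   oth : ∀ {c'} → c' ≢ c → ∀ {l} → Lst κ (fs c') l → Lst κ' (fs c') l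

 -- The edges inside `C'` are common to both classes, so only the degrees of `x` and `v` into `C'`
 -- have to be compared.
 exch : ∀ {κ} → Opt κ → ∀ c {x v C' R'} → Lst κ (fs c) (x ∷ C') → Lst κ fz (v ∷ R') →
  Σ[ C ∈ CC ] (∀ {y} → y ∈ vs C → y ∈ v ∷ C') → cntL (e x) C' ≤ cntL (e v) C' → Swapped κ c x v C' R'
 exch {κ} o c {x} {v} {C'} {R'} pC pR CX le = record
  { κ' = recolor (v ∷ C') c κ
  ; opt' = swapO o c uX (sym (size-L pC)) iX CX (≤-trans (≡⇒≤ (edges-L pC)) (+-monoˡ-≤ (eL C') le))
  ; LC = r-L-c {X = v ∷ C'} {κ = κ} uX
  ; LR = r-L-0 {X = v ∷ C'} {κ = κ} pC pR perm
  ; oth = λ ne p → r-L-oth {κ = κ} iX ne p }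
  where
  uX : Unique (v ∷ C')
  uX = U-cons (λ m → Fin.0≢1+n (sym (l⇒ pR i1) ⨾ l⇒ pC (there m))) (U-++ʳ (x ∷ []) (lu pC))
  iX : ∀ {y} → y ∈ v ∷ C' → In κ c y
  iX i1 = inj₁ (l⇒ pR i1)
  iX (there m) = inj₂ (l⇒ pC (there m))
  perm : (v ∷ C') ++ x ∷ R' ↭ (x ∷ C') ++ v ∷ R'
  perm = ↭-trans (prep v (Perm.shift x C' R')) (↭-trans (swap v x refl) (prep x (↭-sym (Perm.shift v C' R'))))

 module K4m {κ : V → K} (o : Opt κ) (c : Fin k') {α β γ δ : V} (L : Lst κ (fs c) (α ∷ β ∷ γ ∷ δ ∷ []))
  (αβ : α ~ β) (βγ : β ~ γ) (γδ : γ ~ δ) (δα : δ ~ α) (βδ : β ~ δ) (αγ : α ≁ γ) where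

  -- Exchanging γ' for `v` would turn the class into K₄, with one more edge.
  noK4 : ∀ {α' γ'} → Lst κ (fs c) (α' ∷ β ∷ γ' ∷ δ ∷ []) → α' ~ β → β ~ γ' → γ' ~ δ → δ ~ α' → α' ≁ γ' →
   ∀ {v} → κ v ≡ fz → v ~ α' → v ~ β → v ~ δ → ⊥
  noK4 {α'} {γ'} L ab bg gd da ag {v} kv va vb vd = absurd (≤-trans (swapM o c uX (sym (size-L L)) iX CX) (≡⇒≤ (edges-L L)))
   where
   X = α' ∷ β ∷ δ ∷ v ∷ []
   perm : α' ∷ β ∷ γ' ∷ δ ∷ v ∷ [] ↭ γ' ∷ X
   perm = ↭-trans (prep α' (swap β γ' refl)) (swap α' γ' refl)
   u5 : Unique (α' ∷ β ∷ γ' ∷ δ ∷ v ∷ [])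
   u5 = mixU L uq1 (in1 {κ} kv)
   uX : Unique X
   uX = U-++ʳ (γ' ∷ []) (U-↭ perm u5)
   iX : ∀ {y} → y ∈ X → In κ c y
   iX m = mixI {κ} L (in1 {κ} kv) (Perm.∈-resp-↭ (↭-sym perm) (there m))
   CX : Σ[ C ∈ CC ] (∀ {y} → y ∈ vs C → y ∈ X)
   CX = CC! (vx α') (vx β ∷ vx δ ∷ vx v ∷ []) uX (0 - 1 ! ab ∷ 2 - 0 ! da ∷ 1 - 2 ! βδ ∷ 3 - 0 ! va ∷ 3 - 1 ! vb ∷ [])
    0 (fw 3 ∷ fw 1 ∷ fw 2 ∷ []) refl
   absurd : eL X ≤ eL (α' ∷ β ∷ γ' ∷ δ ∷ []) → ⊥
   absurd le rewrite ab | adj-sym da | adj-sym va | βδ | adj-sym vb | adj-sym vd | ag | bg | gd = <-irrefl refl le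

  L' : Lst κ (fs c) (γ ∷ β ∷ α ∷ δ ∷ [])
  L' = L-perm (Perm.++⁺ (Perm.↭-reverse (γ ∷ β ∷ α ∷ [])) (refl {xs = δ ∷ []})) L

  nα : ∀ {v} → κ v ≡ fz → v ~ α → v ~ β → v ~ δ → ⊥
  nα = noK4 L αβ βγ γδ δα αγ

  nγ : ∀ {v} → κ v ≡ fz → v ~ γ → v ~ β → v ~ δ → ⊥
  nγ = noK4 L' (adj-sym βγ) (adj-sym αβ) (adj-sym δα) (adj-sym γδ) (nadj-sym αγ)

  le3 : ∀ {v} → κ v ≡ fz → d κ (fs c) v ≤ 3
  le3 {v} kv = ≤-trans (≡⇒≤ (d-L L v)) go
   where
   go : cntL (e v) (α ∷ β ∷ γ ∷ δ ∷ []) ≤ 3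
   go with e v α | e v β | e v γ | e v δ | nα {v} kv
   ... | true | true | _ | true | k = ⊥-elim (k refl refl refl)
   ... | false | b | b' | b'' | _ = cntL≤length id (b ∷ b' ∷ b'' ∷ [])
   ... | true | false | b' | b'' | _ = s≤s (cntL≤length id (b' ∷ b'' ∷ []))
   ... | true | true | b' | false | _ = s≤s (s≤s (≤-trans (≡⇒≤ (+-identityʳ (b2n b'))) (b2n≤1 b')))

  -- A tight vertex that saw β and δ would also see α or γ, which is excluded; so its neighbours are
  -- α, γ and one of β, δ.
  pat : ∀ {v} → κ v ≡ fz → d κ (fs c) v ≡ 3 → v ~ α × v ~ γ × ((v ~ β × v ≁ δ) ⊎ (v ≁ β × v ~ δ))
  pat {v} kv q with e v α | e v β | e v γ | e v δ | nα {v} kv | nγ {v} kv | sym (d-L L v) ⨾ q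
  ... | true | true | true | false | _ | _ | _ = refl , refl , inj₁ (refl , refl)
  ... | true | false | true | true | _ | _ | _ = refl , refl , inj₂ (refl , refl)
  ... | true | true | _ | true | k | _ | _ = ⊥-elim (k refl refl refl)
  ... | _ | true | true | true | _ | k | _ = ⊥-elim (k refl refl refl)
  ... | false | false | false | false | _ | _ | ()
  ... | false | false | false | true | _ | _ | ()
  ... | false | false | true | false | _ | _ | ()
  ... | false | false | true | true | _ | _ | ()
  ... | false | true | false | false | _ | _ | ()
  ... | false | true | false | true | _ | _ | ()
  ... | false | true | true | false | _ | _ | ()
  ... | true | false | false | false | _ | _ | ()
  ... | true | false | false | true | _ | _ | ()
  ... | true | false | true | false | _ | _ | ()
  ... | true | true | false | false | _ | _ | ()

 module K5 {κ : V → K} (o : Opt κ) (c : Fin k') {x y z w t : V} (L : Lst κ (fs c) (x ∷ y ∷ z ∷ w ∷ t ∷ []))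
  (xy : x ~ y) (yz : y ~ z) (zw : z ~ w) (wt : w ~ t) (tx : t ~ x) (xz : x ~ z) where

  sz : 5 ≤ size κ (fs c)
  sz = ≡⇒≤ (sym (size-L L))

  module _ {v : V} (kv : κ v ≡ fz) where
   u6 : Unique (x ∷ y ∷ z ∷ w ∷ t ∷ v ∷ [])
   u6 = mixU L uq1 (in1 {κ} kv)
   i6 : ∀ {y'} → y' ∈ x ∷ y ∷ z ∷ w ∷ t ∷ v ∷ [] → In κ c y'
   i6 = mixI {κ} L (in1 {κ} kv)
   base : List (Layout.Fact (vx x) (vx y ∷ vx z ∷ vx w ∷ vx t ∷ vx v ∷ []) u6)
   base = 0 - 1 ! xy ∷ 1 - 2 ! yz ∷ 2 - 3 ! zw ∷ 3 - 4 ! wt ∷ 4 - 0 ! tx ∷ 0 - 2 ! xz ∷ []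
   bad : ∀ fa h l → suc (suc (length l)) ≤ 5 → (let open Layout.Facts (vx x) (vx y ∷ vx z ∷ vx w ∷ vx t ∷ vx v ∷ []) u6 fa in okCC h l ∧ allV l) ≡ true → ⊥
   bad fa h l le q = small! o c _ _ u6 i6 fa h l (≤-trans le sz) q
   bxy : v ~ x → v ~ y → ⊥
   bxy p q = bad (5 - 0 ! p ∷ 5 - 1 ! q ∷ base) 0 (fw 5 ∷ fw 1 ∷ fw 2 ∷ []) ≤-refl refl
   byz : v ~ y → v ~ z → ⊥
   byz p q = bad (5 - 1 ! p ∷ 5 - 2 ! q ∷ base) 1 (fw 0 ∷ fw 2 ∷ fw 5 ∷ []) ≤-refl refl
   bxz : v ~ x → v ~ z → ⊥
   bxz p q = bad (5 - 0 ! p ∷ 5 - 2 ! q ∷ base) 0 (fw 5 ∷ fw 2 ∷ fw 1 ∷ []) ≤-refl refl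
   bxwt : v ~ x → v ~ w → v ~ t → ⊥
   bxwt p q r = bad (5 - 0 ! p ∷ 5 - 3 ! q ∷ 5 - 4 ! r ∷ base) 5 (fw 0 ∷ fw 4 ∷ fw 3 ∷ []) ≤-refl refl
   bzwt : v ~ z → v ~ w → v ~ t → ⊥
   bzwt p q r = bad (5 - 2 ! p ∷ 5 - 3 ! q ∷ 5 - 4 ! r ∷ base) 5 (fw 2 ∷ fw 3 ∷ fw 4 ∷ []) ≤-refl refl

   concl : cntL (e v) (x ∷ y ∷ z ∷ w ∷ t ∷ []) ≤ 3 × (cntL (e v) (x ∷ y ∷ z ∷ w ∷ t ∷ []) ≡ 3 → v ~ w × v ~ t)
   concl = le?-sound (sumB (e v x ∷ e v y ∷ e v z ∷ e v w ∷ e v t ∷ [])) 3 (∧-l r) ,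
    λ q → ∧2 (e v w) (e v t) (mp (∧-r {le? (sumB (e v x ∷ e v y ∷ e v z ∷ e v w ∷ e v t ∷ [])) 3} r) (le?-complete (≡⇒≤ (sym q))))
    where
    r : le? (sumB (e v x ∷ e v y ∷ e v z ∷ e v w ∷ e v t ∷ [])) 3 ∧ (le? 3 (sumB (e v x ∷ e v y ∷ e v z ∷ e v w ∷ e v t ∷ [])) ⇒b (e v w ∧ e v t)) ≡ true
    r = mp (allB-sound 5 house refl (e v x ∷ e v y ∷ e v z ∷ e v w ∷ e v t ∷ []))
     (∧-i (not₂ _ _ bxy) (∧-i (not₂ _ _ byz) (∧-i (not₂ _ _ bxz) (∧-i (not₃ _ _ _ bxwt) (not₃ _ _ _ bzwt)))))

  le3 : ∀ {v} → κ v ≡ fz → d κ (fs c) v ≤ 3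
  le3 {v} kv = ≤-trans (≡⇒≤ (d-L L v)) (fst (concl kv))

  -- Both see the edge `wt`, and `u`, `v`, `w`, `t` carry a chorded cycle smaller than the class.
  one-tight : ∀ {u v} → u ≢ v → κ u ≡ fz → κ v ≡ fz → d κ (fs c) u ≡ 3 → d κ (fs c) v ≡ 3 → ⊥
  one-tight {u} {v} ne ku kv du dv with snd (concl ku) (sym (d-L L u) ⨾ du) | snd (concl kv) (sym (d-L L v) ⨾ dv)
  ... | uw , ut | vw , vt = small! o c (vx x) (vx y ∷ vx z ∷ vx w ∷ vx t ∷ vx u ∷ vx v ∷ [])
   (mixU L (uq2 ne) (in2 {κ} ku kv)) (mixI {κ} L (in2 {κ} ku kv))
   (3 - 4 ! wt ∷ 5 - 3 ! uw ∷ 5 - 4 ! ut ∷ 6 - 3 ! vw ∷ 6 - 4 ! vt ∷ [])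
   3 (fw 5 ∷ fw 4 ∷ fw 6 ∷ []) sz refl

 flip33 : ∀ {κ c} → K33 κ c → K33 κ c
 flip33 {κ} {c} (mk33 {a1} {a2} {a3} {b1} {b2} {b3} l a) = mk33 {a₁ = b1} {b2} {b3} {a1} {a2} {a3} (L-perm (Perm.++-comm (a1 ∷ a2 ∷ a3 ∷ []) (b1 ∷ b2 ∷ b3 ∷ [])) l) (λ p q → adj-sym (a q p))

 permA : ∀ {κ c} (q : K33 κ c) {x y z} → K33.A q ↭ x ∷ y ∷ z ∷ [] → Σ[ q' ∈ K33 κ c ] (K33.A q' ≡ x ∷ y ∷ z ∷ [] × K33.B q' ≡ K33.B q)
 permA (mk33 {b₁ = b1} {b2} {b3} l a) {x} {y} {z} h = mk33 {a₁ = x} {y} {z} (L-perm (Perm.++⁺ h refl) l) (λ p q → a (Perm.∈-resp-↭ (↭-sym h) p) q) , refl , refl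

 -- Any vertex of `A` can be made the first one without changing the sides, so facts need to be
 -- proved for `a₁` only.
 record PickA {κ c} (q : K33 κ c) (x : V) : Set where
  field
   q' : K33 κ c
   a₁≡ : K33.a₁ q' ≡ x
   A↭ : K33.A q ↭ K33.A q'
   B≡ : K33.B q' ≡ K33.B q

 pickA : ∀ {κ c} (q : K33 κ c) {x} → x ∈ K33.A q → PickA q x
 pickA q i1 = record { q' = q ; a₁≡ = refl ; A↭ = refl ; B≡ = refl }
 pickA q@(mk33 {a1} {a2} {a3} l a) i2 = record { q' = fst r ; a₁≡ = refl ; A↭ = swap a1 a2 refl ; B≡ = refl }
  where r = permA q (swap a1 a2 refl)
 pickA q@(mk33 {a1} {a2} {a3} l a) i3 = record { q' = fst r ; a₁≡ = refl ; A↭ = p ; B≡ = refl }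
  where p : a1 ∷ a2 ∷ a3 ∷ [] ↭ a3 ∷ a1 ∷ a2 ∷ []
        p = ↭-trans (prep a1 (swap a2 a3 refl)) (swap a1 a3 refl)
        r = permA q p

 -- A vertex on side A sees all of `A`, so it can take the place of a vertex of `B`.
 SideA SideB : ∀ {κ c} → K33 κ c → V → Set
 SideA q v = (∀ {a} → a ∈ K33.A q → v ~ a) × (∀ {b} → b ∈ K33.B q → v ≁ b)
 SideB q v = (∀ {b} → b ∈ K33.B q → v ~ b) × (∀ {a} → a ∈ K33.A q → v ≁ a)

 module _ {κ : V → K} (o : Opt κ) {c : Fin k'} where

  -- An edge within a side, with two vertices of the other side, gives a chorded cycle on four
  -- vertices.
  noA₁₂ : (q : K33 κ c) → (K33.a₁ q) ~ (K33.a₂ q) → ⊥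
  noA₁₂ (mk33 {a1} {a2} {a3} {b1} {b2} {b3} l a) h = small! o c (vx a1) (vx a2 ∷ vx a3 ∷ vx b1 ∷ vx b2 ∷ vx b3 ∷ []) (lu l) (inj₂ ∘ l⇒ l)
   (0 - 1 ! h ∷ 0 - 3 ! a i1 i1 ∷ 0 - 4 ! a i1 i2
   ∷ 1 - 3 ! a i2 i1 ∷ 1 - 4 ! a i2 i2 ∷ [])
   0 (fw 3 ∷ fw 1 ∷ fw 4 ∷ []) (≤-trans (n≤1+n 5) (≡⇒≤ (sym (size-L l)))) refl

  nadjA : (q : K33 κ c) → ∀ {x y} → x ∈ K33.A q → y ∈ K33.A q → x ≁ y
  nadjA q@(mk33 {a1} {a2} {a3} l a) = go
   where
   f12 : a1 ≁ a2
   f12 = ¬t→f (noA₁₂ q)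
   f13 : a1 ≁ a3
   f13 = ¬t→f (noA₁₂ (fst (permA q (prep a1 (swap a2 a3 refl)))))
   f23 : a2 ≁ a3
   f23 = ¬t→f (noA₁₂ (fst (permA q (↭-trans (swap a1 a2 refl) (prep a2 (swap a1 a3 refl))))))
   go : ∀ {x y} → x ∈ a1 ∷ a2 ∷ a3 ∷ [] → y ∈ a1 ∷ a2 ∷ a3 ∷ [] → x ≁ y
   go i1 i1 = E-irr G _
   go i1 i2 = f12
   go i1 i3 = f13
   go i2 i1 = nadj-sym f12
   go i2 i2 = E-irr G _
   go i2 i3 = f23
   go i3 i1 = nadj-sym f13
   go i3 i2 = nadj-sym f23
   go i3 i3 = E-irr G _

  -- With `v` adjacent to both ends of a₁b₁, the five vertices a₁, v, b₁, a₂, b₂ carry a chorded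
  -- cycle, fewer than the six of the class.
  noAB₁ : (q : K33 κ c) → ∀ {v} → κ v ≡ fz → v ~ (K33.a₁ q) → v ~ (K33.b₁ q) → ⊥
  noAB₁ (mk33 {a1} {a2} {a3} {b1} {b2} {b3} l a) {v} kv p q = small! o c (vx a1) (vx a2 ∷ vx a3 ∷ vx b1 ∷ vx b2 ∷ vx b3 ∷ vx v ∷ [])
   (mixU l uq1 (in1 {κ} kv)) (mixI {κ} l (in1 {κ} kv))
   (6 - 0 ! p ∷ 6 - 3 ! q ∷ 0 - 3 ! a i1 i1 ∷ 0 - 4 ! a i1 i2
   ∷ 1 - 3 ! a i2 i1 ∷ 1 - 4 ! a i2 i2 ∷ [])
   0 (fw 6 ∷ fw 3 ∷ fw 1 ∷ fw 4 ∷ []) (≡⇒≤ (sym (size-L l))) refl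

  noAB : (q : K33 κ c) → ∀ {v} → κ v ≡ fz → ∀ {a b} → a ∈ K33.A q → b ∈ K33.B q → v ~ a → v ~ b → ⊥
  noAB q {v} kv a∈ b∈ ea eb with pickA q a∈
  ... | record { q' = q1 ; a₁≡ = refl ; B≡ = B≡ } with pickA (flip33 q1) (cast∈ (sym B≡) b∈)
  ... | record { q' = q2 ; a₁≡ = refl ; B≡ = B≡' } = noAB₁ (flip33 q2) kv (subst (λ t → v ~ t) (hdeq B≡') ea) eb
   where hdeq : ∀ {x y : V} {l m : List V} → _≡_ {A = List V} (x ∷ l) (y ∷ m) → y ≡ x
         hdeq refl = refl

  side : (q : K33 κ c) → ∀ {v} → κ v ≡ fz → d κ (fs c) v ≡ 3 → SideA q v ⊎ SideB q v
  side q {v} kv dv with 1 ≤? cntL (e v) (K33.A q)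
  ... | yes h with cntL-any (e v) _ h
  ... | a , a∈ , ea = inj₁ ((λ m → cnt3-all (e v) cA m) , nB)
   where
   nB : ∀ {b} → b ∈ K33.B q → v ≁ b
   nB m = ¬t→f (noAB q kv a∈ m ea)
   cA : cntL (e v) (K33.A q) ≡ 3
   cA = sym (+-identityʳ _) ⨾ cong (cntL (e v) (K33.A q) +_) (sym (cntL-zero (e v) (K33.B q) nB)) ⨾ sym (cntL-++ (e v) (K33.A q) (K33.B q)) ⨾ sym (d-L (K33.l33 q) v) ⨾ dv
  side q {v} kv dv | no h = inj₂ ((λ m → cnt3-all (e v) cB m) , cntL-zero⁻ (e v) _ z0)
   where
   z0 : cntL (e v) (K33.A q) ≡ 0
   z0 = n≤0⇒n≡0 (≤-pred (≰⇒> h))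
   cB : cntL (e v) (K33.B q) ≡ 3
   cB = cong (_+ cntL (e v) (K33.B q)) (sym z0) ⨾ sym (cntL-++ (e v) (K33.A q) (K33.B q)) ⨾ sym (d-L (K33.l33 q) v) ⨾ dv

  nadjB : (q : K33 κ c) → ∀ {x y} → x ∈ K33.B q → y ∈ K33.B q → x ≁ y
  nadjB q = nadjA (flip33 q)

  -- If `u` and `v` were adjacent, they would form a chorded cycle on four vertices with two
  -- vertices of `A`.
  same-nadj : (q : K33 κ c) → ∀ {u v} → κ u ≡ fz → κ v ≡ fz → SideA q u → SideA q v → u ≁ v
  same-nadj (mk33 {a1} {a2} {a3} {b1} {b2} {b3} l a) {u} {v} ku kv (su , _) (sv , _) = ¬t→f λ h →
   small! o c (vx a1) (vx a2 ∷ vx a3 ∷ vx b1 ∷ vx b2 ∷ vx b3 ∷ vx u ∷ vx v ∷ [])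
   (mixU l (uq2 (adj-≢ h)) (in2 {κ} ku kv)) (mixI {κ} l (in2 {κ} ku kv))
   (6 - 7 ! h ∷ 6 - 0 ! su i1 ∷ 6 - 1 ! su i2 ∷ 7 - 0 ! sv i1 ∷ 7 - 1 ! sv i2 ∷ [])
   6 (fw 0 ∷ fw 7 ∷ fw 1 ∷ []) (≤-trans (n≤1+n 5) (≡⇒≤ (sym (size-L l)))) refl

  -- `v` and b₁ have the same neighbours in the rest of the class, so the exchange preserves both
  -- K₃,₃ and the number of edges.
  exch33 : (q : K33 κ c) → ∀ {v R'} → Lst κ fz (v ∷ R') → SideA q v →
   Σ[ S ∈ Swapped κ c (K33.b₁ q) v (K33.A q ++ K33.b₂ q ∷ K33.b₃ q ∷ []) R' ]
   Σ[ q' ∈ K33 (Swapped.κ' S) c ] (K33.A q' ≡ K33.A q × K33.B q' ≡ v ∷ K33.b₂ q ∷ K33.b₃ q ∷ [])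
  exch33 q@(mk33 {a1} {a2} {a3} {b1} {b2} {b3} l a) {v} {R'} pR (sA , sB) = S , mk33 {a₁ = a1} {a2} {a3} {v} {b2} {b3} (L-perm (↭-sym (Perm.shift v (a1 ∷ a2 ∷ a3 ∷ []) (b2 ∷ b3 ∷ []))) (Swapped.LC S)) adj , refl , refl
   where
   C' = a1 ∷ a2 ∷ a3 ∷ b2 ∷ b3 ∷ []
   p : Lst κ (fs c) (b1 ∷ C')
   p = L-perm (Perm.shift b1 (a1 ∷ a2 ∷ a3 ∷ []) (b2 ∷ b3 ∷ [])) l
   adj : ∀ {x y} → x ∈ a1 ∷ a2 ∷ a3 ∷ [] → y ∈ v ∷ b2 ∷ b3 ∷ [] → x ~ y
   adj m i1 = adj-sym (sA m)
   adj m (there r) = a m (there r)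
   kv = l⇒ pR i1
   uX : Unique (v ∷ C')
   uX = U-cons (λ m → Fin.0≢1+n (sym kv ⨾ l⇒ p (there m))) (U-++ʳ (b1 ∷ []) (lu p))
   S : Swapped κ c b1 v C' R'
   S = exch o c p pR (CC! (vx v) (vx a1 ∷ vx a2 ∷ vx a3 ∷ vx b2 ∷ vx b3 ∷ []) uX
    (0 - 1 ! sA i1 ∷ 0 - 2 ! sA i2 ∷ (hd 0 , hd 3 , sA i3) ∷
    1 - 4 ! a i1 i2 ∷ 2 - 4 ! a i2 i2 ∷
    (hd 2 , hd 5 , a i2 i3) ∷ (hd 3 , hd 5 , a i3 i3) ∷ [])
    0 (fw 1 ∷ fw 4 ∷ fw 2 ∷ fw 5 ∷ fw 3 ∷ []) refl)
    (≡⇒≤ (cntL-cong (e b1) (e v) C' λ {y} m → same y m))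
    where
    same : ∀ y → y ∈ C' → e b1 y ≡ e v y
    same y m with ∈-++⁻ (a1 ∷ a2 ∷ a3 ∷ []) m
    ... | inj₁ r = adj-sym (a r i1) ⨾ sym (sA r)
    ... | inj₂ r = nadjB q i1 (there r) ⨾ sym (sB (there r))

 pull : ∀ (κ : V → K) {v c} → κ v ≡ c → Σ[ R' ∈ List V ] Lst κ c (v ∷ R')
 pull κ {v} {c} h with ∈-split (l⇐ (cls-L κ c) h)
 ... | a , b , eq = a ++ b , L-perm (Perm.shift v a b) (subst (Lst κ c) eq (cls-L κ c))

 dR : (V → K) → V → ℕ
 dR κ v = d κ fz v

 D : (V → K) → V → Fin k' → ℕ
 D κ v c = d κ (fs c) v

 -- The degree condition sorted by classes: once every class has taken six, four remain for R.
 PI : ∀ κ {u w} → u ≢ w → u ≁ w → 6 * k' + 4 ≤ dR κ u + dR κ w + ΣF (λ c → D κ u c + D κ w c)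
 PI κ {u} {w} ne na = ≤-trans (σ u w ne na) (≡⇒≤ (cong₂ _+_ (deg-split κ u) (deg-split κ w) ⨾ +-inter (dR κ u) (ΣF (D κ u)) (dR κ w) (ΣF (D κ w)) ⨾ cong (dR κ u + dR κ w +_) (sym (ΣF-+ (D κ u) (D κ w)))))

 -- Classes that are K₄

 record Tet (κ : V → K) (c : Fin k') (x y z w : V) : Set where
  constructor tet
  field
   tl4 : Lst κ (fs c) (x ∷ y ∷ z ∷ w ∷ [])
   xy : x ~ y
   xz : x ~ z
   xw : x ~ w
   yz : y ~ z
   yw : y ~ w
   zw : z ~ w

 -- Patterns are stated for the first vertex against the triangle of the other three; three
 -- rotations transfer them to the remaining vertices.
 trot : ∀ {κ c x y z w} → Tet κ c x y z w → Tet κ c y z w x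
 trot {x = x} (tet l a b f g h i) = tet (L-perm (Perm.++-comm (x ∷ []) _) l) g h (adj-sym a) i (adj-sym b) (adj-sym f)

 NotK4 : (V → K) → Set
 NotK4 κ = ∀ c {x y z w} → Tet κ c x y z w → ⊥

 D≤3 : ∀ {κ} → Opt κ → ∀ c → (∀ {x y z w} → Tet κ c x y z w → ⊥) → ∀ {v} → κ v ≡ fz → D κ v c ≤ 3
 D≤3 o c nt kv with kind o c
 ... | k4 L a b f g h i = ⊥-elim (nt (tet L a b f g h i))
 ... | k4m L ab bg gd da bd ag = K4m.le3 o c L ab bg gd da bd ag kv
 ... | k5 L a b f g h i = K5.le3 o c L a b f g h i kv
 ... | big _ le _ = le kv

 tet-D : ∀ {κ c x y z w} → Tet κ c x y z w → ∀ v → D κ v c ≡ sumB (e v x ∷ e v y ∷ e v z ∷ e v w ∷ [])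
 tet-D t v = d-L (Tet.tl4 t) v

 isTet : ∀ {κ} → Opt κ → ∀ c → (Σ[ x ∈ V ] Σ[ y ∈ V ] Σ[ z ∈ V ] Σ[ w ∈ V ] Tet κ c x y z w) ⊎ (∀ {v} → κ v ≡ fz → D κ v c ≤ 3)
 isTet o c with kind o c
 ... | k4 L a b f g h i = inj₁ (_ , _ , _ , _ , tet L a b f g h i)
 ... | k4m L ab bg gd da bd ag = inj₂ (K4m.le3 o c L ab bg gd da bd ag)
 ... | k5 L a b f g h i = inj₂ (K5.le3 o c L a b f g h i)
 ... | big _ le _ = inj₂ le

 tet-CC : ∀ {κ c x y z w v} → Tet κ c x y z w → κ v ≡ fz → 2 ≤ sumB (e v y ∷ e v z ∷ e v w ∷ []) →
  Σ[ C ∈ CC ] (∀ {a} → a ∈ vs C → a ∈ v ∷ y ∷ z ∷ w ∷ [])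
 tet-CC {κ} {c} {x} {y} {z} {w} {v} (tet l _ _ _ yz yw zw) kv h = go h
  where
  uX : Unique (v ∷ y ∷ z ∷ w ∷ [])
  uX = U-cons (λ m → Fin.0≢1+n (sym kv ⨾ l⇒ l (there m))) (U-++ʳ (x ∷ []) (lu l))
  base : List (Layout.Fact (vx v) (vx y ∷ vx z ∷ vx w ∷ []) uX)
  base = 1 - 2 ! yz ∷ 1 - 3 ! yw ∷ 2 - 3 ! zw ∷ []
  go : 2 ≤ sumB (e v y ∷ e v z ∷ e v w ∷ []) → Σ[ C ∈ CC ] (∀ {a} → a ∈ vs C → a ∈ v ∷ y ∷ z ∷ w ∷ [])
  go h' with e v y in vy | e v z in vz | e v w in vw | h'
  ... | true | true | _ | _ = CC! _ _ uX (0 - 1 ! vy ∷ 0 - 2 ! vz ∷ base) 1 (fw 0 ∷ fw 2 ∷ fw 3 ∷ []) refl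
  ... | true | false | true | _ = CC! _ _ uX (0 - 1 ! vy ∷ 0 - 3 ! vw ∷ base) 1 (fw 0 ∷ fw 3 ∷ fw 2 ∷ []) refl
  ... | false | true | true | _ = CC! _ _ uX (0 - 2 ! vz ∷ 0 - 3 ! vw ∷ base) 2 (fw 0 ∷ fw 3 ∷ fw 1 ∷ []) refl
  ... | true | false | false | s≤s ()
  ... | false | true | false | s≤s ()
  ... | false | false | true | s≤s ()
  ... | false | false | false | ()

 -- `v` and the triangle form one chorded cycle, which frees `x`; the cycle `C` uses only `x` and R
 -- without `v`.
 tet-two : ∀ {κ c x y z w v} → Opt κ → Tet κ c x y z w → κ v ≡ fz → 2 ≤ sumB (e v y ∷ e v z ∷ e v w ∷ []) →
  (C : CC) → (∀ {a} → a ∈ vs C → a ≢ v × (a ≡ x ⊎ κ a ≡ fz)) → ⊥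
 tet-two {κ} {c} {x} {y} {z} {w} {v} o t kv h C hC with tet-CC t kv h
 ... | D' , hD = two (cfg o) c C D' (λ m → f (snd (hC m))) (λ m → g (hD m)) (λ p q → dj (hC p) (hD q))
  where
  L = Tet.tl4 t
  f : ∀ {a} → a ≡ x ⊎ κ a ≡ fz → In κ c a
  f (inj₁ refl) = inj₂ (l⇒ L i1)
  f (inj₂ q) = inj₁ q
  g : ∀ {a} → a ∈ v ∷ y ∷ z ∷ w ∷ [] → In κ c a
  g i1 = inj₁ kv
  g (there m) = inj₂ (l⇒ L (there m))
  dj : ∀ {a} → a ≢ v × (a ≡ x ⊎ κ a ≡ fz) → a ∈ v ∷ y ∷ z ∷ w ∷ [] → ⊥
  dj (ne , _) (here q) = ne q
  dj (_ , inj₁ refl) (there m) = U∉ (lu L) m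
  dj (_ , inj₂ q) (there m) = Fin.0≢1+n (sym q ⨾ l⇒ L (there m))

 tet-exch : ∀ {κ c x y z w v R'} → Opt κ → Tet κ c x y z w → Lst κ fz (v ∷ R') → v ~ y → v ~ z → v ~ w →
  Σ[ S ∈ Swapped κ c x v (y ∷ z ∷ w ∷ []) R' ] Tet (Swapped.κ' S) c v y z w
 tet-exch {κ} {c} {x} {y} {z} {w} {v} o t@(tet l xy xz xw yz yw zw) pR vy vz vw = S , tet (Swapped.LC S) vy vz vw yz yw zw
  where
  S : Swapped κ c x v (y ∷ z ∷ w ∷ []) _
  S = exch o c l pR (tet-CC t (l⇒ pR i1) (≤-trans (n≤1+n 2) (≡⇒≤ (sym c3)))) (≡⇒≤ (c3' ⨾ sym c3))
   where
   c3 : sumB (e v y ∷ e v z ∷ e v w ∷ []) ≡ 3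
   c3 rewrite vy | vz | vw = refl
   c3' : cntL (e x) (y ∷ z ∷ w ∷ []) ≡ 3
   c3' rewrite xy | xz | xw = refl

 -- Longest paths of the remainder

 -- The comparison runs over the remainders of all optimal colourings, so a path lengthened after an
 -- exchange is also a contradiction.
 record LongP (κ : V → K) (p : V) (P : List V) (q : V) : Set where
  constructor mkLP
  field
   lo : Opt κ
   lw : Walk p P q
   lU : Unique P
   lz : ∀ {x} → x ∈ P → κ x ≡ fz
   lmax : ∀ {κ' p' P' q'} → Opt κ' → Walk p' P' q' → Unique P' → (∀ {x} → x ∈ P' → κ' x ≡ fz) → length P' ≤ length P
 open LongP public

 LP-rev : ∀ {κ p P q} → LongP κ p P q → LongP κ q (reverse P) p
 LP-rev {P = P} L = mkLP (lo L) (w-rev (lw L)) (U-rev (lU L)) (λ m → lz L (Perm.∈-resp-↭ (Perm.↭-reverse P) m))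
  (λ o w u z → ≤-trans (lmax L o w u z) (≡⇒≤ (sym (length-reverse P))))

 module PathEnd {κ : V → K} {p P' q} (L : LongP κ p (p ∷ P') q) where

  o = lo L
  P = p ∷ P'

  uP' : Unique P'
  uP' = U-++ʳ (p ∷ []) (lU L)

  nbr-on : ∀ {x} → κ x ≡ fz → x ∉ P → p ≁ x
  nbr-on {x} kx nx = ¬t→f λ h → <-irrefl refl (lmax L o (adj-sym h ∷ lw L) (U-cons nx (lU L)) λ { i1 → kx ; (there m) → lz L m })

  tail-walk : ∀ {x} → q ~ x → Σ[ a ∈ V ] Walk a (P' ++ x ∷ []) x
  tail-walk {x} h = go P' (lw L)
   where go : ∀ P' → Walk p (p ∷ P') q → Σ[ a ∈ V ] Walk a (P' ++ x ∷ []) x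
         go [] w = x , one
         go (y ∷ P') w = y , w-snoc (snd (w-2nd w)) h

  P'≤2 : cntL (e p) P' ≤ 2
  P'≤2 with 3 ≤? cntL (e p) P'
  ... | no h = ≤-pred (≰⇒> h)
  ... | yes h = ⊥-elim (go P' refl (lw L) h)
   where
   go : ∀ P'' → P'' ≡ P' → Walk p (p ∷ P'') q → 3 ≤ cntL (e p) P'' → ⊥
   go (y ∷ P'') refl w h = noCC₀ (cfg o) (mkCC (snd (w-2nd w)) (lU L) h) (lz L)

  cP : cntL (e p) P ≡ cntL (e p) P'
  cP = cong (λ t → b2n t + cntL (e p) P') (E-irr G p)

  dR≤ : dR κ p ≤ cntL (e p) P'
  dR≤ = ≤-trans (cntL-⊆' (e p) (lu (cls-L κ fz)) f) (≡⇒≤ cP)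
   where
   f : ∀ {x} → x ∈ cls κ fz → p ~ x → x ∈ P
   f {x} m h with x ∈? P
   ... | yes r = r
   ... | no nr = ⊥-elim (true≢false (sym h ⨾ nbr-on (l⇒ (cls-L κ fz) m) nr))

  dR≤2 : dR κ p ≤ 2
  dR≤2 = ≤-trans dR≤ P'≤2

  -- The hub is `p`; its path runs through `P'` to `q` and on to `x`, which is the third neighbour.
  closeCC : ∀ {x} → 2 ≤ cntL (e p) P' → p ~ x → q ~ x → x ∉ P → Σ[ C ∈ CC ] (∀ {a} → a ∈ vs C → a ∈ P ⊎ a ≡ x)
  closeCC {x} h px qx nx = mkCC (snd (tail-walk qx)) uq (≤-trans (+-mono-≤ h (≡⇒≤ (sym (cong (λ t → b2n t + 0) px)))) (≡⇒≤ (sym (cntL-++ (e p) P' (x ∷ []))))) , f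
   where
   uq : Unique (p ∷ P' ++ x ∷ [])
   uq = U-++ (lU L) uq1 (λ { m i1 → nx m })
   f : ∀ {a} → a ∈ p ∷ P' ++ x ∷ [] → a ∈ P ⊎ a ≡ x
   f m with ∈-++⁻ P m
   ... | inj₁ r = inj₁ r
   ... | inj₂ (here r) = inj₂ r

  -- After `p` has been exchanged for `x`, the path `P'` continued by `x` and `v` has one vertex
  -- more than `P`.
  prolong : ∀ {c x C' R' v} → (S : Swapped κ c x p C' R') → Lst κ fz (p ∷ R') → q ~ x → x ~ v → κ v ≡ fz → v ∉ P → x ∉ P → v ≢ x → ⊥
  prolong {c} {x} {C'} {R'} {v} S pR qx xv kv nv nx vx' = <-irrefl refl (≤-trans (≡⇒≤ len) (lmax L (Swapped.opt' S) (w-snoc (snd (tail-walk qx)) xv) uq zz))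
   where
   len : suc (length P) ≡ length ((P' ++ x ∷ []) ++ v ∷ [])
   len = sym (length-++ (P' ++ x ∷ []) ⨾ cong (_+ 1) (length-++ P') ⨾ lem (length P'))
    where lem : ∀ a → a + 1 + 1 ≡ suc (suc a)
          lem = solve-∀
   uq : Unique ((P' ++ x ∷ []) ++ v ∷ [])
   uq = U-++ (U-++ uP' uq1 (λ { m i1 → nx (there m) })) uq1 λ { m i1 → g m }
    where g : v ∈ P' ++ x ∷ [] → ⊥
          g m with ∈-++⁻ P' m
          ... | inj₁ r = nv (there r)
          ... | inj₂ (here r) = vx' r
   inR' : ∀ {a} → κ a ≡ fz → a ≢ p → Swapped.κ' S a ≡ fz
   inR' h ne with l⇐ pR h
   ... | here r = ⊥-elim (ne r)
   ... | there r = l⇒ (Swapped.LR S) (there r)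
   zz : ∀ {a} → a ∈ (P' ++ x ∷ []) ++ v ∷ [] → Swapped.κ' S a ≡ fz
   zz m with ∈-++⁻ (P' ++ x ∷ []) m
   ... | inj₂ i1 = inR' kv (λ { refl → nv i1 })
   ... | inj₁ m' with ∈-++⁻ P' m'
   ... | inj₁ r = inR' (lz L (there r)) (λ { refl → U∉ (lU L) r })
   ... | inj₂ i1 = l⇒ (Swapped.LR S) i1

  -- `x` enters the remainder in place of `v`, which is not on the path, and extends the path at
  -- `p`.
  prolong₀ : ∀ {c x C' R' v} → (S : Swapped κ c x v C' R') → Lst κ fz (v ∷ R') → p ~ x → v ∉ P → x ∉ P → ⊥
  prolong₀ {c} {x} {C'} {R'} {v} S pR px nv nx = <-irrefl refl (lmax L (Swapped.opt' S) (adj-sym px ∷ lw L) (U-cons nx (lU L)) zz)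
   where
   zz : ∀ {a} → a ∈ x ∷ P → Swapped.κ' S a ≡ fz
   zz i1 = l⇒ (Swapped.LR S) i1
   zz (there m) with l⇐ pR (lz L m)
   ... | here refl = ⊥-elim (nv m)
   ... | there r = l⇒ (Swapped.LR S) (there r)

 LP-hd : ∀ {κ p P q} → LongP κ p P q → Σ[ P' ∈ List V ] P ≡ p ∷ P'
 LP-hd L = w-head (lw L)

 -- A vertex off a longest path is adjacent to neither end, so the degree condition applies to `vp`
 -- and to `vq`. With `v` of degree at most 2 in R, the sum of the two leaves no slack.
 module Off {κ : V → K} {p P' q Q'} (L : LongP κ p (p ∷ P') q) (L' : LongP κ q (q ∷ Q') p) (P↭ : p ∷ P' ↭ q ∷ Q')
  {v : V} (kv : κ v ≡ fz) (nv : v ∉ p ∷ P') (dv : dR κ v ≤ 2) where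

  module X = PathEnd L
  module Y = PathEnd L'

  o = lo L

  nvQ : v ∉ q ∷ Q'
  nvQ m = nv (Perm.∈-resp-↭ (↭-sym P↭) m)

  vp : v ≁ p
  vp = nadj-sym (X.nbr-on kv nv)
  vq : v ≁ q
  vq = nadj-sym (Y.nbr-on kv nvQ)
  v≢p : v ≢ p
  v≢p refl = nv i1
  v≢q : v ≢ q
  v≢q refl = nvQ i1

  off : ∀ {x c} → κ x ≡ fs c → x ∉ p ∷ P'
  off h m = Fin.0≢1+n (sym (lz L m) ⨾ h)
  offQ : ∀ {x c} → κ x ≡ fs c → x ∉ q ∷ Q'
  offQ h m = Fin.0≢1+n (sym (lz L' m) ⨾ h)

  -- One end has two neighbours on the path. This is what is needed to close the path to a chorded
  -- cycle through a common neighbour of both ends.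
  Flag : Set
  Flag = 2 ≤ cntL (e p) P' ⊎ 2 ≤ cntL (e q) Q'

  R' = fst (pull κ kv)
  pR = snd (pull κ kv)

  flagCC : Flag → ∀ {x c} → κ x ≡ fs c → p ~ x → q ~ x → Σ[ C ∈ CC ] (∀ {a} → a ∈ vs C → a ≢ v × (a ≡ x ⊎ κ a ≡ fz))
  flagCC (inj₁ h) kx px qx with X.closeCC h px qx (off kx)
  ... | C , hC = C , λ m → g (hC m)
   where g : ∀ {a} → a ∈ p ∷ P' ⊎ a ≡ _ → a ≢ v × (a ≡ _ ⊎ κ a ≡ fz)
         g (inj₁ r) = (λ { refl → nv r }) , inj₂ (lz L r)
         g (inj₂ refl) = (λ { refl → Fin.0≢1+n (sym kv ⨾ kx) }) , inj₁ refl
  flagCC (inj₂ h) kx px qx with Y.closeCC h qx px (offQ kx)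
  ... | C , hC = C , λ m → g (hC m)
   where g : ∀ {a} → a ∈ q ∷ Q' ⊎ a ≡ _ → a ≢ v × (a ≡ _ ⊎ κ a ≡ fz)
         g (inj₁ r) = (λ { refl → nvQ r }) , inj₂ (lz L' r)
         g (inj₂ refl) = (λ { refl → Fin.0≢1+n (sym kv ⨾ kx) }) , inj₁ refl

  module _ {c : Fin k'} {x y z w : V} (t : Tet κ c x y z w) where
   kx : κ x ≡ fs c
   kx = l⇒ (Tet.tl4 t) i1
   v≢x : v ≢ x
   v≢x refl = Fin.0≢1+n (sym kv ⨾ kx)

   F1 : e v y ∧ e v z ∧ e v w ∧ e p x ≡ true → ⊥
   F1 h with ∧4 _ _ _ _ h
   ... | vy , vz , vw , px = X.prolong₀ (fst (tet-exch o t pR vy vz vw)) pR px nv (off kx)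

   F2 : e v y ∧ e v z ∧ e v w ∧ e q x ≡ true → ⊥
   F2 h with ∧4 _ _ _ _ h
   ... | vy , vz , vw , qx = Y.prolong₀ (fst (tet-exch o t pR vy vz vw)) pR qx nvQ (offQ kx)

   F4 : (e p y ∧ e p z ∧ e p w) ∧ e q x ∧ e v x ≡ true → ⊥
   F4 h with ∧3 (e p y) (e p z) (e p w) (∧-l h) | ∧2 (e q x) (e v x) (∧-r {e p y ∧ e p z ∧ e p w} h)
   ... | py , pz , pw | qx , vx' = X.prolong (fst (tet-exch o t (snd pp) py pz pw)) (snd pp) qx (adj-sym vx') kv nv (off kx) v≢x
    where pp = pull κ (lz L i1)

   F3 : Flag → le? 2 (sumB (e v y ∷ e v z ∷ e v w ∷ [])) ∧ e p x ∧ e q x ≡ true → ⊥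
   F3 fl h with ∧3 (le? 2 (sumB (e v y ∷ e v z ∷ e v w ∷ []))) (e p x) (e q x) h
   ... | v2 , px , qx with flagCC fl kx px qx
   ... | C , hC = tet-two o t kv (le?-sound 2 (sumB (e v y ∷ e v z ∷ e v w ∷ [])) v2) C hC

  bits : V → V → V → V → Vec Bool 12
  bits x y z w = e v x ∷ e v y ∷ e v z ∷ e v w ∷ e p x ∷ e p y ∷ e p z ∷ e p w ∷ e q x ∷ e q y ∷ e q z ∷ e q w ∷ []

  f : Fin k' → ℕ
  f c = (D κ v c + D κ p c) + (D κ v c + D κ q c)

  module _ {c : Fin k'} {x y z w : V} (t : Tet κ c x y z w) where
   f≡ : f c ≡ wt (bits x y z w)
   f≡ rewrite tet-D t v | tet-D t p | tet-D t q = refl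

   one1 : ∀ {x y z w} → Tet κ c x y z w → c1 (e v x) (e v y) (e v z) (e v w) (e p x) (e p y) (e p z) (e p w) (e q x) (e q y) (e q z) (e q w) ≡ true
   one1 t = ∧-i (nots (F1 t)) (∧-i (nots (F2 t)) (nots (F4 t)))
   one2 : Flag → ∀ {x y z w} → Tet κ c x y z w → c2 (e v x) (e v y) (e v z) (e v w) (e p x) (e p y) (e p z) (e p w) (e q x) (e q y) (e q z) (e q w) ≡ true
   one2 fl t = nots (F3 t fl)
   t' = trot t
   t'' = trot t'
   t''' = trot t''
   h1 : hyp1 (bits x y z w) ≡ true
   h1 = ∧-i (one1 t) (∧-i (one1 t') (∧-i (one1 t'') (one1 t''')))
   h2 : Flag → hyp2 (bits x y z w) ≡ true
   h2 fl = ∧-i (one2 fl t) (∧-i (one2 fl t') (∧-i (one2 fl t'') (one2 fl t''')))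

   f12 : f c ≤ 12
   f12 = ≤-trans (≡⇒≤ f≡) (wt12 (bits x y z w) h1)

   f11 : Flag → f c ≤ 11
   f11 fl = ≤-trans (≡⇒≤ f≡) (wt11 (bits x y z w) h1 (h2 fl))

  kp : κ p ≡ fz
  kp = lz L i1
  kq : κ q ≡ fz
  kq = lz L' i1

  f≤12 : ∀ c → f c ≤ 12
  f≤12 c with isTet o c
  ... | inj₁ (_ , _ , _ , _ , t) = f12 t
  ... | inj₂ le = +-mono-≤ (+-mono-≤ (le kv) (le kp)) (+-mono-≤ (le kv) (le kq))

  main : (6 * k' + 4) + (6 * k' + 4) ≤ ((dR κ v + dR κ p) + (dR κ v + dR κ q)) + ΣF f
  main = ≤-trans (+-mono-≤ (PI κ v≢p vp) (PI κ v≢q vq)) (≡⇒≤ (+-inter (dR κ v + dR κ p) _ (dR κ v + dR κ q) _ ⨾ cong ((dR κ v + dR κ p) + (dR κ v + dR κ q) +_) (sym (ΣF-+ (λ c → D κ v c + D κ p c) (λ c → D κ v c + D κ q c)))))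

  dec : Flag ⊎ (cntL (e p) P' ≤ 1 × cntL (e q) Q' ≤ 1)
  dec with 2 ≤? cntL (e p) P' | 2 ≤? cntL (e q) Q'
  ... | yes h | _ = inj₁ (inj₁ h)
  ... | no _ | yes h = inj₁ (inj₂ h)
  ... | no a | no b = inj₂ (≤-pred (≰⇒> a) , ≤-pred (≰⇒> b))

  -- Otherwise both ends have degree at most 1 in R, and the two pairs find only 6 edge ends there
  -- instead of 8.
  flag : Flag
  flag with dec
  ... | inj₁ fl = fl
  ... | inj₂ (a , b) = ⊥-elim (arithA 6 ≤-refl k' _ _ main (+-mono-≤ (+-mono-≤ dv (≤-trans X.dR≤ a)) (+-mono-≤ dv (≤-trans Y.dR≤ b))) (ΣF-upper f≤12))

  sumR≤8 : (dR κ v + dR κ p) + (dR κ v + dR κ q) ≤ 8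
  sumR≤8 = +-mono-≤ (+-mono-≤ dv X.dR≤2) (+-mono-≤ dv Y.dR≤2)

  -- A K₄ contributes at most 11, while every class must contribute 12.
  notK4 : NotK4 κ
  notK4 c t = arithB k' _ _ main sumR≤8 (ΣF-strict f≤12 c (≤-trans (≡⇒≤ (+-comm (f c) 1)) (s≤s (f11 t flag))))

  bothTight : ((dR κ v + dR κ p) + (dR κ v + dR κ q)) ≡ 8 × ΣF f ≡ 12 * k'
  bothTight = arithC k' _ _ main sumR≤8 (ΣF-upper f≤12)

  dR2 : dR κ v ≡ 2 × dR κ p ≡ 2 × dR κ q ≡ 2
  dR2 = tight3 dv X.dR≤2 Y.dR≤2 (fst bothTight)

  l3 : ∀ c {u} → κ u ≡ fz → D κ u c ≤ 3
  l3 c = D≤3 o c (notK4 c)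

  D3 : ∀ c → D κ v c ≡ 3 × D κ p c ≡ 3 × D κ q c ≡ 3
  D3 c = tight3 (l3 c kv) (l3 c kp) (l3 c kq) (ΣF-tight f≤12 (≡⇒≤ (sym (snd bothTight))) c)

  pc2 : 2 ≤ cntL (e p) P'
  pc2 = ≤-trans (≡⇒≤ (sym (fst (snd dR2)))) X.dR≤

  Vtx4 : V → V → V → V → V → Set
  Vtx4 u α β γ δ = u ~ α × u ~ γ × ((u ~ β × u ≁ δ) ⊎ (u ≁ β × u ~ δ))

  triCC : ∀ {β γ δ} (u4 : Unique (β ∷ γ ∷ δ ∷ v ∷ [])) → β ~ γ → γ ~ δ → β ~ δ → v ~ γ → v ~ β ⊎ v ~ δ →
   Σ[ C ∈ CC ] (∀ {a} → a ∈ vs C → a ∈ β ∷ γ ∷ δ ∷ v ∷ [])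
  triCC {β} {γ} {δ} u4 bg gd bd vγ (inj₁ vβ) = CC! (vx β) (vx γ ∷ vx δ ∷ vx v ∷ []) u4 (0 - 1 ! bg ∷ 1 - 2 ! gd ∷ 0 - 2 ! bd ∷ 3 - 1 ! vγ ∷ 3 - 0 ! vβ ∷ [])
   1 (fw 3 ∷ fw 0 ∷ fw 2 ∷ []) refl
  triCC {β} {γ} {δ} u4 bg gd bd vγ (inj₂ vδ) = CC! (vx β) (vx γ ∷ vx δ ∷ vx v ∷ []) u4 (0 - 1 ! bg ∷ 1 - 2 ! gd ∷ 0 - 2 ! bd ∷ 3 - 1 ! vγ ∷ 3 - 2 ! vδ ∷ [])
   1 (fw 3 ∷ fw 2 ∷ fw 0 ∷ []) refl

  -- One chorded cycle consists of the path and the common neighbour `x` of its ends; `v` takes the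
  -- place of `x` in the class and gives the other.
  flag-two : ∀ {x c C'} → Lst κ (fs c) (x ∷ C') → p ~ x → q ~ x → Σ[ C ∈ CC ] (∀ {a} → a ∈ vs C → a ∈ C' ++ v ∷ []) → ⊥
  flag-two {x} {c} {C'} l px qx (C₂ , h₂) = two (cfg o) c (fst C₁) C₂ (λ m → f1 (snd (snd C₁ m))) (λ m → mixI {κ} l (in1 {κ} kv) (there (h₂ m))) (λ a b → dj (snd C₁ a) (h₂ b))
   where
   C₁ : Σ[ C ∈ CC ] (∀ {a} → a ∈ vs C → a ≢ v × (a ≡ x ⊎ κ a ≡ fz))
   C₁ = flagCC flag (l⇒ l i1) px qx
   f1 : ∀ {a} → a ≡ x ⊎ κ a ≡ fz → In κ c a
   f1 (inj₁ refl) = inj₂ (l⇒ l i1)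
   f1 (inj₂ r) = inj₁ r
   dj : ∀ {a} → a ≢ v × (a ≡ x ⊎ κ a ≡ fz) → a ∈ C' ++ v ∷ [] → ⊥
   dj (_ , inj₁ refl) m = U∉ (mixU l uq1 (in1 {κ} kv)) m
   dj (ne , inj₂ r) m = [ (λ s → Fin.0≢1+n (sym r ⨾ l⇒ l (there s))) , (λ { (here s) → ne s }) ]′ (∈-++⁻ C' m)

  no4m : ∀ c {α β γ δ} → Lst κ (fs c) (α ∷ β ∷ γ ∷ δ ∷ []) → α ~ β → β ~ γ → γ ~ δ → δ ~ α → β ~ δ → α ≁ γ → ⊥
  no4m c {α} {β} {γ} {δ} l ab bg gd da bd ag = flag-two l (fst (P kp (fst (snd (D3 c))))) (fst (P kq (snd (snd (D3 c)))))
   (triCC (U-++ʳ (α ∷ []) (mixU l uq1 (in1 {κ} kv))) bg gd bd (fst (snd Pv)) ([ inj₁ ∘ fst , inj₂ ∘ snd ]′ (snd (snd Pv))))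
   where
   P : ∀ {u} → κ u ≡ fz → D κ u c ≡ 3 → Vtx4 u α β γ δ
   P = K4m.pat o c l ab bg gd da bd ag
   Pv : Vtx4 v α β γ δ
   Pv = P kv (fst (D3 c))

  has33 : ∀ c → Σ[ q₃ ∈ K33 κ c ] SideA q₃ v
  has33 c = go (kind o c)
   where
   dv3 : D κ v c ≡ 3
   dv3 = fst (D3 c)
   pick : (q₃ : K33 κ c) → SideA q₃ v ⊎ SideB q₃ v → Σ[ q₃ ∈ K33 κ c ] SideA q₃ v
   pick q₃ (inj₁ s) = q₃ , s
   pick q₃ (inj₂ s) = flip33 q₃ , s
   go : Kind κ c → Σ[ q₃ ∈ K33 κ c ] SideA q₃ v
   go (k4 l a b f g h i) = ⊥-elim (notK4 c (tet l a b f g h i))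
   go (k4m l ab bg gd da bd ag) = ⊥-elim (no4m c l ab bg gd da bd ag)
   go (k5 l a b f g h i) = ⊥-elim (K5.one-tight o c l a b f g h i v≢p kv kp dv3 (fst (snd (D3 c))))
   go (big _ _ mk) = pick (mk kv dv3) (side o (mk kv dv3) kv dv3)

  -- If both ends were on the other side, b₁ would be a common neighbour of them and `v` could
  -- replace it in the class. If only one end were there, exchanging that end for a₁ would give a
  -- longer path that continues from the other end through a₁ to `v`.
  sides : ∀ {c} (q₃ : K33 κ c) → SideA q₃ v → SideA q₃ p × SideA q₃ q
  sides {c} q₃ sv = go (side o q₃ kp (fst (snd (D3 c)))) (side o q₃ kq (snd (snd (D3 c))))
   where
   ka : κ (K33.a₁ q₃) ≡ fs c
   ka = l⇒ (K33.l33 q₃) i1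
   v≢a : v ≢ K33.a₁ q₃
   v≢a h = Fin.0≢1+n (sym kv ⨾ (cong κ h ⨾ ka))
   bothB : SideB q₃ p → SideB q₃ q → ⊥
   bothB (sp , _) (sq , _) = flag-two lb (sp i1) (sq i1) DD
    where
    open K33 q₃
    lb : Lst κ (fs c) (b₁ ∷ a₁ ∷ a₂ ∷ a₃ ∷ b₂ ∷ b₃ ∷ [])
    lb = L-perm (Perm.shift b₁ (a₁ ∷ a₂ ∷ a₃ ∷ []) (b₂ ∷ b₃ ∷ [])) l33
    DD : Σ[ C ∈ CC ] (∀ {x} → x ∈ vs C → x ∈ a₁ ∷ a₂ ∷ a₃ ∷ b₂ ∷ b₃ ∷ v ∷ [])
    DD = CC! (vx a₁) (vx a₂ ∷ vx a₃ ∷ vx b₂ ∷ vx b₃ ∷ vx v ∷ []) (U-++ʳ (b₁ ∷ []) (mixU lb uq1 (in1 {κ} kv)))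
     (5 - 0 ! fst sv i1 ∷ 5 - 1 ! fst sv i2 ∷ (hd 5 , hd 2 , fst sv i3) ∷
     0 - 3 ! a33 i1 i2 ∷ 1 - 3 ! a33 i2 i2 ∷
     (hd 1 , hd 4 , a33 i2 i3) ∷ (hd 2 , hd 4 , a33 i3 i3) ∷ [])
     5 (fw 0 ∷ fw 3 ∷ fw 1 ∷ fw 4 ∷ fw 2 ∷ []) refl
   AB : SideA q₃ p → SideB q₃ q → ⊥
   AB sp sq = Y.prolong (fst (exch33 o (flip33 q₃) (snd (pull κ kq)) sq)) (snd (pull κ kq)) (fst sp i1) (adj-sym (fst sv i1)) kv nvQ (offQ ka) v≢a
   BA : SideB q₃ p → SideA q₃ q → ⊥
   BA sp sq = X.prolong (fst (exch33 o (flip33 q₃) (snd (pull κ kp)) sp)) (snd (pull κ kp)) (fst sq i1) (adj-sym (fst sv i1)) kv nv (off ka) v≢a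
   go : SideA q₃ p ⊎ SideB q₃ p → SideA q₃ q ⊎ SideB q₃ q → SideA q₃ p × SideA q₃ q
   go (inj₁ sp) (inj₁ sq) = sp , sq
   go (inj₁ sp) (inj₂ sq) = ⊥-elim (AB sp sq)
   go (inj₂ sp) (inj₁ sq) = ⊥-elim (BA sp sq)
   go (inj₂ sp) (inj₂ sq) = ⊥-elim (bothB sp sq)

 -- Paths with two closed ends: barbells and thetas

 w-split : ∀ {a b x l y m} → Walk a ((x ∷ l) ++ y ∷ m) b → Σ[ c ∈ V ] (Walk a (x ∷ l) c × c ~ y × Walk y (y ∷ m) b)
 w-split {x = x} {l} w = fst p , fst (snd p) , snd (snd p) , w-suffix (x ∷ l) w
  where p = w-prefix x l w

 w-long : ∀ {a l b} → Walk a (a ∷ l) b → a ≢ b → Σ[ a' ∈ V ] (a ~ a' × Walk a' l b)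
 w-long one ne = ⊥-elim (ne refl)
 w-long (g ∷ w) ne = _ , g , w

 -- Two cycles joined by the path `N'`: the first part of the path closes up at `n1`, the last part
 -- at `n2`. The cycles share a vertex if `N'` is a single vertex.
 record Barbell (P : List V) : Set where
  constructor mkBar
  field
   {l1 l2 n1 n2 m1 m2 l' m'} : V
   {L N' Mz} : List V
   l1l' : l1 ~ l'
   wL : Walk l' L l2
   wN : Walk n1 N' n2
   m1m' : m1 ~ m'
   wM : Walk m' Mz m2
   P≡ : P ≡ (l1 ∷ L) ++ N' ++ (m1 ∷ Mz)
   l2n1 : l2 ~ n1
   l1n1 : l1 ~ n1
   n2m1 : n2 ~ m1
   n2m2 : n2 ~ m2

 -- Three disjoint nonempty arms between the branch vertices. Only a permutation ties it to `P`, so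
 -- that the arms can be rotated and reversed.
 record Theta (P : List V) : Set where
  constructor mkTheta
  field
   {β₁ β₂ x1 x1' x2 x2' x3 x3'} : V
   {X1 X2 X3} : List V
   w1 : Walk x1 X1 x1'
   w2 : Walk x2 X2 x2'
   w3 : Walk x3 X3 x3'
   β1 : β₁ ~ x1
   β2 : β₁ ~ x2
   β3 : β₁ ~ x3
   b1β : x1' ~ β₂
   b2β : x2' ~ β₂
   b3β : x3' ~ β₂
   P↭ : X1 ++ β₁ ∷ X2 ++ β₂ ∷ X3 ↭ P

 th-rot : ∀ {P} → Theta P → Theta P
 th-rot (mkTheta {β₁} {β₂} {X1 = X1} {X2} {X3} w1 w2 w3 a b c d f g h) = mkTheta w2 w3 w1 b c a f g d (↭-trans perm h)
  where
  perm : X2 ++ β₁ ∷ X3 ++ β₂ ∷ X1 ↭ X1 ++ β₁ ∷ X2 ++ β₂ ∷ X3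
  perm = ↭-trans (Perm.shift β₁ X2 _) (↭-trans (prep β₁ (↭-trans (Perm.++⁺ˡ X2 (Perm.++-comm X3 (β₂ ∷ X1))) (↭-trans (Perm.++⁺ˡ X2 (prep β₂ (Perm.++-comm X1 X3)))
   (↭-trans (↭-reflexive' (sym (++-assoc X2 (β₂ ∷ X3) X1))) (Perm.++-comm (X2 ++ β₂ ∷ X3) X1))))) (↭-sym (Perm.shift β₁ X1 _)))
   where ↭-reflexive' : ∀ {l m : List V} → l ≡ m → l ↭ m
         ↭-reflexive' refl = refl

 th-flip : ∀ {P} → Theta P → Theta P
 th-flip (mkTheta {β₁} {β₂} {X1 = X1} {X2} {X3} w1 w2 w3 a b c d f g h) =
  mkTheta (w-rev w1) (w-rev w2) (w-rev w3) (adj-sym d) (adj-sym f) (adj-sym g) (adj-sym a) (adj-sym b) (adj-sym c) (↭-trans perm h)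
  where
  perm : reverse X1 ++ β₂ ∷ reverse X2 ++ β₁ ∷ reverse X3 ↭ X1 ++ β₁ ∷ X2 ++ β₂ ∷ X3
  perm = Perm.++⁺ (Perm.↭-reverse X1) (↭-trans (prep β₂ (Perm.++⁺ (Perm.↭-reverse X2) (prep β₁ (Perm.↭-reverse X3))))
   (↭-trans (prep β₂ (Perm.shift β₁ X2 X3)) (↭-trans (swap β₂ β₁ refl) (prep β₁ (↭-sym (Perm.shift β₂ X2 X3))))))

 th-swap : ∀ {P} → Theta P → Theta P
 th-swap (mkTheta {β₁} {β₂} {X1 = X1} {X2} {X3} w1 w2 w3 a b c d f g h) = mkTheta w3 w2 w1 c b a g f d (↭-trans perm h)
  where
  perm : X3 ++ β₁ ∷ X2 ++ β₂ ∷ X1 ↭ X1 ++ β₁ ∷ X2 ++ β₂ ∷ X3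
  perm = ↭-trans (Perm.shift β₁ X3 _) (↭-trans (prep β₁ (↭-trans (Perm.++-comm X3 (X2 ++ β₂ ∷ X1)) (↭-trans (Perm.++⁺ʳ X3 (↭-trans (Perm.shift β₂ X2 X1) (prep β₂ (Perm.++-comm X2 X1)))) (step)))) (↭-sym (Perm.shift β₁ X1 _)))
   where
   re : ∀ {l m : List V} → l ≡ m → l ↭ m
   re refl = refl
   step : (β₂ ∷ X1 ++ X2) ++ X3 ↭ X1 ++ X2 ++ β₂ ∷ X3
   step = ↭-trans (prep β₂ (re (++-assoc X1 X2 X3))) (↭-trans (↭-sym (Perm.shift β₂ X1 (X2 ++ X3))) (Perm.++⁺ˡ X1 (↭-sym (Perm.shift β₂ X2 X3))))

 -- Leaving out x1'β₂ and β₁x3 makes the theta a path with ends x1' and x3; rotating the theta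
 -- yields the same for the other arms, so all arm ends are ends of paths spanning `P`.
 th-path : ∀ {P} (θ : Theta P) → let open Theta θ in Walk x1' (reverse X1 ++ β₁ ∷ X2 ++ β₂ ∷ reverse X3) x3 × (reverse X1 ++ β₁ ∷ X2 ++ β₂ ∷ reverse X3 ↭ P)
 th-path (mkTheta {β₁} {β₂} {X1 = X1} {X2} {X3} w1 w2 w3 a b c d f g h) =
  w-join (w-rev w1) (adj-sym a) (b ∷ w-join w2 f (adj-sym g ∷ w-rev w3)) ,
  ↭-trans (Perm.++⁺ (Perm.↭-reverse X1) (prep β₁ (Perm.++⁺ˡ X2 (prep β₂ (Perm.↭-reverse X3))))) h

 data Shape (P : List V) : Set where
  bar : Barbell P → Shape P
  the : Theta P → Shape P

 module _ {κ : V → K} (cf : Config κ) {p P' q} (w : Walk p (p ∷ P') q) (u : Unique (p ∷ P')) (z : ∀ {x} → x ∈ p ∷ P' → κ x ≡ fz) where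

  private P = p ∷ P'

  second : p ≁ q → 2 ≤ cntL (e p) P' → Σ[ p' ∈ V ] Σ[ X ∈ List V ] Σ[ y ∈ V ] Σ[ y' ∈ V ] Σ[ Y ∈ List V ]
   (P ≡ (p ∷ p' ∷ X) ++ y ∷ y' ∷ Y × p ~ y)
  second pq h = go P' refl w h
   where
   go : ∀ P'' → P'' ≡ P' → Walk p (p ∷ P'') q → 2 ≤ cntL (e p) P'' → Σ[ p' ∈ V ] Σ[ X ∈ List V ] Σ[ y ∈ V ] Σ[ y' ∈ V ] Σ[ Y ∈ List V ]
    (p ∷ P'' ≡ (p ∷ p' ∷ X) ++ y ∷ y' ∷ Y × p ~ y)
   go (p' ∷ R) q' w h with cntL-first (e p) R (≤-pred (≤-trans h (+-monoˡ-≤ _ (b2n≤1 (e p p')))))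
   ... | X , y , y' ∷ Y , refl , py , _ = p' , X , y , y' , Y , refl , py
   ... | X , y , [] , refl , py , _ = ⊥-elim (true≢false (sym py ⨾ subst (λ t → p ≁ t) (w-lst≡ (p ∷ p' ∷ X) w) pq))

  module _ {Q'} (w' : Walk q (q ∷ Q') p) (rv : reverse (p ∷ P') ≡ q ∷ Q') where

   -- The neighbour `y` of `p` beyond its successor is compared with the corresponding neighbour `j`
   -- of `q`. If `y` comes before `j` or equals it, the path is a barbell. If `j` comes first, `j`
   -- and `y` are the branch vertices of a theta; were they consecutive, the path would carry a
   -- chorded cycle.
   shape : p ≁ q → 2 ≤ cntL (e p) P' → 2 ≤ cntL (e q) Q' → Shape P
   shape pq hp hq = go1 (second pq hp)
    where
    secondq : Σ[ q' ∈ V ] Σ[ Z ∈ List V ] Σ[ y ∈ V ] Σ[ y' ∈ V ] Σ[ W ∈ List V ] (q ∷ Q' ≡ (q ∷ q' ∷ Z) ++ y ∷ y' ∷ W × q ~ y)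
    secondq = go Q' w' hq
     where
     go : ∀ Q'' → Walk q (q ∷ Q'') p → 2 ≤ cntL (e q) Q'' → Σ[ q' ∈ V ] Σ[ Z ∈ List V ] Σ[ y ∈ V ] Σ[ y' ∈ V ] Σ[ W ∈ List V ]
      (q ∷ Q'' ≡ (q ∷ q' ∷ Z) ++ y ∷ y' ∷ W × q ~ y)
     go (q' ∷ R) w h with cntL-first (e q) R (≤-pred (≤-trans h (+-monoˡ-≤ _ (b2n≤1 (e q q')))))
     ... | Z , y , y' ∷ W , refl , qy , _ = q' , Z , y , y' , W , refl , qy
     ... | Z , y , [] , refl , qy , _ = ⊥-elim (true≢false (sym qy ⨾ subst (λ t → q ≁ t) (w-lst≡ (q ∷ q' ∷ Z) w) (nadj-sym pq)))
    go1 : (Σ[ p' ∈ V ] Σ[ X ∈ List V ] Σ[ y ∈ V ] Σ[ y' ∈ V ] Σ[ Y ∈ List V ] (P ≡ (p ∷ p' ∷ X) ++ y ∷ y' ∷ Y × p ~ y)) → Shape P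
    go1 (p' , X , y , y' , Y , eq , py) = go2 secondq
     where
     go2 : (Σ[ q' ∈ V ] Σ[ Z ∈ List V ] Σ[ j ∈ V ] Σ[ j' ∈ V ] Σ[ W ∈ List V ] (q ∷ Q' ≡ (q ∷ q' ∷ Z) ++ j ∷ j' ∷ W × q ~ j)) → Shape P
     go2 (q' , Z , j , j' , W , eq' , qj) = go3 (split-cmp (p ∷ p' ∷ X) (sym eq ⨾ Pq))
      where
      Wr = reverse (j' ∷ W)
      Zr = reverse Z
      Pq : P ≡ Wr ++ j ∷ Zr ++ q' ∷ q ∷ []
      Pq = sym (reverse-involutive P) ⨾ cong reverse (rv ⨾ eq') ⨾ reverse-++ (q ∷ q' ∷ Z) (j ∷ j' ∷ W) ⨾
       cong₂ _++_ (unfold-reverse j (j' ∷ W)) (reverse-++ (q ∷ q' ∷ []) Z) ⨾ ++-assoc Wr (j ∷ []) _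
      wP : ∀ {X} → P ≡ X → Walk p X q
      wP r = subst (λ t → Walk p t q) r w
      tailM : ∀ {a} Zr → Walk a (Zr ++ q' ∷ q ∷ []) q → Σ[ m1 ∈ V ] Σ[ m' ∈ V ] Σ[ M ∈ List V ] (Zr ++ q' ∷ q ∷ [] ≡ m1 ∷ M × m1 ~ m' × Walk m' M q × a ≡ m1)
      tailM [] (g ∷ w) = q' , _ , _ , refl , g , w , refl
      tailM (m ∷ []) (g ∷ w) = m , _ , _ , refl , g , w , refl
      tailM (m ∷ m' ∷ Zr) (g ∷ w) = m , _ , _ , refl , g , w , refl
      mkB : ∀ {n1 N n2 l2 a} Zr → Walk p (p ∷ p' ∷ X) l2 → l2 ~ n1 → p ~ n1 → Walk n1 N n2 → n2 ~ a → n2 ~ q → Walk a (Zr ++ q' ∷ q ∷ []) q →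
       P ≡ (p ∷ p' ∷ X) ++ N ++ (Zr ++ q' ∷ q ∷ []) → Shape P
      mkB {N = N₀} Zr (g ∷ wl) ln pn wN na nq wz eqP with tailM Zr wz
      ... | m1 , m' , M , eqM , mm , wM , refl = bar (mkBar g wl wN mm wM (eqP ⨾ cong (λ t → (p ∷ p' ∷ X) ++ N₀ ++ t) eqM) ln pn na nq)
      nonempty : ∀ (Zr : List V) → Σ[ s ∈ V ] Σ[ S ∈ List V ] Zr ++ q' ∷ q ∷ [] ≡ s ∷ S
      nonempty [] = q' , _ , refl
      nonempty (m ∷ _) = m , _ , refl
      go3 : (Σ[ s ∈ List V ] (p ∷ p' ∷ X ≡ Wr ++ j ∷ s × Zr ++ q' ∷ q ∷ [] ≡ s ++ y ∷ y' ∷ Y)) ⊎ ((p ∷ p' ∷ X ≡ Wr × y ≡ j × y' ∷ Y ≡ Zr ++ q' ∷ q ∷ []) ⊎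
       (Σ[ s ∈ List V ] (Wr ≡ (p ∷ p' ∷ X) ++ y ∷ s × y' ∷ Y ≡ s ++ j ∷ Zr ++ q' ∷ q ∷ []))) → Shape P
      go3 (inj₂ (inj₁ (_ , refl , eY))) with w-split {x = p} {p' ∷ X} (wP eq)
      ... | l2 , wL , ly , wy with subst (λ t → Walk y (y ∷ t) q) eY wy
      ... | wy' with nonempty Zr
      ... | s , S , eS with w-2nd (subst (λ t → Walk y (y ∷ t) q) eS wy')
      ... | ys , wS = mkB Zr wL ly py one ys (adj-sym qj) (subst (λ t → Walk s t q) (sym eS) wS) (eq ⨾ cong (λ t → (p ∷ p' ∷ X) ++ y ∷ t) eY)
      go3 (inj₂ (inj₂ (s , _ , eY))) with w-split {x = p} {p' ∷ X} (wP eq)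
      ... | l2 , wL , ly , wy with subst (λ t → Walk y (y ∷ t) q) (eY ⨾ sym (++-assoc s (j ∷ []) _)) wy
      ... | wy' with nonempty Zr
      ... | m , S , eS with w-split {x = y} {s ++ j ∷ []} (subst (λ t → Walk y (y ∷ (s ++ j ∷ []) ++ t) q) eS wy')
      ... | n2 , wN , nm , wS with w-lst≡ (y ∷ s) wN
      ... | refl = mkB Zr wL ly py wN nm (adj-sym qj) (subst (λ t → Walk m t q) (sym eS) wS) (eq ⨾ cong (λ t → (p ∷ p' ∷ X) ++ y ∷ t) (eY ⨾ sym (++-assoc s (j ∷ []) _)))
      go3 (inj₁ (s , eX , eZ)) = thet Wr (reverse-ne j' W) s eX
       where
       reverse-ne : ∀ (x : V) l → reverse (x ∷ l) ≢ []
       reverse-ne x l h with cong length h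
       ... | r with sym (length-reverse (x ∷ l)) ⨾ r
       ... | ()
       thet : ∀ Wr' → Wr' ≢ [] → ∀ s → p ∷ p' ∷ X ≡ Wr' ++ j ∷ s → Shape P
       thet [] ne s eX = ⊥-elim (ne refl)
       thet (x ∷ W') ne s eX with w-split {x = x} {W'} {y = j} {m = s ++ y ∷ y' ∷ Y} (subst (λ t → Walk p t q) (eq ⨾ cong (_++ y ∷ y' ∷ Y) eX ⨾ ++-assoc (x ∷ W') (j ∷ s) _) w)
       thet (x ∷ W') ne [] eX | u1 , w1 , uj , wj with w-2nd wj
       ... | jy , wy with w-2nd wy
       ... | yy' , wy' = ⊥-elim (noCC₀ cf (fst C) (λ m → z (cast∈ (sym eqP) (snd C m))))
        where
        eqP : P ≡ (x ∷ W') ++ j ∷ y ∷ y' ∷ Y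
        eqP = eq ⨾ cong (_++ y ∷ y' ∷ Y) eX ⨾ ++-assoc (x ∷ W') (j ∷ []) _
        C = Layout.Facts.one-CC (seg w1) (vx j ∷ vx y ∷ seg wy' ∷ []) (subst Unique eqP u)
         ((tl 0 , hd 1 , uj) ∷ 1 - 2 ! jy ∷ 2 - 3 ! yy' ∷ 0 - 2 ! py ∷ (tl 3 , hd 1 , qj) ∷ [])
         1 (bw 0 ∷ fw 2 ∷ fw 3 ∷ []) refl
       thet (x ∷ W') ne (s ∷ S) eX | u1 , w1 , uj , wj with w-2nd wj
       ... | js , ws with w-split {x = s} {S} ws
       ... | s' , wS , sy , wy with w-2nd wy
       ... | yy' , wy' = the (mkTheta (w-rev w1) wS (w-rev wy') (adj-sym uj) js (adj-sym qj) py sy (adj-sym yy')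
        (↭-trans (Perm.++⁺ (Perm.↭-reverse (x ∷ W')) (prep j (Perm.++⁺ˡ (s ∷ S) (prep y (Perm.↭-reverse (y' ∷ Y)))))) (re (sym eqP))))
        where
        re : ∀ {l m : List V} → l ≡ m → l ↭ m
        re refl = refl
        eqP : P ≡ (x ∷ W') ++ j ∷ (s ∷ S) ++ y ∷ y' ∷ Y
        eqP = eq ⨾ cong (_++ y ∷ y' ∷ Y) eX ⨾ ++-assoc (x ∷ W') (j ∷ s ∷ S) _

 -- Two chorded cycles from K₃,₃ and an attached path

 -- C = K₃,₃ with sides A, B, and T is a path off P from a vertex w completely joined to A.
 -- CC₁ uses a₂, a₃, b₂ and a path of R with two ends joined to A; CC₂ uses a₁ and a path with three neighbours of a₁.
 module BT {κ : V → K} (o : Opt κ) {c : Fin k'} (q₃ : K33 κ c) {T : List V} {w t : V} (wT : Walk w T t)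
  (wA : ∀ {a} → a ∈ K33.A q₃ → w ~ a) {P : List V}
  (UU : Unique (K33.a₁ q₃ ∷ K33.a₂ q₃ ∷ K33.a₃ q₃ ∷ K33.b₂ q₃ ∷ T ++ P))
  (IT : ∀ {y} → y ∈ T → In κ c y) (IP : ∀ {y} → y ∈ P → κ y ≡ fz) where

  open K33 q₃

  Tg : V → Set
  Tg s = ∀ {a} → a ∈ K33.A q₃ → s ~ a


  Lay : List V → Set
  Lay X = Unique (a₁ ∷ a₂ ∷ a₃ ∷ b₂ ∷ T ++ X) × (∀ {y} → y ∈ X → y ∈ P)

  lay : ∀ {X P'} → X ⊑ P' → P' ↭ P → Lay X
  lay h k = ⊑-U (⊑-pre (a₁ ∷ a₂ ∷ a₃ ∷ b₂ ∷ T) h) (U-↭ (prep a₁ (prep a₂ (prep a₃ (prep b₂ (Perm.++⁺ˡ T (↭-sym k)))))) UU) , λ m → Perm.∈-resp-↭ k (⊑-∈ h m)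

  I : ∀ {X} → Lay X → ∀ {y} → y ∈ a₁ ∷ a₂ ∷ a₃ ∷ b₂ ∷ T ++ X → In κ c y
  I {X} ly m = go (∈-++⁻ (a₁ ∷ a₂ ∷ a₃ ∷ b₂ ∷ T) m)
   where
   go : ∀ {y} → y ∈ a₁ ∷ a₂ ∷ a₃ ∷ b₂ ∷ T ⊎ y ∈ X → In κ c y
   go (inj₁ i1) = inj₂ (l⇒ l33 i1)
   go (inj₁ i2) = inj₂ (l⇒ l33 i2)
   go (inj₁ i3) = inj₂ (l⇒ l33 i3)
   go (inj₁ i4) = inj₂ (l⇒ l33 i5)
   go (inj₁ (there (there (there (there r))))) = IT r
   go (inj₂ r) = inj₁ (IP (snd ly r))

  kill! : ∀ pc pcs (ly : Lay (flat (pc ∷ pcs))) →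
   let ss = vx a₂ ∷ vx a₃ ∷ vx b₂ ∷ seg wT ∷ pc ∷ pcs in
   (fa : List (Layout.Fact (vx a₁) ss (fst ly))) → ∀ l l' →
   (let open Layout.Facts (vx a₁) ss (fst ly) fa in okCC 1 l ∧ okCC 0 l' ∧ distinct (is 1 l ++ is 0 l')) ≡ true → ⊥
  kill! pc pcs ly fa l l' q = two! (cfg o) c (vx a₁) (vx a₂ ∷ vx a₃ ∷ vx b₂ ∷ seg wT ∷ pc ∷ pcs) (fst ly) (I ly) fa 1 l 0 l' q

  ab22 : a₂ ~ b₂
  ab22 = a33 i2 i2
  ab32 : a₃ ~ b₂
  ab32 = a33 i3 i2

  module _ (B : Barbell P) (tl1 : Tg (Barbell.l1 B)) (tl2 : Tg (Barbell.l2 B)) (tm1 : Tg (Barbell.m1 B)) (tm2 : Tg (Barbell.m2 B)) where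
   open Barbell B

   ↭P : (l1 ∷ L) ++ N' ++ (m1 ∷ Mz) ↭ P
   ↭P = subst (_↭ P) P≡ refl

   bar-L : ∀ {y} L1 L2 → L ≡ L1 ++ y ∷ L2 → t ~ y → ⊥
   bar-L {y} L1 L2 eq ty = go (w-split {x = l1} {L1} {y = y} {L2} (subst (λ z → Walk l1 (l1 ∷ z) l2) eq (l1l' ∷ wL))) (w-head wN)
    where
    go : Σ[ c' ∈ V ] (Walk l1 (l1 ∷ L1) c' × c' ~ y × Walk y (y ∷ L2) l2) → Σ[ N'' ∈ List V ] N' ≡ n1 ∷ N'' → ⊥
    go (c' , w1 , _ , w2) (N'' , eN) = kill! (seg w1) (seg w2 ∷ vx n1 ∷ vx m1 ∷ seg wM ∷ [])
     (lay (keep (⊑-pre L1 (⊑-pre (y ∷ L2) (keep (⊑-drop N'' ⊑-refl))))) (subst (_↭ P) (cong₂ (λ a b → (l1 ∷ a) ++ b ++ (m1 ∷ Mz)) eq eN ⨾ cong (l1 ∷_) (++-assoc L1 (y ∷ L2) _)) ↭P))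
     (1 - 3 ! ab22 ∷ 2 - 3 ! ab32 ∷ 8 - 1 ! tm1 i2 ∷ 8 - 2 ! tm1 i3 ∷ (tl 9 , hd 1 , tm2 i2) ∷ 8 - 9 ! m1m' ∷
     4 - 0 ! wA i1 ∷ (tl 6 , hd 0 , tl2 i1) ∷ 5 - 0 ! tl1 i1 ∷ (tl 4 , hd 6 , ty) ∷ (tl 6 , hd 7 , l2n1) ∷ 5 - 7 ! l1n1 ∷ [])
     (fw 3 ∷ fw 2 ∷ fw 8 ∷ fw 9 ∷ []) (fw 4 ∷ fw 6 ∷ fw 7 ∷ fw 5 ∷ []) refl

   bar-M : ∀ {y} M1 M2 → Mz ≡ M1 ++ y ∷ M2 → t ~ y → ⊥
   bar-M {y} M1 M2 eq ty = go (w-split {x = m1} {M1} {y = y} {M2} (subst (λ z → Walk m1 (m1 ∷ z) m2) eq (m1m' ∷ wM))) (w-last wN)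
    where
    go : Σ[ c' ∈ V ] (Walk m1 (m1 ∷ M1) c' × c' ~ y × Walk y (y ∷ M2) m2) → Σ[ N'' ∈ List V ] N' ≡ N'' ++ n2 ∷ [] → ⊥
    go (c' , w1 , _ , w2) (N'' , eN) = kill! (vx l1) (seg wL ∷ vx n2 ∷ seg w1 ∷ seg w2 ∷ [])
     (lay (keep (⊑-pre L (⊑-drop N'' ⊑-refl))) (subst (_↭ P) (cong₂ (λ a b → (l1 ∷ L) ++ b ++ (m1 ∷ a)) eq eN ⨾ cong (λ z → l1 ∷ L ++ z) (++-assoc N'' (n2 ∷ []) _)) ↭P))
     (1 - 3 ! ab22 ∷ 2 - 3 ! ab32 ∷ 5 - 1 ! tl1 i2 ∷ 5 - 2 ! tl1 i3 ∷ (tl 6 , hd 1 , tl2 i2) ∷ 5 - 6 ! l1l' ∷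
     4 - 0 ! wA i1 ∷ (tl 9 , hd 0 , tm2 i1) ∷ 8 - 0 ! tm1 i1 ∷ (tl 4 , hd 9 , ty) ∷ (tl 9 , hd 7 , adj-sym n2m2) ∷ 8 - 7 ! adj-sym n2m1 ∷ [])
     (fw 3 ∷ fw 2 ∷ fw 5 ∷ fw 6 ∷ []) (fw 4 ∷ fw 9 ∷ fw 7 ∷ fw 8 ∷ []) refl

   bar-N : ∀ {y} N1 N2 → N' ≡ N1 ++ y ∷ N2 → t ~ y → ⊥
   bar-N {y} N1 N2 eq ty = kill! (vx l1) (seg wL ∷ seg wy ∷ vx m1 ∷ seg wM ∷ [])
    (lay (keep (⊑-pre L (⊑-drop N1 ⊑-refl))) (subst (_↭ P) (cong (λ b → (l1 ∷ L) ++ b ++ (m1 ∷ Mz)) eq ⨾ cong (λ z → l1 ∷ L ++ z) (++-assoc N1 (y ∷ N2) _)) ↭P))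
    (1 - 3 ! ab22 ∷ 2 - 3 ! ab32 ∷ 5 - 1 ! tl1 i2 ∷ 5 - 2 ! tl1 i3 ∷ (tl 6 , hd 1 , tl2 i2) ∷ 5 - 6 ! l1l' ∷
    4 - 0 ! wA i1 ∷ 8 - 0 ! tm1 i1 ∷ (tl 9 , hd 0 , tm2 i1) ∷ (tl 4 , hd 7 , ty) ∷ (tl 7 , hd 8 , n2m1) ∷ 8 - 9 ! m1m' ∷ [])
    (fw 3 ∷ fw 2 ∷ fw 5 ∷ fw 6 ∷ []) (fw 4 ∷ fw 7 ∷ fw 8 ∷ fw 9 ∷ []) refl
    where
    wy : Walk y (y ∷ N2) n2
    wy = w-suffix N1 (subst (λ z → Walk n1 z n2) eq wN)

   -- T attaches to the first cycle, to `N'` or to the second cycle. The end of the barbell that T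
   -- does not use supplies CC₁, and the part entered by T supplies CC₂.
   bar-kill : ∀ {y} → y ∈ P → t ~ y → y ≢ l1 → y ≢ m1 → ⊥
   bar-kill {y} y∈ ty n1' n2' = go (∈-++⁻ (l1 ∷ L) (cast∈ P≡ y∈))
    where
    goM : y ∈ m1 ∷ Mz → ⊥
    goM (here r) = n2' r
    goM (there r) with ∈-split r
    ... | a , b , q = bar-M a b q ty
    goN : y ∈ N' → ⊥
    goN r with ∈-split r
    ... | a , b , q = bar-N a b q ty
    go : y ∈ l1 ∷ L ⊎ y ∈ N' ++ (m1 ∷ Mz) → ⊥
    go (inj₁ (here r)) = n1' r
    go (inj₁ (there r)) with ∈-split r
    ... | a , b , q = bar-L a b q ty
    go (inj₂ r) = [ goN , goM ]′ (∈-++⁻ N' r)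

  record Tight (θ : Theta P) : Set where
   constructor mkTight
   open Theta θ
   field
    z1 : Tg x1
    z1' : Tg x1'
    z2 : Tg x2
    z2' : Tg x2'
    z3 : Tg x3
    z3' : Tg x3'

  module _ (θ : Theta P) (τ : Tight θ) where
   open Theta θ
   open Tight τ

   module _ {X2' x2₂} (eX : X2 ≡ x2 ∷ X2') (g2 : x2 ~ x2₂) (w2' : Walk x2₂ X2' x2') where

    ↭P2 : X1 ++ β₁ ∷ (x2 ∷ X2') ++ β₂ ∷ X3 ↭ P
    ↭P2 = subst (λ z → X1 ++ β₁ ∷ z ++ β₂ ∷ X3 ↭ P) eX P↭

    th-β₁ : t ~ β₁ → ⊥
    th-β₁ ty = kill! (seg w1) (vx β₁ ∷ vx x2 ∷ seg w2' ∷ vx β₂ ∷ seg w3 ∷ []) (lay ⊑-refl ↭P2)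
     (1 - 3 ! ab22 ∷ 2 - 3 ! ab32 ∷ 7 - 1 ! z2 i2 ∷ 7 - 2 ! z2 i3 ∷ (tl 8 , hd 1 , z2' i2) ∷ 7 - 8 ! g2 ∷
     4 - 0 ! wA i1 ∷ 5 - 0 ! z1 i1 ∷ 10 - 0 ! z3 i1 ∷ (tl 4 , hd 6 , ty) ∷ 6 - 5 ! β1 ∷ (tl 5 , hd 9 , b1β) ∷ (hd 9 , tl 10 , adj-sym b3β) ∷ [])
     (fw 3 ∷ fw 2 ∷ fw 7 ∷ fw 8 ∷ []) (fw 4 ∷ fw 6 ∷ fw 5 ∷ fw 9 ∷ bw 10 ∷ []) refl

    th-β₂ : t ~ β₂ → ⊥
    th-β₂ ty = kill! (seg w1) (vx β₁ ∷ vx x2 ∷ seg w2' ∷ vx β₂ ∷ seg w3 ∷ []) (lay ⊑-refl ↭P2)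
     (1 - 3 ! ab22 ∷ 2 - 3 ! ab32 ∷ 7 - 1 ! z2 i2 ∷ 7 - 2 ! z2 i3 ∷ (tl 8 , hd 1 , z2' i2) ∷ 7 - 8 ! g2 ∷
     4 - 0 ! wA i1 ∷ 5 - 0 ! z1 i1 ∷ 10 - 0 ! z3 i1 ∷ (tl 4 , hd 9 , ty) ∷ (hd 9 , tl 5 , adj-sym b1β) ∷ 5 - 6 ! adj-sym β1 ∷ 6 - 10 ! β3 ∷ [])
     (fw 3 ∷ fw 2 ∷ fw 7 ∷ fw 8 ∷ []) (fw 4 ∷ fw 9 ∷ bw 5 ∷ fw 6 ∷ fw 10 ∷ []) refl

    th-X1 : ∀ {y} h H J → X1 ≡ (h ∷ H) ++ y ∷ J → t ~ y → ⊥
    th-X1 {y} h H J eq ty = go (w-split {x = h} {H} {y = y} {J} (subst (λ z → Walk x1 z x1') eq w1))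
     where
     go : Σ[ c' ∈ V ] (Walk x1 (h ∷ H) c' × c' ~ y × Walk y (y ∷ J) x1') → ⊥
     go (c' , wh , _ , wj) = kill! (seg wh) (seg wj ∷ vx β₁ ∷ vx x2 ∷ seg w2' ∷ vx β₂ ∷ seg w3 ∷ [])
      (lay ⊑-refl (subst (_↭ P) (cong (λ z → z ++ β₁ ∷ (x2 ∷ X2') ++ β₂ ∷ X3) eq ⨾ ++-assoc (h ∷ H) (y ∷ J) _) ↭P2))
      (1 - 3 ! ab22 ∷ 2 - 3 ! ab32 ∷ 8 - 1 ! z2 i2 ∷ 8 - 2 ! z2 i3 ∷ (tl 9 , hd 1 , z2' i2) ∷ 8 - 9 ! g2 ∷
      4 - 0 ! wA i1 ∷ (tl 6 , hd 0 , z1' i1) ∷ 5 - 0 ! z1 i1 ∷ (tl 4 , hd 6 , ty) ∷ (tl 6 , hd 10 , b1β) ∷ (hd 10 , tl 11 , adj-sym b3β) ∷ 11 - 7 ! adj-sym β3 ∷ 7 - 5 ! β1 ∷ [])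
      (fw 3 ∷ fw 2 ∷ fw 8 ∷ fw 9 ∷ []) (fw 4 ∷ fw 6 ∷ fw 10 ∷ bw 11 ∷ fw 7 ∷ fw 5 ∷ []) refl

    th-X3 : ∀ {y} h H J → X3 ≡ (h ∷ H) ++ y ∷ J → t ~ y → ⊥
    th-X3 {y} h H J eq ty = go (w-split {x = h} {H} {y = y} {J} (subst (λ z → Walk x3 z x3') eq w3))
     where
     go : Σ[ c' ∈ V ] (Walk x3 (h ∷ H) c' × c' ~ y × Walk y (y ∷ J) x3') → ⊥
     go (c' , wh , _ , wj) = kill! (seg w1) (vx β₁ ∷ vx x2 ∷ seg w2' ∷ vx β₂ ∷ seg wh ∷ seg wj ∷ [])
      (lay ⊑-refl (subst (_↭ P) (cong (λ z → X1 ++ β₁ ∷ (x2 ∷ X2') ++ β₂ ∷ z) eq) ↭P2))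
      (1 - 3 ! ab22 ∷ 2 - 3 ! ab32 ∷ 7 - 1 ! z2 i2 ∷ 7 - 2 ! z2 i3 ∷ (tl 8 , hd 1 , z2' i2) ∷ 7 - 8 ! g2 ∷
      4 - 0 ! wA i1 ∷ (tl 11 , hd 0 , z3' i1) ∷ 10 - 0 ! z3 i1 ∷ (tl 4 , hd 11 , ty) ∷ (tl 11 , hd 9 , b3β) ∷ (hd 9 , tl 5 , adj-sym b1β) ∷ 5 - 6 ! adj-sym β1 ∷ 6 - 10 ! β3 ∷ [])
      (fw 3 ∷ fw 2 ∷ fw 7 ∷ fw 8 ∷ []) (fw 4 ∷ fw 11 ∷ fw 9 ∷ bw 5 ∷ fw 6 ∷ fw 10 ∷ []) refl

    th-X2 : ∀ {y} h H j J → x2 ∷ X2' ≡ (h ∷ H) ++ y ∷ j ∷ J → t ~ y → ⊥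
    th-X2 {y} h H j J eq ty = go (w-split {x = h} {H} {y = y} {j ∷ J} (subst (λ z → Walk x2 z x2') eq (g2 ∷ w2')))
     where
     go : Σ[ c' ∈ V ] (Walk x2 (h ∷ H) c' × c' ~ y × Walk y (y ∷ j ∷ J) x2') → ⊥
     go (c' , wh , cy , wj) = kill! (seg w1) (vx β₁ ∷ seg wh ∷ vx y ∷ seg (snd (w-2nd wj)) ∷ vx β₂ ∷ seg w3 ∷ [])
      (lay ⊑-refl (subst (_↭ P) (cong (λ z → X1 ++ β₁ ∷ z ++ β₂ ∷ X3) eq ⨾ cong (λ z → X1 ++ β₁ ∷ z) (++-assoc (h ∷ H) (y ∷ j ∷ J) _)) ↭P2))
      (1 - 3 ! ab22 ∷ 2 - 3 ! ab32 ∷ 4 - 1 ! wA i2 ∷ 4 - 2 ! wA i3 ∷ 7 - 1 ! z2 i2 ∷ (tl 4 , hd 8 , ty) ∷ (hd 8 , tl 7 , adj-sym cy) ∷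
      (tl 9 , hd 0 , z2' i1) ∷ (tl 5 , hd 0 , z1' i1) ∷ 11 - 0 ! z3 i1 ∷ (tl 9 , hd 10 , b2β) ∷ (hd 10 , tl 5 , adj-sym b1β) ∷ 5 - 6 ! adj-sym β1 ∷ 6 - 11 ! β3 ∷ [])
      (fw 3 ∷ fw 2 ∷ fw 4 ∷ fw 8 ∷ bw 7 ∷ []) (fw 9 ∷ fw 10 ∷ bw 5 ∷ fw 6 ∷ fw 11 ∷ []) refl

    -- The arm `X2` has two distinct ends joined to `A` and serves CC₁, while the rest of the theta
    -- with T serves CC₂. If T attaches inside `X2`, the arm is cut there: the first piece with T
    -- serves CC₁ and the last piece goes to CC₂.
    th-kill : ∀ {y} → y ∈ P → t ~ y → y ≢ x1 → y ≢ x2 → y ≢ x3 → y ≢ x2' → ⊥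
    th-kill {y} y∈ ty n1 n2 n3 n2' = go (∈-++⁻ X1 (Perm.∈-resp-↭ (↭-sym ↭P2) y∈))
     where
     s1 : ∀ {x x' X} → Walk x X x' → y ∈ X → y ≢ x → Σ[ h ∈ V ] Σ[ H ∈ List V ] Σ[ J ∈ List V ] (X ≡ (h ∷ H) ++ y ∷ J)
     s1 wx m ne with ∈-split m
     ... | [] , J , refl = ⊥-elim (ne (sym (w-hd≡ wx)))
     ... | h ∷ H , J , q = h , H , J , q
     g1 : y ∈ X1 → ⊥
     g1 m with s1 w1 m n1
     ... | h , H , J , q = th-X1 h H J q ty
     g3 : y ∈ X3 → ⊥
     g3 m with s1 w3 m n3
     ... | h , H , J , q = th-X3 h H J q ty
     g2' : y ∈ x2 ∷ X2' → ⊥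
     g2' m with s1 (g2 ∷ w2') m n2
     ... | h , H , [] , q = n2' (sym (w-lst≡ (h ∷ H) (subst (λ z → Walk x2 z x2') q (g2 ∷ w2'))))
     ... | h , H , j ∷ J , q = th-X2 h H j J q ty
     gr : y ∈ β₂ ∷ X3 → ⊥
     gr i1 = th-β₂ ty
     gr (there m) = g3 m
     go : y ∈ X1 ⊎ y ∈ β₁ ∷ (x2 ∷ X2') ++ β₂ ∷ X3 → ⊥
     go (inj₁ m) = g1 m
     go (inj₂ i1) = th-β₁ ty
     go (inj₂ (there m)) = [ g2' , gr ]′ (∈-++⁻ (x2 ∷ X2') m)

  module _ {s P₀} (P≡s : P ≡ s ∷ P₀) (st : s ~ t) (zs : Tg s) where

   -- The path formed by `s` and T has two ends joined to `A` and serves CC₁; the barbell is then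
   -- free for CC₂.
   pair-bar : (B : Barbell P₀) → Tg (Barbell.l1 B) → Tg (Barbell.l2 B) → Tg (Barbell.m1 B) → ⊥
   pair-bar (mkBar {l1} {m1 = m1} {L = L} {N' = N'} {Mz = Mz} l1l' wL wN m1m' wM P≡ l2n1 l1n1 n2m1 n2m2) tl1 tl2 tm1 =
    kill! (vx s) (vx l1 ∷ seg wL ∷ seg wN ∷ seg (m1m' ∷ wM) ∷ []) (lay ⊑-refl (subst (s ∷ (l1 ∷ L) ++ N' ++ (m1 ∷ Mz) ↭_) (cong (s ∷_) (sym P≡) ⨾ sym P≡s) refl))
    (1 - 3 ! ab22 ∷ 2 - 3 ! ab32 ∷ 5 - 1 ! zs i2 ∷ 5 - 2 ! zs i3 ∷ 4 - 1 ! wA i2 ∷ (hd 5 , tl 4 , st) ∷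
    6 - 0 ! tl1 i1 ∷ (tl 7 , hd 0 , tl2 i1) ∷ 9 - 0 ! tm1 i1 ∷ 6 - 7 ! l1l' ∷ (tl 7 , hd 8 , l2n1) ∷ (tl 8 , hd 9 , n2m1) ∷ [])
    (fw 3 ∷ fw 2 ∷ fw 5 ∷ bw 4 ∷ []) (fw 6 ∷ fw 7 ∷ fw 8 ∷ fw 9 ∷ []) refl

   pair-theta : (θ : Theta P₀) → Tg (Theta.x1 θ) → Tg (Theta.x2 θ) → Tg (Theta.x3 θ) → ⊥
   pair-theta (mkTheta {β₁} {β₂} {X1 = X1} {X2} {X3} w1 w2 w3 β1 β2 β3 b1β b2β b3β P↭) z1 z2 z3 =
    kill! (vx s) (seg w1 ∷ vx β₁ ∷ seg w2 ∷ vx β₂ ∷ seg w3 ∷ []) (lay ⊑-refl (subst (s ∷ X1 ++ β₁ ∷ X2 ++ β₂ ∷ X3 ↭_) (sym P≡s) (prep s P↭)))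
    (1 - 3 ! ab22 ∷ 2 - 3 ! ab32 ∷ 5 - 1 ! zs i2 ∷ 5 - 2 ! zs i3 ∷ 4 - 1 ! wA i2 ∷ (hd 5 , tl 4 , st) ∷
    6 - 0 ! z1 i1 ∷ 8 - 0 ! z2 i1 ∷ 10 - 0 ! z3 i1 ∷ 6 - 7 ! adj-sym β1 ∷ 7 - 8 ! β2 ∷ (tl 8 , hd 9 , b2β) ∷ (hd 9 , tl 10 , adj-sym b3β) ∷ [])
    (fw 3 ∷ fw 2 ∷ fw 5 ∷ bw 4 ∷ []) (bw 6 ∷ fw 7 ∷ fw 8 ∷ fw 9 ∷ bw 10 ∷ []) refl


 -- Some vertex of R lies off the longest path

 -- R as K₂,ₛ. That there are no edges within its two sides is not recorded, as it follows from the
 -- absence of chorded cycles.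
 record K2s (κ : V → K) : Set where
  constructor mkK2s
  field
   ko : Opt κ
   {ka kb} : V
   {Vs} : List V
   kl : Lst κ fz (ka ∷ kb ∷ Vs)
   kva : ∀ {v} → v ∈ Vs → v ~ ka
   kvb : ∀ {v} → v ∈ Vs → v ~ kb
   k33 : ∀ c → Σ[ q₃ ∈ K33 κ c ] (∀ {v} → v ∈ Vs → SideA q₃ v)

 LP-perm : ∀ {κ p P q p2 P2 q2} → LongP κ p P q → Walk p2 P2 q2 → P2 ↭ P → LongP κ p2 P2 q2
 LP-perm L w h = mkLP (lo L) w (U-↭ (↭-sym h) (lU L)) (λ m → lz L (Perm.∈-resp-↭ h m)) (λ o w' u z → ≤-trans (lmax L o w' u z) (≡⇒≤ (sym (Perm.↭-length h))))

 re↭ : ∀ {l m : List V} → l ≡ m → l ↭ m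
 re↭ refl = refl

 module One {κ : V → K} {v : V} (kv : κ v ≡ fz) (dv : dR κ v ≤ 2) where

  module Use {p P q} (L : LongP κ p P q) (nv : v ∉ P) where
   P' = fst (LP-hd L)
   P≡ : P ≡ p ∷ P'
   P≡ = snd (LP-hd L)
   Q' = fst (LP-hd (LP-rev L))
   Q≡ : reverse P ≡ q ∷ Q'
   Q≡ = snd (LP-hd (LP-rev L))
   L₁ : LongP κ p (p ∷ P') q
   L₁ = LP-perm L (subst (λ t → Walk p t q) P≡ (lw L)) (re↭ (sym P≡))
   L₂ : LongP κ q (q ∷ Q') p
   L₂ = LP-perm L (subst (λ t → Walk q t p) Q≡ (w-rev (lw L))) (↭-trans (re↭ (sym Q≡)) (Perm.↭-reverse P))
   h : p ∷ P' ↭ q ∷ Q'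
   h = ↭-trans (re↭ (sym P≡)) (↭-trans (↭-sym (Perm.↭-reverse P)) (re↭ Q≡))
   rv : reverse (p ∷ P') ≡ q ∷ Q'
   rv = cong reverse (sym P≡) ⨾ Q≡
   nv' : v ∉ p ∷ P'
   nv' m = nv (cast∈ (sym P≡) m)
   open Off L₁ L₂ h kv nv' dv public

  offSides : ∀ {p P q} → LongP κ p P q → v ∉ P → ∀ {c} (q₃ : K33 κ c) → SideA q₃ v → SideA q₃ p × SideA q₃ q
  offSides L nv = Use.sides L nv

  off33 : ∀ {p P q} → LongP κ p P q → v ∉ P → ∀ c → Σ[ q₃ ∈ K33 κ c ] SideA q₃ v
  off33 L nv = Use.has33 L nv

 module Theta-ends {κ : V → K} {v : V} (kv : κ v ≡ fz) (dv : dR κ v ≤ 2) {p P q} (L : LongP κ p P q) (nv : v ∉ P) where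
  open One kv dv

  tight↭ : ∀ {p2 P2 q2} → Walk p2 P2 q2 → P2 ↭ P → ∀ {c} (q₃ : K33 κ c) → SideA q₃ v → SideA q₃ p2 × SideA q₃ q2
  tight↭ w h = offSides (LP-perm L w h) (λ m → nv (Perm.∈-resp-↭ h m))

  end-off : ∀ {p2 P2 q2 u} → Walk p2 P2 q2 → P2 ↭ P → κ u ≡ fz → u ∉ P → u ≁ p2
  end-off {p2} {P2} w h ku nu = nadj-sym (PathEnd.nbr-on L1 ku (λ m → nu (Perm.∈-resp-↭ h (cast∈ (sym (snd hd')) m))))
   where
   hd' = w-head w
   L1 : LongP κ p2 (p2 ∷ fst hd') _
   L1 = LP-perm L (subst (λ t → Walk p2 t _) (snd hd') w) (↭-trans (re↭ (sym (snd hd'))) h)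

 module Tail {κ : V → K} {p P q} (L : LongP κ p P q) where

  record TailAt : Set where
   constructor mkTail
   field
    {av az ay} : V
    {aT} : List V
    aw : Walk av aT az
    aU : Unique aT
    aR : ∀ {x} → x ∈ aT → κ x ≡ fz
    aP : ∀ {x} → x ∈ aT → x ∉ P
    ad : dR κ av ≤ 2
    ay∈ : ay ∈ P
    ae : az ~ ay
    am : ∀ {a' Q' b'} → Walk a' Q' b' → Unique Q' → (∀ {x} → x ∈ Q' → κ x ≡ fz) → (∀ {x} → x ∈ Q' → x ∉ P) → length Q' ≤ length aT

  record PairAt : Set where
   constructor mkPair
   field
    {pv pu pt} : V
    {pT} : List V
    puw : pv ~ pu
    pw : Walk pu pT pt
    pU : Unique (pv ∷ pT)
    pR : ∀ {x} → x ∈ pv ∷ pT → κ x ≡ fz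
    pP : ∀ {x} → x ∈ pv ∷ pT → x ∉ P
    pd : dR κ pv ≤ 2
    pd' : dR κ pt ≤ 2

  record MaxQ (a : V) (Q : List V) (b : V) : Set where
   constructor mkQ
   field
    qw : Walk a Q b
    qU : Unique Q
    qR : ∀ {x} → x ∈ Q → κ x ≡ fz
    qP : ∀ {x} → x ∈ Q → x ∉ P
    qm : ∀ {a' Q' b'} → Walk a' Q' b' → Unique Q' → (∀ {x} → x ∈ Q' → κ x ≡ fz) → (∀ {x} → x ∈ Q' → x ∉ P) → length Q' ≤ length Q
  open MaxQ

  Q-rev : ∀ {a Q b} → MaxQ a Q b → MaxQ b (reverse Q) a
  Q-rev {Q = Q} M = mkQ (w-rev (qw M)) (U-rev (qU M)) (λ m → qR M (Perm.∈-resp-↭ (Perm.↭-reverse Q) m)) (λ m → qP M (Perm.∈-resp-↭ (Perm.↭-reverse Q) m))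
   (λ w u r p' → ≤-trans (qm M w u r p') (≡⇒≤ (sym (length-reverse Q))))

  onQ : ∀ {a Q b} → MaxQ a Q b → ∀ {x} → κ x ≡ fz → x ∉ P → a ~ x → x ∈ Q
  onQ {a} {Q} M {x} kx nx ax with x ∈? Q
  ... | yes m = m
  ... | no nm = ⊥-elim (<-irrefl refl (qm M (adj-sym ax ∷ qw M) (U-cons nm (qU M)) (λ { i1 → kx ; (there m) → qR M m }) (λ { i1 → nx ; (there m) → qP M m })))

  -- Neighbours of `a` in R off `P` lie on the maximal path, and those on `P` are not in `pre`. All
  -- of them lie on the path `Q'` continued by `y ∷ post`, and three of them would make `a` a hub.
  low : ∀ {a Q' b y pre post} → MaxQ a (a ∷ Q') b → P ≡ pre ++ y ∷ post → b ~ y → cntL (e a) pre ≡ 0 → dR κ a ≤ 2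
  low {a} {Q'} {b} {y} {pre} {post} M P≡ by c0 = go (3 ≤? cntL (e a) (Q' ++ y ∷ post))
   where
   W : Σ[ s ∈ V ] Walk s (Q' ++ y ∷ post) q
   W = f Q' (qw M)
    where
    wy : Walk y (y ∷ post) q
    wy = w-suffix pre (subst (λ t → Walk p t q) P≡ (lw L))
    f : ∀ Q' → Walk a (a ∷ Q') b → Σ[ s ∈ V ] Walk s (Q' ++ y ∷ post) q
    f [] one = y , wy
    f (z ∷ Q') w = z , w-join (snd (w-2nd w)) by wy
   in-post : ∀ {x} → x ∈ y ∷ post → x ∈ P
   in-post m = cast∈ (sym P≡) (∈-++⁺ʳ pre m)
   uq : Unique (a ∷ Q' ++ y ∷ post)
   uq = U-++ (qU M) (U-++ʳ pre (subst Unique P≡ (lU L))) (λ m m' → qP M m (in-post m'))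
   go : Dec (3 ≤ cntL (e a) (Q' ++ y ∷ post)) → dR κ a ≤ 2
   go (yes h) = ⊥-elim (noCC₀ (cfg (lo L)) (mkCC (snd W) uq h) zz)
    where
    zz : ∀ {x} → x ∈ a ∷ Q' ++ y ∷ post → κ x ≡ fz
    zz m = [ qR M , (λ r → lz L (in-post r)) ]′ (∈-++⁻ (a ∷ Q') m)
   go (no h) = ≤-trans (cntL-⊆' (e a) (lu (cls-L κ fz)) sub) (≤-pred (≰⇒> h))
    where
    sub : ∀ {x} → x ∈ cls κ fz → a ~ x → x ∈ Q' ++ y ∷ post
    sub {x} m ax with x ∈? P
    ... | yes xP with ∈-++⁻ pre (cast∈ P≡ xP)
    ... | inj₁ r = ⊥-elim (true≢false (sym ax ⨾ cntL-zero⁻ (e a) pre c0 r))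
    ... | inj₂ r = ∈-++⁺ʳ Q' r
    sub {x} m ax | no nx with onQ M (l⇒ (cls-L κ fz) m) nx ax
    ... | here refl = ⊥-elim (adj-≢ ax refl)
    ... | there r = ∈-++⁺ˡ r

  low₀ : ∀ {a Q' b} → MaxQ a (a ∷ Q') b → cntL (e a) P ≡ 0 → dR κ a ≤ 2
  low₀ {a} {Q'} {b} M c0 = go (3 ≤? cntL (e a) Q')
   where
   W : 1 ≤ length Q' → Σ[ s ∈ V ] Walk s Q' b
   W = f Q' (qw M)
    where
    f : ∀ Q' → Walk a (a ∷ Q') b → 1 ≤ length Q' → Σ[ s ∈ V ] Walk s Q' b
    f (z ∷ Q') w _ = z , snd (w-2nd w)
   go : Dec (3 ≤ cntL (e a) Q') → dR κ a ≤ 2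
   go (yes h) = ⊥-elim (noCC₀ (cfg (lo L)) (mkCC (snd (W (≤-trans (≤-trans (s≤s z≤n) h) (cntL≤length (e a) Q')))) (qU M) h) (qR M))
   go (no h) = ≤-trans (cntL-⊆' (e a) (lu (cls-L κ fz)) sub) (≤-pred (≰⇒> h))
    where
    sub : ∀ {x} → x ∈ cls κ fz → a ~ x → x ∈ Q'
    sub {x} m ax with x ∈? P
    ... | yes xP = ⊥-elim (true≢false (sym ax ⨾ cntL-zero⁻ (e a) P c0 xP))
    ... | no nx with onQ M (l⇒ (cls-L κ fz) m) nx ax
    ... | here refl = ⊥-elim (adj-≢ ax refl)
    ... | there r = r

  QHead : ∀ {a Q b} → MaxQ a Q b → Σ[ Q' ∈ List V ] Q ≡ a ∷ Q'
  QHead M = w-head (qw M)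

  tail₁ : ∀ {a Q b} → MaxQ a Q b → ∀ {y pre post} → P ≡ pre ++ y ∷ post → b ~ y → cntL (e a) pre ≡ 0 → TailAt
  tail₁ {a} {Q} {b} M {y} {pre} {post} P≡ by c0 = mkTail (qw M) (qU M) (qR M) (qP M) (low (M' (snd (QHead M))) P≡ by c0) (cast∈ (sym P≡) (∈-++⁺ʳ pre i1)) by (qm M)
   where M' : ∀ {Q'} → Q ≡ a ∷ Q' → MaxQ a (a ∷ Q') b
         M' refl = M

  -- The first vertex of `P` that sees an end of `Q` is taken as the attachment; the opposite end
  -- has no earlier neighbour on `P` and is therefore low. Without an attachment both ends of `Q`
  -- are low.
  both : ∀ {a Q b} → MaxQ a Q b → TailAt ⊎ PairAt ⊎ (Q ≡ a ∷ [] × cntL (e a) P ≡ 0 × dR κ a ≤ 2)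
  both {a} {Q} {b} M = go (1 ≤? cntL (λ x → e a x ∨ e b x) P)
   where
   or0 : ∀ {x y} → x ∨ y ≡ false → x ≡ false × y ≡ false
   or0 {false} h = refl , h
   go : Dec (1 ≤ cntL (λ x → e a x ∨ e b x) P) → TailAt ⊎ PairAt ⊎ (Q ≡ a ∷ [] × cntL (e a) P ≡ 0 × dR κ a ≤ 2)
   go (yes h) with cntL-first (λ x → e a x ∨ e b x) P h
   ... | pre , y , post , eq , or , c0 = inj₁ (pick (∨-case or))
    where
    za : cntL (e a) pre ≡ 0
    za = cntL-zero (e a) pre (λ m → fst (or0 (cntL-zero⁻ (λ x → e a x ∨ e b x) pre c0 m)))
    zb : cntL (e b) pre ≡ 0
    zb = cntL-zero (e b) pre (λ {x} m → snd (or0 {e a x} (cntL-zero⁻ (λ x → e a x ∨ e b x) pre c0 m)))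
    pick : a ~ y ⊎ b ~ y → TailAt
    pick (inj₂ by) = tail₁ M eq by za
    pick (inj₁ ay) = tail₁ (Q-rev M) eq ay zb
   go (no h) = inj₂ (fin M)
    where
    z0 : ∀ {x} → x ∈ P → a ≁ x × b ≁ x
    z0 m = or0 (cntL-zero⁻ (λ x → e a x ∨ e b x) P (n≤0⇒n≡0 (≤-pred (≰⇒> h))) m)
    ca : cntL (e a) P ≡ 0
    ca = cntL-zero (e a) P (fst ∘ z0)
    cb : cntL (e b) P ≡ 0
    cb = cntL-zero (e b) P (snd ∘ z0)
    da : ∀ {a Q b} → MaxQ a Q b → cntL (e a) P ≡ 0 → dR κ a ≤ 2
    da {a} {Q} {b} M c = k (QHead M)
     where
     M' : ∀ {Q'} → Q ≡ a ∷ Q' → MaxQ a (a ∷ Q') b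
     M' refl = M
     k : Σ[ Q' ∈ List V ] Q ≡ a ∷ Q' → dR κ a ≤ 2
     k (Q' , r) = low₀ (M' r) c
    fin : MaxQ a Q b → PairAt ⊎ (Q ≡ a ∷ [] × cntL (e a) P ≡ 0 × dR κ a ≤ 2)
    fin M = sp (qw M) (qU M) (qR M) (qP M)
     where
     sp : ∀ {Q} → Walk a Q b → Unique Q → (∀ {x} → x ∈ Q → κ x ≡ fz) → (∀ {x} → x ∈ Q → x ∉ P) → PairAt ⊎ (Q ≡ a ∷ [] × cntL (e a) P ≡ 0 × dR κ a ≤ 2)
     sp one u r' p' = inj₂ (refl , ca , da M ca)
     sp (g ∷ w) u r' p' = inj₁ (mkPair g w u r' p' (da M ca) (da (Q-rev M) cb))


 one-or-long : ∀ {x X x'} → Walk x X x' → (X ≡ x ∷ [] × x ≡ x') ⊎ (Σ[ X' ∈ List V ] Σ[ y ∈ V ] (X ≡ x ∷ X' × x ~ y × Walk y X' x'))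
 one-or-long one = inj₁ (refl , refl)
 one-or-long (g ∷ w) = inj₂ (_ , _ , refl , g , w)

 bar-path₂ : ∀ {P} (B : Barbell P) → let open Barbell B in Σ[ P2 ∈ List V ] (P2 ↭ P × Walk l2 P2 m2)
 bar-path₂ {P} (mkBar {l1} {L = L} {N'} {Mz} l1l' wL wN m1m' wM P≡ l2n1 l1n1 n2m1 n2m2) =
  _ , ↭-trans (Perm.++⁺ʳ _ (Perm.↭-reverse (l1 ∷ L))) (re↭ (sym P≡)) , w-join (w-rev (l1l' ∷ wL)) l1n1 (w-join wN n2m1 (m1m' ∷ wM))

 bar-path-m : ∀ {P} (B : Barbell P) → let open Barbell B in Σ[ P2 ∈ List V ] (P2 ↭ P × Walk l1 P2 m1)
 bar-path-m {P} (mkBar {l1} {m1 = m1} {L = L} {N'} {Mz} l1l' wL wN m1m' wM P≡ l2n1 l1n1 n2m1 n2m2) =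
  _ , ↭-trans (Perm.++⁺ˡ (l1 ∷ L) (Perm.++⁺ˡ N' (Perm.↭-reverse (m1 ∷ Mz)))) (re↭ (sym P≡)) , w-join (l1l' ∷ wL) l2n1 (w-join wN n2m2 (w-rev (m1m' ∷ wM)))

 module Fin-A {κ : V → K} {p P' q} (L : LongP κ p (p ∷ P') q) where
  P : List V
  P = p ∷ P'
  open Tail L

  o = lo L

  module V1 {v : V} (kv : κ v ≡ fz) (dv : dR κ v ≤ 2) (nv : v ∉ P) where
   open One kv dv
   module U = Use L nv
   open Theta-ends kv dv L nv

   Q3 : Σ[ q₃ ∈ K33 κ c₀ ] SideA q₃ v
   Q3 = off33 L nv c₀
   q₃ = fst Q3
   sv = snd Q3

   Tg : V → Set
   Tg s = ∀ {a} → a ∈ K33.A q₃ → s ~ a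

   ends : ∀ {p2 P2 q2} → Walk p2 P2 q2 → P2 ↭ P → Tg p2 × Tg q2
   ends w h = fst (fst r) , fst (snd r)
    where r = tight↭ w h q₃ sv

   pq : p ≁ q
   pq = same-nadj o q₃ (lz L (w-head∈ (lw L))) (lz L (w-last∈ (lw L))) (fst r) (snd r)
    where r = tight↭ (lw L) refl q₃ sv

   hp : 2 ≤ cntL (e p) P'
   hp = subst (λ t → 2 ≤ cntL (e p) t) (tl≡ (sym U.P≡)) U.pc2
    where tl≡ : ∀ {l m : List V} → _≡_ {A = List V} (p ∷ l) (p ∷ m) → l ≡ m
          tl≡ refl = refl

   hq : 2 ≤ cntL (e q) U.Q'
   hq = ≤-trans (≡⇒≤ (sym (snd (snd U.dR2)))) U.Y.dR≤

   shp : Shape P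
   shp = shape (cfg o) (lw L) (lU L) (lz L) (lw U.L₂) U.Q≡ pq hp hq

   bar-ends : (B : Barbell P) → let open Barbell B in Tg l1 × Tg l2 × Tg m1 × Tg m2
   bar-ends B = fst b , fst a , snd b , snd a
    where
    x = bar-path₂ B
    y = bar-path-m B
    a = ends (snd (snd x)) (fst (snd x))
    b = ends (snd (snd y)) (fst (snd y))

   th-ends : (θ : Theta P) → let open Theta θ in Tg x1' × Tg x3
   th-ends θ = ends (fst (th-path θ)) (snd (th-path θ))

  UUof : ∀ {c} (q₃ : K33 κ c) {T} → Unique T → (∀ {x} → x ∈ T → κ x ≡ fz) → (∀ {x} → x ∈ T → x ∉ P) →
   Unique (K33.a₁ q₃ ∷ K33.a₂ q₃ ∷ K33.a₃ q₃ ∷ K33.b₂ q₃ ∷ T ++ P)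
  UUof q₃ uT rT pT = ⊑-U (keep (keep (keep (skip (keep (skip ⊑-refl)))))) (mixU (K33.l33 q₃) (U-++ uT (lU L) pT) (λ m → [ rT , lz L ]′ (∈-++⁻ _ m)))

  -- Both ends of the detached path are low, hence on the same side as the ends of `P`. The detached
  -- path then serves one chorded cycle and `P` the other.
  pair-dead : PairAt → ⊥
  pair-dead (mkPair {pv} {pu} {pt} {T} puw pw pU pR pP pd pd') = go X.shp
   where
   kt = pR (there (w-last∈ pw))
   nt = pP (there (w-last∈ pw))
   module X = V1 (pR i1) pd (pP i1)
   module Y = V1 kt pd' nt
   tT : X.Tg pt
   tT = f (side o X.q₃ kt (fst (Y.U.D3 c₀)))
    where
    f : SideA X.q₃ pt ⊎ SideB X.q₃ pt → X.Tg pt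
    f (inj₁ s) = fst s
    f (inj₂ s) = ⊥-elim (true≢false (sym (fst (X.ends (lw L) refl) i1) ⨾ snd (fst (One.offSides kt pd' L nt (flip33 X.q₃) s)) i1))
   uT : Unique T
   uT = U-++ʳ (pv ∷ []) pU
   R-pv∷P : ∀ {y} → y ∈ pv ∷ P → κ y ≡ fz
   R-pv∷P i1 = pR i1
   R-pv∷P (there m) = lz L m
   -- The low vertex `pv` is counted to `P`, so that the attached path is the reverse of `T`, ending
   -- at `pu`, with attachment `pv`.
   module Z = BT o X.q₃ (w-rev pw) tT {P = pv ∷ P}
    (U-↭ (prep _ (prep _ (prep _ (prep _ (↭-trans (re↭ refl) (↭-trans (Perm.++⁺ʳ P (prep pv (↭-sym (Perm.↭-reverse T)))) (↭-sym (Perm.shift pv (reverse T) P))))))))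
    (UUof X.q₃ pU pR pP))
    (λ m → inj₁ (pR (there (Perm.∈-resp-↭ (Perm.↭-reverse T) m)))) R-pv∷P
   go : Shape P → ⊥
   go (bar B) = Z.pair-bar refl puw (fst X.sv) B (fst r) (fst (snd r)) (fst (snd (snd r)))
    where r = X.bar-ends B
   go (the θ) = Z.pair-theta refl puw (fst X.sv) θ (snd (X.th-ends (th-rot θ))) (snd (X.th-ends (th-rot (th-rot θ)))) (snd (X.th-ends θ))

  module TailCase (tl : TailAt) where
   open TailAt tl
   kv = aR (w-head∈ aw)
   nv = aP (w-head∈ aw)
   open V1 kv ad nv
   open Theta-ends kv ad L nv
   module Z = BT o q₃ aw (fst sv) {P = P} (UUof q₃ aU aR aP) (inj₁ ∘ aR) (lz L)

   az-off : ∀ {p2 P2 q2} → Walk p2 P2 q2 → P2 ↭ P → ay ≢ p2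
   az-off w h refl = true≢false (sym ae ⨾ end-off w h (aR (w-last∈ aw)) (aP (w-last∈ aw)))

   tail-bar : Barbell P → ⊥
   tail-bar B = Z.bar-kill B (fst r) (fst (snd r)) (fst (snd (snd r))) (snd (snd (snd r))) ay∈ ae
    (az-off (snd (snd y)) (fst (snd y))) (az-off (w-rev (snd (snd y))) (↭-trans (Perm.↭-reverse _) (fst (snd y))))
    where
    r = bar-ends B
    y = bar-path-m B

   tight : (θ : Theta P) → Z.Tight θ
   tight θ = Z.mkTight (snd b) (fst a) (snd c) (fst b) (snd a) (fst c)
    where
    a = th-ends θ
    b = th-ends (th-rot θ)
    c = th-ends (th-rot (th-rot θ))

   not-end₁ : (θ : Theta P) → ay ≢ Theta.x1' θ
   not-end₁ θ = az-off (fst (th-path θ)) (snd (th-path θ))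
   not-end₃ : (θ : Theta P) → ay ≢ Theta.x3 θ
   not-end₃ θ = az-off (w-rev (fst (th-path θ))) (↭-trans (Perm.↭-reverse _) (snd (th-path θ)))

   -- The attachment `ay` is not an end of a path spanning `P`, hence no arm end; for an arm with
   -- two vertices `th-kill` would exclude all other positions.
   short₂ : (θ : Theta P) → let open Theta θ in X2 ≡ x2 ∷ [] × x2 ≡ x2'
   short₂ θ = go (one-or-long w2)
    where
    open Theta θ
    go : (X2 ≡ x2 ∷ [] × x2 ≡ x2') ⊎ (Σ[ X' ∈ List V ] Σ[ y ∈ V ] (X2 ≡ x2 ∷ X' × x2 ~ y × Walk y X' x2')) → X2 ≡ x2 ∷ [] × x2 ≡ x2'
    go (inj₁ r) = r
    go (inj₂ (X' , y , eX , g , w')) = ⊥-elim (Z.th-kill θ (tight θ) eX g w' ay∈ ae (not-end₃ (th-rot θ)) (not-end₃ (th-rot (th-rot θ))) (not-end₃ θ) (not-end₁ (th-rot θ)))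

   five : (θ : Theta P) → Σ[ a ∈ V ] Σ[ b ∈ V ] Σ[ x ∈ V ] Σ[ y ∈ V ] Σ[ z ∈ V ] (a ∷ b ∷ x ∷ y ∷ z ∷ [] ↭ P ×
    (∀ {v} → v ∈ x ∷ y ∷ z ∷ [] → v ~ a × v ~ b × Σ[ P2 ∈ List V ] Σ[ q2 ∈ V ] (Walk v P2 q2 × P2 ↭ P)))
   five θ = β₁ , β₂ , x1 , x2 , x3 , ↭-trans perm P↭ , f
    where
    open Theta θ
    s1 = short₂ (th-rot (th-rot θ))
    s2 = short₂ θ
    s3 = short₂ (th-rot θ)
    perm : β₁ ∷ β₂ ∷ x1 ∷ x2 ∷ x3 ∷ [] ↭ X1 ++ β₁ ∷ X2 ++ β₂ ∷ X3
    perm = ↭-trans (↭-trans (prep β₁ (↭-trans (swap β₂ x1 refl) (prep x1 (swap β₂ x2 refl)))) (swap β₁ x1 refl))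
     (re↭ (sym (cong₂ _++_ (fst s1) (cong (β₁ ∷_) (cong₂ _++_ (fst s2) (cong (β₂ ∷_) (fst s3)))))))
    pth : ∀ (θ' : Theta P) → Σ[ P2 ∈ List V ] Σ[ q2 ∈ V ] (Walk (Theta.x3 θ') P2 q2 × P2 ↭ P)
    pth θ' = _ , _ , w-rev (fst (th-path θ')) , ↭-trans (Perm.↭-reverse _) (snd (th-path θ'))
    f : ∀ {v} → v ∈ x1 ∷ x2 ∷ x3 ∷ [] → v ~ β₁ × v ~ β₂ × Σ[ P2 ∈ List V ] Σ[ q2 ∈ V ] (Walk v P2 q2 × P2 ↭ P)
    f i1 = adj-sym β1 , subst (λ t → t ~ β₂) (sym (snd s1)) b1β , pth (th-rot θ)
    f i2 = adj-sym β2 , subst (λ t → t ~ β₂) (sym (snd s2)) b2β , pth (th-rot (th-rot θ))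
    f i3 = adj-sym β3 , subst (λ t → t ~ β₂) (sym (snd s3)) b3β , pth θ

   module K23P {a b x y z : V} (h5 : a ∷ b ∷ x ∷ y ∷ z ∷ [] ↭ P)
    (h : ∀ {v} → v ∈ x ∷ y ∷ z ∷ [] → v ~ a × v ~ b × Σ[ P2 ∈ List V ] Σ[ q2 ∈ V ] (Walk v P2 q2 × P2 ↭ P)) where

    U5 : Unique (a ∷ b ∷ x ∷ y ∷ z ∷ [])
    U5 = U-↭ (↭-sym h5) (lU L)

    hx = h i1
    hy = h i2
    hz = h i3

    not-xyz : ∀ {v} → v ∈ x ∷ y ∷ z ∷ [] → ay ≢ v
    not-xyz m = az-off (fst (snd (snd (snd (snd (h m)))))) (snd (snd (snd (snd (snd (h m))))))

    ab : ay ≡ a ⊎ ay ≡ b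
    ab = f (Perm.∈-resp-↭ (↭-sym h5) ay∈)
     where f : ay ∈ a ∷ b ∷ x ∷ y ∷ z ∷ [] → ay ≡ a ⊎ ay ≡ b
           f (here r) = inj₁ r
           f (there (here r)) = inj₂ r
           f (there (there m)) = ⊥-elim (not-xyz m refl)

    longer : ∀ {c d} → Walk ay (ay ∷ x ∷ c ∷ y ∷ []) d → Unique (ay ∷ x ∷ c ∷ y ∷ []) → (∀ {v} → v ∈ ay ∷ x ∷ c ∷ y ∷ [] → v ∈ P) → length aT ≤ 1
    longer w u i = +-cancelʳ-≤ 4 (length aT) 1 (≤-trans (≡⇒≤ (sym (length-++ aT))) (≤-trans
     (lmax L o (w-join aw ae w) (U-++ aU u (λ m m' → aP m (i m'))) (λ m → [ aR , lz L ∘ i ]′ (∈-++⁻ aT m))) (≡⇒≤ (sym (Perm.↭-length h5)))))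

    -- From either small-side vertex of the K₂,₃ a path covers four of its vertices; together with
    -- `aT` it must not exceed the five vertices of the longest path.
    T1 : length aT ≤ 1
    T1 = f ab
     where
     f : ay ≡ a ⊎ ay ≡ b → length aT ≤ 1
     f (inj₁ r) = subst (λ t → Walk t (t ∷ x ∷ b ∷ y ∷ []) y → Unique (t ∷ x ∷ b ∷ y ∷ []) → (∀ {v} → v ∈ t ∷ x ∷ b ∷ y ∷ [] → v ∈ P) → length aT ≤ 1) r longer
      (adj-sym (fst hx) ∷ fst (snd hx) ∷ adj-sym (fst (snd hy)) ∷ one) (⊑-U (keep (keep (keep (keep (skip done))))) (U-↭ (prep a (swap b x refl)) U5))
      (λ m → Perm.∈-resp-↭ h5 (Perm.∈-resp-↭ (prep a (swap x b refl)) (⊑-∈ (keep (keep (keep (keep (skip done))))) m)))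
     f (inj₂ r) = subst (λ t → Walk t (t ∷ x ∷ a ∷ y ∷ []) y → Unique (t ∷ x ∷ a ∷ y ∷ []) → (∀ {v} → v ∈ t ∷ x ∷ a ∷ y ∷ [] → v ∈ P) → length aT ≤ 1) r longer
      (adj-sym (fst (snd hx)) ∷ fst hx ∷ adj-sym (fst hy) ∷ one) (⊑-U (keep (keep (keep (keep (skip done))))) (U-↭ pm U5))
      (λ m → Perm.∈-resp-↭ h5 (Perm.∈-resp-↭ (↭-sym pm) (⊑-∈ (keep (keep (keep (keep (skip done))))) m)))
      where pm : a ∷ b ∷ x ∷ y ∷ z ∷ [] ↭ b ∷ x ∷ a ∷ y ∷ z ∷ []
            pm = ↭-trans (swap a b refl) (prep b (swap a x refl))

    module _ {u : V} (ku : κ u ≡ fz) (nu : u ∉ P) where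

     nbrP : ∀ {v} → κ v ≡ fz → u ~ v → v ∈ P
     nbrP {v} kw uv with v ∈? P
     ... | yes m = m
     ... | no nm = ⊥-elim (<-irrefl refl (≤-trans (am (uv ∷ one) (uq2 (adj-≢ uv)) (in2 {κ} ku kw) (λ { i1 → nu ; i2 → nm })) T1))

     c≤2 : cntL (e u) P ≤ 2
     c≤2 with 3 ≤? cntL (e u) P
     ... | no r = ≤-pred (≰⇒> r)
     ... | yes r = ⊥-elim (noCC₀ (cfg o) (mkCC (lw L) (U-cons nu (lU L)) r) (λ { i1 → ku ; (there m) → lz L m }))

     dR≤c : dR κ u ≤ cntL (e u) P
     dR≤c = cntL-⊆' (e u) (lu (cls-L κ fz)) (λ m uv → nbrP (l⇒ (cls-L κ fz) m) uv)

     du : dR κ u ≤ 2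
     du = ≤-trans dR≤c c≤2

     module Uu = V1 ku du nu

     na : ∀ {v} → v ∈ x ∷ y ∷ z ∷ [] → u ≁ v
     na m = end-off (fst (snd (snd (snd (snd (h m)))))) (snd (snd (snd (snd (snd (h m)))))) ku nu

     uab : u ~ a × u ~ b
     uab = f (e u a) (e u b) (≤-trans (≡⇒≤ (sym (fst Uu.U.dR2))) (≤-trans dR≤c (≡⇒≤ (cntL-↭ (e u) (↭-sym h5)
      ⨾ cong (λ t → b2n (e u a) + (b2n (e u b) + t)) (cntL-zero (e u) (x ∷ y ∷ z ∷ []) na)))))
      where f : ∀ s t → 2 ≤ b2n s + (b2n t + 0) → s ≡ true × t ≡ true
            f true true _ = refl , refl
            f true false (s≤s ())
            f false true (s≤s ())
            f false false ()

     uside : ∀ {c} (q' : K33 κ c) → SideA q' x → SideA q' u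
     uside {c} q' sx = f (side o q' ku (fst (Uu.U.D3 c)))
      where f : SideA q' u ⊎ SideB q' u → SideA q' u
            f (inj₁ s) = s
            f (inj₂ s) = ⊥-elim (true≢false (sym (fst sx i1) ⨾ snd (fst (One.offSides ku du (LP-perm L (fst px) (snd px)) (λ m → nu (Perm.∈-resp-↭ (snd px) m)) (flip33 q') s)) i1))
             where px = snd (snd (snd (snd hx)))

    rest : List V
    rest = filter (λ u → dec¬ (u ∈? P)) (cls κ fz)
     where dec¬ : ∀ {X : Set} → Dec X → Dec (¬ X)
           dec¬ (yes r) = no (λ f → f r)
           dec¬ (no r) = yes r

    rest-m : ∀ {u} → u ∈ rest → κ u ≡ fz × u ∉ P
    rest-m m = l⇒ (cls-L κ fz) (fst r) , snd r
     where r = ∈-filter⁻ _ {xs = cls κ fz} m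

    kl : Lst κ fz (a ∷ b ∷ x ∷ y ∷ z ∷ rest)
    kl = mkL (U-++ U5 (Uniq.filter⁺ _ (lu (cls-L κ fz))) (λ m m' → snd (rest-m m') (Perm.∈-resp-↭ h5 m)))
     (λ m → [ (λ r → lz L (Perm.∈-resp-↭ h5 r)) , (λ r → fst (rest-m r)) ]′ (∈-++⁻ (a ∷ b ∷ x ∷ y ∷ z ∷ []) m))
     g
     where
     g : ∀ {u} → κ u ≡ fz → u ∈ a ∷ b ∷ x ∷ y ∷ z ∷ rest
     g {u} ku with u ∈? P
     ... | yes m = ∈-++⁺ˡ (Perm.∈-resp-↭ (↭-sym h5) m)
     ... | no nm = ∈-++⁺ʳ (a ∷ b ∷ x ∷ y ∷ z ∷ []) (∈-filter⁺ _ (l⇐ (cls-L κ fz) ku) nm)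

    result : K2s κ
    result = mkK2s o kl (λ m → fst (vab m)) (λ m → snd (vab m)) sd
     where
     vab : ∀ {v} → v ∈ x ∷ y ∷ z ∷ rest → v ~ a × v ~ b
     vab m = [ (λ r → fst (h r) , fst (snd (h r))) , (λ r → uab (fst (rest-m r)) (snd (rest-m r))) ]′ (∈-++⁻ (x ∷ y ∷ z ∷ []) m)
     sd : ∀ c → Σ[ q' ∈ K33 κ c ] (∀ {v} → v ∈ x ∷ y ∷ z ∷ rest → SideA q' v)
     sd c = fst Qc , λ m → [ s3 , (λ r → uside (fst (rest-m r)) (snd (rest-m r)) (fst Qc) (s3 i1)) ]′ (∈-++⁻ (x ∷ y ∷ z ∷ []) m)
      where
      Qc = One.off33 kv ad L nv c
      s3 : ∀ {v} → v ∈ x ∷ y ∷ z ∷ [] → SideA (fst Qc) v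
      s3 m = fst (tight↭ (fst px) (snd px) (fst Qc) (snd Qc))
       where px = snd (snd (snd (snd (h m))))

    size3 : 3 ≤ length (K2s.Vs result)
    size3 = s≤s (s≤s (s≤s z≤n))

   tail-case : Σ[ k ∈ K2s κ ] 3 ≤ length (K2s.Vs k)
   tail-case = go shp
    where
    go : Shape P → Σ[ k ∈ K2s κ ] 3 ≤ length (K2s.Vs k)
    go (bar B) = ⊥-elim (tail-bar B)
    go (the θ) = K23P.result h5 hh , K23P.size3 h5 hh
     where
     r = snd (snd (snd (snd (snd (five θ)))))
     h5 = fst r
     hh = snd r

  caseA : ∀ {r} → κ r ≡ fz → r ∉ P → (Σ[ k ∈ K2s κ ] 3 ≤ length (K2s.Vs k) → ⊥) → ⊥
  caseA {r} kr nr kont = maximal {V × List V × V} (λ (a , Q , b) → Walk a Q b × Unique Q × (∀ {x} → x ∈ Q → κ x ≡ fz) × (∀ {x} → x ∈ Q → x ∉ P))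
   (λ (a , Q , b) → length Q) (length (allFin n)) (λ (a , Q , b) (_ , u , _) → U-⊆-length u (λ _ → ∈-allFin _)) (r , r ∷ [] , r) (one , uq1 , in1 {κ} kr , λ { i1 → nr })
   λ (a , Q , b) (w , u , zr , zp) mx → go (mkQ w u zr zp (λ w' u' r' p' → mx (_ , _ , _) (w' , u' , r' , p')))
   where
   go : ∀ {a Q b} → MaxQ a Q b → ⊥
   go {a} {Q} M = f (both M)
    where
    f : TailAt ⊎ PairAt ⊎ (Q ≡ a ∷ [] × cntL (e a) P ≡ 0 × dR κ a ≤ 2) → ⊥
    f (inj₁ t) = kont (TailCase.tail-case t)
    f (inj₂ (inj₁ pr)) = pair-dead pr
    -- Here `a` is isolated in R, whereas a low vertex off the path has degree exactly 2 there.
    f (inj₂ (inj₂ (Q≡ , c0 , da))) = 0≢2 (sym d0 ⨾ fst (One.Use.dR2 ka da L na))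
     where
     a∈ : a ∈ Q
     a∈ = w-head∈ (MaxQ.qw M)
     ka = MaxQ.qR M a∈
     na = MaxQ.qP M a∈
     0≢2 : 0 ≢ 2
     0≢2 ()
     d0 : dR κ a ≡ 0
     d0 = cntL-zero (e a) (cls κ fz) (λ {x} m → ¬t→f λ ax → g m ax)
      where
      g : ∀ {x} → x ∈ cls κ fz → a ~ x → ⊥
      g {x} m ax with x ∈? P
      ... | yes xP = true≢false (sym ax ⨾ cntL-zero⁻ (e a) P c0 xP)
      ... | no nx with cast∈ Q≡ (onQ M (l⇒ (cls-L κ fz) m) nx ax)
      ... | here refl = adj-≢ ax refl

 -- R is spanned by a path

 -- The last criterion: most edges in R among all optimal colourings whose remainder has a spanning
 -- path.
 record HamP (κ : V → K) (P : List V) : Set where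
  constructor mkHam
  field
   ho : Opt κ
   hl : Lst κ fz P
   hm : ∀ {κ' p' P' q'} → Opt κ' → Walk p' P' q' → Lst κ' fz P' → eL P' ≤ eL P
 open HamP public

 -- The pendant vertex has degree 1 and the two far vertices of the triangle have degree 2, so the
 -- two nonadjacent pairs have 6 instead of 8 inside R, while no class exceeds 12.
 paw : ∀ {κ} → Opt κ → ∀ {z c y₁ y₂} → Lst κ fz (z ∷ c ∷ y₁ ∷ y₂ ∷ []) → z ~ c → c ~ y₁ → c ~ y₂ → y₁ ~ y₂ →
  z ≁ y₁ → z ≁ y₂ → ⊥
 paw {κ} o {z} {c} {y₁} {y₂} l zc cy₁ cy₂ yy zy₁ zy₂ = arithA 6 ≤-refl k' _ _ main (≡⇒≤ dsum) (ΣF-upper f≤12)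
  where
  ks : ∀ {x} → x ∈ z ∷ c ∷ y₁ ∷ y₂ ∷ [] → κ x ≡ fz
  ks = l⇒ l
  kz = ks i1
  ky₁ = ks i3
  ky₂ = ks i4
  z≢1 : z ≢ y₁
  z≢1 refl = U∉ (lu l) i2
  z≢2 : z ≢ y₂
  z≢2 refl = U∉ (lu l) i3
  dz : dR κ z ≡ 1
  dz = d-L l z ⨾ cong₂ _+_ (cong b2n (E-irr G z)) (cong₂ _+_ (cong b2n zc) (cong₂ _+_ (cong b2n zy₁) (cong (λ t → b2n t + 0) zy₂)))
  dy₁ : dR κ y₁ ≡ 2
  dy₁ = d-L l y₁ ⨾ cong₂ _+_ (cong b2n (nadj-sym zy₁)) (cong₂ _+_ (cong b2n (adj-sym cy₁)) (cong₂ _+_ (cong b2n (E-irr G y₁)) (cong (λ t → b2n t + 0) yy)))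
  dy₂ : dR κ y₂ ≡ 2
  dy₂ = d-L l y₂ ⨾ cong₂ _+_ (cong b2n (nadj-sym zy₂)) (cong₂ _+_ (cong b2n (adj-sym cy₂)) (cong₂ _+_ (cong b2n (adj-sym yy)) (cong (λ t → b2n t + 0) (E-irr G y₂))))
  dsum : (dR κ z + dR κ y₁) + (dR κ z + dR κ y₂) ≡ 6
  dsum = cong₂ _+_ (cong₂ _+_ dz dy₁) (cong₂ _+_ dz dy₂)
  f : Fin k' → ℕ
  f c = (D κ z c + D κ y₁ c) + (D κ z c + D κ y₂ c)
  main : (6 * k' + 4) + (6 * k' + 4) ≤ ((dR κ z + dR κ y₁) + (dR κ z + dR κ y₂)) + ΣF f
  main = ≤-trans (+-mono-≤ (PI κ z≢1 zy₁) (PI κ z≢2 zy₂)) (≡⇒≤ (+-inter (dR κ z + dR κ y₁) _ (dR κ z + dR κ y₂) _ ⨾ cong ((dR κ z + dR κ y₁) + (dR κ z + dR κ y₂) +_) (sym (ΣF-+ (λ c → D κ z c + D κ y₁ c) (λ c → D κ z c + D κ y₂ c)))))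
  F : ∀ {c' x y s w} → Tet κ c' x y s w → le? 2 (sumB (e z y ∷ e z s ∷ e z w ∷ [])) ∧ e y₁ x ∧ e y₂ x ≡ true → ⊥
  F {c'} {x} {y} {s} {w} t h = go (∧3 (le? 2 (sumB (e z y ∷ e z s ∷ e z w ∷ []))) (e y₁ x) (e y₂ x) h)
   where
   kx : κ x ≡ fs c'
   kx = l⇒ (Tet.tl4 t) i1
   u4 : Unique (x ∷ c ∷ y₁ ∷ y₂ ∷ [])
   u4 = U-cons (λ m → Fin.0≢1+n (sym (ks (there m)) ⨾ kx)) (U-++ʳ (z ∷ []) (lu l))
   go : le? 2 (sumB (e z y ∷ e z s ∷ e z w ∷ [])) ≡ true × y₁ ~ x × y₂ ~ x → ⊥
   go (a , b , b') = tet-two o t kz (le?-sound 2 (sumB (e z y ∷ e z s ∷ e z w ∷ [])) a) (fst C) (λ m → g (snd C m))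
    where
    C = CC! (vx x) (vx c ∷ vx y₁ ∷ vx y₂ ∷ []) u4 (2 - 0 ! b ∷ 3 - 0 ! b' ∷ 1 - 2 ! cy₁ ∷ 1 - 3 ! cy₂ ∷ 2 - 3 ! yy ∷ [])
     2 (fw 0 ∷ fw 3 ∷ fw 1 ∷ []) refl
    g : ∀ {v} → v ∈ x ∷ c ∷ y₁ ∷ y₂ ∷ [] → v ≢ z × (v ≡ x ⊎ κ v ≡ fz)
    g i1 = (λ { refl → Fin.0≢1+n (sym kz ⨾ kx) }) , inj₁ refl
    g (there m) = (λ { refl → U∉ (lu l) m }) , inj₂ (ks (there m))
  f≤12 : ∀ c → f c ≤ 12
  f≤12 c' = go (isTet o c')
   where
   go : (Σ[ x ∈ V ] Σ[ y ∈ V ] Σ[ s ∈ V ] Σ[ w ∈ V ] Tet κ c' x y s w) ⊎ (∀ {v} → κ v ≡ fz → D κ v c' ≤ 3) → f c' ≤ 12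
   go (inj₂ le) = +-mono-≤ (+-mono-≤ (le kz) (le ky₁)) (+-mono-≤ (le kz) (le ky₂))
   go (inj₁ (x , y , s , w , t)) = ≤-trans (≡⇒≤ (cong₂ _+_ (cong₂ _+_ (tet-D t z) (tet-D t y₁)) (cong₂ _+_ (tet-D t z) (tet-D t y₂))))
    (wtpaw (e z x ∷ e z y ∷ e z s ∷ e z w ∷ e y₁ x ∷ e y₁ y ∷ e y₁ s ∷ e y₁ w ∷ e y₂ x ∷ e y₂ y ∷ e y₂ s ∷ e y₂ w ∷ [])
    (∧-i (nots (F t)) (∧-i (nots (F (trot t))) (∧-i (nots (F (trot (trot t)))) (nots (F (trot (trot (trot t)))))))))

 C4 K23 : (V → K) → Set
 C4 κ = Σ[ p1 ∈ V ] Σ[ p2 ∈ V ] Σ[ p3 ∈ V ] Σ[ p4 ∈ V ] (Lst κ fz (p1 ∷ p2 ∷ p3 ∷ p4 ∷ []) × p1 ~ p2 × p2 ~ p3 × p3 ~ p4 × p4 ~ p1)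
 K23 κ = Σ[ a ∈ V ] Σ[ b ∈ V ] Σ[ x ∈ V ] Σ[ y ∈ V ] Σ[ z ∈ V ] (Lst κ fz (a ∷ b ∷ x ∷ y ∷ z ∷ []) × (∀ {v} → v ∈ x ∷ y ∷ z ∷ [] → v ~ a × v ~ b))

 HamP-perm : ∀ {κ P P₂} → P₂ ↭ P → HamP κ P → HamP κ P₂
 HamP-perm h (mkHam o l m) = mkHam o (L-perm (↭-sym h) l) (λ o' w l' → ≤-trans (m o' w l') (≡⇒≤ (eL-↭ (↭-sym h))))

 w-uncons : ∀ {a l b} → Walk a l b → a ≢ b → Σ[ l' ∈ List V ] Σ[ x ∈ V ] (l ≡ a ∷ l' × a ~ x × Walk x l' b)
 w-uncons one ne = ⊥-elim (ne refl)
 w-uncons (g ∷ w) ne = _ , _ , refl , g , w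

 bar-flip : ∀ {P} (B : Barbell P) → Unique P → Σ[ B' ∈ Barbell (reverse P) ] length (Barbell.L B') ≡ length (Barbell.Mz B)
 bar-flip {P} (mkBar {l1} {l2} {m1 = m1} {m2} {L = L} {N'} {Mz} l1l' wL wN m1m' wM P≡ l2n1 l1n1 n2m1 n2m2) u = go (w-uncons (w-rev (m1m' ∷ wM)) m≢) (w-uncons (w-rev (l1l' ∷ wL)) l≢)
  where
  uL : Unique (l1 ∷ L)
  uL = U-++ˡ (l1 ∷ L) (subst Unique P≡ u)
  uM : Unique (m1 ∷ Mz)
  uM = U-++ʳ N' (U-++ʳ (l1 ∷ L) (subst Unique P≡ u))
  l≢ : l2 ≢ l1
  l≢ refl = U∉ uL (w-last∈ wL)
  m≢ : m2 ≢ m1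
  m≢ refl = U∉ uM (w-last∈ wM)
  go : Σ[ l ∈ List V ] Σ[ x ∈ V ] (reverse (m1 ∷ Mz) ≡ m2 ∷ l × m2 ~ x × Walk x l m1) → Σ[ l ∈ List V ] Σ[ x ∈ V ] (reverse (l1 ∷ L) ≡ l2 ∷ l × l2 ~ x × Walk x l l1) → Σ[ B' ∈ Barbell (reverse P) ] length (Barbell.L B') ≡ length Mz
  go (M' , x , eM , gx , wx) (L' , y , eL' , gy , wy) = (mkBar gx wx (w-rev wN) gy wy
   (cong reverse P≡ ⨾ reverse-++ (l1 ∷ L) (N' ++ m1 ∷ Mz) ⨾ cong₂ _++_ (reverse-++ N' (m1 ∷ Mz)) refl ⨾ ++-assoc (reverse (m1 ∷ Mz)) (reverse N') _ ⨾ cong₂ _++_ eM (cong (reverse N' ++_) eL'))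
   (adj-sym n2m1) (adj-sym n2m2) (adj-sym l2n1) (adj-sym l1n1)) , suc-injective (sym (cong length eM) ⨾ length-reverse (m1 ∷ Mz))

 pred : ∀ {a a' l b} → a ~ a' → Walk a' l b → Σ[ x ∈ V ] (b ~ x × x ∈ a ∷ l)
 pred g one = _ , adj-sym g , here refl
 pred g (g' ∷ w) with pred g' w
 ... | x , bx , m = x , bx , there m

 module Ham3 {κ : V → K} {P : List V} (H : HamP κ P) where

  o = ho H

  -- A start of some spanning path of R. The rest of R is then a path, which limits such a vertex to
  -- two neighbours in R.
  record Head (s : V) : Set where
   constructor mkHead
   field
    {hr} : List V
    {ht} : V
    hw : Walk s (s ∷ hr) ht
    h↭ : s ∷ hr ↭ P

  mkHd : ∀ {s Q t} → Walk s Q t → Q ↭ P → Head s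
  mkHd {s} {Q} {t} w h = mkHead (subst (λ z → Walk s z t) (snd r) w) (↭-trans (re↭ (sym (snd r))) h)
   where r = w-head w

  module _ {s : V} (hs : Head s) where
   open Head hs

   hU : Unique (s ∷ hr)
   hU = U-↭ (↭-sym h↭) (lu (hl H))

   h0 : ∀ {x} → x ∈ s ∷ hr → κ x ≡ fz
   h0 m = l⇒ (hl H) (Perm.∈-resp-↭ h↭ m)

   hk : κ s ≡ fz
   hk = h0 i1

   in-hr : ∀ {x} → κ x ≡ fz → x ≢ s → x ∈ hr
   in-hr {x} kx ne = f (Perm.∈-resp-↭ (↭-sym h↭) (l⇐ (hl H) kx))
    where f : x ∈ s ∷ hr → x ∈ hr
          f (there m) = m
          f (here r) = ⊥-elim (ne r)

   hrCC : ∀ {x} → x ∉ hr → 3 ≤ cntL (e x) hr → Σ[ C ∈ CC ] (∀ {a} → a ∈ vs C → a ≡ x ⊎ a ∈ hr)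
   hrCC {x} nx h = go hr refl hw h
    where
    go : ∀ R → R ≡ hr → Walk s (s ∷ R) ht → 3 ≤ cntL (e x) R → Σ[ C ∈ CC ] (∀ {a} → a ∈ vs C → a ≡ x ⊎ a ∈ hr)
    go (y ∷ R) refl w h = mkCC (snd (w-2nd w)) (U-cons nx (U-++ʳ (s ∷ []) hU)) h , λ { (here r) → inj₁ r ; (there m) → inj₂ m }

   s-le2 : cntL (e s) hr ≤ 2
   s-le2 with 3 ≤? cntL (e s) hr
   ... | no r = ≤-pred (≰⇒> r)
   ... | yes r = ⊥-elim (noCC₀ (cfg o) (fst C) (λ m → [ (λ { refl → hk }) , h0 ∘ there ]′ (snd C m)))
    where C = hrCC (U∉ hU) r

   s-dR : dR κ s ≡ cntL (e s) hr
   s-dR = d-L (L-perm (↭-sym h↭) (hl H)) s ⨾ cong (λ t → b2n t + cntL (e s) hr) (E-irr G s)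

   s-dR2 : dR κ s ≤ 2
   s-dR2 = ≤-trans (≡⇒≤ s-dR) s-le2

   no3rd : ∀ {x y z} → κ x ≡ fz → κ y ≡ fz → κ z ≡ fz → x ≢ y → x ≢ z → y ≢ z → s ~ x → s ~ y → s ≁ z
   no3rd kx ky kz xy xz yz sx sy = ¬t→f λ sz → <-irrefl refl (≤-trans (three-cnt (e s) xy xz yz (in-hr kx (adj-≢ sx ∘ sym)) (in-hr ky (adj-≢ sy ∘ sym)) (in-hr kz (adj-≢ sz ∘ sym)) sx sy sz) s-le2)

   -- `s` and the triangle of the K₄ form one chorded cycle; `x` with three neighbours on the path R
   -- without `s` would give another.
   tet3 : ∀ {c x y z w} → Tet κ c x y z w → 2 ≤ sumB (e s y ∷ e s z ∷ e s w ∷ []) → ∀ {u v t} → κ u ≡ fz → κ v ≡ fz → κ t ≡ fz →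
    u ≢ s → v ≢ s → t ≢ s → u ≢ v → u ≢ t → v ≢ t → e u x ∧ e v x ∧ e t x ≡ true → ⊥
   tet3 {c} {x} t h {u} {v} {w'} ku kv kt us vs' ts uv ut vt hh = tet-two o t hk h (fst C) (λ m → f (snd C m))
    where
    kx : κ x ≡ fs c
    kx = l⇒ (Tet.tl4 t) i1
    hx = ∧3 (e u x) (e v x) (e w' x) hh
    C = hrCC {x} (λ m → Fin.0≢1+n (sym (h0 (there m)) ⨾ kx)) (three-cnt (e x) uv ut vt (in-hr ku us) (in-hr kv vs') (in-hr kt ts)
     (adj-sym (fst hx)) (adj-sym (fst (snd hx))) (adj-sym (snd (snd hx))))
    f : ∀ {a} → a ≡ x ⊎ a ∈ hr → a ≢ s × (a ≡ x ⊎ κ a ≡ fz)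
    f (inj₁ refl) = (λ { refl → Fin.0≢1+n (sym hk ⨾ kx) }) , inj₁ refl
    f (inj₂ m) = (λ { refl → U∉ hU m }) , inj₂ (h0 (there m))

   -- `s` takes the place of `a` in the class, and `a` becomes the hub of a chorded cycle on the
   -- path R without `s`.
   kill33 : ∀ {c} (q₃ : K33 κ c) → SideB q₃ s → ∀ {a} → a ∈ K33.A q₃ → ∀ {u v t} → κ u ≡ fz → κ v ≡ fz → κ t ≡ fz →
    u ≢ s → v ≢ s → t ≢ s → u ≢ v → u ≢ t → v ≢ t → u ~ a → v ~ a → t ~ a → ⊥
   kill33 {c} q₀ sB {a} a∈ {u} {v} {w'} ku kv kt us vs' ts uv ut vt ua va ta = go (pickA q₀ a∈)
    where
    go : PickA q₀ a → ⊥
    go record { q' = mk33 {a1} {a2} {a3} {b1} {b2} {b3} l ad ; a₁≡ = refl ; B≡ = B≡ } = two (cfg o) c (fst C) (fst D')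
     (λ m → f (snd C m)) (λ m → mixI {κ} l (in1 {κ} hk) (there (snd D' m))) (λ p q → dj (snd C p) (snd D' q))
     where
     ka : κ a1 ≡ fs c
     ka = l⇒ l i1
     C = hrCC {a1} (λ m → Fin.0≢1+n (sym (h0 (there m)) ⨾ ka)) (three-cnt (e a1) uv ut vt (in-hr ku us) (in-hr kv vs') (in-hr kt ts) (adj-sym ua) (adj-sym va) (adj-sym ta))
     u7 : Unique (a1 ∷ a2 ∷ a3 ∷ b1 ∷ b2 ∷ b3 ∷ s ∷ [])
     u7 = mixU l uq1 (in1 {κ} hk)
     sb : ∀ {b} → b ∈ b1 ∷ b2 ∷ b3 ∷ [] → s ~ b
     sb m = fst sB (cast∈ B≡ m)
     D' : Σ[ C ∈ CC ] (∀ {x} → x ∈ vs C → x ∈ a2 ∷ a3 ∷ b1 ∷ b2 ∷ b3 ∷ s ∷ [])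
     D' = CC! (vx a2) (vx a3 ∷ vx b1 ∷ vx b2 ∷ vx b3 ∷ vx s ∷ []) (U-++ʳ (a1 ∷ []) u7)
      (5 - 2 ! sb i1 ∷ 5 - 3 ! sb i2 ∷ (hd 5 , hd 4 , sb i3) ∷
      0 - 2 ! ad i2 i1 ∷ 0 - 3 ! ad i2 i2 ∷
      (hd 1 , hd 3 , ad i3 i2) ∷ (hd 1 , hd 4 , ad i3 i3) ∷ [])
      5 (fw 2 ∷ fw 0 ∷ fw 3 ∷ fw 1 ∷ fw 4 ∷ []) refl
     f : ∀ {x} → x ≡ a1 ⊎ x ∈ hr → In κ c x
     f (inj₁ refl) = inj₂ ka
     f (inj₂ m) = inj₁ (h0 (there m))
     dj : ∀ {x} → x ≡ a1 ⊎ x ∈ hr → x ∈ a2 ∷ a3 ∷ b1 ∷ b2 ∷ b3 ∷ s ∷ [] → ⊥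
     dj (inj₁ refl) m = U∉ u7 m
     dj (inj₂ r) m = [ (λ m' → Fin.0≢1+n (sym (h0 (there r)) ⨾ l⇒ l (there m'))) , (λ { i1 → U∉ hU r }) ]′ (∈-++⁻ (a2 ∷ a3 ∷ b1 ∷ b2 ∷ b3 ∷ []) m)

   kill4m : ∀ {c α β γ δ} (l : Lst κ (fs c) (α ∷ β ∷ γ ∷ δ ∷ [])) → β ~ γ → γ ~ δ → β ~ δ → s ~ γ → s ~ β ⊎ s ~ δ →
    ∀ {u v t} → κ u ≡ fz → κ v ≡ fz → κ t ≡ fz → u ≢ s → v ≢ s → t ≢ s → u ≢ v → u ≢ t → v ≢ t → u ~ α → v ~ α → t ~ α → ⊥
   kill4m {c} {α} {β} {γ} {δ} l bg gd bd sg sbd {u} {v} {w'} ku kv kt us vs' ts uv ut vt ua va ta = two (cfg o) c (fst C) (fst D')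
    (λ m → f (snd C m)) (λ m → mixI {κ} l (in1 {κ} hk) (there (snd D' m))) (λ p q → dj (snd C p) (snd D' q))
    where
    ka : κ α ≡ fs c
    ka = l⇒ l i1
    C = hrCC {α} (λ m → Fin.0≢1+n (sym (h0 (there m)) ⨾ ka)) (three-cnt (e α) uv ut vt (in-hr ku us) (in-hr kv vs') (in-hr kt ts) (adj-sym ua) (adj-sym va) (adj-sym ta))
    u5 : Unique (α ∷ β ∷ γ ∷ δ ∷ s ∷ [])
    u5 = mixU l uq1 (in1 {κ} hk)
    tri : s ~ β ⊎ s ~ δ → Σ[ C ∈ CC ] (∀ {x} → x ∈ vs C → x ∈ β ∷ γ ∷ δ ∷ s ∷ [])
    tri (inj₁ sβ) = CC! (vx β) (vx γ ∷ vx δ ∷ vx s ∷ []) (U-++ʳ (α ∷ []) u5) (0 - 1 ! bg ∷ 1 - 2 ! gd ∷ 0 - 2 ! bd ∷ 3 - 1 ! sg ∷ 3 - 0 ! sβ ∷ [])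
     1 (fw 3 ∷ fw 0 ∷ fw 2 ∷ []) refl
    tri (inj₂ sδ) = CC! (vx β) (vx γ ∷ vx δ ∷ vx s ∷ []) (U-++ʳ (α ∷ []) u5) (0 - 1 ! bg ∷ 1 - 2 ! gd ∷ 0 - 2 ! bd ∷ 3 - 1 ! sg ∷ 3 - 2 ! sδ ∷ [])
     1 (fw 3 ∷ fw 2 ∷ fw 0 ∷ []) refl
    D' = tri sbd
    f : ∀ {x} → x ≡ α ⊎ x ∈ hr → In κ c x
    f (inj₁ refl) = inj₂ ka
    f (inj₂ m) = inj₁ (h0 (there m))
    dj : ∀ {x} → x ≡ α ⊎ x ∈ hr → x ∈ β ∷ γ ∷ δ ∷ s ∷ [] → ⊥
    dj (inj₁ refl) m = U∉ u5 m
    dj (inj₂ r) m = [ (λ m' → Fin.0≢1+n (sym (h0 (there r)) ⨾ l⇒ l (there m'))) , (λ { i1 → U∉ hU r }) ]′ (∈-++⁻ (β ∷ γ ∷ δ ∷ []) m)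

  -- Two nonadjacent pairs of starts of spanning paths have degree sum at most 4 each in R, so every
  -- class must contribute exactly 12. A K₄ reaches 12 only if the fifth vertex `u` sends nothing to
  -- it.
  module Four {s1 s2 s3 s4 u : V} (H1 : Head s1) (H2 : Head s2) (H3 : Head s3) (H4 : Head s4) (ku : κ u ≡ fz)
   (U5 : Unique (s1 ∷ s2 ∷ s3 ∷ s4 ∷ u ∷ [])) (n12 : s1 ≁ s2) (n34 : s3 ≁ s4) where

   private
    dst : ∀ {l : List V} → Unique (s1 ∷ s2 ∷ s3 ∷ s4 ∷ u ∷ []) → s1 ≢ s2 × s1 ≢ s3 × s1 ≢ s4 × s1 ≢ u × s2 ≢ s3 × s2 ≢ s4 × s2 ≢ u × s3 ≢ s4 × s3 ≢ u × s4 ≢ u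
    dst ((a ∷ b ∷ c ∷ d ∷ []) ∷ (f ∷ g ∷ h ∷ []) ∷ (i ∷ j ∷ []) ∷ (k ∷ []) ∷ _) = a , b , c , d , f , g , h , i , j , k
    D₀ = dst {[]} U5
   s12 = fst D₀
   s13 = fst (snd D₀)
   s14 = fst (snd (snd D₀))
   s1u = fst (snd (snd (snd D₀)))
   s23 = fst (snd (snd (snd (snd D₀))))
   s24 = fst (snd (snd (snd (snd (snd D₀)))))
   s2u = fst (snd (snd (snd (snd (snd (snd D₀))))))
   s34 = fst (snd (snd (snd (snd (snd (snd (snd D₀)))))))
   s3u = fst (snd (snd (snd (snd (snd (snd (snd (snd D₀))))))))
   s4u = snd (snd (snd (snd (snd (snd (snd (snd (snd D₀))))))))
   k1 = hk H1
   k2 = hk H2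
   k3 = hk H3
   k4' = hk H4

   f : Fin k' → ℕ
   f c = (D κ s1 c + D κ s2 c) + (D κ s3 c + D κ s4 c)

   -- When `s` has three edges to the K₄, it sees two vertices of every triangle in it; by `tet3`
   -- each vertex of the K₄ is then seen by at most two of the other four.
   col : ∀ {s} → Head s → ∀ {v1 v2 v3 v4} → κ v1 ≡ fz → κ v2 ≡ fz → κ v3 ≡ fz → κ v4 ≡ fz → Unique (s ∷ v1 ∷ v2 ∷ v3 ∷ v4 ∷ []) →
    ∀ {c x y z w} → Tet κ c x y z w → 3 ≤ D κ s c → D κ v1 c + (D κ v2 c + (D κ v3 c + D κ v4 c)) ≤ 8
   col {s} hs {v1} {v2} {v3} {v4} kv1 kv2 kv3 kv4 ((a1 ∷ a2 ∷ a3 ∷ a4 ∷ []) ∷ (a12 ∷ a13 ∷ a14 ∷ []) ∷ (a23 ∷ a24 ∷ []) ∷ (a34 ∷ []) ∷ _) {c} {x} {y} {z} {w} t h =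
    subst₂ _≤_ (sym (cong₂ _+_ (tet-D t v1) (cong₂ _+_ (tet-D t v2) (cong₂ _+_ (tet-D t v3) (tet-D t v4))))) refl
    (cols4 (b2n (e v1 x)) (b2n (e v1 y)) (b2n (e v1 z)) (b2n (e v1 w)) (b2n (e v2 x)) (b2n (e v2 y)) (b2n (e v2 z)) (b2n (e v2 w))
    (b2n (e v3 x)) (b2n (e v3 y)) (b2n (e v3 z)) (b2n (e v3 w)) (b2n (e v4 x)) (b2n (e v4 y)) (b2n (e v4 z)) (b2n (e v4 w))
    (colx t h1) (colx t1 h2) (colx t2' h3) (colx t3 h4))
    where
    t1 = trot t
    t2' = trot t1
    t3 = trot t2'
    sh : ∀ a b c d → 3 ≤ sumB (a ∷ b ∷ c ∷ d ∷ []) → 3 ≤ sumB (b ∷ c ∷ d ∷ a ∷ [])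
    sh a b c d h = ≤-trans h (≡⇒≤ (lem (b2n a) (b2n b) (b2n c) (b2n d)))
     where lem : ∀ a b c d → a + (b + (c + (d + 0))) ≡ b + (c + (d + (a + 0)))
           lem = solve-∀
    h1 : 3 ≤ sumB (e s x ∷ e s y ∷ e s z ∷ e s w ∷ [])
    h1 = subst (3 ≤_) (tet-D t s) h
    h2 = sh (e s x) (e s y) (e s z) (e s w) h1
    h3 = sh (e s y) (e s z) (e s w) (e s x) h2
    h4 = sh (e s z) (e s w) (e s x) (e s y) h3
    colx : ∀ {x y z w} → Tet κ c x y z w → 3 ≤ sumB (e s x ∷ e s y ∷ e s z ∷ e s w ∷ []) → b2n (e v1 x) + (b2n (e v2 x) + (b2n (e v3 x) + b2n (e v4 x))) ≤ 2
    colx {x} {y} {z} {w} t h = c≤1 (e v1 x) (e v2 x) (e v3 x) (e v4 x)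
     (T₃ kv1 kv2 kv3 (a1 ∘ sym) (a2 ∘ sym) (a3 ∘ sym) a12 a13 a23) (T₃ kv1 kv2 kv4 (a1 ∘ sym) (a2 ∘ sym) (a4 ∘ sym) a12 a14 a24)
     (T₃ kv1 kv3 kv4 (a1 ∘ sym) (a3 ∘ sym) (a4 ∘ sym) a13 a14 a34) (T₃ kv2 kv3 kv4 (a2 ∘ sym) (a3 ∘ sym) (a4 ∘ sym) a23 a24 a34)
     where T₃ = tet3 hs t (sum3≥2 (e s x) (e s y) (e s z) (e s w) h)

   D≤4 : ∀ {c x y z w} → Tet κ c x y z w → ∀ v → D κ v c ≤ 4
   D≤4 {x = x} {y} {z} {w} t v = ≤-trans (≡⇒≤ (d-L (Tet.tl4 t) v)) (cntL≤length (e v) (x ∷ y ∷ z ∷ w ∷ []))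

   tet12 : ∀ {c x y z w} → Tet κ c x y z w → f c ≤ 12 × (f c ≡ 12 → D κ u c ≡ 0)
   tet12 {c} t = go (3 ≤? D κ s1 c) (3 ≤? D κ s2 c) (3 ≤? D κ s3 c) (3 ≤? D κ s4 c)
    where
    Goal = f c ≤ 12 × (f c ≡ 12 → D κ u c ≡ 0)
    mv : ∀ {a b} → a ≡ b → b ≤ 12 × (b ≡ 12 → D κ u c ≡ 0) → a ≤ 12 × (a ≡ 12 → D κ u c ≡ 0)
    mv refl h = h
    p2 : Unique (s2 ∷ s1 ∷ s3 ∷ s4 ∷ u ∷ [])
    p2 = U-↭ (swap s1 s2 refl) U5
    p3 : Unique (s3 ∷ s4 ∷ s1 ∷ s2 ∷ u ∷ [])
    p3 = U-↭ (↭-trans (prep s1 (↭-trans (swap s2 s3 refl) (prep s3 (swap s2 s4 refl)))) (↭-trans (swap s1 s3 refl) (prep s3 (swap s1 s4 refl)))) U5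
    p4 : Unique (s4 ∷ s3 ∷ s1 ∷ s2 ∷ u ∷ [])
    p4 = U-↭ (swap s3 s4 refl) p3
    go : Dec (3 ≤ D κ s1 c) → Dec (3 ≤ D κ s2 c) → Dec (3 ≤ D κ s3 c) → Dec (3 ≤ D κ s4 c) → Goal
    go (yes h) _ _ _ = heavy12 (D κ s1 c) (D κ s2 c) (D κ s3 c) (D κ s4 c) (D κ u c) (D≤4 t s1) (col H1 k2 k3 k4' ku U5 t h)
    go (no _) (yes h) _ _ = mv (cong (_+ (D κ s3 c + D κ s4 c)) (+-comm (D κ s1 c) (D κ s2 c))) (heavy12 (D κ s2 c) (D κ s1 c) (D κ s3 c) (D κ s4 c) (D κ u c) (D≤4 t s2) (col H2 k1 k3 k4' ku p2 t h))
    go (no _) (no _) (yes h) _ = mv (+-comm (D κ s1 c + D κ s2 c) (D κ s3 c + D κ s4 c)) (heavy12 (D κ s3 c) (D κ s4 c) (D κ s1 c) (D κ s2 c) (D κ u c) (D≤4 t s3) (col H3 k4' k1 k2 ku p3 t h))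
    go (no _) (no _) (no _) (yes h) = mv (+-comm (D κ s1 c + D κ s2 c) (D κ s3 c + D κ s4 c) ⨾ cong (_+ (D κ s1 c + D κ s2 c)) (+-comm (D κ s3 c) (D κ s4 c)))
     (heavy12 (D κ s4 c) (D κ s3 c) (D κ s1 c) (D κ s2 c) (D κ u c) (D≤4 t s4) (col H4 k3 k1 k2 ku p4 t h))
    go (no a) (no b) (no c') (no d') = light8 (D κ u c) (≤-pred (≰⇒> a)) (≤-pred (≰⇒> b)) (≤-pred (≰⇒> c')) (≤-pred (≰⇒> d'))

   f≤12 : ∀ c → f c ≤ 12
   f≤12 c = go (isTet o c)
    where
    go : (Σ[ x ∈ V ] Σ[ y ∈ V ] Σ[ z ∈ V ] Σ[ w ∈ V ] Tet κ c x y z w) ⊎ (∀ {v} → κ v ≡ fz → D κ v c ≤ 3) → f c ≤ 12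
    go (inj₁ (_ , _ , _ , _ , t)) = fst (tet12 t)
    go (inj₂ le) = +-mono-≤ (+-mono-≤ (le k1) (le k2)) (+-mono-≤ (le k3) (le k4'))

   main : (6 * k' + 4) + (6 * k' + 4) ≤ ((dR κ s1 + dR κ s2) + (dR κ s3 + dR κ s4)) + ΣF f
   main = ≤-trans (+-mono-≤ (PI κ s12 n12) (PI κ s34 n34)) (≡⇒≤ (+-inter (dR κ s1 + dR κ s2) _ (dR κ s3 + dR κ s4) _ ⨾ cong ((dR κ s1 + dR κ s2) + (dR κ s3 + dR κ s4) +_) (sym (ΣF-+ (λ c → D κ s1 c + D κ s2 c) (λ c → D κ s3 c + D κ s4 c)))))

   f≡12 : ∀ c → f c ≡ 12
   f≡12 = ΣF-tight f≤12 (≡⇒≤ (sym (snd (arithC k' _ _ main (+-mono-≤ (+-mono-≤ (s-dR2 H1) (s-dR2 H2)) (+-mono-≤ (s-dR2 H3) (s-dR2 H4))) (ΣF-upper f≤12)))))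

   D4 : ∀ c → (∀ {x y z w} → Tet κ c x y z w → ⊥) → D κ s1 c ≡ 3 × D κ s2 c ≡ 3 × D κ s3 c ≡ 3 × D κ s4 c ≡ 3
   D4 c nt = fst x , snd x , fst y , snd y
    where
    l : ∀ {v} → κ v ≡ fz → D κ v c ≤ 3
    l = D≤3 o c nt
    r = t2 {m = 6} {n = 6} (+-mono-≤ (l k1) (l k2)) (+-mono-≤ (l k3) (l k4')) (≡⇒≤ (sym (f≡12 c)))
    x = t2 (l k1) (l k2) (≡⇒≤ (sym (fst r)))
    y = t2 (l k3) (l k4') (≡⇒≤ (sym (snd r)))

   get33 : ∀ c → (∀ {x y z w} → Tet κ c x y z w → ⊥) → K33 κ c
   get33 c nt = go (kind o c)
    where
    d4 = D4 c nt
    go : Kind κ c → K33 κ c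
    go (k4 l a b f g h i) = ⊥-elim (nt (tet l a b f g h i))
    go (k4m l ab bg gd da bd ag) = ⊥-elim (kill4m H4 l bg gd bd (fst (snd P4)) ([ inj₁ ∘ fst , inj₂ ∘ snd ]′ (snd (snd P4)))
     k1 k2 k3 s14 s24 s34 s12 s13 s23 (fst (pt k1 (fst d4))) (fst (pt k2 (fst (snd d4)))) (fst (pt k3 (fst (snd (snd d4))))))
     where pt = K4m.pat o c l ab bg gd da bd ag
           P4 = pt k4' (snd (snd (snd d4)))
    go (k5 l a b f g h i) = ⊥-elim (K5.one-tight o c l a b f g h i s12 k1 k2 (fst d4) (fst (snd d4)))
    go (big _ _ mk) = mk k1 (fst d4)

   -- The pair of `u` and `su` has degree sum at most 5 in R, so its slack over all classes is 1. A
   -- class that receives nothing from `u` would lose at least 2.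
   module WithU {su : V} (su∈ : Head su) (nu : u ≁ su) (usu : u ≢ su) (du : dR κ u ≤ 3) where

    g : Fin k' → ℕ
    g c = D κ u c + D κ su c

    PIu : 6 * k' + 4 ≤ (dR κ u + dR κ su) + ΣF g
    PIu = PI κ usu nu

    notK4 : NotK4 κ
    notK4 c t = arithU k' _ _ PIu (+-mono-≤ du (s-dR2 su∈)) (ΣF-strict g≤6 c gc)
     where
     Du0 : ∀ {c x y z w} → Tet κ c x y z w → D κ u c ≡ 0
     Du0 {c} t = snd (tet12 t) (f≡12 c)
     gt : ∀ {c x y z w} → Tet κ c x y z w → g c ≤ 4
     gt {c} t = ≤-trans (≡⇒≤ (cong (_+ D κ su c) (Du0 t))) (D≤4 t su)
     gc : g c + 2 ≤ 6
     gc = +-monoˡ-≤ 2 (gt t)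
     g≤6 : ∀ c → g c ≤ 6
     g≤6 c = go (isTet o c)
      where
      go : (Σ[ x ∈ V ] Σ[ y ∈ V ] Σ[ z ∈ V ] Σ[ w ∈ V ] Tet κ c x y z w) ⊎ (∀ {v} → κ v ≡ fz → D κ v c ≤ 3) → g c ≤ 6
      go (inj₁ (_ , _ , _ , _ , t)) = ≤-trans (gt t) (m≤m+n 4 2)
      go (inj₂ le) = +-mono-≤ (le ku) (le (hk su∈))

    all33 : ∀ c → K33 κ c
    all33 c = get33 c (notK4 c)

    D3 : ∀ c → D κ s1 c ≡ 3 × D κ s2 c ≡ 3 × D κ s3 c ≡ 3 × D κ s4 c ≡ 3
    D3 c = D4 c (notK4 c)

    Du≥1 : ∀ c → D κ u c ≡ 0 → ⊥
    Du≥1 c z = arithU k' _ _ PIu (+-mono-≤ du (s-dR2 su∈)) (ΣF-strict g≤6 c (+-monoˡ-≤ 2 (≤-trans (≡⇒≤ (cong (_+ D κ su c) z)) (≤-trans (l c (hk su∈)) (n≤1+n 3)))))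
     where
     l : ∀ c {v} → κ v ≡ fz → D κ v c ≤ 3
     l c = D≤3 o c (notK4 c)
     g≤6 : ∀ c → g c ≤ 6
     g≤6 c = +-mono-≤ (l c ku) (l c (hk su∈))

    module _ {c : Fin k'} (q₃ : K33 κ c) where

     -- With two starts on each side, a neighbour of `u` in the class would be a third neighbour in
     -- R of that vertex, which `kill33` excludes on either side; but every class receives an edge
     -- from `u`.
     split22 : ∀ {x y z w} → Head x → Head y → Head z → Head w → x ≢ y → z ≢ w → u ≢ x → u ≢ y → u ≢ z → u ≢ w → x ≢ z → y ≢ z → x ≢ w → z ≢ x → w ≢ x →
      SideA q₃ x → SideA q₃ y → SideB q₃ z → SideB q₃ w → ⊥
     split22 {x} {y} {z} {w} hx hy hz hw xy zw ux uy uz uw xz yz xw zx wx ax ay bz bω = Du≥1 c (d-L (K33.l33 q₃) u ⨾ cntL-zero (e u) _ none)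
      where
      none : ∀ {v} → v ∈ K33.A q₃ ++ K33.B q₃ → u ≁ v
      none m = [ (λ m' → ¬t→f λ h → kill33 hz q₃ bz m' (hk hx) (hk hy) ku xz yz uz xy (ux ∘ sym) (uy ∘ sym) (fst ax m') (fst ay m') h)
       , (λ m' → ¬t→f λ h → kill33 hx (flip33 q₃) ax m' (hk hz) (hk hw) ku zx wx ux zw (uz ∘ sym) (uw ∘ sym) (fst bz m') (fst bω m') h) ]′ (∈-++⁻ (K33.A q₃) m)

     odd : ∀ {x y z w} → Head x → Head y → Head z → Head w → y ≢ x → z ≢ x → w ≢ x → y ≢ z → y ≢ w → z ≢ w → SideB q₃ x → SideA q₃ y → SideA q₃ z → SideA q₃ w → ⊥
     odd hx hy hz hw yx zx wx yz yw zw bx ay az aw = kill33 hx q₃ bx i1 (hk hy) (hk hz) (hk hw) yx zx wx yz yw zw (fst ay i1) (fst az i1) (fst aw i1)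

    same : ∀ {c} (q₃ : K33 κ c) → SideA q₃ s1 → SideA q₃ s2 × SideA q₃ s3 × SideA q₃ s4
    same {c} q₃ a1 = go (side o q₃ k2 (fst (snd (D3 c)))) (side o q₃ k3 (fst (snd (snd (D3 c))))) (side o q₃ k4' (snd (snd (snd (D3 c)))))
     where
     ≠ : ∀ {x y : V} → x ≢ y → y ≢ x
     ≠ h = h ∘ sym
     go : SideA q₃ s2 ⊎ SideB q₃ s2 → SideA q₃ s3 ⊎ SideB q₃ s3 → SideA q₃ s4 ⊎ SideB q₃ s4 → SideA q₃ s2 × SideA q₃ s3 × SideA q₃ s4
     go (inj₁ a2) (inj₁ a3) (inj₁ a4) = a2 , a3 , a4
     go (inj₂ b2) (inj₁ a3) (inj₁ a4) = ⊥-elim (odd q₃ H2 H1 H3 H4 s12 (≠ s23) (≠ s24) s13 s14 s34 b2 a1 a3 a4)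
     go (inj₁ a2) (inj₂ b3) (inj₁ a4) = ⊥-elim (odd q₃ H3 H1 H2 H4 s13 s23 (≠ s34) s12 s14 s24 b3 a1 a2 a4)
     go (inj₁ a2) (inj₁ a3) (inj₂ b4) = ⊥-elim (odd q₃ H4 H1 H2 H3 s14 s24 s34 s12 s13 s23 b4 a1 a2 a3)
     go (inj₂ b2) (inj₂ b3) (inj₂ b4) = ⊥-elim (odd (flip33 q₃) H1 H2 H3 H4 (≠ s12) (≠ s13) (≠ s14) s23 s24 s34 a1 b2 b3 b4)
     go (inj₂ b2) (inj₂ b3) (inj₁ a4) = ⊥-elim (split22 q₃ H1 H4 H2 H3 s14 s23 (≠ s1u) (≠ s4u) (≠ s2u) (≠ s3u) s12 (≠ s24) s13 (≠ s12) (≠ s13) a1 a4 b2 b3)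
     go (inj₂ b2) (inj₁ a3) (inj₂ b4) = ⊥-elim (split22 q₃ H1 H3 H2 H4 s13 s24 (≠ s1u) (≠ s3u) (≠ s2u) (≠ s4u) s12 (≠ s23) s14 (≠ s12) (≠ s14) a1 a3 b2 b4)
     go (inj₁ a2) (inj₂ b3) (inj₂ b4) = ⊥-elim (split22 q₃ H1 H2 H3 H4 s12 s34 (≠ s1u) (≠ s2u) (≠ s3u) (≠ s4u) s13 s23 s14 (≠ s13) (≠ s14) a1 a2 b3 b4)

    sided : ∀ c → Σ[ q₃ ∈ K33 κ c ] (SideA q₃ s1 × SideA q₃ s2 × SideA q₃ s3 × SideA q₃ s4)
    sided c = go (side o q₀ k1 (fst (D3 c)))
     where
     q₀ = all33 c
     go : SideA q₀ s1 ⊎ SideB q₀ s1 → Σ[ q₃ ∈ K33 κ c ] (SideA q₃ s1 × SideA q₃ s2 × SideA q₃ s3 × SideA q₃ s4)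
     go (inj₁ a) = q₀ , a , same q₀ a
     go (inj₂ b) = flip33 q₀ , b , same (flip33 q₀) b

  kP : ∀ {x} → x ∈ P → κ x ≡ fz
  kP = l⇒ (hl H)

  UP : Unique P
  UP = lu (hl H)

  -- If `p` had one neighbour only, the pairs `pq`, `pq`, `pa`, `bq` would have at most 3 + 3 + 4 +
  -- 5 = 15 inside R instead of 16, while no class exceeds 24.
  end≥2 : ∀ {p P' q a b} → Walk p (p ∷ P') q → p ∷ P' ↭ P → κ a ≡ fz → κ b ≡ fz → Unique (p ∷ q ∷ a ∷ b ∷ []) → p ≁ q → p ≁ a → b ≁ q →
   dR κ a ≤ 3 → dR κ b ≤ 3 → 2 ≤ cntL (e p) P'
  end≥2 {p} {P'} {q} {a} {b} w h ka kb ((pq' ∷ pa' ∷ pb' ∷ []) ∷ (qa' ∷ qb' ∷ []) ∷ (ab' ∷ []) ∷ _) pq pa bq da db = go (2 ≤? cntL (e p) P')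
   where
   hp : Head p
   hp = mkHead w h
   hq : Head q
   hq = mkHd (w-rev w) (↭-trans (Perm.↭-reverse (p ∷ P')) h)
   kp = hk hp
   kq = hk hq
   go : Dec (2 ≤ cntL (e p) P') → 2 ≤ cntL (e p) P'
   go (yes r) = r
   go (no r) = ⊥-elim (arithB0 k' _ _ main (+-mono-≤ (+-mono-≤ (+-mono-≤ dp (s-dR2 hq)) (+-mono-≤ dp (s-dR2 hq))) (+-mono-≤ (+-mono-≤ dp da) (+-mono-≤ db (s-dR2 hq)))) (ΣF-upper f≤24))
    where
    p≤1 : cntL (e p) P' ≤ 1
    p≤1 = ≤-pred (≰⇒> r)
    dp : dR κ p ≤ 1
    dp = ≤-trans (≡⇒≤ (s-dR hp)) p≤1
    f g : Fin k' → ℕ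
    f c = ((D κ p c + D κ q c) + (D κ p c + D κ q c)) + ((D κ p c + D κ a c) + (D κ b c + D κ q c))
    g c = D κ p c + D κ q c
    main : ((6 * k' + 4) + (6 * k' + 4)) + ((6 * k' + 4) + (6 * k' + 4)) ≤ (((dR κ p + dR κ q) + (dR κ p + dR κ q)) + ((dR κ p + dR κ a) + (dR κ b + dR κ q))) + ΣF f
    main = ≤-trans (+-mono-≤ (two-PI pq' pq pq' pq) (two-PI pa' pa (qb' ∘ sym) bq))
     (≡⇒≤ (+-inter ((dR κ p + dR κ q) + (dR κ p + dR κ q)) _ ((dR κ p + dR κ a) + (dR κ b + dR κ q)) _
     ⨾ cong (((dR κ p + dR κ q) + (dR κ p + dR κ q)) + ((dR κ p + dR κ a) + (dR κ b + dR κ q)) +_) (sym (ΣF-+ (λ c → (D κ p c + D κ q c) + (D κ p c + D κ q c)) (λ c → (D κ p c + D κ a c) + (D κ b c + D κ q c))))))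
     where
     two-PI : ∀ {u w u' w'} → u ≢ w → u ≁ w → u' ≢ w' → u' ≁ w' → (6 * k' + 4) + (6 * k' + 4) ≤ ((dR κ u + dR κ w) + (dR κ u' + dR κ w')) + ΣF (λ c → (D κ u c + D κ w c) + (D κ u' c + D κ w' c))
     two-PI {u} {w} {u'} {w'} n1 a1 n2 a2 = ≤-trans (+-mono-≤ (PI κ n1 a1) (PI κ n2 a2)) (≡⇒≤ (+-inter (dR κ u + dR κ w) _ (dR κ u' + dR κ w') _ ⨾ cong ((dR κ u + dR κ w) + (dR κ u' + dR κ w') +_) (sym (ΣF-+ (λ c → D κ u c + D κ w c) (λ c → D κ u' c + D κ w' c)))))
    module _ {c : Fin k'} {x y z t : V} (T : Tet κ c x y z t) where
     kx : κ x ≡ fs c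
     kx = l⇒ (Tet.tl4 T) i1
     -- Exchanging `p` for `x` leaves `P'` followed by `x` as a spanning path. By maximality of the
     -- edges of R, `x` has at most one neighbour on it; but it sees `q` and one of `a`, `b`.
     F1 : e p y ∧ e p z ∧ e p t ∧ e q x ≡ true → e a x ∨ e b x ≡ true → ⊥
     F1 hh ho' = go' (∧4 (e p y) (e p z) (e p t) (e q x) hh)
      where
      go' : p ~ y × p ~ z × p ~ t × q ~ x → ⊥
      go' (py , pz , pt , qx) = <-irrefl refl (≤-trans two≤ (≤-trans c≤ p≤1))
       where
       S = fst (tet-exch o T (L-perm (↭-sym h) (hl H)) py pz pt)
       wP : Σ[ s ∈ V ] Walk s (P' ++ x ∷ []) x
       wP = f' P' w
        where f' : ∀ P' → Walk p (p ∷ P') q → Σ[ s ∈ V ] Walk s (P' ++ x ∷ []) x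
              f' [] w = x , one
              f' (y ∷ P') w = y , w-snoc (snd (w-2nd w)) qx
       c≤ : cntL (e x) P' ≤ cntL (e p) P'
       c≤ = +-cancelʳ-≤ (eL P') _ _ (≤-trans (≡⇒≤ (eL-↭ (↭-sym (Perm.++-comm P' (x ∷ []))))) (≤-trans (hm H (Swapped.opt' S) (snd wP) (L-perm (↭-sym (Perm.++-comm P' (x ∷ []))) (Swapped.LR S))) (≡⇒≤ (eL-↭ (↭-sym h)))))
       two≤ : 2 ≤ cntL (e x) P'
       two≤ = [ (λ ax → two-cnt qa' (in-hr hp ka (pa' ∘ sym)) (adj-sym ax)) , (λ bx → two-cnt qb' (in-hr hp kb (pb' ∘ sym)) (adj-sym bx)) ]′ (∨-case ho')
        where
        two-cnt : ∀ {v} → q ≢ v → v ∈ P' → x ~ v → 2 ≤ cntL (e x) P'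
        two-cnt {v} ne m xv = ≤-trans (≡⇒≤ (sym (cong₂ _+_ (cong b2n (adj-sym qx)) (cong (λ t → b2n t + 0) xv)))) (cntL-⊆ (e x) {q ∷ v ∷ []} ((ne ∷ []) ∷ [] ∷ []) λ { i1 → in-hr hp kq (pq' ∘ sym) ; i2 → m })
     F2 : le? 2 (sumB (e p y ∷ e p z ∷ e p t ∷ [])) ∧ e q x ∧ e a x ∧ e b x ≡ true → ⊥
     F2 hh = tet3 hp T (le?-sound 2 (sumB (e p y ∷ e p z ∷ e p t ∷ [])) (∧-l hh)) kq ka kb (pq' ∘ sym) (pa' ∘ sym) (pb' ∘ sym) qa' qb' ab' (∧-r {le? 2 (sumB (e p y ∷ e p z ∷ e p t ∷ []))} hh)
     F3 : le? 2 (sumB (e q y ∷ e q z ∷ e q t ∷ [])) ∧ e p x ∧ e a x ∧ e b x ≡ true → ⊥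
     F3 hh = tet3 hq T (le?-sound 2 (sumB (e q y ∷ e q z ∷ e q t ∷ [])) (∧-l hh)) kp ka kb pq' (qa' ∘ sym) (qb' ∘ sym) pa' pb' ab' (∧-r {le? 2 (sumB (e q y ∷ e q z ∷ e q t ∷ []))} hh)
     bnd : b2n (e a x) + b2n (e b x) ≤ βcol (e p x) (e p y) (e p z) (e p t) (e q x) (e q y) (e q z) (e q t)
     bnd = βbound (e p x) (e p y) (e p z) (e p t) (e q x) (e q y) (e q z) (e q t) (e a x) (e b x) F1 F2 F3
    tet24 : ∀ {c x y z t} → Tet κ c x y z t → f c ≤ 24
    tet24 {c} {x} {y} {z} {t} T = ≤-trans (≡⇒≤ (cong₂ _+_ (cong₂ _+_ pq≡ pq≡) (cong₂ _+_ (cong₂ _+_ (tet-D T p) (tet-D T a)) (cong₂ _+_ (tet-D T b) (tet-D T q)))))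
     (arith24 (b2n (e a x)) (b2n (e a y)) (b2n (e a z)) (b2n (e a t)) (b2n (e b x)) (b2n (e b y)) (b2n (e b z)) (b2n (e b t)) (sumB (e p x ∷ e p y ∷ e p z ∷ e p t ∷ [])) (sumB (e q x ∷ e q y ∷ e q z ∷ e q t ∷ [])) _ _ _ _
     (bnd T) (bnd (trot T)) (bnd (trot (trot T))) (bnd (trot (trot (trot T)))) (βsum (e p x) (e p y) (e p z) (e p t) (e q x) (e q y) (e q z) (e q t)))
     where pq≡ = cong₂ _+_ (tet-D T p) (tet-D T q)
    f≤24 : ∀ c → f c ≤ 24
    f≤24 c = go' (isTet o c)
     where
     go' : (Σ[ x ∈ V ] Σ[ y ∈ V ] Σ[ s ∈ V ] Σ[ w ∈ V ] Tet κ c x y s w) ⊎ (∀ {v} → κ v ≡ fz → D κ v c ≤ 3) → f c ≤ 24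
     go' (inj₁ (_ , _ , _ , _ , T)) = tet24 T
     go' (inj₂ le) = +-mono-≤ (+-mono-≤ (+-mono-≤ (le kp) (le kq)) (+-mono-≤ (le kp) (le kq))) (+-mono-≤ (+-mono-≤ (le kp) (le ka)) (+-mono-≤ (le kb) (le kq)))

  -- One edge may go back to `p`; the rest of the path carries at most two more neighbours.
  2nd≤3 : ∀ {p p2 R q} → Walk p (p ∷ p2 ∷ R) q → p ∷ p2 ∷ R ↭ P → dR κ p2 ≤ 3
  2nd≤3 {p} {p2} {R} {q} w h = ≤-trans (≡⇒≤ (d-L (L-perm (↭-sym h) (hl H)) p2)) (+-mono-≤ (b2n≤1 (e p2 p)) (≤-trans (≡⇒≤ (cong (λ t → b2n t + cntL (e p2) R) (E-irr G p2))) (go R (snd (w-2nd w)) (U-++ʳ (p ∷ []) (U-↭ (↭-sym h) UP)) (λ m → kP (Perm.∈-resp-↭ h (there m))))))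
   where
   go : ∀ R → Walk p2 (p2 ∷ R) q → Unique (p2 ∷ R) → (∀ {x} → x ∈ p2 ∷ R → κ x ≡ fz) → cntL (e p2) R ≤ 2
   go [] w u z = z≤n
   go (y ∷ R) w u z = k (3 ≤? cntL (e p2) (y ∷ R))
    where
    k : Dec (3 ≤ cntL (e p2) (y ∷ R)) → cntL (e p2) (y ∷ R) ≤ 2
    k (no r) = ≤-pred (≰⇒> r)
    k (yes r) = ⊥-elim (noCC₀ (cfg o) (mkCC (snd (w-2nd w)) u r) z)

  ends≥2 : ∀ {p p2 p3 R q} → Walk p (p ∷ p2 ∷ p3 ∷ R) q → p ∷ p2 ∷ p3 ∷ R ↭ P → 1 ≤ length R → p ≁ q → 2 ≤ cntL (e p) (p2 ∷ p3 ∷ R)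
  ends≥2 {p} {p2} {p3} {R} {q} w h len pq = go (2 ≤? cntL (e p) (p2 ∷ p3 ∷ R))
   where
   Pl = p ∷ p2 ∷ p3 ∷ R
   Up : Unique Pl
   Up = U-↭ (↭-sym h) UP
   kk : ∀ {x} → x ∈ Pl → κ x ≡ fz
   kk m = kP (Perm.∈-resp-↭ h m)
   pp2 : p ~ p2
   pp2 = fst (w-2nd w)
   w2 = snd (w-2nd w)
   p2p3 = fst (w-2nd w2)
   w3 = snd (w-2nd w2)
   hq : Head q
   hq = mkHd (w-rev w) (↭-trans (Perm.↭-reverse Pl) h)
   go : Dec (2 ≤ cntL (e p) (p2 ∷ p3 ∷ R)) → 2 ≤ cntL (e p) (p2 ∷ p3 ∷ R)
   go (yes r) = r
   go (no r) = main (lastTwo (w-rev w3))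
    where
    lastTwo : Walk q (reverse (p3 ∷ R)) p3 → Σ[ a ∈ V ] Σ[ S ∈ List V ] (reverse (p3 ∷ R) ≡ q ∷ a ∷ S)
    lastTwo wr = k (reverse (p3 ∷ R)) refl wr
     where
     k : ∀ l → l ≡ reverse (p3 ∷ R) → Walk q l p3 → Σ[ a ∈ V ] Σ[ S ∈ List V ] (l ≡ q ∷ a ∷ S)
     k (z ∷ []) eq one = ⊥-elim (<-irrefl refl (≤-trans (s≤s len) (≡⇒≤ (sym (length-reverse (p3 ∷ R)) ⨾ cong length (sym eq)))))
     k (z ∷ z' ∷ S) eq (g ∷ wz) = z' , S , refl
    no2 : ∀ {x} → x ∈ p3 ∷ R → p ≁ x
    no2 {x} m = ¬t→f λ px → r (+-mono-≤ (≡⇒≤ (sym (cong b2n pp2))) (cntL-pos (e p) m px))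
    main : Σ[ a ∈ V ] Σ[ S ∈ List V ] (reverse (p3 ∷ R) ≡ q ∷ a ∷ S) → 2 ≤ cntL (e p) (p2 ∷ p3 ∷ R)
    main (a , S , eqr) = pick (e p2 q) refl
     where
     perm : q ∷ a ∷ S ↭ p3 ∷ R
     perm = ↭-trans (re↭ (sym eqr)) (Perm.↭-reverse (p3 ∷ R))
     U' : Unique (p ∷ p2 ∷ q ∷ a ∷ S)
     U' = U-↭ (prep p (prep p2 (↭-sym perm))) Up
     kx' : ∀ {x} → x ∈ p ∷ p2 ∷ q ∷ a ∷ S → κ x ≡ fz
     kx' m = kk (Perm.∈-resp-↭ (prep p (prep p2 perm)) m)
     wq : Walk q (q ∷ a ∷ (S ++ p2 ∷ p ∷ [])) p
     wq = subst (λ t → Walk q t p) (++-assoc' eqr) (w-join (w-rev w3) (adj-sym p2p3) (adj-sym pp2 ∷ one))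
      where ++-assoc' : reverse (p3 ∷ R) ≡ q ∷ a ∷ S → reverse (p3 ∷ R) ++ p2 ∷ p ∷ [] ≡ q ∷ a ∷ (S ++ p2 ∷ p ∷ [])
            ++-assoc' r = cong (_++ p2 ∷ p ∷ []) r
     permq : q ∷ a ∷ (S ++ p2 ∷ p ∷ []) ↭ P
     permq = ↭-trans (Perm.++-comm (q ∷ a ∷ S) (p2 ∷ p ∷ [])) (↭-trans (swap p2 p (perm)) h)
     da = 2nd≤3 wq permq
     pa : p ≁ a
     pa = no2 (Perm.∈-resp-↭ perm i2)
     -- For `end≥2` the vertex before `q` serves as `a`, and `b` must not see `q`: `p2` serves if
     -- possible, otherwise `p3`. In the latter case a remainder of four vertices is a paw and is
     -- treated apart.
     pick : ∀ v → e p2 q ≡ v → 2 ≤ cntL (e p) (p2 ∷ p3 ∷ R)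
     pick false p2q = end≥2 w h (kx' i4) (kx' i2) (⊑-U (keep (keep (keep (keep (⊑-drop S done))))) (U-↭ pm U')) pq pa p2q da (2nd≤3 w h)
      where
      pm : p ∷ p2 ∷ q ∷ a ∷ S ↭ p ∷ q ∷ a ∷ p2 ∷ (S ++ [])
      pm = prep p (↭-trans (swap p2 q refl) (prep q (↭-trans (swap p2 a refl) (prep a (prep p2 (re↭ (sym (++-identityʳ S))))))))
     pick true p2q = fin S refl
      where
      -- p2 q closes the path R − p to a cycle, so p3 is the end of a spanning path
      w' : Walk p (p ∷ p2 ∷ reverse (p3 ∷ R)) p3
      w' = pp2 ∷ p2q ∷ w-rev w3
      h' : p ∷ p2 ∷ reverse (p3 ∷ R) ↭ P
      h' = ↭-trans (prep p (prep p2 (Perm.↭-reverse (p3 ∷ R)))) h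
      h3 : Head p3
      h3 = mkHd (w-rev w') (↭-trans (Perm.↭-reverse _) h')
      fin : ∀ S₀ → S₀ ≡ S → 2 ≤ cntL (e p) (p2 ∷ p3 ∷ R)
      fin [] refl = ⊥-elim (paw o (L-perm (↭-sym (↭-trans (prep p (prep p2 perm)) h)) (hl H)) pp2 p2q p2a (qa) pq pa)
       where
       qa : q ~ a
       qa = fst (w-2nd wq)
       a≡ : a ≡ p3
       a≡ = sym (w-lst≡ (q ∷ []) (subst (λ t → Walk q t p3) eqr (w-rev w3)))
       p2a : p2 ~ a
       p2a = subst (λ t → p2 ~ t) (sym a≡) p2p3
      fin (s ∷ S₁) refl = end≥2 w h (kx' i4) (kk i3) Uab pq pa p3q da (≤-trans (s-dR2 h3) (n≤1+n 2))
       where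
       wr : Walk q (q ∷ a ∷ s ∷ S₁) p3
       wr = subst (λ t → Walk q t p3) eqr (w-rev w3)
       p3∈' : p3 ∈ s ∷ S₁
       p3∈' = w-last∈ (snd (w-2nd (snd (w-2nd wr))))
       d4 : ∀ {x} → x ∈ s ∷ S₁ → Unique (p ∷ q ∷ a ∷ x ∷ [])
       d4 {x} m = sel (∈-split m)
        where
        sel : Σ[ A ∈ List V ] Σ[ B ∈ List V ] (s ∷ S₁ ≡ A ++ x ∷ B) → Unique (p ∷ q ∷ a ∷ x ∷ [])
        sel (A , B , q') = ⊑-U (keep (skip (keep (keep (⊑-drop A (keep (⊑-drop B done))))))) (subst (λ t → Unique (p ∷ p2 ∷ q ∷ a ∷ t)) (q' ⨾ cong (λ t → A ++ _ ∷ t) (sym (++-identityʳ B))) U')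
       Uab : Unique (p ∷ q ∷ a ∷ p3 ∷ [])
       Uab = d4 p3∈'
       p3q : p3 ≁ q
       p3q = nadj-sym (no3rd hq (kx' i2) (kx' i4) (kk i3)
        (λ { refl → U∉ (U-++ʳ (p ∷ []) U') i2 }) (λ { refl → U∉ (U-++ʳ (p ∷ []) Up) i1 }) (λ { refl → U∉ (U-++ʳ (p ∷ p2 ∷ q ∷ []) U') p3∈' })
        (adj-sym p2q) (fst (w-2nd wr)))

  rotH : ∀ {a l q} → Walk a l q → q ~ a → l ↭ P → ∀ A x B → l ≡ A ++ x ∷ B → Head x
  rotH w qa h [] x B refl = mkHd (subst (λ t → Walk t _ _) (w-hd≡ w) w) h
  rotH w qa h (y ∷ A) x B refl with w-split {x = y} {A} w
  ... | c , w1 , cx , w2 = mkHd (w-join w2 qa w1) (↭-trans (Perm.++-comm (x ∷ B) (y ∷ A)) h)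

  -- After b₁ has been exchanged for `s`, it is nonadjacent to `t`, which has degree at most 2 in
  -- the new remainder. The classes take at most 6 each, so b₁ has two neighbours there.
  Bnbr : NotK4 κ → ∀ {c} (q₃ : K33 κ c) {s t} → Head s → Head t → s ≢ t → SideA q₃ s → SideA q₃ t → Σ[ y ∈ V ] (y ∈ P × (K33.b₁ q₃) ~ y)
  Bnbr nk {c} q₃ {s} {t} hs ht' st as at' = go (exch33 o q₃ pR as)
   where
   open K33 q₃
   ps = pull κ (hk hs)
   pR = snd ps
   R' = fst ps
   kb : κ b₁ ≡ fs c
   kb = l⇒ l33 i4
   go : Σ[ S ∈ Swapped κ c b₁ s (A ++ b₂ ∷ b₃ ∷ []) R' ] Σ[ q' ∈ K33 (Swapped.κ' S) c ] (K33.A q' ≡ A × K33.B q' ≡ s ∷ b₂ ∷ b₃ ∷ []) → Σ[ y ∈ V ] (y ∈ P × b₁ ~ y)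
   go (S , q' , _) = fin (cntL-any (e b₁) R' (≤-trans (s≤s z≤n) two≤))
    where
    open Swapped S
    nk' : NotK4 κ'
    nk' c' T = sel (c' Fin.≟ c)
     where
     sel : Dec (c' ≡ c) → ⊥
     sel (yes refl) = 4≢6 (sym (size-L (Tet.tl4 T)) ⨾ size-L (K33.l33 q'))
      where 4≢6 : 4 ≢ 6
            4≢6 ()
     sel (no ne) = nk c' (tet (L-perm (L-↭ (oth ne (cls-L κ (fs c'))) (Tet.tl4 T)) (cls-L κ (fs c'))) (Tet.xy T) (Tet.xz T) (Tet.xw T) (Tet.yz T) (Tet.yw T) (Tet.zw T))
    kb' : κ' b₁ ≡ fz
    kb' = l⇒ LR i1
    kt' : κ' t ≡ fz
    kt' = f (l⇐ pR (hk ht'))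
     where f : t ∈ s ∷ R' → κ' t ≡ fz
           f (here r) = ⊥-elim (st (sym r))
           f (there m) = l⇒ LR (there m)
    bt : b₁ ≁ t
    bt = nadj-sym (snd at' i1)
    b≢t : b₁ ≢ t
    b≢t r = Fin.0≢1+n (sym (hk ht') ⨾ cong κ (sym r) ⨾ kb)
    dt : dR κ' t ≤ 2
    dt = ≤-trans (≡⇒≤ (d-L LR t ⨾ cong (λ z → b2n z + cntL (e t) R') (nadj-sym bt))) (≤-trans (m≤n+m (cntL (e t) R') (b2n (e t s))) (≤-trans (≡⇒≤ (sym (d-L pR t))) (s-dR2 ht')))
    db : dR κ' b₁ ≡ cntL (e b₁) R'
    db = d-L LR b₁ ⨾ cong (λ z → b2n z + cntL (e b₁) R') (E-irr G b₁)
    two≤ : 2 ≤ cntL (e b₁) R'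
    two≤ = ar k' _ _ _ (PI κ' b≢t bt) (ΣF-upper (λ c' → +-mono-≤ (D≤3 opt' c' (nk' c') kb') (D≤3 opt' c' (nk' c') kt'))) dt db
     where
     ar : ∀ k a b S {r} → 6 * k + 4 ≤ (a + b) + S → S ≤ 6 * k → b ≤ 2 → a ≡ r → 2 ≤ r
     ar k a b S h hS hb refl = +-cancelʳ-≤ (2 + 6 * k) 2 a (≤-trans (≡⇒≤ (lem k)) (≤-trans h (≤-trans (≡⇒≤ (+-assoc a b S)) (+-monoʳ-≤ a (+-mono-≤ hb hS)))))
      where lem : ∀ k → 2 + (2 + 6 * k) ≡ 6 * k + 4
            lem = solve-∀
    fin : Σ[ y ∈ V ] (y ∈ R' × b₁ ~ y) → Σ[ y ∈ V ] (y ∈ P × b₁ ~ y)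
    fin (y , m , by) = y , l⇐ (hl H) (l⇒ pR (there m)) , by

  UUb : ∀ {c} (q₃ : K33 κ c) → Unique (K33.a₁ q₃ ∷ K33.a₂ q₃ ∷ K33.a₃ q₃ ∷ K33.b₂ q₃ ∷ (K33.b₁ q₃ ∷ []) ++ P)
  UUb q₃ = ⊑-U (keep (keep (keep (keep (keep (skip ⊑-refl)))))) (U-↭ (prep _ (prep _ (prep _ (swap _ _ refl)))) (mixU (K33.l33 q₃) UP kP))

  b₁-In : ∀ {c} (q₃ : K33 κ c) {y} → y ∈ K33.b₁ q₃ ∷ [] → In κ c y
  b₁-In q₃ i1 = inj₂ (l⇒ (K33.l33 q₃) i4)

  -- The attached path is the single vertex b₁ of the class, which sees all of `A`.
  module BTx {c : Fin k'} (q₃ : K33 κ c) = BT o q₃ (one {K33.b₁ q₃}) (λ m → adj-sym (K33.a33 q₃ m i1)) {P = P} (UUb q₃)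
   (b₁-In q₃) kP

  -- On a spanning cycle every vertex starts a spanning path, so p1, ..., p4 all lie on one side of
  -- some class; but p1 and p2 are adjacent.
  cyc5 : ∀ {p1 p2 p3 p4 p5 R q} → Walk p1 (p1 ∷ p2 ∷ p3 ∷ p4 ∷ p5 ∷ R) q → p1 ∷ p2 ∷ p3 ∷ p4 ∷ p5 ∷ R ↭ P → q ~ p1 → ⊥
  cyc5 {p1} {p2} {p3} {p4} {p5} {R} {q} w h qp = true≢false (sym p12 ⨾ same-nadj o (fst sd) (hk h1) (hk h2) (fst (snd sd)) (fst (snd (snd (snd sd)))))
   where
   U0 : Unique (p1 ∷ p2 ∷ p3 ∷ p4 ∷ p5 ∷ R)
   U0 = U-↭ (↭-sym h) UP
   U5 : Unique (p1 ∷ p2 ∷ p3 ∷ p4 ∷ p5 ∷ [])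
   U5 = U-++ˡ (p1 ∷ p2 ∷ p3 ∷ p4 ∷ p5 ∷ []) U0
   h1 = rotH w qp h [] p1 _ refl
   h2 = rotH w qp h (p1 ∷ []) p2 _ refl
   h3 = rotH w qp h (p1 ∷ p2 ∷ []) p3 _ refl
   h4 = rotH w qp h (p1 ∷ p2 ∷ p3 ∷ []) p4 _ refl
   h5 = rotH w qp h (p1 ∷ p2 ∷ p3 ∷ p4 ∷ []) p5 _ refl
   p12 = fst (w-2nd w)
   w2 = snd (w-2nd w)
   p23 = fst (w-2nd w2)
   w3 = snd (w-2nd w2)
   w4 = snd (w-2nd w3)
   w5 = snd (w-2nd w4)
   kq : κ q ≡ fz
   kq = kP (Perm.∈-resp-↭ h (w-last∈ w))
   q∈ : q ∈ p5 ∷ R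
   q∈ = w-last∈ w5
   ne : ∀ {a b : V} {l} → Unique (a ∷ b ∷ l) → a ≢ b
   ne ((x ∷ _) ∷ _) = x
   n13 : p1 ≁ p3
   n13 = no3rd h1 (hk h2) kq (hk h3) (λ { refl → U∉ (U-++ʳ (p1 ∷ []) U0) (there (there q∈)) }) (ne (⊑-U (skip (keep (keep (skip (skip done))))) U5))
    (λ { refl → U∉ (U-++ʳ (p1 ∷ p2 ∷ []) U0) (there q∈) }) p12 (adj-sym qp)
   n24 : p2 ≁ p4
   n24 = no3rd h2 (hk h1) (hk h3) (hk h4) (ne (⊑-U (keep (skip (keep (skip (skip done))))) U5)) (ne (⊑-U (keep (skip (skip (keep (skip done))))) U5))
    (ne (⊑-U (skip (skip (keep (keep (skip done))))) U5)) (adj-sym p12) p23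
   n25 : p2 ≁ p5
   n25 = no3rd h2 (hk h1) (hk h3) (hk h5) (ne (⊑-U (keep (skip (keep (skip (skip done))))) U5)) (ne (⊑-U (keep (skip (skip (skip (keep done))))) U5))
    (ne (⊑-U (skip (skip (keep (skip (keep done))))) U5)) (adj-sym p12) p23
   p5≢p2 : p5 ≢ p2
   p5≢p2 refl = U∉ (U-++ʳ (p1 ∷ []) U5) i3
   module F = Four h1 h3 h2 h4 (hk h5) (U-↭ (prep p1 (swap p2 p3 refl)) U5) n13 n24 using (module WithU)
   module W = F.WithU h2 (nadj-sym n25) p5≢p2 (≤-trans (s-dR2 h5) (n≤1+n 2)) using (notK4; sided)
   sd = W.sided c₀

  module BarB (B : Barbell P) where
   open Barbell B

   private
    U0 : Unique ((l1 ∷ L) ++ N' ++ (m1 ∷ Mz))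
    U0 = subst Unique P≡ UP
    inP : ∀ {x} → x ∈ (l1 ∷ L) ++ N' ++ (m1 ∷ Mz) → x ∈ P
    inP m = cast∈ (sym P≡) m
    k0 : ∀ {x} → x ∈ (l1 ∷ L) ++ N' ++ (m1 ∷ Mz) → κ x ≡ fz
    k0 m = kP (inP m)
    inL : ∀ {x} → x ∈ l1 ∷ L → x ∈ (l1 ∷ L) ++ N' ++ (m1 ∷ Mz)
    inL = ∈-++⁺ˡ
    inN : ∀ {x} → x ∈ N' → x ∈ (l1 ∷ L) ++ N' ++ (m1 ∷ Mz)
    inN m = ∈-++⁺ʳ (l1 ∷ L) (∈-++⁺ˡ m)
    inM : ∀ {x} → x ∈ m1 ∷ Mz → x ∈ (l1 ∷ L) ++ N' ++ (m1 ∷ Mz)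
    inM m = ∈-++⁺ʳ (l1 ∷ L) (∈-++⁺ʳ N' m)
    LN : ∀ {x y} → x ∈ l1 ∷ L → y ∈ N' → x ≢ y
    LN a b refl = U-disj (l1 ∷ L) U0 a (∈-++⁺ˡ b)
    LM : ∀ {x y} → x ∈ l1 ∷ L → y ∈ m1 ∷ Mz → x ≢ y
    LM a b refl = U-disj (l1 ∷ L) U0 a (∈-++⁺ʳ N' b)
    NM : ∀ {x y} → x ∈ N' → y ∈ m1 ∷ Mz → x ≢ y
    NM a b refl = U-disj N' (U-++ʳ (l1 ∷ L) U0) a b
    n1∈ = w-head∈ wN
    n2∈ = w-last∈ wN
    l2∈ : l2 ∈ l1 ∷ L
    l2∈ = there (w-last∈ wL)
    m2∈ : m2 ∈ m1 ∷ Mz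
    m2∈ = there (w-last∈ wM)
    l'∈ : l' ∈ l1 ∷ L
    l'∈ = there (w-head∈ wL)
    l1≢l2 : l1 ≢ l2
    l1≢l2 refl = U∉ (U-++ˡ (l1 ∷ L) U0) (w-last∈ wL)
    l1≢l' : l1 ≢ l'
    l1≢l' refl = U∉ (U-++ˡ (l1 ∷ L) U0) (w-head∈ wL)
    m1≢m2 : m1 ≢ m2
    m1≢m2 refl = U∉ (U-++ʳ N' (U-++ʳ (l1 ∷ L) U0)) (w-last∈ wM)
    pa = bar-path₂ B
    pb = bar-path-m B
   hl2 : Head l2
   hl2 = mkHd (snd (snd pa)) (fst (snd pa))
   hm2 : Head m2
   hm2 = mkHd (w-rev (snd (snd pa))) (↭-trans (Perm.↭-reverse _) (fst (snd pa)))
   hl1 : Head l1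
   hl1 = mkHd (snd (snd pb)) (fst (snd pb))
   hm1 : Head m1
   hm1 = mkHd (w-rev (snd (snd pb))) (↭-trans (Perm.↭-reverse _) (fst (snd pb)))

   n11 : l1 ≁ m1
   n11 = no3rd hl1 (k0 (inL l'∈)) (k0 (inN n1∈)) (hk hm1) (LN l'∈ n1∈) (LM l'∈ i1) (NM n1∈ i1) l1l' l1n1

   m2no : ∀ {x} → x ∈ l1 ∷ L → m2 ≁ x
   m2no {x} m = no3rd hm2 (k0 (inN n2∈)) (k0 (inM (snd (snd pm)))) (k0 (inL m)) (NM n2∈ (snd (snd pm))) (LN m n2∈ ∘ sym) (LM m (snd (snd pm)) ∘ sym) (adj-sym n2m2) (fst (snd pm))
    where pm = pred m1m' wM

   finish : NotK4 κ → (q₃ : K33 κ c₀) → SideA q₃ l1 → SideA q₃ l2 → SideA q₃ m1 → SideA q₃ m2 → ⊥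
   finish nk q₃ a1 a2 b1 b2 = go (Bnbr nk q₃ hl1 hm1 (LM i1 i1) a1 b1)
    where
    go : Σ[ y ∈ V ] (y ∈ P × (K33.b₁ q₃) ~ y) → ⊥
    go (y , y∈ , by) = BTx.bar-kill q₃ B (fst a1) (fst a2) (fst b1) (fst b2) y∈ by (ne a1) (ne b1)
     where ne : ∀ {s} → SideA q₃ s → y ≢ s
           ne a refl = true≢false (sym (adj-sym by) ⨾ snd a i1)

   -- A fifth vertex `l'` on the first cycle allows `Four` for l1, m1, l2, m2, which all end up on
   -- one side. A neighbour of b₁ on the path is then an attachment that `bar-kill` excludes.
   bar-long : l' ≢ l2 → ⊥
   bar-long ne = finish W.notK4 (fst sd) (fst (snd sd)) (fst (snd (snd (snd sd)))) (fst (snd (snd sd))) (snd (snd (snd (snd sd))))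
    where
    l2≢m2 = LM l2∈ m2∈
    U5 : Unique (l1 ∷ m1 ∷ l2 ∷ m2 ∷ l' ∷ [])
    U5 = (LM i1 i1 ∷ l1≢l2 ∷ LM i1 m2∈ ∷ l1≢l' ∷ []) ∷ ((LM l2∈ i1 ∘ sym) ∷ m1≢m2 ∷ (LM l'∈ i1 ∘ sym) ∷ []) ∷
     (l2≢m2 ∷ (ne ∘ sym) ∷ []) ∷ ((LM l'∈ m2∈ ∘ sym) ∷ []) ∷ [] ∷ []
    du : dR κ l' ≤ 3
    du = k (w-head wL)
     where
     wP : Walk l1 ((l1 ∷ L) ++ N' ++ (m1 ∷ Mz)) m2
     wP = w-join (l1l' ∷ wL) l2n1 (w-join wN n2m1 (m1m' ∷ wM))
     k : Σ[ L' ∈ List V ] L ≡ l' ∷ L' → dR κ l' ≤ 3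
     k (L' , eq) = 2nd≤3 (subst (λ t → Walk l1 ((l1 ∷ t) ++ N' ++ (m1 ∷ Mz)) m2) eq wP) (re↭ (cong (λ t → (l1 ∷ t) ++ N' ++ (m1 ∷ Mz)) (sym eq) ⨾ sym P≡))
    module F = Four hl1 hm1 hl2 hm2 (k0 (inL l'∈)) U5 n11 (nadj-sym (m2no l2∈)) using (module WithU)
    module W = F.WithU hm2 (nadj-sym (m2no l'∈)) (LM l'∈ m2∈) du using (notK4; sided)
    sd = W.sided c₀

  module Triangles {l1 l2 n1 n2 m1 m2 N'} (wN : Walk n1 N' n2) (P↭ : l1 ∷ l2 ∷ N' ++ m1 ∷ m2 ∷ [] ↭ P)
   (ll : l1 ~ l2) (l1n : l1 ~ n1) (l2n : l2 ~ n1) (mm : m1 ~ m2) (m1n : m1 ~ n2) (m2n : m2 ~ n2) where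

   U0 : Unique (l1 ∷ l2 ∷ N' ++ m1 ∷ m2 ∷ [])
   U0 = U-↭ (↭-sym P↭) UP
   k0 : ∀ {x} → x ∈ l1 ∷ l2 ∷ N' ++ m1 ∷ m2 ∷ [] → κ x ≡ fz
   k0 m = kP (Perm.∈-resp-↭ P↭ m)

   hl1 : Head l1
   hl1 = mkHd (ll ∷ l2n ∷ w-join wN (adj-sym m1n) (mm ∷ one)) P↭

   -- `l1` and the triangle of the K₄ form a chorded cycle. Two of l2, m1, m2 seeing `x` would give
   -- a second one in R without `l1`, together with `x`.
   col0 : ∀ {c x y z w} → Tet κ c x y z w → 2 ≤ sumB (e l1 y ∷ e l1 z ∷ e l1 w ∷ []) →
    (e m1 x ∧ e m2 x ≡ true → ⊥) × (e l2 x ∧ e m1 x ≡ true → ⊥) × (e l2 x ∧ e m2 x ≡ true → ⊥)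
   col0 {c} {x} t h = (λ q → f1 (∧2 (e m1 x) (e m2 x) q)) , (λ q → f2 (∧2 (e l2 x) (e m1 x) q)) , (λ q → f3 (∧2 (e l2 x) (e m2 x) q))
    where
    kx : κ x ≡ fs c
    kx = l⇒ (Tet.tl4 t) i1
    ux : Unique (x ∷ l2 ∷ N' ++ m1 ∷ m2 ∷ [])
    ux = U-cons (λ m → Fin.0≢1+n (sym (k0 (there m)) ⨾ kx)) (U-++ʳ (l1 ∷ []) U0)
    g : ∀ {v} → v ∈ x ∷ l2 ∷ N' ++ m1 ∷ m2 ∷ [] → v ≢ l1 × (v ≡ x ⊎ κ v ≡ fz)
    g i1 = (λ { refl → Fin.0≢1+n (sym (hk hl1) ⨾ kx) }) , inj₁ refl
    g (there m) = (λ { refl → U∉ U0 m }) , inj₂ (k0 (there m))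
    kill : Σ[ C ∈ CC ] (∀ {v} → v ∈ vs C → v ∈ x ∷ l2 ∷ N' ++ m1 ∷ m2 ∷ []) → ⊥
    kill (C , hC) = tet-two o t (hk hl1) h C (λ m → g (hC m))
    base : List (Layout.Fact (vx x) (vx l2 ∷ seg wN ∷ vx m1 ∷ vx m2 ∷ []) ux)
    base = 1 - 2 ! l2n ∷ (tl 2 , hd 3 , adj-sym m1n) ∷ (tl 2 , hd 4 , adj-sym m2n) ∷ 3 - 4 ! mm ∷ []
    f1 : m1 ~ x × m2 ~ x → ⊥
    f1 (a , b) = kill (CC! (vx x) (vx l2 ∷ seg wN ∷ vx m1 ∷ vx m2 ∷ []) ux (3 - 0 ! a ∷ 4 - 0 ! b ∷ base) 3 (fw 0 ∷ fw 4 ∷ bw 2 ∷ []) refl)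
    f2 : l2 ~ x × m1 ~ x → ⊥
    f2 (a , b) = kill (CC! (vx x) (vx l2 ∷ seg wN ∷ vx m1 ∷ vx m2 ∷ []) ux (1 - 0 ! a ∷ 3 - 0 ! b ∷ base) 3 (fw 0 ∷ fw 1 ∷ fw 2 ∷ fw 4 ∷ []) refl)
    f3 : l2 ~ x × m2 ~ x → ⊥
    f3 (a , b) = kill (CC! (vx x) (vx l2 ∷ seg wN ∷ vx m1 ∷ vx m2 ∷ []) ux (1 - 0 ! a ∷ 4 - 0 ! b ∷ base) 4 (fw 0 ∷ fw 1 ∷ fw 2 ∷ fw 3 ∷ []) refl)

   heavy : ∀ {c x y z w} → Tet κ c x y z w → 3 ≤ D κ l1 c → D κ l2 c + (D κ m1 c + D κ m2 c) ≤ 4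
   heavy {c} {x} {y} {z} {w} t h = ≤-trans (≡⇒≤ (cong₂ _+_ (tet-D t l2) (cong₂ _+_ (tet-D t m1) (tet-D t m2))))
    (cols3 {b2n (e l2 x)} {b2n (e l2 y)} {b2n (e l2 z)} {b2n (e l2 w)} {b2n (e m1 x)} {b2n (e m1 y)} {b2n (e m1 z)} {b2n (e m1 w)} {b2n (e m2 x)} {b2n (e m2 y)} {b2n (e m2 z)} {b2n (e m2 w)} (cl t h1) (cl (trot t) h2) (cl (trot (trot t)) h3) (cl (trot (trot (trot t))) h4))
    where
    sh : ∀ a b c d → 3 ≤ sumB (a ∷ b ∷ c ∷ d ∷ []) → 3 ≤ sumB (b ∷ c ∷ d ∷ a ∷ [])
    sh a b c d h = ≤-trans h (≡⇒≤ (lem (b2n a) (b2n b) (b2n c) (b2n d)))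
     where lem : ∀ a b c d → a + (b + (c + (d + 0))) ≡ b + (c + (d + (a + 0)))
           lem = solve-∀
    h1 : 3 ≤ sumB (e l1 x ∷ e l1 y ∷ e l1 z ∷ e l1 w ∷ [])
    h1 = subst (3 ≤_) (tet-D t l1) h
    h2 = sh (e l1 x) (e l1 y) (e l1 z) (e l1 w) h1
    h3 = sh (e l1 y) (e l1 z) (e l1 w) (e l1 x) h2
    h4 = sh (e l1 z) (e l1 w) (e l1 x) (e l1 y) h3
    cl : ∀ {x y z w} → Tet κ c x y z w → 3 ≤ sumB (e l1 x ∷ e l1 y ∷ e l1 z ∷ e l1 w ∷ []) → b2n (e l2 x) + (b2n (e m1 x) + b2n (e m2 x)) ≤ 1
    cl {x} {y} {z} {w} t h = le1 (e l2 x) (e m1 x) (e m2 x) (fst (snd r)) (snd (snd r)) (fst r)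
     where
     r = col0 t (sum3≥2 (e l1 x) (e l1 y) (e l1 z) (e l1 w) h)
     le1 : ∀ a b c → (a ∧ b ≡ true → ⊥) → (a ∧ c ≡ true → ⊥) → (b ∧ c ≡ true → ⊥) → b2n a + (b2n b + b2n c) ≤ 1
     le1 true true _ h _ _ = ⊥-elim (h refl)
     le1 true false true _ h _ = ⊥-elim (h refl)
     le1 false true true _ _ h = ⊥-elim (h refl)
     le1 true false false _ _ _ = s≤s z≤n
     le1 false true false _ _ _ = s≤s z≤n
     le1 false false c _ _ _ = b2n≤1 c
    cols3 : ∀ {px py pz pw qx qy qz qw rx ry rz rw} → px + (qx + rx) ≤ 1 → py + (qy + ry) ≤ 1 → pz + (qz + rz) ≤ 1 → pw + (qw + rw) ≤ 1 →
     (px + (py + (pz + (pw + 0)))) + ((qx + (qy + (qz + (qw + 0)))) + (rx + (ry + (rz + (rw + 0))))) ≤ 4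
    cols3 {px} {py} {pz} {pw} {qx} {qy} {qz} {qw} {rx} {ry} {rz} {rw} a b c d = ≤-trans (≡⇒≤ (lem px py pz pw qx qy qz qw rx ry rz rw)) (+-mono-≤ (+-mono-≤ a b) (+-mono-≤ c d))
     where lem : ∀ px py pz pw qx qy qz qw rx ry rz rw → (px + (py + (pz + (pw + 0)))) + ((qx + (qy + (qz + (qw + 0)))) + (rx + (ry + (rz + (rw + 0))))) ≡ ((px + (qx + rx)) + (py + (qy + ry))) + ((pz + (qz + rz)) + (pw + (qw + rw)))
           lem = solve-∀

   -- `l1` replaces b₁ in the class, and b₁ closes l2, N', m2, m1 to a cycle with the chord from m1
   -- to the end of N'.
   opp : ∀ {c} (q₃ : K33 κ c) → SideA q₃ l1 → SideB q₃ l2 → SideB q₃ m1 → ⊥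
   opp {c} (mk33 {a1} {a2} {a3} {b1} {b2} {b3} l a) (s1 , _) (s2 , _) (sm , _) =
    two! (cfg o) c (vx a1) (vx a2 ∷ vx a3 ∷ vx b1 ∷ vx b2 ∷ vx b3 ∷ vx l1 ∷ vx l2 ∷ seg wN ∷ vx m1 ∷ vx m2 ∷ [])
    (mixU l U0 k0) (mixI {κ} l k0)
    (6 - 0 ! s1 i1 ∷ 6 - 1 ! s1 i2 ∷ (hd 6 , hd 2 , s1 i3) ∷
    0 - 4 ! a i1 i2 ∷ 1 - 4 ! a i2 i2 ∷
    (hd 1 , hd 5 , a i2 i3) ∷ (hd 2 , hd 5 , a i3 i3) ∷
    3 - 7 ! adj-sym (s2 i1) ∷ 3 - 9 ! adj-sym (sm i1) ∷ 7 - 8 ! l2n ∷ (tl 8 , hd 10 , adj-sym m2n) ∷ (hd 9 , tl 8 , m1n) ∷ 9 - 10 ! mm ∷ [])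
    6 (fw 0 ∷ fw 4 ∷ fw 1 ∷ fw 5 ∷ fw 2 ∷ []) 9 (fw 3 ∷ fw 7 ∷ fw 8 ∷ fw 10 ∷ []) refl

 module TriEnd {κ : V → K} {P : List V} (H : HamP κ P) {l1 l2 n1 n2 m1 m2 N'} (wN : Walk n1 N' n2) (P↭ : l1 ∷ l2 ∷ N' ++ m1 ∷ m2 ∷ [] ↭ P)
  (ll : l1 ~ l2) (l1n : l1 ~ n1) (l2n : l2 ~ n1) (mm : m1 ~ m2) (m1n : m1 ~ n2) (m2n : m2 ~ n2) where
  open Ham3 H using (module Four; Head; module Triangles; hk; no3rd; o)

  sw : ∀ {l1 l2 m1 m2 : V} N' → l2 ∷ l1 ∷ N' ++ m1 ∷ m2 ∷ [] ↭ l1 ∷ l2 ∷ N' ++ m1 ∷ m2 ∷ []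
  sw {l1} {l2} N' = swap l2 l1 refl
  swm : ∀ {l1 l2 m1 m2 : V} N' → l1 ∷ l2 ∷ N' ++ m2 ∷ m1 ∷ [] ↭ l1 ∷ l2 ∷ N' ++ m1 ∷ m2 ∷ []
  swm {l1} {l2} {m1} {m2} N' = prep l1 (prep l2 (Perm.++⁺ˡ N' (swap m2 m1 refl)))
  rv : m1 ∷ m2 ∷ reverse N' ++ l1 ∷ l2 ∷ [] ↭ P
  rv = ↭-trans (Perm.++-comm (m1 ∷ m2 ∷ []) (reverse N' ++ l1 ∷ l2 ∷ [])) (↭-trans (Perm.++⁺ʳ (m1 ∷ m2 ∷ []) (↭-trans (Perm.++-comm (reverse N') (l1 ∷ l2 ∷ [])) (prep l1 (prep l2 (Perm.↭-reverse N'))))) P↭)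

  module T1 = Triangles wN P↭ ll l1n l2n mm m1n m2n using (U0; heavy; hl1; k0; opp)
  module T1m = Triangles wN (↭-trans (swm N') P↭) ll l1n l2n (adj-sym mm) m2n m1n using (opp)
  module T2 = Triangles wN (↭-trans (sw N') P↭) (adj-sym ll) l2n l1n mm m1n m2n using (heavy; hl1)
  module T3 = Triangles (w-rev wN) rv mm m1n m2n ll l1n l2n using (heavy; hl1)
  module T4 = Triangles (w-rev wN) (↭-trans (sw (reverse N')) rv) (adj-sym mm) m2n m1n ll l1n l2n using (heavy; hl1)

  n1∈ = w-head∈ wN
  U0 = T1.U0
  k0 = T1.k0
  U5 : Unique (l1 ∷ m1 ∷ l2 ∷ m2 ∷ n1 ∷ [])
  U5 = go (∈-split n1∈)
   where
   go : Σ[ a ∈ List V ] Σ[ b ∈ List V ] (N' ≡ a ++ n1 ∷ b) → Unique (l1 ∷ m1 ∷ l2 ∷ m2 ∷ n1 ∷ [])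
   go (a , b , q) = U-↭ pm (⊑-U (keep (keep (⊑-drop a (keep (⊑-drop b ⊑-refl))))) (subst (λ t → Unique (l1 ∷ l2 ∷ t)) (cong (_++ m1 ∷ m2 ∷ []) q ⨾ ++-assoc a (n1 ∷ b) _) U0))
    where
    pm : l1 ∷ l2 ∷ n1 ∷ m1 ∷ m2 ∷ [] ↭ l1 ∷ m1 ∷ l2 ∷ m2 ∷ n1 ∷ []
    pm = prep l1 (↭-trans (prep l2 (Perm.++-comm (n1 ∷ []) (m1 ∷ m2 ∷ []))) (swap l2 m1 refl))
  nn : ∀ {l l' m} → Head l → κ l' ≡ fz → κ n1 ≡ fz → κ m ≡ fz → Unique (l' ∷ n1 ∷ m ∷ []) → l ~ l' → l ~ n1 → l ≁ m
  nn h a b c ((x ∷ y ∷ []) ∷ (z ∷ []) ∷ _) = no3rd h a b c x y z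
  kl1 = hk T1.hl1
  kl2 = hk T2.hl1
  km1 = hk T3.hl1
  km2 = hk T4.hl1
  kn1 : κ n1 ≡ fz
  kn1 = k0 (there (there (∈-++⁺ˡ n1∈)))
  n11 : l1 ≁ m1
  n11 = nn T1.hl1 kl2 kn1 km1 (⊑-U (keep (keep (keep done))) (U-↭ (↭-trans (swap m1 l2 refl) (prep l2 (swap m1 n1 refl))) (⊑-U (skip (keep (keep (skip (keep done))))) U5))) ll l1n
  n22 : l2 ≁ m2
  n22 = nn T2.hl1 kl1 kn1 km2 (U-↭ (prep l1 (swap m2 n1 refl)) (⊑-U (keep (skip (skip (keep (keep done))))) U5)) (adj-sym ll) l2n

  module F = Four T1.hl1 T3.hl1 T2.hl1 T4.hl1 kn1 U5 n11 n22 using (D4; D≤4; module WithU; f≡12; get33; k1)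

  -- A vertex with three edges to the K₄ leaves at most four for the other three; if there is no
  -- such vertex, each has at most two. Either way the total is at most 8 instead of 12.
  nt : ∀ {x y z w} → Tet κ c₀ x y z w → ⊥
  nt t = tri8 (D κ l1 c₀) (D κ m1 c₀) (D κ l2 c₀) (D κ m2 c₀) (F.D≤4 t l1) (F.D≤4 t m1) (F.D≤4 t l2) (F.D≤4 t m2)
   (T1.heavy t) (T2.heavy t) (T3.heavy t) (T4.heavy t) (F.f≡12 c₀)

  q₀ = F.get33 c₀ nt
  d4 = F.D4 c₀ nt

  opp-sides : (q : K33 κ c₀) → ∀ {u v} → κ u ≡ fz → κ v ≡ fz → u ~ v → SideA q u → D κ v c₀ ≡ 3 → SideB q v
  opp-sides q ku kv uv a dv = [ (λ b → ⊥-elim (true≢false (sym uv ⨾ same-nadj o q ku kv a b))) , id ]′ (side o q kv dv)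

  -- l1 and l2 are adjacent and hence on opposite sides, as are m1 and m2; so one of the m's is
  -- opposite to l1, and `opp` applies.
  endA : (q : K33 κ c₀) → SideA q l1 → ⊥
  endA q a1 = [ (λ ma → T1m.opp q a1 b2 (opp-sides q km1 km2 mm ma (snd (snd (snd d4))))) , (λ mb → T1.opp q a1 b2 mb) ]′ (side o q km1 (fst (snd d4)))
   where b2 = opp-sides q kl1 kl2 ll a1 (fst (snd (snd d4)))

  dead : ⊥
  dead = [ endA q₀ , endA (flip33 q₀) ]′ (side o q₀ kl1 (fst d4))

 short-walk : ∀ {x X x'} → Walk x X x' → ¬ (2 ≤ length X) → X ≡ x ∷ [] × x ≡ x'
 short-walk one h = refl , refl
 short-walk (g ∷ w) h = ⊥-elim (h (s≤s (ln w)))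
  where ln : ∀ {a l b} → Walk a l b → 1 ≤ length l
        ln one = s≤s z≤n
        ln (_ ∷ _) = s≤s z≤n

 long-ends : ∀ {x X x'} → Walk x X x' → Unique X → 2 ≤ length X → x ≢ x'
 long-ends one u (s≤s ())
 long-ends (g ∷ w) u h refl = U∉ u (w-last∈ w)

 bar-dead : ∀ {κ P} → HamP κ P → Barbell P → ⊥
 bar-dead {κ} {P} H B = go (2 ≤? length L) (2 ≤? length Mz)
  where
  open Barbell B
  UP : Unique P
  UP = lu (hl H)
  UL : ∀ {P} (B : Barbell P) → Unique P → Unique (Barbell.L B)
  UL B u = U-++ʳ (Barbell.l1 B ∷ []) (U-++ˡ (Barbell.l1 B ∷ Barbell.L B) (subst Unique (Barbell.P≡ B) u))
  go : Dec (2 ≤ length L) → Dec (2 ≤ length Mz) → ⊥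
  go (yes h) _ = Ham3.BarB.bar-long H B (long-ends wL (UL B UP) h)
  go (no _) (yes h) = Ham3.BarB.bar-long (HamP-perm (Perm.↭-reverse P) H) B' (long-ends (Barbell.wL B') (UL B' (U-rev UP)) (≤-trans h (≡⇒≤ (sym (snd r)))))
   where
   r = bar-flip B UP
   B' = fst r
  go (no a) (no b) = k (short-walk wL a) (short-walk wM b)
   where
   k : L ≡ l' ∷ [] × l' ≡ l2 → Mz ≡ m' ∷ [] × m' ≡ m2 → ⊥
   k (eL , refl) (eM , refl) = TriEnd.dead H wN (re↭ (sym (P≡ ⨾ cong₂ (λ x y → (l1 ∷ x) ++ N' ++ (m1 ∷ y)) eL eM))) l1l' l1n1 l2n1 m1m' (adj-sym n2m1) (adj-sym n2m2)

 module ThetaLong {κ : V → K} {P : List V} (H : HamP κ P) (θ : Theta P) {X2' x2₂} (eX : Theta.X2 θ ≡ Theta.x2 θ ∷ X2') (g2 : (Theta.x2 θ) ~ x2₂) (w2' : Walk x2₂ X2' (Theta.x2' θ)) where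
  open Theta θ
  open Ham3 H using (module Four; Head; UP; hk; kP; mkHd; no3rd; o)

  ↭P2 : X1 ++ β₁ ∷ (x2 ∷ X2') ++ β₂ ∷ X3 ↭ P
  ↭P2 = subst (λ z → X1 ++ β₁ ∷ z ++ β₂ ∷ X3 ↭ P) eX P↭
  hs : (θ : Theta P) → Head (Theta.x1' θ) × Head (Theta.x3 θ)
  hs θ = mkHd (fst (th-path θ)) (snd (th-path θ)) , mkHd (w-rev (fst (th-path θ))) (↭-trans (Perm.↭-reverse _) (snd (th-path θ)))
  h1' = fst (hs θ)
  h3 = snd (hs θ)
  h2' = fst (hs (th-rot θ))
  h2 = snd (hs (th-rot (th-rot θ)))

  U0 : Unique (X1 ++ β₁ ∷ (x2 ∷ X2') ++ β₂ ∷ X3)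
  U0 = U-↭ (↭-sym ↭P2) UP
  k0 : ∀ {x} → x ∈ X1 ++ β₁ ∷ (x2 ∷ X2') ++ β₂ ∷ X3 → κ x ≡ fz
  k0 m = kP (Perm.∈-resp-↭ ↭P2 m)
  j1 : ∀ {x} → x ∈ X1 → x ∈ X1 ++ β₁ ∷ (x2 ∷ X2') ++ β₂ ∷ X3
  j1 = ∈-++⁺ˡ
  iβ : β₁ ∈ X1 ++ β₁ ∷ (x2 ∷ X2') ++ β₂ ∷ X3
  iβ = ∈-++⁺ʳ X1 i1
  j2 : ∀ {x} → x ∈ x2 ∷ X2' → x ∈ X1 ++ β₁ ∷ (x2 ∷ X2') ++ β₂ ∷ X3
  j2 m = ∈-++⁺ʳ X1 (there (∈-++⁺ˡ m))
  iγ : β₂ ∈ X1 ++ β₁ ∷ (x2 ∷ X2') ++ β₂ ∷ X3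
  iγ = ∈-++⁺ʳ X1 (there (∈-++⁺ʳ (x2 ∷ X2') i1))
  j3 : ∀ {x} → x ∈ X3 → x ∈ X1 ++ β₁ ∷ (x2 ∷ X2') ++ β₂ ∷ X3
  j3 m = ∈-++⁺ʳ X1 (there (∈-++⁺ʳ (x2 ∷ X2') (there m)))
  d12 : ∀ {x y} → x ∈ X1 → y ∈ x2 ∷ X2' → x ≢ y
  d12 a b refl = U-disj X1 U0 a (there (∈-++⁺ˡ b))
  d1β : ∀ {x} → x ∈ X1 → x ≢ β₁
  d1β a refl = U-disj X1 U0 a i1
  d13 : ∀ {x y} → x ∈ X1 → y ∈ X3 → x ≢ y
  d13 a b refl = U-disj X1 U0 a (there (∈-++⁺ʳ (x2 ∷ X2') (there b)))
  Uβ : Unique (β₁ ∷ (x2 ∷ X2') ++ β₂ ∷ X3)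
  Uβ = U-++ʳ X1 U0
  dβ2 : ∀ {x} → x ∈ x2 ∷ X2' → x ≢ β₁
  dβ2 a refl = U∉ Uβ (∈-++⁺ˡ a)
  dβγ : β₁ ≢ β₂
  dβγ q = U∉ Uβ (subst (_∈ (x2 ∷ X2') ++ β₂ ∷ X3) (sym q) (∈-++⁺ʳ (x2 ∷ X2') i1))
  dβ3 : ∀ {x} → x ∈ X3 → x ≢ β₁
  dβ3 a refl = U∉ Uβ (∈-++⁺ʳ (x2 ∷ X2') (there a))
  U2 = U-++ʳ (β₁ ∷ []) Uβ
  d2γ : ∀ {x} → x ∈ x2 ∷ X2' → x ≢ β₂
  d2γ a refl = U-disj (x2 ∷ X2') U2 a i1
  d23 : ∀ {x y} → x ∈ x2 ∷ X2' → y ∈ X3 → x ≢ y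
  d23 a b refl = U-disj (x2 ∷ X2') U2 a (there b)
  dγ3 : ∀ {x} → x ∈ X3 → x ≢ β₂
  dγ3 a refl = U∉ (U-++ʳ (x2 ∷ X2') U2) a
  m1' = w-last∈ w1
  m2' : x2' ∈ x2 ∷ X2'
  m2' = there (w-last∈ w2')
  m3 = w-head∈ w3
  m22 : x2₂ ∈ x2 ∷ X2'
  m22 = there (w-head∈ w2')
  x2≢x2' : x2 ≢ x2'
  x2≢x2' q = U∉ (U-++ˡ (x2 ∷ X2') U2) (subst (_∈ X2') (sym q) (w-last∈ w2'))
  pr : Σ[ x ∈ V ] (x2' ~ x × x ∈ x2 ∷ X2')
  pr = pred g2 w2'
  n12 : x1' ≁ x2
  n12 = nadj-sym (no3rd h2 (k0 iβ) (k0 (j2 m22)) (hk h1') (dβ2 m22 ∘ sym) (d1β m1' ∘ sym) (d12 m1' m22 ∘ sym) (adj-sym β2) g2)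
  n2' : ∀ {y} → κ y ≡ fz → y ≢ β₂ → (∀ {x} → x ∈ x2 ∷ X2' → x ≢ y) → x2' ≁ y
  n2' ky yb y2 = no3rd h2' (k0 iγ) (k0 (j2 (snd (snd pr)))) ky (d2γ (snd (snd pr)) ∘ sym) (yb ∘ sym) (y2 (snd (snd pr))) b2β (fst (snd pr))
  n23 : x2' ≁ x3
  n23 = n2' (hk h3) (dγ3 m3) (λ m → d23 m m3)
  nβ : β₁ ≁ x2'
  nβ = nadj-sym (n2' (k0 iβ) dβγ dβ2)
  U5 : Unique (x1' ∷ x2 ∷ x2' ∷ x3 ∷ β₁ ∷ [])
  U5 = (d12 m1' i1 ∷ d12 m1' m2' ∷ d13 m1' m3 ∷ d1β m1' ∷ []) ∷ (x2≢x2' ∷ d23 i1 m3 ∷ dβ2 i1 ∷ []) ∷ (d23 m2' m3 ∷ dβ2 m2' ∷ []) ∷ (dβ3 m3 ∷ []) ∷ [] ∷ []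
  hub≤2 : ∀ {a Q b} → Walk a Q b → Unique (β₁ ∷ Q) → (∀ {x} → x ∈ Q → κ x ≡ fz) → cntL (e β₁) Q ≤ 2
  hub≤2 {Q = Q} w u z = go (3 ≤? cntL (e β₁) Q)
   where
   go : Dec (3 ≤ cntL (e β₁) Q) → cntL (e β₁) Q ≤ 2
   go (no r) = ≤-pred (≰⇒> r)
   go (yes r) = ⊥-elim (noCC₀ (cfg o) (mkCC w u r) (λ { i1 → k0 iβ ; (there m) → z m }))
  -- β₁ is a possible hub for the path through X1, β₂ and a second arm in reverse. The two detours,
  -- through X2 and through X3, bound the degree of β₁ in R by 3.
  detour : ∀ X {x x'} → Walk x X x' → x' ~ β₂ → Unique (β₁ ∷ X1 ++ β₂ ∷ X) → (∀ {y} → y ∈ X → κ y ≡ fz) → cntL (e β₁) X1 + (b2n (e β₁ β₂) + cntL (e β₁) X) ≤ 2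
  detour X w g u z = ≤-trans (≡⇒≤ (sym (cntL-++ (e β₁) X1 (β₂ ∷ reverse X) ⨾ cong (λ t → cntL (e β₁) X1 + (b2n (e β₁ β₂) + t)) (cntL-reverse (e β₁) X))))
   (hub≤2 (w-join w1 b1β (adj-sym g ∷ w-rev w)) (U-↭ (prep β₁ (Perm.++⁺ˡ X1 (prep β₂ (↭-sym (Perm.↭-reverse X))))) u)
   (λ m → [ (λ r → k0 (j1 r)) , (λ { i1 → k0 iγ ; (there r) → z (Perm.∈-resp-↭ (Perm.↭-reverse X) r) }) ]′ (∈-++⁻ X1 m)))
  dβ : dR κ β₁ ≤ 3
  dβ = ≤-trans (≡⇒≤ (d-L (L-perm (↭-sym ↭P2) (hl H)) β₁ ⨾ cntL-++ (e β₁) X1 _ ⨾ cong (cntL (e β₁) X1 +_) (cong (λ t → b2n t + cntL (e β₁) ((x2 ∷ X2') ++ β₂ ∷ X3)) (E-irr G β₁) ⨾ cntL-++ (e β₁) (x2 ∷ X2') (β₂ ∷ X3))))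
   (branch3 (cntL (e β₁) X1) (cntL (e β₁) (x2 ∷ X2')) (cntL (e β₁) X3) (b2n (e β₁ β₂)) (cntL-pos (e β₁) (w-head∈ w1) β1) (cntL-pos (e β₁) {x2 ∷ X2'} i1 β2)
   (detour (x2 ∷ X2') (g2 ∷ w2') b2β (⊑-U (keep (⊑-pre X1 (keep (subst (x2 ∷ X2' ⊑_) refl (⊑-fst (x2 ∷ X2')))))) u2) (k0 ∘ j2))
   (detour X3 w3 b3β (⊑-U (keep (⊑-pre X1 (keep (⊑-drop (x2 ∷ X2') ⊑-refl)))) u2) (k0 ∘ j3)))
   where
   ⊑-fst : ∀ (l : List V) {m} → l ⊑ l ++ m
   ⊑-fst [] {[]} = done
   ⊑-fst [] {x ∷ m} = skip (⊑-fst [])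
   ⊑-fst (x ∷ l) = keep (⊑-fst l)
   u2 : Unique (β₁ ∷ X1 ++ β₂ ∷ (x2 ∷ X2') ++ X3)
   u2 = U-↭ (↭-trans (Perm.shift β₁ X1 _) (prep β₁ (Perm.++⁺ˡ X1 (Perm.shift β₂ (x2 ∷ X2') X3)))) U0

  module F = Four h1' h2 h2' h3 (k0 iβ) U5 n12 n23 using (D4; D≤4; module WithU; f≡12; get33; k1)
  module W = F.WithU h2' nβ (dβ2 m2' ∘ sym) dβ using (D3; notK4; same; sided)

  follow : (q : K33 κ c₀) → SideA q x2' → SideA q x1' × SideA q x2 × SideA q x3
  follow q a = go (side o q F.k1 (fst (W.D3 c₀)))
   where
   go : SideA q x1' ⊎ SideB q x1' → SideA q x1' × SideA q x2 × SideA q x3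
   go (inj₁ a1) = a1 , fst r , snd (snd r)
    where r = W.same q a1
   go (inj₂ b1) = ⊥-elim (true≢false (sym (fst a i1) ⨾ snd (fst (snd (W.same (flip33 q) b1))) i1))

  follow₂ : (q : K33 κ c₀) → SideA q x2 → SideA q x2'
  follow₂ q a = go (side o q F.k1 (fst (W.D3 c₀)))
   where
   go : SideA q x1' ⊎ SideB q x1' → SideA q x2'
   go (inj₁ a1) = fst (snd (W.same q a1))
   go (inj₂ b1) = ⊥-elim (true≢false (sym (fst a i1) ⨾ snd (fst (W.same (flip33 q) b1)) i1))

 th-cons : ∀ {x X x'} → Walk x X x' → 2 ≤ length X → Σ[ X' ∈ List V ] Σ[ y ∈ V ] (X ≡ x ∷ X' × x ~ y × Walk y X' x')
 th-cons w h = [ (λ { (refl , _) → ⊥-elim (1≱2 h) }) , id ]′ (one-or-long w)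
  where 1≱2 : 2 ≤ 1 → ⊥
        1≱2 (s≤s ())

 -- An arm with a single vertex has equal ends, and for a longer one `ThetaLong` puts both ends on
 -- the same side. Once all six ends agree, a neighbour of b₁ on the path contradicts `th-kill`.
 theta-long : ∀ {κ P} → HamP κ P → (θ : Theta P) → 2 ≤ length (Theta.X2 θ) → ⊥
 theta-long {κ} {P} H θ h = main (th-cons w2 h)
  where
  open Theta θ
  open Ham3 H using (module BTx; Bnbr)
  ends₁ : (q : K33 κ c₀) → SideA q x1' → SideA q x2 → SideA q x1
  ends₁ q a b = go (2 ≤? length X1)
   where
   go : Dec (2 ≤ length X1) → SideA q x1
   go (no r) = subst (SideA q) (sym (snd (short-walk w1 r))) a
   go (yes r) = fst (snd (ThetaLong.follow H (th-rot (th-rot θ)) (fst (snd (snd c))) (fst (snd (snd (snd c)))) (snd (snd (snd (snd c)))) q a))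
    where c = th-cons w1 r
  ends₃ : (q : K33 κ c₀) → SideA q x2' → SideA q x3 → SideA q x3'
  ends₃ q a b = go (2 ≤? length X3)
   where
   go : Dec (2 ≤ length X3) → SideA q x3'
   go (no r) = subst (SideA q) (snd (short-walk w3 r)) b
   go (yes r) = ThetaLong.follow₂ H (th-rot θ) (fst (snd (snd c))) (fst (snd (snd (snd c)))) (snd (snd (snd (snd c)))) q b
    where c = th-cons w3 r
  main : Σ[ X' ∈ List V ] Σ[ y ∈ V ] (X2 ≡ x2 ∷ X' × x2 ~ y × Walk y X' x2') → ⊥
  main (X2' , y , eX , g2 , w2') = fin (TL.W.sided c₀)
   where
   module TL = ThetaLong H θ eX g2 w2' using (module W; h2; h2'; x2≢x2')
   fin : Σ[ q ∈ K33 κ c₀ ] (SideA q x1' × SideA q x2 × SideA q x2' × SideA q x3) → ⊥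
   fin (q , a1' , a2 , a2' , a3) = go (Bnbr TL.W.notK4 q TL.h2 TL.h2' TL.x2≢x2' a2 a2')
    where
    module Z = BTx q
    a1 = ends₁ q a1' a2
    a3' = ends₃ q a2' a3
    go : Σ[ y ∈ V ] (y ∈ P × (K33.b₁ q) ~ y) → ⊥
    go (y , y∈ , by) = Z.th-kill θ (Z.mkTight (fst a1) (fst a1') (fst a2) (fst a2') (fst a3) (fst a3')) eX g2 w2' y∈ by (ne a1) (ne a2) (ne a3) (ne a2')
     where ne : ∀ {s} → SideA q s → y ≢ s
           ne a refl = true≢false (sym (adj-sym by) ⨾ snd a i1)

 theta-case : ∀ {κ P} → HamP κ P → Theta P → (K23 κ → ⊥) → ⊥
 theta-case {κ} {P} H θ kont = go (2 ≤? length X1) (2 ≤? length X2) (2 ≤? length X3)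
  where
  open Theta θ
  go : Dec (2 ≤ length X1) → Dec (2 ≤ length X2) → Dec (2 ≤ length X3) → ⊥
  go (yes h) _ _ = theta-long H (th-rot (th-rot θ)) h
  go _ (yes h) _ = theta-long H θ h
  go _ _ (yes h) = theta-long H (th-rot θ) h
  go (no a) (no b) (no c) = k (short-walk w1 a) (short-walk w2 b) (short-walk w3 c)
   where
   k : X1 ≡ x1 ∷ [] × x1 ≡ x1' → X2 ≡ x2 ∷ [] × x2 ≡ x2' → X3 ≡ x3 ∷ [] × x3 ≡ x3' → ⊥
   k (e1 , refl) (e2 , refl) (e3 , refl) = kont (β₁ , β₂ , x1 , x2 , x3 , L-perm pm (hl H) ,
    λ { i1 → adj-sym β1 , b1β ; i2 → adj-sym β2 , b2β ; i3 → adj-sym β3 , b3β })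
    where
    pm : P ↭ β₁ ∷ β₂ ∷ x1 ∷ x2 ∷ x3 ∷ []
    pm = ↭-trans (↭-sym P↭) (↭-trans (re↭ (cong₂ (λ a bc → a ++ β₁ ∷ bc) e1 (cong₂ (λ b c → b ++ β₂ ∷ c) e2 e3)))
     (↭-trans (swap x1 β₁ refl) (prep β₁ (Perm.shift β₂ (x1 ∷ x2 ∷ []) (x3 ∷ [])))))

 caseB : ∀ {κ p P q} → Walk p P q → HamP κ P → 4 ≤ length P → (C4 κ → ⊥) → (K23 κ → ⊥) → ⊥
 caseB {κ} {p} {P} {q} w H len c4 k23 = begin′ P refl w len
  where
  open Ham3 H using (UP; cyc5; ends≥2; kP; o)
  two-ends : ∀ {a Q b} → Walk a (a ∷ Q) b → a ∷ Q ↭ P → a ≁ b → 2 ≤ cntL (e a) Q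
  two-ends {a} {Q} {b} wa h ab = go Q refl
   where
   ln : 4 ≤ suc (length Q)
   ln = ≤-trans len (≡⇒≤ (sym (Perm.↭-length h)))
   go : ∀ Q' → Q' ≡ Q → 2 ≤ cntL (e a) Q'
   go (p2 ∷ p3 ∷ p4 ∷ R) refl = ends≥2 wa h (s≤s z≤n) ab
   go (p2 ∷ p3 ∷ []) refl = ⊥-elim (3≱4 ln)
    where 3≱4 : 4 ≤ 3 → ⊥
          3≱4 (s≤s (s≤s (s≤s ())))
   go (p2 ∷ []) refl = ⊥-elim (2≱4 ln)
    where 2≱4 : 4 ≤ 2 → ⊥
          2≱4 (s≤s (s≤s ()))
   go [] refl = ⊥-elim (1≱4 ln)
    where 1≱4 : 4 ≤ 1 → ⊥
          1≱4 (s≤s ())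
  begin′ : ∀ P₀ → P₀ ≡ P → Walk p P₀ q → 4 ≤ length P₀ → ⊥
  begin′ (x ∷ P') refl w' ln = go (w-hd≡ w') (w-head (w-rev w'))
   where
   go : p ≡ x → Σ[ Q' ∈ List V ] reverse (x ∷ P') ≡ q ∷ Q' → ⊥
   go refl (Q' , rv) = cs (e p q) refl
    where
    wq : Walk q (q ∷ Q') p
    wq = subst (λ t → Walk q t p) rv (w-rev w')
    permq : q ∷ Q' ↭ p ∷ P'
    permq = ↭-trans (re↭ (sym rv)) (Perm.↭-reverse (p ∷ P'))
    cyc : ∀ P'' → P'' ≡ P' → Walk p (p ∷ P'') q → q ~ p → ⊥
    cyc (p2 ∷ p3 ∷ p4 ∷ p5 ∷ R) refl wc qp = cyc5 wc refl qp
    cyc (p2 ∷ p3 ∷ p4 ∷ []) refl wc qp = c4 (p , p2 , p3 , p4 , hl H , fst a , fst b , fst c , subst (λ t → t ~ p) (w-lst≡ (p ∷ p2 ∷ p3 ∷ []) wc) qp)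
     where a = w-2nd wc
           b = w-2nd (snd a)
           c = w-2nd (snd b)
    cyc (p2 ∷ p3 ∷ []) refl wc qp = 3≱4 ln
     where 3≱4 : 4 ≤ 3 → ⊥
           3≱4 (s≤s (s≤s (s≤s ())))
    cyc (p2 ∷ []) refl wc qp = 2≱4 ln
     where 2≱4 : 4 ≤ 2 → ⊥
           2≱4 (s≤s (s≤s ()))
    cyc [] refl wc qp = 1≱4 ln
     where 1≱4 : 4 ≤ 1 → ⊥
           1≱4 (s≤s ())
    shp : Shape (p ∷ P') → ⊥
    shp (bar B) = bar-dead H B
    shp (the θ) = theta-case H θ k23
    cs : ∀ b → e p q ≡ b → ⊥
    cs true pq = cyc P' refl w' (adj-sym pq)
    cs false pq = shp (shape (cfg o) w' UP kP wq rv pq (two-ends w' refl pq) (two-ends wq permq (nadj-sym pq)))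

 -- R is a 4-cycle

 record Cyc (κ : V → K) (a b c d : V) : Set where
  constructor mkCyc
  field
   yH : HamP κ (a ∷ b ∷ c ∷ d ∷ [])
   yab : a ~ b
   ybc : b ~ c
   ycd : c ~ d
   yda : d ~ a
 open Cyc

 cyc-rot : ∀ {κ a b c d} → Cyc κ a b c d → Cyc κ b c d a
 cyc-rot {a = a} (mkCyc H p q r s) = mkCyc (HamP-perm (↭-sym (Perm.++-comm (a ∷ []) _)) H) q r s p

 module OnCyc {κ a b c d} (Y : Cyc κ a b c d) where
  open Ham3 (yH Y) public using (Head; UP; hk; kP; kill4m; mkHd; no3rd; o; s-dR2; tet3)

  ha : Head a
  ha = mkHd (yab Y ∷ ybc Y ∷ ycd Y ∷ one) refl
  ka = hk ha
  kb = kP i2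
  kc = kP i3
  kd = kP i4
  ac : a ≢ c
  ac refl = U∉ UP i2
  nac : a ≁ c
  nac = no3rd ha kb kd kc (λ { refl → U∉ (U-++ʳ (a ∷ []) UP) i2 }) (λ { refl → U∉ (U-++ʳ (a ∷ []) UP) i1 }) (λ { refl → U∉ (U-++ʳ (a ∷ b ∷ []) UP) i1 }) (yab Y) (adj-sym (yda Y))

  S : Fin k' → ℕ
  S i = D κ a i + (D κ b i + (D κ c i + D κ d i))

  module OnTet {i x y z w} (t : Tet κ i x y z w) (h3 : 3 ≤ D κ a i) where

   colx : ∀ {x y z w} → Tet κ i x y z w → 3 ≤ sumB (e a x ∷ e a y ∷ e a z ∷ e a w ∷ []) → b2n (e b x) + (b2n (e c x) + b2n (e d x)) ≤ 2
   colx {x} {y} {z} {w} t h = b3≤2 (e b x) (e c x) (e d x) (f UP)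
    where
    f : Unique (a ∷ b ∷ c ∷ d ∷ []) → e b x ∧ e c x ∧ e d x ≡ true → ⊥
    f ((ab ∷ ac ∷ ad ∷ []) ∷ (bc ∷ bd ∷ []) ∷ (cd ∷ []) ∷ _) = tet3 ha t (sum3≥2 (e a x) (e a y) (e a z) (e a w) h) kb kc kd (ab ∘ sym) (ac ∘ sym) (ad ∘ sym) bc bd cd

   sh : ∀ p q r s → 3 ≤ sumB (p ∷ q ∷ r ∷ s ∷ []) → 3 ≤ sumB (q ∷ r ∷ s ∷ p ∷ [])
   sh p q r s h = ≤-trans h (≡⇒≤ (lem (b2n p) (b2n q) (b2n r) (b2n s)))
    where lem : ∀ a b c d → a + (b + (c + (d + 0))) ≡ b + (c + (d + (a + 0)))
          lem = solve-∀
   h1 : 3 ≤ sumB (e a x ∷ e a y ∷ e a z ∷ e a w ∷ [])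
   h1 = subst (3 ≤_) (tet-D t a) h3
   h2 = sh (e a x) (e a y) (e a z) (e a w) h1
   h3' = sh (e a y) (e a z) (e a w) (e a x) h2
   h4 = sh (e a z) (e a w) (e a x) (e a y) h3'

   Tight4 : Set
   Tight4 = D κ a i ≡ 4 × b2n (e b x) + (b2n (e c x) + b2n (e d x)) ≡ 2 × b2n (e b y) + (b2n (e c y) + b2n (e d y)) ≡ 2
    × b2n (e b z) + (b2n (e c z) + b2n (e d z)) ≡ 2 × b2n (e b w) + (b2n (e c w) + b2n (e d w)) ≡ 2

   bound : S i ≤ 12 × (S i ≡ 12 → Tight4)
   bound = subst (λ s → D κ a i + s ≤ 12 × (D κ a i + s ≡ 12 → Tight4)) (sym (cong₂ _+_ (tet-D t b) (cong₂ _+_ (tet-D t c) (tet-D t d))))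
    (cols12 (D κ a i) (b2n (e b x)) (b2n (e b y)) (b2n (e b z)) (b2n (e b w)) (b2n (e c x)) (b2n (e c y)) (b2n (e c z)) (b2n (e c w)) (b2n (e d x)) (b2n (e d y)) (b2n (e d z)) (b2n (e d w))
    (≤-trans (≡⇒≤ (tet-D t a)) (cntL≤length id (e a x ∷ e a y ∷ e a z ∷ e a w ∷ [])))
    (colx t h1) (colx (trot t) h2) (colx (trot (trot t)) h3') (colx (trot (trot (trot t))) h4))

   -- exchanging a for a vertex seen by two consecutive vertices of the cycle would make R a paw
   pawx : ∀ {x y z w} → Tet κ i x y z w → a ~ y → a ~ z → a ~ w → b2n (e b x) + (b2n (e c x) + b2n (e d x)) ≡ 2 →
    b ≁ d → b ~ x × c ≁ x × d ~ x
   pawx {x} t ay az aw q bd = outer2 (e b x) (e c x) (e d x) q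
    (λ bx cx dx → paw (Swapped.opt' X) (L-perm (↭-sym (Perm.↭-reverse (x ∷ b ∷ c ∷ d ∷ []))) (Swapped.LR X)) (adj-sym (ycd Y)) (adj-sym (ybc Y)) cx bx (nadj-sym bd) dx)
    (λ cx dx bx → paw (Swapped.opt' X) (L-perm (Perm.++-comm (x ∷ []) (b ∷ c ∷ d ∷ [])) (Swapped.LR X)) (ybc Y) (ycd Y) cx dx bd bx)
    where X = fst (tet-exch o t (hl (yH Y)) ay az aw)


   -- At equality `a` sees all of the K₄, and each of its vertices is seen by exactly two of `b`,
   -- `c`, `d`. By `pawx` these are `b` and `d`, so `b` sees all four as well.
   outer : b ≁ d → S i ≡ 12 → (b ~ x × c ≁ x × d ~ x) × D κ b i ≡ 4
   outer bd q = f1 , (tet-D t b ⨾ cong₂ _+_ (cong b2n (fst f1)) (cong₂ _+_ (cong b2n (fst f2)) (cong₂ _+_ (cong b2n (fst f3)) (cong (λ v → b2n v + 0) (fst f4)))))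
    where
    r = snd bound q
    a4 = all4 (e a x) (e a y) (e a z) (e a w) (sym (tet-D t a) ⨾ fst r)
    ax = fst a4
    ay = fst (snd a4)
    az = fst (snd (snd a4))
    aw = snd (snd (snd a4))
    f1 = pawx t ay az aw (fst (snd r)) bd
    f2 = pawx (trot t) az aw ax (fst (snd (snd r))) bd
    f3 = pawx (trot (trot t)) aw ax ay (fst (snd (snd (snd r)))) bd
    f4 = pawx (trot (trot (trot t))) ax ay az (snd (snd (snd (snd r)))) bd

 S-rot : ∀ a b c d → a + (b + (c + d)) ≡ b + (c + (d + a))
 S-rot = solve-∀

 module CycK2s {κ a b c d} (Y : Cyc κ a b c d) where
  Y2 = cyc-rot Y
  Y3 = cyc-rot Y2
  Y4 = cyc-rot Y3
  module A1 = OnCyc Y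
  module A2 = OnCyc Y2
  module A3 = OnCyc Y3
  module A4 = OnCyc Y4
  open A1 using (o; S)

  r12 : ∀ i → A2.S i ≡ S i
  r12 i = sym (S-rot (D κ a i) (D κ b i) (D κ c i) (D κ d i))
  r13 : ∀ i → A3.S i ≡ S i
  r13 i = sym (S-rot (D κ b i) (D κ c i) (D κ d i) (D κ a i)) ⨾ r12 i
  r14 : ∀ i → A4.S i ≡ S i
  r14 i = sym (S-rot (D κ c i) (D κ d i) (D κ a i) (D κ b i)) ⨾ r13 i

  S≤12 : ∀ i → S i ≤ 12
  S≤12 i = go (isTet o i)
   where
   lt : ∀ {m} → ¬ (3 ≤ m) → m ≤ 2
   lt h = ≤-pred (≰⇒> h)
   go : (Σ[ x ∈ V ] Σ[ y ∈ V ] Σ[ z ∈ V ] Σ[ w ∈ V ] Tet κ i x y z w) ⊎ (∀ {v} → κ v ≡ fz → D κ v i ≤ 3) → S i ≤ 12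
   go (inj₂ le) = +-mono-≤ (le A1.ka) (+-mono-≤ (le A1.kb) (+-mono-≤ (le A1.kc) (le A1.kd)))
   go (inj₁ (x , y , z , w , t)) = k (3 ≤? D κ a i) (3 ≤? D κ b i) (3 ≤? D κ c i) (3 ≤? D κ d i)
    where
    k : Dec (3 ≤ D κ a i) → Dec (3 ≤ D κ b i) → Dec (3 ≤ D κ c i) → Dec (3 ≤ D κ d i) → S i ≤ 12
    k (yes h) _ _ _ = fst (A1.OnTet.bound t h)
    k _ (yes h) _ _ = ≤-trans (≡⇒≤ (sym (r12 i))) (fst (A2.OnTet.bound t h))
    k _ _ (yes h) _ = ≤-trans (≡⇒≤ (sym (r13 i))) (fst (A3.OnTet.bound t h))
    k _ _ _ (yes h) = ≤-trans (≡⇒≤ (sym (r14 i))) (fst (A4.OnTet.bound t h))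
    k (no p) (no q) (no r) (no s) = ≤-trans (+-mono-≤ (lt p) (+-mono-≤ (lt q) (+-mono-≤ (lt r) (lt s)))) (m≤m+n 8 4)

  reassoc : ∀ i → (D κ a i + D κ c i) + (D κ b i + D κ d i) ≡ S i
  reassoc i = lem (D κ a i) (D κ b i) (D κ c i) (D κ d i)
   where lem : ∀ a b c d → (a + c) + (b + d) ≡ a + (b + (c + d))
         lem = solve-∀

  main : (6 * k' + 4) + (6 * k' + 4) ≤ ((dR κ a + dR κ c) + (dR κ b + dR κ d)) + ΣF S
  main = ≤-trans (+-mono-≤ (PI κ A1.ac A1.nac) (PI κ A2.ac A2.nac)) (≡⇒≤ (+-inter (dR κ a + dR κ c) _ (dR κ b + dR κ d) _
   ⨾ cong ((dR κ a + dR κ c) + (dR κ b + dR κ d) +_) (sym (ΣF-+ (λ i → D κ a i + D κ c i) (λ i → D κ b i + D κ d i)) ⨾ ΣF-cong reassoc)))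

  S≡12 : ∀ i → S i ≡ 12
  S≡12 = ΣF-tight S≤12 (≡⇒≤ (sym (snd (arithC k' _ _ main
   (+-mono-≤ (+-mono-≤ (A1.s-dR2 A1.ha) (A3.s-dR2 A3.ha)) (+-mono-≤ (A2.s-dR2 A2.ha) (A4.s-dR2 A4.ha))) (ΣF-upper S≤12)))))

  4≥3 : ∀ {m} → m ≡ 4 → 3 ≤ m
  4≥3 refl = s≤s (s≤s (s≤s z≤n))

 -- the neighbours of a common vertex x of C would be both cycle neighbours of a and both cycle neighbours of b
 noTet : ∀ {κ a b c d} (Y : Cyc κ a b c d) {i x y z w} → Tet κ i x y z w → 3 ≤ D κ a i → ⊥
 noTet {κ} {a} {b} {c} {d} Y {i} {x} t h = true≢false (sym (fst (fst u)) ⨾ fst (snd (fst r)))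
  where
  r = (CycK2s.A1.OnTet.outer Y) t h (CycK2s.A2.nac Y) ((CycK2s.S≡12 Y) i)
  u = (CycK2s.A2.OnTet.outer Y) t ((CycK2s.4≥3 Y) (snd r)) (CycK2s.A3.nac Y) ((CycK2s.r12 Y) i ⨾ (CycK2s.S≡12 Y) i)

 cyc-K2s : ∀ {κ a b c d} → Cyc κ a b c d → Σ[ k ∈ K2s κ ] 2 ≤ length (K2s.Vs k)
 cyc-K2s {κ} {a} {b} {c} {d} Y = mkK2s o {b} {d} {a ∷ c ∷ []} (L-perm (↭-trans (swap a b refl) (prep b (Perm.++-comm (a ∷ c ∷ []) (d ∷ [])))) (hl (yH Y)))
  (λ { i1 → yab Y ; i2 → adj-sym (ybc Y) }) (λ { i1 → adj-sym (yda Y) ; i2 → ycd Y }) sided , s≤s (s≤s z≤n)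
  where
  open CycK2s.A1 Y using (o; ka; kb; kc; kd; UP; kill4m; ha)
  nt : NotK4 κ
  nt i t = go (3 ≤? D κ a i) (3 ≤? D κ b i) (3 ≤? D κ c i) (3 ≤? D κ d i)
   where
   lt : ∀ {m} → ¬ (3 ≤ m) → m ≤ 2
   lt h = ≤-pred (≰⇒> h)
   12≰8 : ∀ {m} → m ≡ 12 → m ≤ 8 → ⊥
   12≰8 refl (s≤s (s≤s (s≤s (s≤s (s≤s (s≤s (s≤s (s≤s ()))))))))
   go : Dec (3 ≤ D κ a i) → Dec (3 ≤ D κ b i) → Dec (3 ≤ D κ c i) → Dec (3 ≤ D κ d i) → ⊥
   go (yes h) _ _ _ = noTet Y t h
   go _ (yes h) _ _ = noTet (CycK2s.Y2 Y) t h
   go _ _ (yes h) _ = noTet (CycK2s.Y3 Y) t h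
   go _ _ _ (yes h) = noTet (CycK2s.Y4 Y) t h
   go (no p) (no q) (no r) (no s) = 12≰8 ((CycK2s.S≡12 Y) i) (+-mono-≤ (lt p) (+-mono-≤ (lt q) (+-mono-≤ (lt r) (lt s))))
  D3 : ∀ i → D κ a i ≡ 3 × D κ b i ≡ 3 × D κ c i ≡ 3 × D κ d i ≡ 3
  D3 i = fst p , fst q , fst r , snd r
   where
   l : ∀ {v} → κ v ≡ fz → D κ v i ≤ 3
   l = D≤3 o i (nt i)
   p = t2 {m = 3} {n = 9} (l ka) (+-mono-≤ (l kb) (+-mono-≤ (l kc) (l kd))) (≡⇒≤ (sym ((CycK2s.S≡12 Y) i)))
   q = t2 {m = 3} {n = 6} (l kb) (+-mono-≤ (l kc) (l kd)) (≡⇒≤ (sym (snd p)))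
   r = t2 {m = 3} {n = 3} (l kc) (l kd) (≡⇒≤ (sym (snd q)))
  get : ∀ i → K33 κ i
  get i = go (kind o i)
   where
   d3 = D3 i
   go : Kind κ i → K33 κ i
   go (k4 l a b f g h j) = ⊥-elim (nt i (tet l a b f g h j))
   go (k4m l ab bg gd da bd ag) = ⊥-elim (f UP)
    where
    pt = K4m.pat o i l ab bg gd da bd ag
    Pa = pt ka (fst d3)
    f : Unique (a ∷ b ∷ c ∷ d ∷ []) → ⊥
    f ((ab' ∷ ac' ∷ ad' ∷ []) ∷ (bc' ∷ bd' ∷ []) ∷ (cd' ∷ []) ∷ _) = kill4m ha l bg gd bd (fst (snd Pa)) ([ inj₁ ∘ fst , inj₂ ∘ snd ]′ (snd (snd Pa)))
     kb kc kd (ab' ∘ sym) (ac' ∘ sym) (ad' ∘ sym) bc' bd' cd' (fst (pt kb (fst (snd d3)))) (fst (pt kc (fst (snd (snd d3))))) (fst (pt kd (snd (snd (snd d3)))))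
   go (k5 l a b f g h j) = ⊥-elim (K5.one-tight o i l a b f g h j (CycK2s.A1.ac Y) ka kc (fst d3) (fst (snd (snd d3))))
   go (big _ _ mk) = mk ka (fst d3)
  -- Consecutive vertices of the cycle are adjacent and so on opposite sides; two steps bring `c` to
  -- the side of `a`.
  opp : ∀ {i} (q : K33 κ i) {u v} → κ u ≡ fz → κ v ≡ fz → u ~ v → SideA q u → D κ v i ≡ 3 → SideB q v
  opp q ku kv uv s dv = [ (λ r → ⊥-elim (true≢false (sym uv ⨾ same-nadj o q ku kv s r))) , id ]′ (side o q kv dv)
  ok : ∀ {i} (q : K33 κ i) → SideA q a → Σ[ q ∈ K33 κ i ] (∀ {v} → v ∈ a ∷ c ∷ [] → SideA q v)
  ok {i} q s = q , λ { i1 → s ; i2 → opp (flip33 q) kb kc (ybc Y) (opp q ka kb (yab Y) s (fst (snd (D3 i)))) (fst (snd (snd (D3 i)))) }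
  sided : ∀ i → Σ[ q ∈ K33 κ i ] (∀ {v} → v ∈ a ∷ c ∷ [] → SideA q v)
  sided i = [ ok (get i) , ok (flip33 (get i)) ]′ (side o (get i) ka (fst (D3 i)))

 C4-K2s : ∀ {κ P} → HamP κ P → C4 κ → Σ[ k ∈ K2s κ ] 2 ≤ length (K2s.Vs k)
 C4-K2s H (p1 , p2 , p3 , p4 , l , a , b , c , d') = cyc-K2s (mkCyc (HamP-perm (L-↭ l (hl H)) H) a b c d')

 -- From K₂,ₛ to a complete bipartite graph

 D1 : Set
 D1 = IsBip G k'

 SideA-D : ∀ {κ c} (q : K33 κ c) {v} → SideA q v → D κ v c ≡ 3
 SideA-D q {v} (sa , sb) = d-L (K33.l33 q) v ⨾ cong₂ _+_ (cong b2n (sa i1)) (cong₂ _+_ (cong b2n (sa i2)) (cong₂ _+_ (cong b2n (sa i3)) (cntL-zero (e v) (K33.B q) sb)))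

 NotK4-33 : ∀ {κ} → (∀ c → K33 κ c) → NotK4 κ
 NotK4-33 f c t = 4≢6 (sym (size-L (Tet.tl4 t)) ⨾ size-L (K33.l33 (f c)))
  where 4≢6 : 4 ≢ 6
        4≢6 ()

 pickB : ∀ {κ c} (q : K33 κ c) {x} → x ∈ K33.B q → Σ[ q' ∈ K33 κ c ] (K33.b₁ q' ≡ x × K33.A q' ≡ K33.A q × (∀ {z} → z ∈ K33.B q' → z ∈ K33.B q))
 pickB q m = flip33 P.q' , P.a₁≡ , P.B≡ , Perm.∈-resp-↭ (↭-sym P.A↭)
  where module P = PickA (pickA (flip33 q) m)

 record W1 (κ : V → K) (a b v y : V) (Vs : List V) : Set where
  constructor mkW1
  field
   wo : Opt κ
   wl : Lst κ fz (a ∷ b ∷ v ∷ y ∷ Vs)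
   wa : ∀ {x} → x ∈ v ∷ y ∷ Vs → x ~ a
   wb : ∀ {x} → x ∈ v ∷ y ∷ Vs → x ~ b
   w33 : ∀ c → Σ[ q ∈ K33 κ c ] (∀ {x} → x ∈ v ∷ y ∷ Vs → SideA q x)
 open W1

 W1-swap : ∀ {κ a b v y Vs} → W1 κ a b v y Vs → W1 κ b a v y Vs
 W1-swap {a = a} {b} (mkW1 o l p q s) = mkW1 o (L-perm (swap a b refl) l) q p s

 abstract
  exA : ∀ {κ} (o : Opt κ) {c} (q : K33 κ c) {a R} → Lst κ fz (a ∷ R) → SideB q a → Σ[ S ∈ Swapped κ c (K33.a₁ q) a (K33.B q ++ K33.a₂ q ∷ K33.a₃ q ∷ []) R ] Σ[ q' ∈ K33 (Swapped.κ' S) c ] (K33.A q' ≡ K33.B q × K33.B q' ≡ a ∷ K33.a₂ q ∷ K33.a₃ q ∷ [])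
  exA o q l s = exch33 o (flip33 q) l s

 module OnW1 {κ a b v y Vs} (W : W1 κ a b v y Vs) where
  o = wo W
  Uv : List V
  Uv = v ∷ y ∷ Vs
  kR : ∀ {x} → x ∈ a ∷ b ∷ Uv → κ x ≡ fz
  kR = l⇒ (wl W)
  kV : ∀ {x} → x ∈ Uv → κ x ≡ fz
  kV m = kR (there (there m))
  ka = kR i1
  UR : Unique (a ∷ b ∷ v ∷ y ∷ Vs)
  UR = lu (wl W)

  VV : ∀ {x z} → x ∈ Uv → z ∈ Uv → x ≁ z
  VV p r = same-nadj o (fst (w33 W c₀)) (kV p) (kV r) (snd (w33 W c₀) p) (snd (w33 W c₀) r)

  ab : a ≁ b
  ab = ¬t→f λ h → one! (cfg o) (vx a) (vx b ∷ vx v ∷ vx y ∷ []) (⊑-U (keep (keep (keep (keep ⊑-nil)))) UR)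
   (λ { i1 → ka ; i2 → kR i2 ; i3 → kV i1 ; i4 → kV i2 })
   (0 - 1 ! h ∷ 2 - 0 ! wa W i1 ∷ 3 - 0 ! wa W i2 ∷ 2 - 1 ! wb W i1 ∷ 3 - 1 ! wb W i2 ∷ [])
   0 (fw 2 ∷ fw 1 ∷ fw 3 ∷ []) refl
   where ⊑-nil : ∀ {l : List V} → [] ⊑ l
         ⊑-nil {[]} = done
         ⊑-nil {x ∷ l} = skip ⊑-nil

  pR : Lst κ fz (v ∷ a ∷ b ∷ y ∷ Vs)
  pR = L-perm (↭-trans (prep a (swap b v refl)) (swap a v refl)) (wl W)

  abstract
   ex : ∀ {c} (q : K33 κ c) → SideA q v → Σ[ S ∈ Swapped κ c (K33.b₁ q) v (K33.A q ++ K33.b₂ q ∷ K33.b₃ q ∷ []) (a ∷ b ∷ y ∷ Vs) ] Σ[ q' ∈ K33 (Swapped.κ' S) c ] (K33.A q' ≡ K33.A q × K33.B q' ≡ v ∷ K33.b₂ q ∷ K33.b₃ q ∷ [])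
   ex q s = exch33 o q pR s

  move : ∀ {c c' x C' R'} {w : V} (S : Swapped κ c x w C' R') → c' ≢ c → K33 κ c' → K33 (Swapped.κ' S) c'
  move S ne (mk33 l p) = mk33 (Swapped.oth S ne l) p

  -- exchanged into R, a vertex of B must see a and b and be tight, by the degree condition with y
  module Ex {c} (q : K33 κ c) (sq : ∀ {x} → x ∈ Uv → SideA q x) where
   S = fst (ex q (sq i1))
   q' = fst (snd (ex q (sq i1)))
   open Swapped S public
   x = K33.b₁ q
   nt' : NotK4 κ'
   nt' = NotK4-33 f
    where f : ∀ c' → K33 κ' c'
          f c' = go (c' Fin.≟ c)
           where go : Dec (c' ≡ c) → K33 κ' c'
                 go (yes refl) = q'
                 go (no ne) = move S ne (fst (w33 W c'))
   kx : κ' x ≡ fz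
   kx = l⇒ LR i1
   ky : κ' y ≡ fz
   ky = l⇒ LR i4
   ka' : κ' a ≡ fz
   ka' = l⇒ LR i2
   x≢y : x ≢ y
   x≢y refl = U∉ (lu LR) i3
   xV : ∀ {z} → z ∈ Uv → x ≁ z
   xV m = nadj-sym (snd (sq m) i1)
   dx : dR κ' x ≡ b2n (e x a) + (b2n (e x b) + 0)
   dx = d-L LR x ⨾ cong₂ _+_ (cong b2n (E-irr G x)) (cong (λ t → b2n (e x a) + (b2n (e x b) + t)) (cntL-zero (e x) (y ∷ Vs) (λ m → xV (there m))))
   dy : dR κ' y ≤ 2
   dy = ≤-trans (≡⇒≤ (d-L LR y ⨾ cong₂ _+_ (cong b2n (nadj-sym (xV i2))) (cong (λ t → b2n (e y a) + (b2n (e y b) + t)) (cntL-zero (e y) (y ∷ Vs) (λ m → VV i2 (there m))))))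
    (+-mono-≤ (b2n≤1 (e y a)) (+-mono-≤ (b2n≤1 (e y b)) z≤n))
   f : Fin k' → ℕ
   f i = D κ' x i + D κ' y i
   f≤ : ∀ i → f i ≤ 6
   f≤ i = +-mono-≤ (D≤3 opt' i (nt' i) kx) (D≤3 opt' i (nt' i) ky)
   dx2 : dR κ' x ≤ 2
   dx2 = ≤-trans (≡⇒≤ dx) (+-mono-≤ (b2n≤1 (e x a)) (+-mono-≤ (b2n≤1 (e x b)) z≤n))
   tot : 6 * k' + 4 ≤ (dR κ' x + dR κ' y) + ΣF f
   tot = PI κ' x≢y (xV i2)
   both : x ~ a × x ~ b
   both = two-bits (e x a) (e x b) (≤-trans (ar k' (dR κ' x) _ _ tot dy (ΣF-upper f≤)) (≡⇒≤ dx))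
    where
    ar : ∀ k a b S → 6 * k + 4 ≤ (a + b) + S → b ≤ 2 → S ≤ 6 * k → 2 ≤ a
    ar k a b S h hb hS = +-cancelʳ-≤ (2 + 6 * k) 2 a (≤-trans (≡⇒≤ (lem k)) (≤-trans h (≤-trans (≡⇒≤ (+-assoc a b S)) (+-monoʳ-≤ a (+-mono-≤ hb hS)))))
     where lem : ∀ k → 2 + (2 + 6 * k) ≡ 6 * k + 4
           lem = solve-∀
   tight : ∀ i → D κ' x i ≡ 3
   tight i = fst (t2 {m = 3} {n = 3} (D≤3 opt' i (nt' i) kx) (D≤3 opt' i (nt' i) ky) (≡⇒≤ (sym (ΣF-tight f≤ (ar k' _ _ tot (+-mono-≤ dx2 dy)) i))))
    where
    ar : ∀ k a S → 6 * k + 4 ≤ a + S → a ≤ 4 → 6 * k ≤ S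
    ar k a S h ha = +-cancelʳ-≤ 4 (6 * k) S (≤-trans h (≤-trans (+-monoˡ-≤ S ha) (≡⇒≤ (+-comm 4 S))))

  B-ab : ∀ {c} (q : K33 κ c) (sq : ∀ {x} → x ∈ Uv → SideA q x) → ∀ {x} → x ∈ K33.B q → x ~ a × x ~ b
  B-ab {c} q sq {x} m = go (pickB q m)
   where
   go : Σ[ q' ∈ K33 κ c ] (K33.b₁ q' ≡ x × K33.A q' ≡ K33.A q × (∀ {z} → z ∈ K33.B q' → z ∈ K33.B q)) → x ~ a × x ~ b
   go (q' , refl , eA , sub) = Ex.both q' (λ z → (λ r → fst (sq z) (cast∈ eA r)) , (λ r → snd (sq z) (sub r)))

  -- An edge from `a` to a₁ would divide the class and a, b, v, y into a chorded cycle on a, v, a₁,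
  -- b₁ and one on the other six vertices.
  a-A : ∀ {c} (q : K33 κ c) (sq : ∀ {x} → x ∈ Uv → SideA q x) → ∀ {u} → u ∈ K33.A q → a ≁ u
  a-A {c} q₀ sq₀ {u} m = ¬t→f (go (pickA q₀ m))
   where
   go : PickA q₀ u → a ~ u → ⊥
   go record { q' = mk33 {a1} {a2} {a3} {b1} {b2} {b3} l p ; a₁≡ = refl ; A↭ = A↭ ; B≡ = B≡ } h =
    two! (cfg o) c (vx a1) (vx a2 ∷ vx a3 ∷ vx b1 ∷ vx b2 ∷ vx b3 ∷ vx a ∷ vx b ∷ vx v ∷ vx y ∷ [])
    (mixU l (U-++ˡ (a ∷ b ∷ v ∷ y ∷ []) UR) (λ r → kR (∈-++⁺ˡ r))) (mixI {κ} l (λ r → kR (∈-++⁺ˡ {xs = a ∷ b ∷ v ∷ y ∷ []} r)))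
    (6 - 0 ! h ∷ 8 - 6 ! wa W i1 ∷ 3 - 6 ! fst (bb i1) ∷ 8 - 0 ! va i1 i1 ∷ 0 - 3 ! p i1 i1 ∷
    1 - 4 ! p i2 i2 ∷ (hd 1 , hd 5 , p i2 i3) ∷ 9 - 1 ! va i2 i2 ∷
    (hd 2 , hd 4 , p i3 i2) ∷ (hd 2 , hd 5 , p i3 i3) ∷
    (hd 5 , hd 7 , snd (bb i3)) ∷ 9 - 7 ! wb W i2 ∷ [])
    6 (fw 8 ∷ fw 0 ∷ fw 3 ∷ []) 1 (fw 4 ∷ fw 2 ∷ fw 5 ∷ fw 7 ∷ fw 9 ∷ []) refl
    where
    va : ∀ {z} → z ∈ Uv → ∀ {r} → r ∈ a1 ∷ a2 ∷ a3 ∷ [] → z ~ r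
    va m r = fst (sq₀ m) (Perm.∈-resp-↭ (↭-sym A↭) r)
    bb : ∀ {x} → x ∈ b1 ∷ b2 ∷ b3 ∷ [] → x ~ a × x ~ b
    bb r = B-ab q₀ sq₀ (cast∈ B≡ r)

  a-side : ∀ {c} (q : K33 κ c) (sq : ∀ {x} → x ∈ Uv → SideA q x) → SideB q a
  a-side q sq = (λ m → adj-sym (fst (B-ab q sq m))) , a-A q sq

  -- Exchanged into the remainder, b₁ is tight towards the other class; being adjacent to `a`, it
  -- cannot be on the same side as `a`.
  B-side₁ : ∀ {c c'} → c' ≢ c → (q : K33 κ c) (sq : ∀ {x} → x ∈ Uv → SideA q x) (p : K33 κ c') (sp : ∀ {x} → x ∈ Uv → SideA p x) → SideA p (K33.b₁ q)
  B-side₁ {c} {c'} ne q sq p@(mk33 _ _) sp = go (side X.opt' p' X.kx (X.tight c'))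
   where
   module X = Ex q sq
   p' = move X.S ne p
   go : SideA p' X.x ⊎ SideB p' X.x → SideA p X.x
   go (inj₁ r) = r
   go (inj₂ r) = ⊥-elim (true≢false (sym (fst X.both) ⨾ same-nadj X.opt' (flip33 p') X.kx X.ka' r (a-side p sp)))

  B-side : ∀ {c c'} → c' ≢ c → (q : K33 κ c) (sq : ∀ {x} → x ∈ Uv → SideA q x) (p : K33 κ c') (sp : ∀ {x} → x ∈ Uv → SideA p x) → ∀ {x} → x ∈ K33.B q → SideA p x
  B-side {c} {c'} ne q sq p sp {x} m = go (pickB q m)
   where
   go : Σ[ q' ∈ K33 κ c ] (K33.b₁ q' ≡ x × K33.A q' ≡ K33.A q × (∀ {z} → z ∈ K33.B q' → z ∈ K33.B q)) → SideA p x
   go (q' , refl , eA , sub) = B-side₁ ne q' (λ z → (λ r → fst (sq z) (cast∈ eA r)) , (λ r → snd (sq z) (sub r))) p sp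

  -- `a` has the same neighbours in the class as a₁ does. The new remainder is again K₂,ₛ, with a₁
  -- in the role of `a`, so what was proved for `a` holds for the vertices of `A`.
  W1-exch : ∀ {c} (q : K33 κ c) (sq : ∀ {x} → x ∈ Uv → SideA q x) → Σ[ S ∈ Swapped κ c (K33.a₁ q) a (K33.B q ++ K33.a₂ q ∷ K33.a₃ q ∷ []) (b ∷ v ∷ y ∷ Vs) ] W1 (Swapped.κ' S) (K33.a₁ q) b v y Vs
  W1-exch {c} q@(mk33 {a1} {a2} {a3} {b1} {b2} {b3} l p) sq = S , mkW1 opt' LR (λ m → fst (sq m) i1) (wb W) nw
   where
   E₀ = exA o q (wl W) (a-side q sq)
   S = fst E₀
   open Swapped S
   nw : ∀ c' → Σ[ q' ∈ K33 κ' c' ] (∀ {x} → x ∈ Uv → SideA q' x)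
   nw c' = go (c' Fin.≟ c)
    where
    go : Dec (c' ≡ c) → Σ[ q' ∈ K33 κ' c' ] (∀ {x} → x ∈ Uv → SideA q' x)
    go (no ne) = move S ne (fst (w33 W c')) , (λ m → snd (w33 W c') m)
    go (yes refl) = flip33 q₁ , λ m → (λ r → f m (cast∈ (snd (snd (snd E₀))) r)) , (λ r → snd (sq m) (cast∈ (fst (snd (snd E₀))) r))
     where
     q₁ = fst (snd E₀)
     f : ∀ {x} → x ∈ Uv → ∀ {r} → r ∈ a ∷ a2 ∷ a3 ∷ [] → x ~ r
     f m i1 = wa W m
     f m (there r) = fst (sq m) (there r)

 A-A₁ : ∀ {κ a b v y Vs} (W : W1 κ a b v y Vs) {c c'} → c' ≢ c → (q : K33 κ c) (sq : ∀ {x} → x ∈ v ∷ y ∷ Vs → SideA q x) (p : K33 κ c') (sp : ∀ {x} → x ∈ v ∷ y ∷ Vs → SideA p x) →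
  ∀ {w} → w ∈ K33.A p → (K33.a₁ q) ≁ w
 A-A₁ W ne q sq p sp m = OnW1.a-A (snd X) (OnW1.move W (fst X) ne p) sp m
  where X = OnW1.W1-exch W q sq

 module Finish {κ a b v y Vs} (W : W1 κ a b v y Vs) where
  module F = OnW1 W
  module F' = OnW1 (W1-swap W) using (a-A)
  open F using (o; Uv; kV; UR)
  Qc : ∀ c → K33 κ c
  Qc c = fst (w33 W c)
  sQ : ∀ c {x} → x ∈ Uv → SideA (Qc c) x
  sQ c = snd (w33 W c)

  A-A : ∀ {c c'} → c' ≢ c → ∀ {u w} → u ∈ K33.A (Qc c) → w ∈ K33.A (Qc c') → u ≁ w
  A-A {c} {c'} ne {u} m r = go (pickA (Qc c) m)
   where
   go : PickA (Qc c) u → u ≁ _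
   go record { q' = q' ; a₁≡ = refl ; A↭ = A↭ ; B≡ = B≡ } = A-A₁ W ne q' (λ z → (λ t → fst (sQ c z) (Perm.∈-resp-↭ (↭-sym A↭) t)) , (λ t → snd (sQ c z) (cast∈ B≡ t))) (Qc c') (sQ c') r

  -- The two sides of the final bipartition: `PA` has two vertices from R and three from each class,
  -- which is the part of size 3k - 1.
  data PA (u : V) : Set where
   isa : u ≡ a → PA u
   isb : u ≡ b → PA u
   inA : ∀ c → u ∈ K33.A (Qc c) → PA u
  data PW (u : V) : Set where
   inV : u ∈ Uv → PW u
   inB : ∀ c → u ∈ K33.B (Qc c) → PW u

  class : ∀ u → PA u ⊎ PW u
  class u = go (κ u) refl
   where
   go : ∀ c → κ u ≡ c → PA u ⊎ PW u
   go fz ku = f (l⇐ (wl W) ku)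
    where f : u ∈ a ∷ b ∷ Uv → PA u ⊎ PW u
          f (here r) = inj₁ (isa r)
          f (there (here r)) = inj₁ (isb r)
          f (there (there r)) = inj₂ (inV r)
   go (fs c) ku = [ inj₁ ∘ inA c , inj₂ ∘ inB c ]′ (∈-++⁻ (K33.A (Qc c)) (l⇐ (K33.l33 (Qc c)) ku))

  same? : ∀ {P : Set} (c c' : Fin k') → (c ≡ c' → P) → (c' ≢ c → P) → P
  same? {P} c c' f g = go (c Fin.≟ c')
   where go : Dec (c ≡ c') → P
         go (yes r) = f r
         go (no r) = g (r ∘ sym)

  WW : ∀ {u w} → PW u → PW w → u ≁ w
  WW (inV p) (inV r) = F.VV p r
  WW (inV p) (inB c r) = snd (sQ c p) r
  WW (inB c r) (inV p) = nadj-sym (snd (sQ c p) r)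
  WW (inB c p) (inB c' r) = same? c c' (λ { refl → nadjB o (Qc c) p r }) (λ ne → snd (F.B-side ne (Qc c) (sQ c) (Qc c') (sQ c') p) r)

  AW : ∀ {u w} → PA u → PW w → u ~ w
  AW (isa refl) (inV r) = adj-sym (wa W r)
  AW (isa refl) (inB c r) = adj-sym (fst (F.B-ab (Qc c) (sQ c) r))
  AW (isb refl) (inV r) = adj-sym (wb W r)
  AW (isb refl) (inB c r) = adj-sym (snd (F.B-ab (Qc c) (sQ c) r))
  AW (inA c p) (inV r) = adj-sym (fst (sQ c r) p)
  AW (inA c p) (inB c' r) = same? c c' (λ { refl → K33.a33 (Qc c) p r }) (λ ne → adj-sym (fst (F.B-side (ne ∘ sym) (Qc c') (sQ c') (Qc c) (sQ c) r) p))

  AA : ∀ {u w} → PA u → PA w → u ≁ w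
  AA (isa refl) (isa refl) = E-irr G _
  AA (isa refl) (isb refl) = F.ab
  AA (isb refl) (isa refl) = nadj-sym F.ab
  AA (isb refl) (isb refl) = E-irr G _
  AA (isa refl) (inA c r) = F.a-A (Qc c) (sQ c) r
  AA (isb refl) (inA c r) = F'.a-A (Qc c) (sQ c) r
  AA (inA c r) (isa refl) = nadj-sym (F.a-A (Qc c) (sQ c) r)
  AA (inA c r) (isb refl) = nadj-sym (F'.a-A (Qc c) (sQ c) r)
  AA (inA c p) (inA c' r) = same? c c' (λ { refl → nadjA o (Qc c) p r }) (λ ne → A-A ne p r)

  y∈ : PW y
  y∈ = inV i2

  result : D1
  result = y , (λ u w → go u w (class u) (class w)) , dy
   where
   go : ∀ u w → PA u ⊎ PW u → PA w ⊎ PW w → e u w ≡ e y u xor e y w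
   go u w (inj₁ p) (inj₁ r) = AA p r ⨾ sym (cong₂ _xor_ (adj-sym (AW p y∈)) (adj-sym (AW r y∈)))
   go u w (inj₁ p) (inj₂ r) = AW p r ⨾ sym (cong₂ _xor_ (adj-sym (AW p y∈)) (WW y∈ r))
   go u w (inj₂ p) (inj₁ r) = adj-sym (AW r p) ⨾ sym (cong₂ _xor_ (WW y∈ p) (adj-sym (AW r y∈)))
   go u w (inj₂ p) (inj₂ r) = WW p r ⨾ sym (cong₂ _xor_ (WW y∈ p) (WW y∈ r))
   dy : deg G y ≡ 3 * k' + 2
   dy = deg-split κ y ⨾ cong₂ _+_ (d-L (wl W) y ⨾ cong₂ _+_ (cong b2n (wa W i2)) (cong₂ _+_ (cong b2n (wb W i2)) (cntL-zero (e y) Uv (λ m → F.VV i2 m))))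
    (ΣF-cong (λ c → SideA-D (Qc c) (sQ c i2)) ⨾ ΣF-const k' 3) ⨾ +-comm 2 (3 * k')

 K2s→D1 : ∀ {κ} (k : K2s κ) → 2 ≤ length (K2s.Vs k) → D1
 K2s→D1 {κ} (mkK2s o {a} {b} {Vs} l va vb k33) h = go Vs refl h
  where
  go : ∀ Vs' → Vs' ≡ Vs → 2 ≤ length Vs' → D1
  go (v ∷ y ∷ Vs') refl _ = Finish.result (mkW1 o l va vb k33)
  go (v ∷ []) refl (s≤s ())

 -- R is K₂,₃

 record R23 (κ : V → K) (a b x y z : V) : Set where
  constructor mkR
  field
   ro : Opt κ
   rl : Lst κ fz (a ∷ b ∷ x ∷ y ∷ z ∷ [])
   rab : ∀ {v} → v ∈ x ∷ y ∷ z ∷ [] → v ~ a × v ~ b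
 open R23 public

 R-perm : ∀ {κ a b x y z x' y' z'} → x ∷ y ∷ z ∷ [] ↭ x' ∷ y' ∷ z' ∷ [] → R23 κ a b x y z → R23 κ a b x' y' z'
 R-perm h (mkR o l f) = mkR o (L-perm (prep _ (prep _ h)) l) (λ m → f (Perm.∈-resp-↭ (↭-sym h) m))

 R-swap : ∀ {κ a b x y z} → R23 κ a b x y z → R23 κ b a x y z
 R-swap (mkR o l f) = mkR o (L-perm (swap _ _ refl) l) (λ m → snd (f m) , fst (f m))

 R-102 : ∀ {κ a b x y z} → R23 κ a b x y z → R23 κ a b y x z
 R-102 = R-perm (swap _ _ refl)
 R-201 : ∀ {κ a b x y z} → R23 κ a b x y z → R23 κ a b z x y
 R-201 {x = x} {y} {z} = R-perm (Perm.++-comm (x ∷ y ∷ []) (z ∷ []))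

 module Basic {κ a b x y z} (R : R23 κ a b x y z) where
  U5 : Unique (a ∷ b ∷ x ∷ y ∷ z ∷ [])
  U5 = lu (rl R)
  k5′ : ∀ {v} → v ∈ a ∷ b ∷ x ∷ y ∷ z ∷ [] → κ v ≡ fz
  k5′ = l⇒ (rl R)
  xa : x ~ a
  xa = fst (rab R i1)
  xb : x ~ b
  xb = snd (rab R i1)
  ya : y ~ a
  ya = fst (rab R i2)
  yb : y ~ b
  yb = snd (rab R i2)
  za : z ~ a
  za = fst (rab R i3)
  zb : z ~ b
  zb = snd (rab R i3)
  FactR : Set
  FactR = Layout.Fact (vx a) (vx b ∷ vx x ∷ vx y ∷ vx z ∷ []) U5
  base : List FactR
  base = 2 - 0 ! xa ∷ 2 - 1 ! xb ∷ 3 - 0 ! ya ∷ 3 - 1 ! yb ∷ 4 - 0 ! za ∷ 4 - 1 ! zb ∷ []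
  xy : x ≁ y
  xy = ¬t→f λ h → one! (cfg (ro R)) _ _ U5 k5′ (2 - 3 ! h ∷ base) 2 (fw 0 ∷ fw 3 ∷ fw 1 ∷ []) refl
  xz : x ≁ z
  xz = ¬t→f λ h → one! (cfg (ro R)) _ _ U5 k5′ (2 - 4 ! h ∷ base) 2 (fw 0 ∷ fw 4 ∷ fw 1 ∷ []) refl
  ab : a ≁ b
  ab = ¬t→f λ h → one! (cfg (ro R)) _ _ U5 k5′ (0 - 1 ! h ∷ base) 0 (fw 2 ∷ fw 1 ∷ fw 3 ∷ []) refl
  ka : κ a ≡ fz
  ka = k5′ i1
  kb : κ b ≡ fz
  kb = k5′ i2
  kx : κ x ≡ fz
  kx = k5′ i3
  ky : κ y ≡ fz
  ky = k5′ i4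
  kz : κ z ≡ fz
  kz = k5′ i5
  dx : dR κ x ≤ 2
  dx = ≤-trans (≡⇒≤ (d-L (rl R) x ⨾ cong (λ t → b2n (e x a) + (b2n (e x b) + t)) (cong₂ _+_ (cong b2n (E-irr G x)) (cong₂ _+_ (cong b2n xy) (cong (λ t → b2n t + 0) xz)))))
   (+-mono-≤ (b2n≤1 (e x a)) (+-mono-≤ (b2n≤1 (e x b)) z≤n))
  da : dR κ a ≤ 3
  da = ≤-trans (≡⇒≤ (d-L (rl R) a ⨾ cong₂ _+_ (cong b2n (E-irr G a)) (cong (λ t → t + cntL (e a) (x ∷ y ∷ z ∷ [])) (cong b2n ab)))) (cntL≤length (e a) (x ∷ y ∷ z ∷ []))
  x≢y : x ≢ y
  x≢y refl = U∉ (U-++ʳ (a ∷ b ∷ []) U5) i1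
  a≢b : a ≢ b
  a≢b refl = U∉ U5 i1

  module _ {c p q r s} (t : Tet κ c p q r s) (h : 2 ≤ sumB (e x q ∷ e x r ∷ e x s ∷ [])) where
   Up : Unique (p ∷ a ∷ b ∷ y ∷ z ∷ [])
   Up = U-cons (λ m → Fin.0≢1+n (sym (k5′ (w m)) ⨾ l⇒ (Tet.tl4 t) i1)) (⊑-U (keep (keep (skip (keep (keep done))))) U5)
    where w : ∀ {v} → v ∈ a ∷ b ∷ y ∷ z ∷ [] → v ∈ a ∷ b ∷ x ∷ y ∷ z ∷ []
          w = ⊑-∈ (keep (keep (skip (keep (keep done)))))
   dead4 : Σ[ C ∈ CC ] (∀ {v} → v ∈ vs C → v ∈ p ∷ a ∷ b ∷ y ∷ z ∷ []) → ⊥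
   dead4 (C , hC) = tet-two (ro R) t kx h C (λ m → f (hC m))
    where
    f : ∀ {v} → v ∈ p ∷ a ∷ b ∷ y ∷ z ∷ [] → v ≢ x × (v ≡ p ⊎ κ v ≡ fz)
    f i1 = (λ { refl → Fin.0≢1+n (sym kx ⨾ l⇒ (Tet.tl4 t) i1) }) , inj₁ refl
    f (there m) = (λ { refl → U∉ (U-↭ (↭-trans (prep a (swap b x refl)) (swap a x refl)) U5) m }) , inj₂ (k5′ (⊑-∈ (keep (keep (skip (keep (keep done))))) m))
   pb : List (Layout.Fact (vx p) (vx a ∷ vx b ∷ vx y ∷ vx z ∷ []) Up)
   pb = 3 - 1 ! ya ∷ 3 - 2 ! yb ∷ 4 - 1 ! za ∷ 4 - 2 ! zb ∷ []
   fay : e a p ∧ e y p ≡ true → ⊥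
   fay g = dead4 (CC! _ _ Up (1 - 0 ! fst (∧2 (e a p) (e y p) g) ∷ 3 - 0 ! snd (∧2 (e a p) (e y p) g) ∷ pb) 1 (fw 0 ∷ fw 3 ∷ fw 2 ∷ fw 4 ∷ []) refl)
   faz : e a p ∧ e z p ≡ true → ⊥
   faz g = dead4 (CC! _ _ Up (1 - 0 ! fst (∧2 (e a p) (e z p) g) ∷ 4 - 0 ! snd (∧2 (e a p) (e z p) g) ∷ pb) 1 (fw 0 ∷ fw 4 ∷ fw 2 ∷ fw 3 ∷ []) refl)
   fby : e b p ∧ e y p ≡ true → ⊥
   fby g = dead4 (CC! _ _ Up (2 - 0 ! fst (∧2 (e b p) (e y p) g) ∷ 3 - 0 ! snd (∧2 (e b p) (e y p) g) ∷ pb) 2 (fw 0 ∷ fw 3 ∷ fw 1 ∷ fw 4 ∷ []) refl)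
   fbz : e b p ∧ e z p ≡ true → ⊥
   fbz g = dead4 (CC! _ _ Up (2 - 0 ! fst (∧2 (e b p) (e z p) g) ∷ 4 - 0 ! snd (∧2 (e b p) (e z p) g) ∷ pb) 2 (fw 0 ∷ fw 4 ∷ fw 1 ∷ fw 3 ∷ []) refl)
   colX : 7 * (b2n (e y p) + b2n (e z p)) + 6 * (b2n (e a p) + b2n (e b p)) ≤ 14
   colX = colx14 (e y p) (e z p) (e a p) (e b p) fay faz fby fbz

  module _ {c p q r s} (t : Tet κ c p q r s) (h : 2 ≤ sumB (e a q ∷ e a r ∷ e a s ∷ [])) where
   Uq : Unique (p ∷ b ∷ x ∷ y ∷ z ∷ [])
   Uq = U-cons (λ m → Fin.0≢1+n (sym (k5′ (there m)) ⨾ l⇒ (Tet.tl4 t) i1)) (U-++ʳ (a ∷ []) U5)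
   dead5 : Σ[ C ∈ CC ] (∀ {v} → v ∈ vs C → v ∈ p ∷ b ∷ x ∷ y ∷ z ∷ []) → ⊥
   dead5 (C , hC) = tet-two (ro R) t ka h C (λ m → f (hC m))
    where
    f : ∀ {v} → v ∈ p ∷ b ∷ x ∷ y ∷ z ∷ [] → v ≢ a × (v ≡ p ⊎ κ v ≡ fz)
    f i1 = (λ { refl → Fin.0≢1+n (sym ka ⨾ l⇒ (Tet.tl4 t) i1) }) , inj₁ refl
    f (there m) = (λ { refl → U∉ U5 m }) , inj₂ (k5′ (there m))
   qb : List (Layout.Fact (vx p) (vx b ∷ vx x ∷ vx y ∷ vx z ∷ []) Uq)
   qb = 2 - 1 ! xb ∷ 3 - 1 ! yb ∷ 4 - 1 ! zb ∷ []
   gxy : e b p ∧ e x p ∧ e y p ≡ true → ⊥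
   gxy g = dead5 (CC! _ _ Uq (1 - 0 ! fst r3 ∷ 2 - 0 ! fst (snd r3) ∷ 3 - 0 ! snd (snd r3) ∷ qb) 0 (fw 2 ∷ fw 1 ∷ fw 3 ∷ []) refl)
    where r3 = ∧3 (e b p) (e x p) (e y p) g
   gxz : e b p ∧ e x p ∧ e z p ≡ true → ⊥
   gxz g = dead5 (CC! _ _ Uq (1 - 0 ! fst r3 ∷ 2 - 0 ! fst (snd r3) ∷ 4 - 0 ! snd (snd r3) ∷ qb) 0 (fw 2 ∷ fw 1 ∷ fw 4 ∷ []) refl)
    where r3 = ∧3 (e b p) (e x p) (e z p) g
   gyz : e b p ∧ e y p ∧ e z p ≡ true → ⊥
   gyz g = dead5 (CC! _ _ Uq (1 - 0 ! fst r3 ∷ 3 - 0 ! fst (snd r3) ∷ 4 - 0 ! snd (snd r3) ∷ qb) 0 (fw 3 ∷ fw 1 ∷ fw 4 ∷ []) refl)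
    where r3 = ∧3 (e b p) (e y p) (e z p) g
   colA : 6 * b2n (e b p) + 3 * (b2n (e x p) + (b2n (e y p) + b2n (e z p))) ≤ 9
   colA = cola9 (e b p) (e x p) (e y p) (e z p) gxy gxz gyz

  -- A class that is not K₄ has at most 7·9 + 6·6 = 99. A K₄ has at most 84, since many edges from
  -- one vertex of R restrict the others; the deficit 15 exceeds the slack 12 left by the degree
  -- condition.
  wtR : Fin k' → ℕ
  wtR c = 7 * (D κ x c + (D κ y c + D κ z c)) + 6 * (D κ a c + D κ b c)

  module _ {c p q r s} (t : Tet κ c p q r s) where
   rots : ∀ v → 3 ≤ D κ v c → 2 ≤ sumB (e v q ∷ e v r ∷ e v s ∷ []) × 2 ≤ sumB (e v r ∷ e v s ∷ e v p ∷ []) × 2 ≤ sumB (e v s ∷ e v p ∷ e v q ∷ []) × 2 ≤ sumB (e v p ∷ e v q ∷ e v r ∷ [])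
   rots v h = sum3≥2 (e v p) (e v q) (e v r) (e v s) h1 , sum3≥2 (e v q) (e v r) (e v s) (e v p) h2 , sum3≥2 (e v r) (e v s) (e v p) (e v q) h3 , sum3≥2 (e v s) (e v p) (e v q) (e v r) h4
    where
    sh : ∀ p q r s → 3 ≤ sumB (p ∷ q ∷ r ∷ s ∷ []) → 3 ≤ sumB (q ∷ r ∷ s ∷ p ∷ [])
    sh p q r s h = ≤-trans h (≡⇒≤ (lem (b2n p) (b2n q) (b2n r) (b2n s)))
     where lem : ∀ a b c d → a + (b + (c + (d + 0))) ≡ b + (c + (d + (a + 0)))
           lem = solve-∀
    h1 : 3 ≤ sumB (e v p ∷ e v q ∷ e v r ∷ e v s ∷ [])
    h1 = subst (3 ≤_) (tet-D t v) h
    h2 = sh (e v p) (e v q) (e v r) (e v s) h1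
    h3 = sh (e v q) (e v r) (e v s) (e v p) h2
    h4 = sh (e v r) (e v s) (e v p) (e v q) h3
   D≤4 : ∀ v → D κ v c ≤ 4
   D≤4 v = ≤-trans (≡⇒≤ (tet-D t v)) (cntL≤length id (e v p ∷ e v q ∷ e v r ∷ e v s ∷ []))
   heavyX : 3 ≤ D κ x c → wtR c ≤ 84
   heavyX h = subst₂ (λ Y A → 7 * (D κ x c + Y) + 6 * A ≤ 84) (sym (cong₂ _+_ (tet-D t y) (tet-D t z))) (sym (cong₂ _+_ (tet-D t a) (tet-D t b)))
    (wtx (D κ x c) (b2n (e y p)) (b2n (e y q)) (b2n (e y r)) (b2n (e y s)) (b2n (e z p)) (b2n (e z q)) (b2n (e z r)) (b2n (e z s))
    (b2n (e a p)) (b2n (e a q)) (b2n (e a r)) (b2n (e a s)) (b2n (e b p)) (b2n (e b q)) (b2n (e b r)) (b2n (e b s)) (D≤4 x)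
    (colX t (fst R4)) (colX (trot t) (fst (snd R4))) (colX (trot (trot t)) (fst (snd (snd R4)))) (colX (trot (trot (trot t))) (snd (snd (snd R4)))))
    where R4 = rots x h
   heavyA : 3 ≤ D κ a c → D κ x c ≤ 2 → D κ y c ≤ 2 → D κ z c ≤ 2 → wtR c ≤ 84
   heavyA h hx hy hz = subst₂ (λ X B → 7 * X + 6 * (D κ a c + B) ≤ 84) (sym (cong₂ _+_ (tet-D t x) (cong₂ _+_ (tet-D t y) (tet-D t z)))) (sym (tet-D t b))
    (wta (D κ a c) (b2n (e b p)) (b2n (e b q)) (b2n (e b r)) (b2n (e b s)) (b2n (e x p)) (b2n (e x q)) (b2n (e x r)) (b2n (e x s))
    (b2n (e y p)) (b2n (e y q)) (b2n (e y r)) (b2n (e y s)) (b2n (e z p)) (b2n (e z q)) (b2n (e z r)) (b2n (e z s)) (D≤4 a)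
    (colA t (fst R4)) (colA (trot t) (fst (snd R4))) (colA (trot (trot t)) (fst (snd (snd R4)))) (colA (trot (trot (trot t))) (snd (snd (snd R4))))
    (subst (_≤ 2) (tet-D t x) hx) (subst (_≤ 2) (tet-D t y) hy) (subst (_≤ 2) (tet-D t z) hz))
    where R4 = rots a h

 module OnR {κ a b x y z} (R : R23 κ a b x y z) where
  open Basic R public
  module By = Basic (R-102 R) using (dx; heavyX; xz)
  module Bz = Basic (R-201 R) using (dx; heavyX; x≢y)
  module Bs = Basic (R-swap R) using (da; heavyA)

  yz : y ≁ z
  yz = By.xz

  tet84 : ∀ {c p q r s} → Tet κ c p q r s → wtR c ≤ 84
  tet84 {c} t = go (3 ≤? D κ x c) (3 ≤? D κ y c) (3 ≤? D κ z c) (3 ≤? D κ a c) (3 ≤? D κ b c)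
   where
   X = D κ x c
   Y = D κ y c
   Z = D κ z c
   lt : ∀ {m} → ¬ (3 ≤ m) → m ≤ 2
   lt h = ≤-pred (≰⇒> h)
   p1 : ∀ X Y Z → X + (Y + Z) ≡ Y + (X + Z)
   p1 = solve-∀
   p2 : ∀ X Y Z → X + (Y + Z) ≡ Z + (X + Y)
   p2 = solve-∀
   go : Dec (3 ≤ D κ x c) → Dec (3 ≤ D κ y c) → Dec (3 ≤ D κ z c) → Dec (3 ≤ D κ a c) → Dec (3 ≤ D κ b c) → wtR c ≤ 84
   go (yes h) _ _ _ _ = heavyX t h
   go _ (yes h) _ _ _ = ≤-trans (≡⇒≤ (cong (λ s → 7 * s + 6 * (D κ a c + D κ b c)) (p1 X Y Z))) (By.heavyX t h)
   go _ _ (yes h) _ _ = ≤-trans (≡⇒≤ (cong (λ s → 7 * s + 6 * (D κ a c + D κ b c)) (p2 X Y Z))) (Bz.heavyX t h)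
   go (no i) (no j) (no l) (yes h) _ = heavyA t h (lt i) (lt j) (lt l)
   go (no i) (no j) (no l) _ (yes h) = ≤-trans (≡⇒≤ (cong (λ s → 7 * (X + (Y + Z)) + 6 * s) (+-comm (D κ a c) (D κ b c)))) (Bs.heavyA t h (lt i) (lt j) (lt l))
   go (no i) (no j) (no l) (no m) (no n') = ≤-trans (+-mono-≤ (*-monoʳ-≤ 7 (+-mono-≤ (lt i) (+-mono-≤ (lt j) (lt l)))) (*-monoʳ-≤ 6 (+-mono-≤ (lt m) (lt n')))) (m≤m+n 66 18)

  le≤ : ∀ c → (∀ {v} → κ v ≡ fz → D κ v c ≤ 3) → wtR c ≤ 99
  le≤ c le = +-mono-≤ (*-monoʳ-≤ 7 (+-mono-≤ (le kx) (+-mono-≤ (le ky) (le kz)))) (*-monoʳ-≤ 6 (+-mono-≤ (le ka) (le kb)))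

  w99 : ∀ c → wtR c ≤ 99
  w99 c = go (isTet (ro R) c)
   where
   go : (Σ[ x ∈ V ] Σ[ y ∈ V ] Σ[ z ∈ V ] Σ[ w ∈ V ] Tet κ c x y z w) ⊎ (∀ {v} → κ v ≡ fz → D κ v c ≤ 3) → wtR c ≤ 99
   go (inj₁ (_ , _ , _ , _ , t)) = ≤-trans (tet84 t) (m≤m+n 84 15)
   go (inj₂ le) = le≤ c le

  off : ∀ {u v r} → u ≢ v → u ≁ v → dR κ u + dR κ v ≤ r → 6 * k' + 4 ≤ r + (ΣF (D κ u) + ΣF (D κ v))
  off {u} {v} ne na h = ≤-trans (PI κ ne na) (+-mono-≤ h (≡⇒≤ (ΣF-+ (D κ u) (D κ v))))

  off4 : ∀ {u v} → u ≢ v → u ≁ v → dR κ u + dR κ v ≤ 4 → 6 * k' ≤ ΣF (D κ u) + ΣF (D κ v)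
  off4 {u} {v} ne na h = +-cancelʳ-≤ 4 _ _ (≤-trans (off ne na h) (≡⇒≤ (+-comm 4 _)))

  sxy : 6 * k' ≤ ΣF (D κ x) + ΣF (D κ y)
  sxy = off4 x≢y xy (+-mono-≤ dx By.dx)
  sxz : 6 * k' ≤ ΣF (D κ x) + ΣF (D κ z)
  sxz = off4 (Bz.x≢y ∘ sym) xz (+-mono-≤ dx Bz.dx)
  syz : 6 * k' ≤ ΣF (D κ y) + ΣF (D κ z)
  syz = off4 (λ { refl → U∉ (U-++ʳ (a ∷ b ∷ x ∷ []) U5) i1 }) yz (+-mono-≤ By.dx Bz.dx)
  -- `a` and `b` have degree 3 in R, two more in sum than the other pairs, so this inequality has
  -- slack 2.
  sab : 6 * k' ≤ (ΣF (D κ a) + ΣF (D κ b)) + 2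
  sab = +-cancelʳ-≤ 4 _ _ (≤-trans (off a≢b ab (+-mono-≤ da Bs.da)) (≡⇒≤ (lem (ΣF (D κ a) + ΣF (D κ b)))))
   where lem : ∀ s → 6 + s ≡ s + 2 + 4
         lem = solve-∀

  ΣwtR : ΣF wtR ≡ 7 * (ΣF (D κ x) + (ΣF (D κ y) + ΣF (D κ z))) + 6 * (ΣF (D κ a) + ΣF (D κ b))
  ΣwtR = ΣF-+ (λ c → 7 * (D κ x c + (D κ y c + D κ z c))) (λ c → 6 * (D κ a c + D κ b c))
   ⨾ cong₂ _+_ (ΣF-* 7 (λ c → D κ x c + (D κ y c + D κ z c)) ⨾ cong (7 *_) (ΣF-+ (D κ x) (λ c → D κ y c + D κ z c) ⨾ cong (ΣF (D κ x) +_) (ΣF-+ (D κ y) (D κ z))))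
   (ΣF-* 6 (λ c → D κ a c + D κ b c) ⨾ cong (6 *_) (ΣF-+ (D κ a) (D κ b)))

  nt : NotK4 κ
  nt c t = arithW k' (ΣF (D κ x)) (ΣF (D κ y)) (ΣF (D κ z)) (ΣF (D κ a) + ΣF (D κ b)) sxy sxz syz sab (≤-trans (≡⇒≤ (cong (_+ 15) (sym ΣwtR))) (ΣF-strict w99 c (+-monoˡ-≤ 15 (tet84 t))))

  D3≤ : ∀ c {v} → κ v ≡ fz → D κ v c ≤ 3
  D3≤ c = D≤3 (ro R) c (nt c)

  tight2 : ∀ {u v} → κ u ≡ fz → κ v ≡ fz → 6 * k' ≤ ΣF (D κ u) + ΣF (D κ v) → ∀ c → D κ u c ≡ 3 × D κ v c ≡ 3
  tight2 {u} {v} ku kv h c = t2 {m = 3} {n = 3} (D3≤ c ku) (D3≤ c kv) (≡⇒≤ (sym (ΣF-tight {f = λ c → D κ u c + D κ v c} (λ c → +-mono-≤ (D3≤ c ku) (D3≤ c kv)) (≤-trans h (≡⇒≤ (sym (ΣF-+ (D κ u) (D κ v))))) c)))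

  Dx : ∀ c → D κ x c ≡ 3
  Dx c = fst (tight2 kx ky sxy c)
  Dy : ∀ c → D κ y c ≡ 3
  Dy c = snd (tight2 kx ky sxy c)
  Dz : ∀ c → D κ z c ≡ 3
  Dz c = snd (tight2 kx kz sxz c)

  -- A class with at most three would fall short of six by three, but the total slack of the pair
  -- `ab` is 2.
  ab≥4 : ∀ c → 4 ≤ D κ a c + D κ b c
  ab≥4 c = go (4 ≤? D κ a c + D κ b c)
   where
   go : Dec (4 ≤ D κ a c + D κ b c) → 4 ≤ D κ a c + D κ b c
   go (yes h) = h
   go (no h) = ⊥-elim (<-irrefl refl (≤-trans (+-monoʳ-< (ΣF (λ c → D κ a c + D κ b c)) {2} {3} ≤-refl)
    (≤-trans (ΣF-strict {f = λ c → D κ a c + D κ b c} (λ c → +-mono-≤ (D3≤ c ka) (D3≤ c kb)) c (+-monoˡ-≤ 3 (≤-pred (≰⇒> h)))) (≤-trans sab (≡⇒≤ (cong (_+ 2) (sym (ΣF-+ (D κ a) (D κ b)))))))))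


 -- The vertices x, y, z cannot be divided between the sides of a class: every further edge from `a`
 -- or `b` risks two disjoint chorded cycles, and fewer than the four required by `ab≥4` remain.
 module Mix {κ a b x y z} (R : R23 κ a b x y z) {c} (q : K33 κ c) (sx : SideB q x) (sy : SideA q y) (sz : SideA q z) where
  open OnR R using (U5; k5′; ka; kb; xa; xb; ya; yb; za; zb; ab≥4)
  open K33 q using (a₁; a₂; a₃; b₁; b₂; b₃; l33; a33)

  U11 : Unique (a₁ ∷ a₂ ∷ a₃ ∷ b₁ ∷ b₂ ∷ b₃ ∷ a ∷ b ∷ x ∷ y ∷ z ∷ [])
  U11 = mixU l33 U5 k5′
  FactM : Set
  FactM = Layout.Fact (vx a₁) (vx a₂ ∷ vx a₃ ∷ vx b₁ ∷ vx b₂ ∷ vx b₃ ∷ vx a ∷ vx b ∷ vx x ∷ vx y ∷ vx z ∷ []) U11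
  known : List FactM
  known = 0 - 3 ! a33 i1 i1 ∷ 0 - 4 ! a33 i1 i2 ∷ 0 - 5 ! a33 i1 i3 ∷ 1 - 3 ! a33 i2 i1 ∷ 1 - 4 ! a33 i2 i2 ∷ 1 - 5 ! a33 i2 i3 ∷ 2 - 3 ! a33 i3 i1 ∷ 2 - 4 ! a33 i3 i2 ∷ 2 - 5 ! a33 i3 i3 ∷ 8 - 3 ! fst sx i1 ∷ 8 - 4 ! fst sx i2 ∷ 8 - 5 ! fst sx i3 ∷ 9 - 0 ! fst sy i1 ∷ 9 - 1 ! fst sy i2 ∷ 9 - 2 ! fst sy i3 ∷ 10 - 0 ! fst sz i1 ∷ 10 - 1 ! fst sz i2 ∷ 10 - 2 ! fst sz i3 ∷
   8 - 6 ! xa ∷ 8 - 7 ! xb ∷ 9 - 6 ! ya ∷ 9 - 7 ! yb ∷ 10 - 6 ! za ∷ 10 - 7 ! zb ∷ []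
  kill : ∀ (fa : List FactM) h l h' l' →
   (let open Layout.Facts (vx a₁) (vx a₂ ∷ vx a₃ ∷ vx b₁ ∷ vx b₂ ∷ vx b₃ ∷ vx a ∷ vx b ∷ vx x ∷ vx y ∷ vx z ∷ []) U11 (fa ++ known) in okCC h l ∧ okCC h' l' ∧ distinct (is h l ++ is h' l')) ≡ true → ⊥
  kill fa h l h' l' r = two! (cfg (ro R)) c (vx a₁) (vx a₂ ∷ vx a₃ ∷ vx b₁ ∷ vx b₂ ∷ vx b₃ ∷ vx a ∷ vx b ∷ vx x ∷ vx y ∷ vx z ∷ []) U11 (mixI {κ} l33 k5′) (fa ++ known) h l h' l' r

  m1-0 : e a a₁ ∧ e b a₁ ≡ true → ⊥
  m1-0 h = kill (6 - 0 ! fst (∧2 (e a a₁) (e b a₁) h) ∷ 7 - 0 ! snd (∧2 (e a a₁) (e b a₁) h) ∷ []) 0 (fw 6 ∷ fw 9 ∷ fw 7 ∷ []) 8 (fw 3 ∷ fw 1 ∷ fw 4 ∷ fw 2 ∷ fw 5 ∷ []) refl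
  m1-1 : e a a₂ ∧ e b a₂ ≡ true → ⊥
  m1-1 h = kill (6 - 1 ! fst (∧2 (e a a₂) (e b a₂) h) ∷ 7 - 1 ! snd (∧2 (e a a₂) (e b a₂) h) ∷ []) 1 (fw 6 ∷ fw 9 ∷ fw 7 ∷ []) 8 (fw 3 ∷ fw 0 ∷ fw 4 ∷ fw 2 ∷ fw 5 ∷ []) refl
  m1-2 : e a a₃ ∧ e b a₃ ≡ true → ⊥
  m1-2 h = kill (6 - 2 ! fst (∧2 (e a a₃) (e b a₃) h) ∷ 7 - 2 ! snd (∧2 (e a a₃) (e b a₃) h) ∷ []) 2 (fw 6 ∷ fw 9 ∷ fw 7 ∷ []) 8 (fw 3 ∷ fw 0 ∷ fw 4 ∷ fw 1 ∷ fw 5 ∷ []) refl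
  m2a : le? 2 (sumB (e a b₁ ∷ e a b₂ ∷ e a b₃ ∷ [])) ≡ true → ⊥
  m2a h = go (two-of-three (e a b₁) (e a b₂) (e a b₃) (le?-sound 2 _ h))
   where
   go : (a ~ b₁ × a ~ b₂) ⊎ (a ~ b₁ × a ~ b₃) ⊎ (a ~ b₂ × a ~ b₃) → ⊥
   go (inj₁ (g , h)) = kill (6 - 3 ! g ∷ 6 - 4 ! h ∷ []) 8 (fw 3 ∷ fw 6 ∷ fw 4 ∷ []) 5 (fw 0 ∷ fw 9 ∷ fw 1 ∷ fw 10 ∷ fw 2 ∷ []) refl
   go (inj₂ (inj₁ (g , h))) = kill (6 - 3 ! g ∷ 6 - 5 ! h ∷ []) 8 (fw 3 ∷ fw 6 ∷ fw 5 ∷ []) 4 (fw 0 ∷ fw 9 ∷ fw 1 ∷ fw 10 ∷ fw 2 ∷ []) refl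
   go (inj₂ (inj₂ (g , h))) = kill (6 - 4 ! g ∷ 6 - 5 ! h ∷ []) 8 (fw 4 ∷ fw 6 ∷ fw 5 ∷ []) 3 (fw 0 ∷ fw 9 ∷ fw 1 ∷ fw 10 ∷ fw 2 ∷ []) refl
  m2b : le? 2 (sumB (e b b₁ ∷ e b b₂ ∷ e b b₃ ∷ [])) ≡ true → ⊥
  m2b h = go (two-of-three (e b b₁) (e b b₂) (e b b₃) (le?-sound 2 _ h))
   where
   go : (b ~ b₁ × b ~ b₂) ⊎ (b ~ b₁ × b ~ b₃) ⊎ (b ~ b₂ × b ~ b₃) → ⊥
   go (inj₁ (g , h)) = kill (7 - 3 ! g ∷ 7 - 4 ! h ∷ []) 8 (fw 3 ∷ fw 7 ∷ fw 4 ∷ []) 5 (fw 0 ∷ fw 9 ∷ fw 1 ∷ fw 10 ∷ fw 2 ∷ []) refl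
   go (inj₂ (inj₁ (g , h))) = kill (7 - 3 ! g ∷ 7 - 5 ! h ∷ []) 8 (fw 3 ∷ fw 7 ∷ fw 5 ∷ []) 4 (fw 0 ∷ fw 9 ∷ fw 1 ∷ fw 10 ∷ fw 2 ∷ []) refl
   go (inj₂ (inj₂ (g , h))) = kill (7 - 4 ! g ∷ 7 - 5 ! h ∷ []) 8 (fw 4 ∷ fw 7 ∷ fw 5 ∷ []) 3 (fw 0 ∷ fw 9 ∷ fw 1 ∷ fw 10 ∷ fw 2 ∷ []) refl
  m3b : le? 2 (sumB (e b a₁ ∷ e b a₂ ∷ e b a₃ ∷ [])) ∧ (e a b₁ ∨ e a b₂ ∨ e a b₃) ≡ true → ⊥
  m3b hh = go (two-of-three (e b a₁) (e b a₂) (e b a₃) (le?-sound 2 _ (∧-l hh))) (or3 (e a b₁) (e a b₂) (e a b₃) (∧-r {le? 2 (sumB (e b a₁ ∷ e b a₂ ∷ e b a₃ ∷ []))} hh))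
   where
   go : (b ~ a₁ × b ~ a₂) ⊎ (b ~ a₁ × b ~ a₃) ⊎ (b ~ a₂ × b ~ a₃) → a ~ b₁ ⊎ a ~ b₂ ⊎ a ~ b₃ → ⊥
   go (inj₁ (g , h)) (inj₁ f) = kill (7 - 0 ! g ∷ 7 - 1 ! h ∷ 6 - 3 ! f ∷ []) 9 (fw 0 ∷ fw 7 ∷ fw 1 ∷ []) 8 (fw 4 ∷ fw 2 ∷ fw 3 ∷ fw 6 ∷ []) refl
   go (inj₁ (g , h)) (inj₂ (inj₁ f)) = kill (7 - 0 ! g ∷ 7 - 1 ! h ∷ 6 - 4 ! f ∷ []) 9 (fw 0 ∷ fw 7 ∷ fw 1 ∷ []) 8 (fw 5 ∷ fw 2 ∷ fw 4 ∷ fw 6 ∷ []) refl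
   go (inj₁ (g , h)) (inj₂ (inj₂ f)) = kill (7 - 0 ! g ∷ 7 - 1 ! h ∷ 6 - 5 ! f ∷ []) 9 (fw 0 ∷ fw 7 ∷ fw 1 ∷ []) 8 (fw 3 ∷ fw 2 ∷ fw 5 ∷ fw 6 ∷ []) refl
   go (inj₂ (inj₁ (g , h))) (inj₁ f) = kill (7 - 0 ! g ∷ 7 - 2 ! h ∷ 6 - 3 ! f ∷ []) 9 (fw 0 ∷ fw 7 ∷ fw 2 ∷ []) 8 (fw 4 ∷ fw 1 ∷ fw 3 ∷ fw 6 ∷ []) refl
   go (inj₂ (inj₁ (g , h))) (inj₂ (inj₁ f)) = kill (7 - 0 ! g ∷ 7 - 2 ! h ∷ 6 - 4 ! f ∷ []) 9 (fw 0 ∷ fw 7 ∷ fw 2 ∷ []) 8 (fw 5 ∷ fw 1 ∷ fw 4 ∷ fw 6 ∷ []) refl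
   go (inj₂ (inj₁ (g , h))) (inj₂ (inj₂ f)) = kill (7 - 0 ! g ∷ 7 - 2 ! h ∷ 6 - 5 ! f ∷ []) 9 (fw 0 ∷ fw 7 ∷ fw 2 ∷ []) 8 (fw 3 ∷ fw 1 ∷ fw 5 ∷ fw 6 ∷ []) refl
   go (inj₂ (inj₂ (g , h))) (inj₁ f) = kill (7 - 1 ! g ∷ 7 - 2 ! h ∷ 6 - 3 ! f ∷ []) 9 (fw 1 ∷ fw 7 ∷ fw 2 ∷ []) 8 (fw 4 ∷ fw 0 ∷ fw 3 ∷ fw 6 ∷ []) refl
   go (inj₂ (inj₂ (g , h))) (inj₂ (inj₁ f)) = kill (7 - 1 ! g ∷ 7 - 2 ! h ∷ 6 - 4 ! f ∷ []) 9 (fw 1 ∷ fw 7 ∷ fw 2 ∷ []) 8 (fw 5 ∷ fw 0 ∷ fw 4 ∷ fw 6 ∷ []) refl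
   go (inj₂ (inj₂ (g , h))) (inj₂ (inj₂ f)) = kill (7 - 1 ! g ∷ 7 - 2 ! h ∷ 6 - 5 ! f ∷ []) 9 (fw 1 ∷ fw 7 ∷ fw 2 ∷ []) 8 (fw 3 ∷ fw 0 ∷ fw 5 ∷ fw 6 ∷ []) refl
  m3a : le? 2 (sumB (e a a₁ ∷ e a a₂ ∷ e a a₃ ∷ [])) ∧ (e b b₁ ∨ e b b₂ ∨ e b b₃) ≡ true → ⊥
  m3a hh = go (two-of-three (e a a₁) (e a a₂) (e a a₃) (le?-sound 2 _ (∧-l hh))) (or3 (e b b₁) (e b b₂) (e b b₃) (∧-r {le? 2 (sumB (e a a₁ ∷ e a a₂ ∷ e a a₃ ∷ []))} hh))
   where
   go : (a ~ a₁ × a ~ a₂) ⊎ (a ~ a₁ × a ~ a₃) ⊎ (a ~ a₂ × a ~ a₃) → b ~ b₁ ⊎ b ~ b₂ ⊎ b ~ b₃ → ⊥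
   go (inj₁ (g , h)) (inj₁ f) = kill (6 - 0 ! g ∷ 6 - 1 ! h ∷ 7 - 3 ! f ∷ []) 9 (fw 0 ∷ fw 6 ∷ fw 1 ∷ []) 8 (fw 4 ∷ fw 2 ∷ fw 3 ∷ fw 7 ∷ []) refl
   go (inj₁ (g , h)) (inj₂ (inj₁ f)) = kill (6 - 0 ! g ∷ 6 - 1 ! h ∷ 7 - 4 ! f ∷ []) 9 (fw 0 ∷ fw 6 ∷ fw 1 ∷ []) 8 (fw 5 ∷ fw 2 ∷ fw 4 ∷ fw 7 ∷ []) refl
   go (inj₁ (g , h)) (inj₂ (inj₂ f)) = kill (6 - 0 ! g ∷ 6 - 1 ! h ∷ 7 - 5 ! f ∷ []) 9 (fw 0 ∷ fw 6 ∷ fw 1 ∷ []) 8 (fw 3 ∷ fw 2 ∷ fw 5 ∷ fw 7 ∷ []) refl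
   go (inj₂ (inj₁ (g , h))) (inj₁ f) = kill (6 - 0 ! g ∷ 6 - 2 ! h ∷ 7 - 3 ! f ∷ []) 9 (fw 0 ∷ fw 6 ∷ fw 2 ∷ []) 8 (fw 4 ∷ fw 1 ∷ fw 3 ∷ fw 7 ∷ []) refl
   go (inj₂ (inj₁ (g , h))) (inj₂ (inj₁ f)) = kill (6 - 0 ! g ∷ 6 - 2 ! h ∷ 7 - 4 ! f ∷ []) 9 (fw 0 ∷ fw 6 ∷ fw 2 ∷ []) 8 (fw 5 ∷ fw 1 ∷ fw 4 ∷ fw 7 ∷ []) refl
   go (inj₂ (inj₁ (g , h))) (inj₂ (inj₂ f)) = kill (6 - 0 ! g ∷ 6 - 2 ! h ∷ 7 - 5 ! f ∷ []) 9 (fw 0 ∷ fw 6 ∷ fw 2 ∷ []) 8 (fw 3 ∷ fw 1 ∷ fw 5 ∷ fw 7 ∷ []) refl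
   go (inj₂ (inj₂ (g , h))) (inj₁ f) = kill (6 - 1 ! g ∷ 6 - 2 ! h ∷ 7 - 3 ! f ∷ []) 9 (fw 1 ∷ fw 6 ∷ fw 2 ∷ []) 8 (fw 4 ∷ fw 0 ∷ fw 3 ∷ fw 7 ∷ []) refl
   go (inj₂ (inj₂ (g , h))) (inj₂ (inj₁ f)) = kill (6 - 1 ! g ∷ 6 - 2 ! h ∷ 7 - 4 ! f ∷ []) 9 (fw 1 ∷ fw 6 ∷ fw 2 ∷ []) 8 (fw 5 ∷ fw 0 ∷ fw 4 ∷ fw 7 ∷ []) refl
   go (inj₂ (inj₂ (g , h))) (inj₂ (inj₂ f)) = kill (6 - 1 ! g ∷ 6 - 2 ! h ∷ 7 - 5 ! f ∷ []) 9 (fw 1 ∷ fw 6 ∷ fw 2 ∷ []) 8 (fw 3 ∷ fw 0 ∷ fw 5 ∷ fw 7 ∷ []) refl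

  noAB′ : ∀ {v} → κ v ≡ fz → (e v a₁ ∨ e v a₂ ∨ e v a₃) ∧ (e v b₁ ∨ e v b₂ ∨ e v b₃) ≡ true → ⊥
  noAB′ {v} kv h = go (or3 (e v a₁) (e v a₂) (e v a₃) (∧-l h)) (or3 (e v b₁) (e v b₂) (e v b₃) (∧-r {e v a₁ ∨ e v a₂ ∨ e v a₃} h))
   where
   fA : v ~ a₁ ⊎ v ~ a₂ ⊎ v ~ a₃ → Σ[ u ∈ V ] (u ∈ K33.A q × v ~ u)
   fA (inj₁ r) = a₁ , i1 , r
   fA (inj₂ (inj₁ r)) = a₂ , i2 , r
   fA (inj₂ (inj₂ r)) = a₃ , i3 , r
   fB : v ~ b₁ ⊎ v ~ b₂ ⊎ v ~ b₃ → Σ[ u ∈ V ] (u ∈ K33.B q × v ~ u)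
   fB (inj₁ r) = b₁ , i1 , r
   fB (inj₂ (inj₁ r)) = b₂ , i2 , r
   fB (inj₂ (inj₂ r)) = b₃ , i3 , r
   go : v ~ a₁ ⊎ v ~ a₂ ⊎ v ~ a₃ → v ~ b₁ ⊎ v ~ b₂ ⊎ v ~ b₃ → ⊥
   go p r = noAB (ro R) q kv (fst (snd (fA p))) (fst (snd (fB r))) (snd (snd (fA p))) (snd (snd (fB r)))

  m1 : (e a a₁ ∧ e b a₁) ∨ (e a a₂ ∧ e b a₂) ∨ (e a a₃ ∧ e b a₃) ≡ true → ⊥
  m1 h = [ m1-0 , [ m1-1 , m1-2 ]′ ]′ (or3 (e a a₁ ∧ e b a₁) (e a a₂ ∧ e b a₂) (e a a₃ ∧ e b a₃) h)

  dead : ⊥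
  dead = <-irrefl refl (≤-trans (≤-trans (ab≥4 c) (≡⇒≤ (cong₂ _+_ (d-L l33 a) (d-L l33 b))))
   (mix3≤3 (e a a₁ ∷ e a a₂ ∷ e a a₃ ∷ e a b₁ ∷ e a b₂ ∷ e a b₃ ∷ e b a₁ ∷ e b a₂ ∷ e b a₃ ∷ e b b₁ ∷ e b b₂ ∷ e b b₃ ∷ [])
   (∧-i (nots (noAB′ ka)) (∧-i (nots (noAB′ kb)) (∧-i (nots m1) (∧-i (nots m2a) (∧-i (nots m2b) (∧-i (nots m3b) (nots m3a)))))))))

 -- Here `x` sees β and `y` sees δ. An edge from `a` or `b` to α, β or γ would split class and R
 -- into two chorded cycles, so only δ is left for each, again too few for `ab≥4`.
 module Mix4 {κ a b x y z} (R : R23 κ a b x y z) {c α β γ δ} (l : Lst κ (fs c) (α ∷ β ∷ γ ∷ δ ∷ []))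
  (αβ : α ~ β) (βγ : β ~ γ) (γδ : γ ~ δ) (δα : δ ~ α) (βδ : β ~ δ)
  (xα : x ~ α) (xγ : x ~ γ) (xβ : x ~ β) (yα : y ~ α) (yγ : y ~ γ) (yδ : y ~ δ) (zα : z ~ α) (zγ : z ~ γ) where
  open OnR R using (U5; k5′; ka; kb; xa; xb; ya; yb; za; zb; ab≥4)

  U9 : Unique (α ∷ β ∷ γ ∷ δ ∷ a ∷ b ∷ x ∷ y ∷ z ∷ [])
  U9 = mixU l U5 k5′
  FactM : Set
  FactM = Layout.Fact (vx α) (vx β ∷ vx γ ∷ vx δ ∷ vx a ∷ vx b ∷ vx x ∷ vx y ∷ vx z ∷ []) U9
  known : List FactM
  known = 0 - 1 ! αβ ∷ 1 - 2 ! βγ ∷ 2 - 3 ! γδ ∷ 3 - 0 ! δα ∷ 1 - 3 ! βδ ∷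
   6 - 0 ! xα ∷ 6 - 2 ! xγ ∷ 6 - 1 ! xβ ∷ 7 - 0 ! yα ∷ 7 - 2 ! yγ ∷ 7 - 3 ! yδ ∷ 8 - 0 ! zα ∷ 8 - 2 ! zγ ∷
   6 - 4 ! xa ∷ 6 - 5 ! xb ∷ 7 - 4 ! ya ∷ 7 - 5 ! yb ∷ 8 - 4 ! za ∷ 8 - 5 ! zb ∷ []
  kill : ∀ (fa : List FactM) h l h' l' →
   (let open Layout.Facts (vx α) (vx β ∷ vx γ ∷ vx δ ∷ vx a ∷ vx b ∷ vx x ∷ vx y ∷ vx z ∷ []) U9 (fa ++ known) in okCC h l ∧ okCC h' l' ∧ distinct (is h l ++ is h' l')) ≡ true → ⊥
  kill fa h l' h' l″ r = two! (cfg (ro R)) c (vx α) (vx β ∷ vx γ ∷ vx δ ∷ vx a ∷ vx b ∷ vx x ∷ vx y ∷ vx z ∷ []) U9 (mixI {κ} l k5′) (fa ++ known) h l' h' l″ r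

  naα : a ≁ α
  naα = ¬t→f λ h → kill (4 - 0 ! h ∷ []) 0 (fw 4 ∷ fw 6 ∷ fw 1 ∷ []) 7 (fw 3 ∷ fw 2 ∷ fw 8 ∷ fw 5 ∷ []) refl
  naβ : a ≁ β
  naβ = ¬t→f λ h → kill (4 - 1 ! h ∷ []) 1 (fw 4 ∷ fw 6 ∷ fw 0 ∷ []) 7 (fw 3 ∷ fw 2 ∷ fw 8 ∷ fw 5 ∷ []) refl
  naγ : a ≁ γ
  naγ = ¬t→f λ h → kill (4 - 2 ! h ∷ []) 2 (fw 4 ∷ fw 6 ∷ fw 1 ∷ []) 7 (fw 3 ∷ fw 0 ∷ fw 8 ∷ fw 5 ∷ []) refl
  nbα : b ≁ α
  nbα = ¬t→f λ h → kill (5 - 0 ! h ∷ []) 0 (fw 5 ∷ fw 6 ∷ fw 1 ∷ []) 7 (fw 3 ∷ fw 2 ∷ fw 8 ∷ fw 4 ∷ []) refl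
  nbβ : b ≁ β
  nbβ = ¬t→f λ h → kill (5 - 1 ! h ∷ []) 1 (fw 5 ∷ fw 6 ∷ fw 0 ∷ []) 7 (fw 3 ∷ fw 2 ∷ fw 8 ∷ fw 4 ∷ []) refl
  nbγ : b ≁ γ
  nbγ = ¬t→f λ h → kill (5 - 2 ! h ∷ []) 2 (fw 5 ∷ fw 6 ∷ fw 1 ∷ []) 7 (fw 3 ∷ fw 0 ∷ fw 8 ∷ fw 4 ∷ []) refl

  one-nbr : ∀ v → v ≁ α → v ≁ β → v ≁ γ → D κ v c ≤ 1
  one-nbr v h1 h2 h3 = ≤-trans (≡⇒≤ (d-L l v ⨾ cong₂ _+_ (cong b2n h1) (cong₂ _+_ (cong b2n h2) (cong (λ t → b2n t + (b2n (e v δ) + 0)) h3)))) (≤-trans (≡⇒≤ (+-identityʳ _)) (b2n≤1 (e v δ)))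

  dead : ⊥
  dead = 4≰2 (≤-trans (ab≥4 c) (+-mono-≤ (one-nbr a naα naβ naγ) (one-nbr b nbα nbβ nbγ)))
   where 4≰2 : 4 ≤ 2 → ⊥
         4≰2 (s≤s (s≤s ()))

 -- A class K₄ minus an edge: the complete tripartite graph

 -- x, y, z choose the same vertex β of the two vertices of degree 3 in the class. This β turns out
 -- to be the dominating vertex of G₂.
 record M4 (κ : V → K) (c : Fin k') (x y z : V) : Set where
  constructor mkM4
  field
   {α β γ δ} : V
   l4 : Lst κ (fs c) (α ∷ β ∷ γ ∷ δ ∷ [])
   αβ : α ~ β
   βγ : β ~ γ
   γδ : γ ~ δ
   δα : δ ~ α
   βδ : β ~ δ
   αγ : α ≁ γ
   s4 : ∀ {v} → v ∈ x ∷ y ∷ z ∷ [] → v ~ α × v ~ β × v ~ γ × v ≁ δ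

 S33 : (V → K) → Fin k' → V → V → V → Set
 S33 κ c x y z = Σ[ q ∈ K33 κ c ] (∀ {v} → v ∈ x ∷ y ∷ z ∷ [] → SideA q v)

 classify : ∀ {κ a b x y z} → R23 κ a b x y z → ∀ c → S33 κ c x y z ⊎ M4 κ c x y z
 classify {κ} {a} {b} {x} {y} {z} R c = go (kind (ro R) c)
  where
  module O = OnR R using (Dx; Dy; Dz; kx; ky; kz; nt; x≢y)
  Ry = R-102 R
  Rz = R-201 R
  c33 : (q : K33 κ c) → SideA q x → S33 κ c x y z
  c33 q ax = f (side (ro R) q O.ky (O.Dy c)) (side (ro R) q O.kz (O.Dz c))
   where
   f : SideA q y ⊎ SideB q y → SideA q z ⊎ SideB q z → S33 κ c x y z
   f (inj₁ ay) (inj₁ az) = q , λ { i1 → ax ; i2 → ay ; i3 → az }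
   f (inj₂ by) (inj₁ az) = ⊥-elim (Mix.dead Ry q by ax az)
   f (inj₁ ay) (inj₂ bz) = ⊥-elim (Mix.dead Rz q bz ax ay)
   f (inj₂ by) (inj₂ bz) = ⊥-elim (Mix.dead R (flip33 q) ax by bz)
  go : Kind κ c → S33 κ c x y z ⊎ M4 κ c x y z
  go (k4 l p q r s t u) = ⊥-elim (O.nt c (tet l p q r s t u))
  go (k5 l p q r s t u) = ⊥-elim (K5.one-tight (ro R) c l p q r s t u O.x≢y O.kx O.ky (O.Dx c) (O.Dy c))
  go (big _ _ mk) = inj₁ ([ c33 q , c33 (flip33 q) ]′ (side (ro R) q O.kx (O.Dx c)))
   where q = mk O.kx (O.Dx c)
  go (k4m {α} {β} {γ} {δ} l αβ βγ γδ δα βδ αγ) = inj₂ (f (pt O.kx (O.Dx c)) (pt O.ky (O.Dy c)) (pt O.kz (O.Dz c)))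
   where
   pt = K4m.pat (ro R) c l αβ βγ γδ δα βδ αγ
   Pt : V → Set
   Pt v = v ~ α × v ~ γ × ((v ~ β × v ≁ δ) ⊎ (v ≁ β × v ~ δ))
   l' : Lst κ (fs c) (α ∷ δ ∷ γ ∷ β ∷ [])
   l' = L-perm (prep α (↭-trans (prep β (swap γ δ refl)) (↭-trans (swap β δ refl) (prep δ (swap β γ refl))))) l
   f : Pt x → Pt y → Pt z → M4 κ c x y z
   f (xα , xγ , inj₁ (xβ , nx)) (yα , yγ , inj₁ (yβ , ny)) (zα , zγ , inj₁ (zβ , nz)) = mkM4 l αβ βγ γδ δα βδ αγ
    λ { i1 → xα , xβ , xγ , nx ; i2 → yα , yβ , yγ , ny ; i3 → zα , zβ , zγ , nz }
   f (xα , xγ , inj₂ (nx , xδ)) (yα , yγ , inj₂ (ny , yδ)) (zα , zγ , inj₂ (nz , zδ)) = mkM4 l' (adj-sym δα) (adj-sym γδ) (adj-sym βγ) (adj-sym αβ) (adj-sym βδ) αγ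
    λ { i1 → xα , xδ , xγ , nx ; i2 → yα , yδ , yγ , ny ; i3 → zα , zδ , zγ , nz }
   f (xα , xγ , inj₁ (xβ , _)) (yα , yγ , inj₂ (_ , yδ)) (zα , zγ , _) = ⊥-elim (Mix4.dead R l αβ βγ γδ δα βδ xα xγ xβ yα yγ yδ zα zγ)
   f (xα , xγ , inj₂ (_ , xδ)) (yα , yγ , inj₁ (yβ , _)) (zα , zγ , _) = ⊥-elim (Mix4.dead Ry l αβ βγ γδ δα βδ yα yγ yβ xα xγ xδ zα zγ)
   f (xα , xγ , inj₁ (xβ , _)) (yα , yγ , inj₁ _) (zα , zγ , inj₂ (_ , zδ)) = ⊥-elim (Mix4.dead (R-perm (prep x (swap y z refl)) R) l αβ βγ γδ δα βδ xα xγ xβ zα zγ zδ yα yγ)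
   f (xα , xγ , inj₂ (_ , xδ)) (yα , yγ , inj₂ _) (zα , zγ , inj₁ (zβ , _)) = ⊥-elim (Mix4.dead Rz l αβ βγ γδ δα βδ zα zγ zβ xα xγ xδ yα yγ)

 D2 : Set
 D2 = IsTri G k'

 tet-adj : ∀ {κ c p q r s} → Tet κ c p q r s → ∀ {u v} → u ∈ p ∷ q ∷ r ∷ s ∷ [] → v ∈ p ∷ q ∷ r ∷ s ∷ [] → u ≢ v → u ~ v
 tet-adj t i1 i1 ne = ⊥-elim (ne refl)
 tet-adj t i1 i2 ne = Tet.xy t
 tet-adj t i1 i3 ne = Tet.xz t
 tet-adj t i1 i4 ne = Tet.xw t
 tet-adj t i2 i1 ne = adj-sym (Tet.xy t)
 tet-adj t i2 i2 ne = ⊥-elim (ne refl)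
 tet-adj t i2 i3 ne = Tet.yz t
 tet-adj t i2 i4 ne = Tet.yw t
 tet-adj t i3 i1 ne = adj-sym (Tet.xz t)
 tet-adj t i3 i2 ne = adj-sym (Tet.yz t)
 tet-adj t i3 i3 ne = ⊥-elim (ne refl)
 tet-adj t i3 i4 ne = Tet.zw t
 tet-adj t i4 i1 ne = adj-sym (Tet.xw t)
 tet-adj t i4 i2 ne = adj-sym (Tet.yw t)
 tet-adj t i4 i3 ne = adj-sym (Tet.zw t)
 tet-adj t i4 i4 ne = ⊥-elim (ne refl)

 -- The changed class is not K₄ because it contains the nonadjacent pair `u`, `w`; the other classes
 -- are the old ones.
 swap-NotK4 : ∀ {κ c x v C' R'} (S : Swapped κ c x v C' R') → NotK4 κ → ∀ {u w} → Swapped.κ' S u ≡ fs c → Swapped.κ' S w ≡ fs c → u ≢ w → u ≁ w → NotK4 (Swapped.κ' S)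
 swap-NotK4 {κ} {c} S nt {u} {w} ku kw ne uw c' t = go (c' Fin.≟ c)
  where
  open Swapped S
  go : Dec (c' ≡ c) → ⊥
  go (yes refl) = true≢false (sym (tet-adj t (l⇐ (Tet.tl4 t) ku) (l⇐ (Tet.tl4 t) kw) ne) ⨾ uw)
  go (no nc) = nt c' (tet (L-perm (L-↭ (oth nc (cls-L κ (fs c'))) (Tet.tl4 t)) (cls-L κ (fs c'))) (Tet.xy t) (Tet.xz t) (Tet.xw t) (Tet.yz t) (Tet.yw t) (Tet.zw t))

 transp : ∀ {κ c x v C' R'} (S : Swapped κ c x v C' R') {c'} → c' ≢ c → K33 κ c' → K33 (Swapped.κ' S) c'
 transp S ne (mk33 l p) = mk33 (Swapped.oth S ne l) p

 M4-flip : ∀ {κ c x y z} → M4 κ c x y z → M4 κ c x y z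
 M4-flip (mkM4 {α} {β} {γ} {δ} l αβ βγ γδ δα βδ αγ s) = mkM4 (L-perm (Perm.++⁺ʳ (δ ∷ []) (↭-sym (Perm.↭-reverse (α ∷ β ∷ γ ∷ [])))) l)
  (adj-sym βγ) (adj-sym αβ) (adj-sym δα) (adj-sym γδ) βδ (nadj-sym αγ) (λ m → fst (snd (snd (s m))) , fst (snd (s m)) , fst (s m) , snd (snd (snd (s m))))

 module OnM {κ a b x y z c} (R : R23 κ a b x y z) (m : M4 κ c x y z) where
  module O = OnR R using (kx; nt; xy; ya; yb; yz; za; zb)
  open M4 m
  v1 : ∀ {u v w : V} → u ∈ u ∷ v ∷ w ∷ []
  v1 = here refl
  xα : x ~ α
  xα = fst (s4 v1)
  xβ : x ~ β
  xβ = fst (snd (s4 v1))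
  xγ : x ~ γ
  xγ = fst (snd (snd (s4 v1)))
  yα : y ~ α
  yα = fst (s4 i2)
  yβ : y ~ β
  yβ = fst (snd (s4 i2))
  zγ : z ~ γ
  zγ = fst (snd (snd (s4 i3)))
  yδ : y ≁ δ
  yδ = snd (snd (snd (s4 i2)))
  zδ : z ≁ δ
  zδ = snd (snd (snd (s4 i3)))

  abstract
   swap₁ : Swapped κ c δ x (α ∷ β ∷ γ ∷ []) (a ∷ b ∷ y ∷ z ∷ [])
   swap₁ = exch (ro R) c (L-perm (Perm.++-comm (α ∷ β ∷ γ ∷ []) (δ ∷ [])) l4) (L-perm (↭-trans (prep a (swap b x refl)) (swap a x refl)) (rl R))
    (CC! (vx x) (vx α ∷ vx β ∷ vx γ ∷ []) (U-cons (λ q → Fin.0≢1+n (sym O.kx ⨾ l⇒ l4 (∈-++⁺ˡ q))) (U-++ˡ (α ∷ β ∷ γ ∷ []) (lu l4)))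
    (0 - 1 ! xα ∷ 0 - 2 ! xβ ∷ 0 - 3 ! xγ ∷ 1 - 2 ! αβ ∷ 2 - 3 ! βγ ∷ []) 2 (fw 1 ∷ fw 0 ∷ fw 3 ∷ []) refl)
    (≤-trans (cntL≤length (e δ) (α ∷ β ∷ γ ∷ [])) (≡⇒≤ (sym (cong₂ _+_ (cong b2n xα) (cong₂ _+_ (cong b2n xβ) (cong (λ t → b2n t + 0) xγ))))))

  -- δ has been exchanged for `x`. The degree condition for δ and `y` forces δ to see `a` and `b`,
  -- so the remainder is again K₂,₃, with δ in the role of `x`.
  module Step₁ (S : Swapped κ c δ x (α ∷ β ∷ γ ∷ []) (a ∷ b ∷ y ∷ z ∷ [])) where
   open Swapped S public
   kδ : κ' δ ≡ fz
   kδ = l⇒ LR i1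
   ky : κ' y ≡ fz
   ky = l⇒ LR i4
   α≢γ : α ≢ γ
   α≢γ refl = U∉ (lu l4) i2
   nt : NotK4 κ'
   nt = swap-NotK4 S O.nt {α} {γ} (l⇒ LC i2) (l⇒ LC i4) α≢γ αγ
   δ≢y : δ ≢ y
   δ≢y refl = U∉ (lu LR) i3
   dδ : dR κ' δ ≡ b2n (e δ a) + (b2n (e δ b) + 0)
   dδ = d-L LR δ ⨾ cong₂ _+_ (cong b2n (E-irr G δ)) (cong (λ t → b2n (e δ a) + (b2n (e δ b) + t)) (cong₂ _+_ (cong b2n (nadj-sym yδ)) (cong (λ t → b2n t + 0) (nadj-sym zδ))))
   dy : dR κ' y ≤ 2
   dy = ≤-trans (≡⇒≤ (d-L LR y ⨾ cong₂ _+_ (cong b2n yδ) (cong (λ t → b2n (e y a) + (b2n (e y b) + t)) (cong₂ _+_ (cong b2n (E-irr G y)) (cong (λ t → b2n t + 0) O.yz)))))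
    (+-mono-≤ (b2n≤1 (e y a)) (+-mono-≤ (b2n≤1 (e y b)) z≤n))
   both : δ ~ a × δ ~ b
   both = two-bits (e δ a) (e δ b) (≤-trans (ar k' (dR κ' δ) _ _ (PI κ' δ≢y (nadj-sym yδ)) dy (ΣF-upper (λ i → +-mono-≤ (D≤3 opt' i (nt i) kδ) (D≤3 opt' i (nt i) ky)))) (≡⇒≤ dδ))
    where
    ar : ∀ k a b S → 6 * k + 4 ≤ (a + b) + S → b ≤ 2 → S ≤ 6 * k → 2 ≤ a
    ar k a b S h hb hS = +-cancelʳ-≤ (2 + 6 * k) 2 a (≤-trans (≡⇒≤ (lem k)) (≤-trans h (≤-trans (≡⇒≤ (+-assoc a b S)) (+-monoʳ-≤ a (+-mono-≤ hb hS)))))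
     where lem : ∀ k → 2 + (2 + 6 * k) ≡ 6 * k + 4
           lem = solve-∀
   R1 : R23 κ' a b y z δ
   R1 = mkR opt' (L-perm (Perm.++-comm (δ ∷ []) (a ∷ b ∷ y ∷ z ∷ [])) LR) λ { i1 → O.ya , O.yb ; i2 → O.za , O.zb ; i3 → both }
   abstract
    swap₂ : Swapped κ' c γ y (x ∷ α ∷ β ∷ []) (a ∷ b ∷ z ∷ δ ∷ [])
    swap₂ = exch opt' c pC (L-perm (↭-trans (prep a (swap b y refl)) (swap a y refl)) (rl R1))
     (CC! (vx y) (vx x ∷ vx α ∷ vx β ∷ []) (U-cons (λ q → Fin.0≢1+n (sym ky ⨾ l⇒ pC (there q))) (U-++ʳ (γ ∷ []) (lu pC)))
     (0 - 2 ! yα ∷ 0 - 3 ! yβ ∷ 1 - 2 ! xα ∷ 1 - 3 ! xβ ∷ 2 - 3 ! αβ ∷ []) 2 (fw 0 ∷ fw 3 ∷ fw 1 ∷ []) refl)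
     (≡⇒≤ (cong₂ _+_ (cong b2n (adj-sym xγ)) (cong₂ _+_ (cong b2n (nadj-sym αγ)) (cong (λ t → b2n t + 0) (adj-sym βγ)))
     ⨾ sym (cong₂ _+_ (cong b2n (nadj-sym O.xy)) (cong₂ _+_ (cong b2n yα) (cong (λ t → b2n t + 0) yβ)))))
     where
     pC : Lst κ' (fs c) (γ ∷ x ∷ α ∷ β ∷ [])
     pC = L-perm (Perm.++-comm (x ∷ α ∷ β ∷ []) (γ ∷ [])) LC

   -- After the further exchange of γ for `y`, the remainder is K₂,₃ with small side z, δ and large
   -- side a, b, γ. What holds for low vertices now applies to `a`, `b` and γ.
   module Step₂ (S2 : Swapped κ' c γ y (x ∷ α ∷ β ∷ []) (a ∷ b ∷ z ∷ δ ∷ [])) where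
    module W2 = Swapped S2
    κ2 : V → K
    κ2 = W2.κ'
    R2 : R23 κ2 z δ a b γ
    R2 = mkR W2.opt' (L-perm pm W2.LR) λ { i1 → adj-sym O.za , adj-sym (fst both) ; i2 → adj-sym O.zb , adj-sym (snd both) ; i3 → adj-sym zγ , γδ }
     where pm : γ ∷ a ∷ b ∷ z ∷ δ ∷ [] ↭ z ∷ δ ∷ a ∷ b ∷ γ ∷ []
           pm = ↭-trans (Perm.++-comm (γ ∷ a ∷ b ∷ []) (z ∷ δ ∷ [])) (prep z (prep δ (Perm.++-comm (γ ∷ []) (a ∷ b ∷ []))))
    module O2 = OnR R2 using (Dx; Dy; Dz; U5; k5′; ka; kb; kx; ky; kz)
    lc : Lst κ2 (fs c) (x ∷ α ∷ y ∷ β ∷ [])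
    lc = L-perm (↭-trans (swap y x refl) (prep x (swap y α refl))) W2.LC
    pt = K4m.pat W2.opt' c lc xα (adj-sym yα) yβ (adj-sym xβ) αβ O.xy
    γβ : γ ≁ α × γ ~ β
    γβ = nadj-sym αγ , adj-sym βγ
    ab-β : ∀ {v w} → R23 κ2 z δ v γ w → D κ2 v c ≡ 3 → D κ2 w c ≡ 3 → κ2 v ≡ fz → κ2 w ≡ fz → v ~ β × v ≁ α
    ab-β {v} {w} R' dv dw kv kw = go (pt kv dv) (pt kw dw)
     where
     go : v ~ x × v ~ y × ((v ~ α × v ≁ β) ⊎ (v ≁ α × v ~ β)) →
      w ~ x × w ~ y × ((w ~ α × w ≁ β) ⊎ (w ≁ α × w ~ β)) → v ~ β × v ≁ α
     go (_ , _ , inj₂ (nα , vβ)) _ = vβ , nα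
     go (vx' , vy , inj₁ (vα , _)) (wx , wy , _) = ⊥-elim (Mix4.dead R' lc xα (adj-sym yα) yβ (adj-sym xβ) αβ vx' vy vα (adj-sym xγ) (fst (snd (pt O2.kz (O2.Dz c)))) (snd γβ) wx wy)
    aβ : a ~ β × a ≁ α
    aβ = ab-β (R-perm (prep a (swap b γ refl)) R2) (O2.Dx c) (O2.Dy c) O2.kx O2.ky
    bβ : b ~ β × b ≁ α
    bβ = ab-β (R-perm (↭-trans (swap a b refl) (prep b (swap a γ refl))) R2) (O2.Dy c) (O2.Dx c) O2.ky O2.kx

    module _ {d} (ne : d ≢ c) where

     oB : (q : K33 κ2 d) → ∀ {v} → κ2 v ≡ fz → z ~ v → D κ2 v d ≡ 3 → SideA q z → SideB q v
     oB q kv zv dv az = [ (λ r → ⊥-elim (true≢false (sym zv ⨾ same-nadj W2.opt' q O2.ka kv az r))) , id ]′ (side W2.opt' q kv dv)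

     sides : (q : K33 κ d) → SideA q z → SideB q a × SideB q b × SideB q γ × SideA q δ
     sides (mk33 l p) az = sa , oB q2 O2.ky O.zb (O2.Dy d) az , oB q2 O2.kz zγ (O2.Dz d) az , sd (side opt' q1 kδ (OnR.Dz R1 d))
      where
      q0 : K33 κ d
      q0 = mk33 l p
      q1 : K33 κ' d
      q1 = mk33 (oth ne l) p
      q2 : K33 κ2 d
      q2 = mk33 (W2.oth ne (oth ne l)) p
      sa : SideB q0 a
      sa = oB q2 O2.kx O.za (O2.Dx d) az
      sd : SideA q1 δ ⊎ SideB q1 δ → SideA q0 δ
      sd (inj₁ r) = r
      sd (inj₂ r) = ⊥-elim (true≢false (sym (fst both) ⨾ same-nadj W2.opt' (flip33 q2) O2.kb O2.kx r sa))

     -- In the new remainders a, b, γ and δ all are low and see α' and γ'. Then z, a, α', γ carry a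
     -- chorded cycle, and γ', b, δ with β' or δ' carry another.
     no-M4 : M4 κ d x y z → ⊥
     no-M4 (mkM4 {α'} {β'} {γ'} {δ'} l' αβ' βγ' γδ' δα' βδ' αγ' s') = go (pd O2.kx (O2.Dx d)) (pd O2.ky (O2.Dy d)) (pd O2.kz (O2.Dz d)) (p1 kδ (OnR.Dz R1 d))
      where
      l2 : Lst κ2 (fs d) (α' ∷ β' ∷ γ' ∷ δ' ∷ [])
      l2 = W2.oth ne (oth ne l')
      pd = K4m.pat W2.opt' d l2 αβ' βγ' γδ' δα' βδ' αγ'
      p1 = K4m.pat opt' d (oth ne l') αβ' βγ' γδ' δα' βδ' αγ'
      Pt : V → Set
      Pt v = v ~ α' × v ~ γ' × ((v ~ β' × v ≁ δ') ⊎ (v ≁ β' × v ~ δ'))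
      U9 : Unique (α' ∷ β' ∷ γ' ∷ δ' ∷ z ∷ δ ∷ a ∷ b ∷ γ ∷ [])
      U9 = mixU l2 O2.U5 O2.k5′
      FactN : Set
      FactN = Layout.Fact (vx α') (vx β' ∷ vx γ' ∷ vx δ' ∷ vx z ∷ vx δ ∷ vx a ∷ vx b ∷ vx γ ∷ []) U9
      go : Pt a → Pt b → Pt γ → Pt δ → ⊥
      go (aα , _) (_ , bγ , _) (gα , _) (_ , δγ' , r) = fin r
       where
       known : List FactN
       known = 4 - 6 ! O.za ∷ 4 - 8 ! zγ ∷ 4 - 0 ! fst (s' i3) ∷ 6 - 0 ! aα ∷ 8 - 0 ! gα ∷
        2 - 5 ! adj-sym δγ' ∷ 2 - 7 ! adj-sym bγ ∷ 5 - 7 ! snd both ∷ 1 - 2 ! βγ' ∷ 2 - 3 ! γδ' ∷ []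
       fin : (δ ~ β' × δ ≁ δ') ⊎ (δ ≁ β' × δ ~ δ') → ⊥
       fin (inj₁ (h , _)) = two! (cfg W2.opt') d (vx α') (vx β' ∷ vx γ' ∷ vx δ' ∷ vx z ∷ vx δ ∷ vx a ∷ vx b ∷ vx γ ∷ []) U9 (mixI {κ2} l2 O2.k5′)
        (5 - 1 ! h ∷ known) 4 (fw 6 ∷ fw 0 ∷ fw 8 ∷ []) 2 (fw 7 ∷ fw 5 ∷ fw 1 ∷ []) refl
       fin (inj₂ (_ , h)) = two! (cfg W2.opt') d (vx α') (vx β' ∷ vx γ' ∷ vx δ' ∷ vx z ∷ vx δ ∷ vx a ∷ vx b ∷ vx γ ∷ []) U9 (mixI {κ2} l2 O2.k5′)
        (5 - 3 ! h ∷ known) 4 (fw 6 ∷ fw 0 ∷ fw 8 ∷ []) 2 (fw 7 ∷ fw 5 ∷ fw 3 ∷ []) refl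

  record Facts : Set where
   field
    δa : δ ~ a
    δb : δ ~ b
    aβ : a ~ β
    bβ : b ~ β
    aα : a ≁ α
    bα : b ≁ α
    sides : ∀ {d} → d ≢ c → (q : K33 κ d) → SideA q z → SideB q a × SideB q b × SideB q γ × SideA q δ
    none : ∀ {d} → d ≢ c → M4 κ d x y z → ⊥

  abstract
   facts : Facts
   facts = record { δa = fst (Step₁.both swap₁) ; δb = snd (Step₁.both swap₁) ; aβ = fst (Step₁.Step₂.aβ swap₁ (Step₁.swap₂ swap₁)) ; bβ = fst (Step₁.Step₂.bβ swap₁ (Step₁.swap₂ swap₁)) ; aα = snd (Step₁.Step₂.aβ swap₁ (Step₁.swap₂ swap₁)) ; bα = snd (Step₁.Step₂.bβ swap₁ (Step₁.swap₂ swap₁))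
    ; sides = λ ne → (Step₁.Step₂.sides swap₁ (Step₁.swap₂ swap₁)) ne ; none = λ ne → (Step₁.Step₂.no-M4 swap₁ (Step₁.swap₂ swap₁)) ne }

 module M4→D2 {κ a b x y z c} (R : R23 κ a b x y z) (m : M4 κ c x y z) where
  open M4 m
  module O = OnR R using (Dx; ab; kx; xa; xb; xy; xz; ya; yb; yz; zb)
  o = ro R
  abstract
   F : OnM.Facts R m
   F = OnM.facts R m
   F' : OnM.Facts R (M4-flip m)
   F' = OnM.facts R (M4-flip m)
  module F = OnM.Facts F
  module F' = OnM.Facts F'
  Uxyz : List V
  Uxyz = x ∷ y ∷ z ∷ []

  -- With b₁ in R instead of `z`, the remainder is still K₂,₃, so b₁ has all the properties proved
  -- for its large side.
  module InB {d} (ne : d ≢ c) (q : K33 κ d) (sq : ∀ {v} → v ∈ Uxyz → SideA q v) (S : Swapped κ d (K33.b₁ q) z (K33.A q ++ K33.b₂ q ∷ K33.b₃ q ∷ []) (a ∷ b ∷ x ∷ y ∷ [])) where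
   open Swapped S
   u = K33.b₁ q
   ua : u ~ a
   ua = adj-sym (fst (fst (F.sides ne q (sq i3))) i1)
   ub : u ~ b
   ub = adj-sym (fst (fst (snd (F.sides ne q (sq i3)))) i1)
   R' : R23 κ' a b x y u
   R' = mkR opt' (L-perm (Perm.++-comm (u ∷ []) (a ∷ b ∷ x ∷ y ∷ [])) LR) λ { i1 → O.xa , O.xb ; i2 → O.ya , O.yb ; i3 → ua , ub }
   module O' = OnR R' using (Dz; ka; kz)
   Pu : u ~ α × u ~ γ × ((u ~ β × u ≁ δ) ⊎ (u ≁ β × u ~ δ))
   Pu = K4m.pat opt' c (oth (ne ∘ sym) l4) αβ βγ γδ δα βδ αγ O'.kz (O'.Dz c)
   onC : u ~ α × u ~ β × u ~ γ × u ≁ δ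
   onC = go Pu
    where
    go : u ~ α × u ~ γ × ((u ~ β × u ≁ δ) ⊎ (u ≁ β × u ~ δ)) → u ~ α × u ~ β × u ~ γ × u ≁ δ
    go (uα , uγ , inj₁ (uβ , uδ)) = uα , uβ , uγ , uδ
    go (uα , uγ , inj₂ (_ , uδ)) = ⊥-elim (Mix4.dead (R-perm (prep x (swap y u refl)) R') (oth (ne ∘ sym) l4) αβ βγ γδ δα βδ
     (fst (s4 i1)) (fst (snd (snd (s4 i1)))) (fst (snd (s4 i1))) uα uγ uδ (fst (s4 i2)) (fst (snd (snd (s4 i2)))))
   other : ∀ {d'} → d' ≢ c → d' ≢ d → (p : K33 κ d') → SideA p z → SideA p u
   other {d'} nc nd (mk33 l adj) sz = go (side opt' p' O'.kz (O'.Dz d'))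
    where
    p₀ : K33 κ d'
    p₀ = mk33 l adj
    p' : K33 κ' d'
    p' = mk33 (oth nd l) adj
    go : SideA p' u ⊎ SideB p' u → SideA p₀ u
    go (inj₁ r) = r
    go (inj₂ r) = ⊥-elim (true≢false (sym ua ⨾ same-nadj opt' (flip33 p') O'.kz O'.ka r (fst (F.sides nc p₀ sz))))

  record BFact (d : Fin k') (u : V) : Set where
   constructor mkB
   field
    ua : u ~ a
    ub : u ~ b
    onC : u ~ α × u ~ β × u ~ γ × u ≁ δ
    other : ∀ {d'} → d' ≢ c → d' ≢ d → (p : K33 κ d') → SideA p z → SideA p u

  abstract
   bfact : ∀ {d} (ne : d ≢ c) (q : K33 κ d) (sq : ∀ {v} → v ∈ Uxyz → SideA q v) → ∀ {u} → u ∈ K33.B q → BFact d u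
   bfact {d} ne q sq {u} mu = go (pickB q mu)
    where
    pz : Lst κ fz (z ∷ a ∷ b ∷ x ∷ y ∷ [])
    pz = L-perm (Perm.++-comm (a ∷ b ∷ x ∷ y ∷ []) (z ∷ [])) (rl R)
    go : Σ[ q' ∈ K33 κ d ] (K33.b₁ q' ≡ u × K33.A q' ≡ K33.A q × (∀ {z} → z ∈ K33.B q' → z ∈ K33.B q)) → BFact d u
    go (q' , refl , eA , sub) = mkB I.ua I.ub I.onC I.other
     where
     sq' : ∀ {v} → v ∈ Uxyz → SideA q' v
     sq' w = (λ r → fst (sq w) (cast∈ eA r)) , (λ r → snd (sq w) (sub r))
     module I = InB ne q' sq' (fst (exch33 o q' pz (sq' i3)))

  -- With a₁ in R instead of `a`, the remainder is still K₂,₃ and class `c` is unchanged, so a₁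
  -- inherits what is known of `a`.
  module InA {d} (ne : d ≢ c) (q : K33 κ d) (sq : ∀ {v} → v ∈ Uxyz → SideA q v) (S : Swapped κ d (K33.a₁ q) a (K33.B q ++ K33.a₂ q ∷ K33.a₃ q ∷ []) (b ∷ x ∷ y ∷ z ∷ [])) where
   open Swapped S
   w = K33.a₁ q
   R' : R23 κ' w b x y z
   R' = mkR opt' LR λ { i1 → fst (sq i1) i1 , O.xb ; i2 → fst (sq i2) i1 , O.yb ; i3 → fst (sq i3) i1 , O.zb }
   m' : M4 κ' c x y z
   m' = mkM4 (oth (ne ∘ sym) l4) αβ βγ γδ δα βδ αγ s4
   module N = OnM.Facts (OnM.facts R' m')
   module N' = OnM.Facts (OnM.facts R' (M4-flip m'))
   other : ∀ {d'} → d' ≢ c → d' ≢ d → (p : K33 κ d') → SideA p z → SideB p w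
   other nc nd (mk33 l adj) sz = fst (N.sides nc (mk33 (oth nd l) adj) sz)

  record AFact (d : Fin k') (w : V) : Set where
   constructor mkA
   field
    wβ : w ~ β
    wα : w ≁ α
    wγ : w ≁ γ
    δw : δ ~ w
    other : ∀ {d'} → d' ≢ c → d' ≢ d → (p : K33 κ d') → SideA p z → SideB p w

  abstract
   afact : ∀ {d} (ne : d ≢ c) (q : K33 κ d) (sq : ∀ {v} → v ∈ Uxyz → SideA q v) → ∀ {w} → w ∈ K33.A q → AFact d w
   afact {d} ne q sq {w} mw = go (pickA q mw)
    where
    go : PickA q w → AFact d w
    go record { q' = q' ; a₁≡ = refl ; A↭ = A↭ ; B≡ = B≡ } = mkA I.N.aβ I.N.aα I.N'.aα I.N.δa I.other
     where
     sq' : ∀ {v} → v ∈ Uxyz → SideA q' v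
     sq' t = (λ r → fst (sq t) (Perm.∈-resp-↭ (↭-sym A↭) r)) , (λ r → snd (sq t) (cast∈ B≡ r))
     module I = InA ne q' sq' (fst (exA o q' (rl R) (fst (F.sides ne q' (sq' i3)))))

  cls33 : ∀ d → d ≢ c → S33 κ d x y z
  cls33 d ne = [ id , (λ m' → ⊥-elim (F.none ne m')) ]′ (classify R d)
  data PA (u : V) : Set where
   isa : u ≡ a → PA u
   isb : u ≡ b → PA u
   isα : u ≡ α → PA u
   isγ : u ≡ γ → PA u
   inA : ∀ d (ne : d ≢ c) → u ∈ K33.A (fst (cls33 d ne)) → PA u
  data PW (u : V) : Set where
   inV : u ∈ Uxyz → PW u
   isδ : u ≡ δ → PW u
   inB : ∀ d (ne : d ≢ c) → u ∈ K33.B (fst (cls33 d ne)) → PW u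

  class : ∀ u → u ≡ β ⊎ PA u ⊎ PW u
  class u = go (κ u) refl
   where
   go : ∀ i → κ u ≡ i → u ≡ β ⊎ PA u ⊎ PW u
   go fz ku = f (l⇐ (rl R) ku)
    where f : u ∈ a ∷ b ∷ Uxyz → u ≡ β ⊎ PA u ⊎ PW u
          f (here r) = inj₂ (inj₁ (isa r))
          f (there (here r)) = inj₂ (inj₁ (isb r))
          f (there (there r)) = inj₂ (inj₂ (inV r))
   go (fs d) ku = g (d Fin.≟ c)
    where
    h : u ∈ α ∷ β ∷ γ ∷ δ ∷ [] → u ≡ β ⊎ PA u ⊎ PW u
    h (here r) = inj₂ (inj₁ (isα r))
    h (there (here r)) = inj₁ r
    h (there (there (here r))) = inj₂ (inj₁ (isγ r))
    h (there (there (there (here r)))) = inj₂ (inj₂ (isδ r))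
    g : Dec (d ≡ c) → u ≡ β ⊎ PA u ⊎ PW u
    g (yes refl) = h (l⇐ l4 ku)
    g (no ne) = inj₂ ([ inj₁ ∘ inA d ne , inj₂ ∘ inB d ne ]′ (∈-++⁻ (K33.A (fst (cls33 d ne))) (l⇐ (K33.l33 (fst (cls33 d ne))) ku)))

  Qd : ∀ d (ne : d ≢ c) → K33 κ d
  Qd d ne = fst (cls33 d ne)
  sQ : ∀ d (ne : d ≢ c) {v} → v ∈ Uxyz → SideA (Qd d ne) v
  sQ d ne = snd (cls33 d ne)

  same? : ∀ {P : Set} (d d' : Fin k') → (d ≡ d' → P) → (d' ≢ d → P) → P
  same? {P} d d' f g = go (d Fin.≟ d')
   where go : Dec (d ≡ d') → P
         go (yes r) = f r
         go (no r) = g (r ∘ sym)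

  VV : ∀ {u w} → u ∈ Uxyz → w ∈ Uxyz → u ≁ w
  VV i1 i1 = E-irr G _
  VV i1 i2 = O.xy
  VV i1 i3 = O.xz
  VV i2 i1 = nadj-sym O.xy
  VV i2 i2 = E-irr G _
  VV i2 i3 = O.yz
  VV i3 i1 = nadj-sym O.xz
  VV i3 i2 = nadj-sym O.yz
  VV i3 i3 = E-irr G _

  bf : ∀ d (ne : d ≢ c) {u} → u ∈ K33.B (Qd d ne) → BFact d u
  bf d ne = bfact ne (Qd d ne) (sQ d ne)
  af : ∀ d (ne : d ≢ c) {u} → u ∈ K33.A (Qd d ne) → AFact d u
  af d ne = afact ne (Qd d ne) (sQ d ne)
  sd : ∀ d (ne : d ≢ c) → SideB (Qd d ne) a × SideB (Qd d ne) b × SideB (Qd d ne) γ × SideA (Qd d ne) δ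
  sd d ne = F.sides ne (Qd d ne) (sQ d ne i3)
  sδ : ∀ d (ne : d ≢ c) → SideA (Qd d ne) δ
  sδ d ne = snd (snd (snd (sd d ne)))

  WW : ∀ {u w} → PW u → PW w → u ≁ w
  WW (inV p) (inV r) = VV p r
  WW (inV p) (isδ refl) = snd (snd (snd (s4 p)))
  WW (inV p) (inB d ne r) = snd (sQ d ne p) r
  WW (isδ refl) (inV p) = nadj-sym (snd (snd (snd (s4 p))))
  WW (isδ refl) (isδ refl) = E-irr G _
  WW (isδ refl) (inB d ne r) = snd (sδ d ne) r
  WW (inB d ne r) (inV p) = nadj-sym (snd (sQ d ne p) r)
  WW (inB d ne r) (isδ refl) = nadj-sym (snd (sδ d ne) r)
  WW (inB d ne p) (inB d' ne' r) = same? d d' (λ { refl → nadjB o (Qd d ne) p r }) (λ nd → snd (BFact.other (bf d ne p) ne' nd (Qd d' ne') (sQ d' ne' i3)) r)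

  AW : ∀ {u w} → PA u → PW w → u ~ w
  AW (isa refl) (inV r) = adj-sym (fst (rab R r))
  AW (isa refl) (isδ refl) = adj-sym F.δa
  AW (isa refl) (inB d ne r) = adj-sym (BFact.ua (bf d ne r))
  AW (isb refl) (inV r) = adj-sym (snd (rab R r))
  AW (isb refl) (isδ refl) = adj-sym F.δb
  AW (isb refl) (inB d ne r) = adj-sym (BFact.ub (bf d ne r))
  AW (isα refl) (inV r) = adj-sym (fst (s4 r))
  AW (isα refl) (isδ refl) = adj-sym δα
  AW (isα refl) (inB d ne r) = adj-sym (fst (BFact.onC (bf d ne r)))
  AW (isγ refl) (inV r) = adj-sym (fst (snd (snd (s4 r))))
  AW (isγ refl) (isδ refl) = γδ
  AW (isγ refl) (inB d ne r) = adj-sym (fst (snd (snd (BFact.onC (bf d ne r)))))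
  AW (inA d ne p) (inV r) = adj-sym (fst (sQ d ne r) p)
  AW (inA d ne p) (isδ refl) = adj-sym (AFact.δw (af d ne p))
  AW (inA d ne p) (inB d' ne' r) = same? d d' (λ { refl → K33.a33 (Qd d ne) p r }) (λ nd → adj-sym (fst (BFact.other (bf d' ne' r) ne (nd ∘ sym) (Qd d ne) (sQ d ne i3)) p))

  AA : ∀ {u w} → PA u → PA w → u ≁ w
  AA (isa refl) (isa refl) = E-irr G _
  AA (isa refl) (isb refl) = O.ab
  AA (isa refl) (isα refl) = F.aα
  AA (isa refl) (isγ refl) = F'.aα
  AA (isa refl) (inA d ne r) = snd (fst (sd d ne)) r
  AA (isb refl) (isa refl) = nadj-sym O.ab
  AA (isb refl) (isb refl) = E-irr G _
  AA (isb refl) (isα refl) = F.bα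
  AA (isb refl) (isγ refl) = F'.bα
  AA (isb refl) (inA d ne r) = snd (fst (snd (sd d ne))) r
  AA (isα refl) (isa refl) = nadj-sym F.aα
  AA (isα refl) (isb refl) = nadj-sym F.bα
  AA (isα refl) (isα refl) = E-irr G _
  AA (isα refl) (isγ refl) = αγ
  AA (isα refl) (inA d ne r) = nadj-sym (AFact.wα (af d ne r))
  AA (isγ refl) (isa refl) = nadj-sym F'.aα
  AA (isγ refl) (isb refl) = nadj-sym F'.bα
  AA (isγ refl) (isα refl) = nadj-sym αγ
  AA (isγ refl) (isγ refl) = E-irr G _
  AA (isγ refl) (inA d ne r) = nadj-sym (AFact.wγ (af d ne r))
  AA (inA d ne p) (isa refl) = nadj-sym (snd (fst (sd d ne)) p)
  AA (inA d ne p) (isb refl) = nadj-sym (snd (fst (snd (sd d ne))) p)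
  AA (inA d ne p) (isα refl) = AFact.wα (af d ne p)
  AA (inA d ne p) (isγ refl) = AFact.wγ (af d ne p)
  AA (inA d ne p) (inA d' ne' r) = same? d d' (λ { refl → nadjA o (Qd d ne) p r }) (λ nd → snd (AFact.other (af d ne p) ne' nd (Qd d' ne') (sQ d' ne' i3)) r)

  βall : ∀ {u} → u ≢ β → u ≡ β ⊎ PA u ⊎ PW u → β ~ u
  βall ne (inj₁ r) = ⊥-elim (ne r)
  βall _ (inj₂ (inj₁ (isa refl))) = adj-sym F.aβ
  βall _ (inj₂ (inj₁ (isb refl))) = adj-sym F.bβ
  βall _ (inj₂ (inj₁ (isα refl))) = adj-sym αβ
  βall _ (inj₂ (inj₁ (isγ refl))) = βγ
  βall _ (inj₂ (inj₁ (inA d ne r))) = adj-sym (AFact.wβ (af d ne r))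
  βall _ (inj₂ (inj₂ (inV r))) = adj-sym (fst (snd (s4 r)))
  βall _ (inj₂ (inj₂ (isδ refl))) = βδ
  βall _ (inj₂ (inj₂ (inB d ne r))) = adj-sym (fst (snd (BFact.onC (bf d ne r))))

  x∈ : PW x
  x∈ = inV i1

  result : D2
  result = β , x , x≢β , (λ u ne → βall ne (class u)) , (λ u w nu nw → go u w nu nw (class u) (class w)) , dx , nn
   where
   x≢β : x ≢ β
   x≢β refl = Fin.0≢1+n (sym O.kx ⨾ l⇒ l4 i2)
   go : ∀ u w → u ≢ β → w ≢ β → u ≡ β ⊎ PA u ⊎ PW u → w ≡ β ⊎ PA w ⊎ PW w → e u w ≡ e x u xor e x w
   go u w nu nw (inj₁ r) _ = ⊥-elim (nu r)
   go u w nu nw _ (inj₁ r) = ⊥-elim (nw r)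
   go u w _ _ (inj₂ (inj₁ p)) (inj₂ (inj₁ r)) = AA p r ⨾ sym (cong₂ _xor_ (adj-sym (AW p x∈)) (adj-sym (AW r x∈)))
   go u w _ _ (inj₂ (inj₁ p)) (inj₂ (inj₂ r)) = AW p r ⨾ sym (cong₂ _xor_ (adj-sym (AW p x∈)) (WW x∈ r))
   go u w _ _ (inj₂ (inj₂ p)) (inj₂ (inj₁ r)) = adj-sym (AW r p) ⨾ sym (cong₂ _xor_ (WW x∈ p) (adj-sym (AW r x∈)))
   go u w _ _ (inj₂ (inj₂ p)) (inj₂ (inj₂ r)) = WW p r ⨾ sym (cong₂ _xor_ (WW x∈ p) (WW x∈ r))
   dx : deg G x ≡ 3 * k' + 2
   dx = deg-split κ x ⨾ cong₂ _+_ (d-L (rl R) x ⨾ cong₂ _+_ (cong b2n O.xa) (cong₂ _+_ (cong b2n O.xb) (cong₂ _+_ (cong b2n (E-irr G x)) (cong₂ _+_ (cong b2n O.xy) (cong (λ t → b2n t + 0) O.xz)))))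
    (ΣF-cong O.Dx ⨾ ΣF-const k' 3) ⨾ +-comm 2 (3 * k')
   -- All classes but `c` have six vertices and `c` has four; together with the five of R this gives
   -- n = 6k - 3.
   NN : N κ + 6 ≡ 6 * k' + 4
   NN = ΣF-replace {f = λ d → size κ (fs d)} {g = λ _ → 6} c (λ d ne → size-L (K33.l33 (Qd d ne))) ⨾ cong₂ _+_ (ΣF-const k' 6) (size-L l4)
   nn : n ≡ 6 * k' + 3
   nn = +-cancelʳ-≡ 6 _ _ (cong (_+ 6) (sym (N+R κ) ⨾ cong (_+ N κ) (size-L (rl R))) ⨾ +-assoc 5 (N κ) 6 ⨾ cong (5 +_) NN ⨾ lem k')
    where lem : ∀ k → 5 + (6 * k + 4) ≡ 6 * k + 3 + 6
          lem = solve-∀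

 K23→D : ∀ {κ} → Opt κ → K23 κ → D1 ⊎ D2
 K23→D {κ} o (a , b , x , y , z , l , h) = go (choose (classify R))
  where
  R : R23 κ a b x y z
  R = mkR o l h
  go : (∀ c → S33 κ c x y z) ⊎ (Σ[ c ∈ Fin k' ] M4 κ c x y z) → D1 ⊎ D2
  go (inj₁ f) = inj₁ (K2s→D1 (mkK2s o {a} {b} {x ∷ y ∷ z ∷ []} l (λ m → fst (h m)) (λ m → snd (h m)) f) (s≤s (s≤s z≤n)))
  go (inj₂ (c , m)) = inj₂ (M4→D2.result R m)


 -- Assembly of the extremal choices

 U≤ : ∀ {l : List V} → Unique l → length l ≤ length (allFin n)
 U≤ u = U-⊆-length u (λ _ → ∈-allFin _)

 -- Fewest vertices in the classes means most in the remainder, so the four initial vertices of R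
 -- are never lost.
 size≥ : ∀ {κ κ'} → Config κ → Opt κ' → size κ fz ≤ size κ' fz
 size≥ {κ} {κ'} cf o = +-cancelʳ-≤ (N κ') _ _ (≤-trans (+-monoʳ-≤ (size κ fz) (minN o κ cf)) (≡⇒≤ (N+R κ ⨾ sym (N+R κ'))))

 PathIn HamIn : (V → K) × V × List V × V → Set
 PathIn (κ , p , P , q) = Opt κ × Walk p P q × Unique P × (∀ {x} → x ∈ P → κ x ≡ fz)
 HamIn (κ , p , P , q) = Opt κ × Walk p P q × Lst κ fz P

 finish : ∀ κ → Config κ → 4 ≤ size κ fz → (IsBip G k' ⊎ IsTri G k' → ⊥) → ⊥
 finish κ cf s4 kont = optimal κ cf λ κ₁ o₁ _ → start₁ κ₁ o₁ (some κ₁ (≤-trans (≤-trans (s≤s z≤n) s4) (size≥ cf o₁)))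
  where
  some : ∀ κ → 1 ≤ size κ fz → Σ[ r ∈ V ] κ r ≡ fz
  some κ h = go (cls κ fz) (l⇒ (cls-L κ fz)) h
   where go : ∀ l → (∀ {y} → y ∈ l → κ y ≡ fz) → 1 ≤ length l → Σ[ r ∈ V ] κ r ≡ fz
         go (r ∷ l) f _ = r , f i1
  ham : ∀ {κ p P q} → Walk p P q → HamP κ P → ⊥
  ham {κ} {P = P} w H = caseB w H (≤-trans (≤-trans s4 (size≥ cf (ho H))) (≡⇒≤ (size-L (hl H))))
   (λ c4 → kont (inj₁ (K2s→D1 (fst (C4-K2s H c4)) (snd (C4-K2s H c4))))) (λ k23 → kont (K23→D (ho H) k23))
  spanning : ∀ {κ p P q} → Opt κ → Walk p P q → Lst κ fz P → ⊥
  spanning o w l = maximal HamIn (λ (_ , _ , P , _) → eL P) (length (allFin n) * length (allFin n)) (λ (_ , _ , P , _) (_ , _ , l) → ≤-trans (eL≤² P) (*-mono-≤ (U≤ (lu l)) (U≤ (lu l))))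
   (_ , _ , _ , _) (o , w , l) λ (κ , p , P , q) (o , w , l) mx → ham w (mkHam o l (λ o' w' l' → mx (_ , _ , _ , _) (o' , w' , l')))
  longest : ∀ {κ p P q} → LongP κ p P q → ⊥
  longest {κ} {p} {P} {q} L = go (1 ≤? cntL (λ v → not (does (v ∈? P))) (cls κ fz))
   where
   out : ∀ {v} → not (does (v ∈? P)) ≡ true → v ∉ P
   out {v} h m = f (v ∈? P) h
    where f : (d : Dec (v ∈ P)) → not (does d) ≡ true → ⊥
          f (no nm) _ = nm m
          f (yes _) ()
   in' : ∀ {v} → not (does (v ∈? P)) ≡ false → v ∈ P
   in' {v} h = f (v ∈? P) h
    where f : (d : Dec (v ∈ P)) → not (does d) ≡ false → v ∈ P
          f (yes m) _ = m
          f (no _) ()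
   go : Dec (1 ≤ cntL (λ v → not (does (v ∈? P))) (cls κ fz)) → ⊥
   go (yes h) = off (cntL-any _ (cls κ fz) h) (w-head (lw L))
    where
    off : Σ[ r ∈ V ] (r ∈ cls κ fz × not (does (r ∈? P)) ≡ true) → Σ[ P' ∈ List V ] P ≡ p ∷ P' → ⊥
    off (r , m , h) (P' , refl) = Fin-A.caseA L (l⇒ (cls-L κ fz) m) (out h) (λ { (k , s3) → kont (inj₁ (K2s→D1 k (≤-trans (n≤1+n 2) s3))) })
   go (no h) = spanning (lo L) (lw L) (mkL (lU L) (lz L) (λ {v} kv → in' (cntL-zero⁻ (λ v → not (does (v ∈? P))) (cls κ fz) (n≤0⇒n≡0 (≤-pred (≰⇒> h))) (l⇐ (cls-L κ fz) kv))))
  start₁ : ∀ κ → Opt κ → Σ[ r ∈ V ] κ r ≡ fz → ⊥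
  start₁ κ o (r , kr) = maximal PathIn (λ (_ , _ , P , _) → length P) (length (allFin n)) (λ _ (_ , _ , u , _) → U≤ u)
   (κ , r , r ∷ [] , r) (o , one , uq1 , in1 {κ} kr) λ (κ , p , P , q) (o , w , u , z) mx → longest (mkLP o w u z (λ o' w' u' z' → mx (_ , _ , _ , _) (o' , w' , u' , z')))

-- Adding an edge, and the complete graph

module AddEdge {n : ℕ} (G : Graph n) (u v : Fin n) (u≢v : u ≢ v) where

 isuv : Fin n → Fin n → Bool
 isuv x y = (does (x Fin.≟ u) ∧ does (y Fin.≟ v)) ∨ (does (x Fin.≟ v) ∧ does (y Fin.≟ u))

 isuv-sym : ∀ x y → isuv x y ≡ isuv y x
 isuv-sym x y = cong₂ _∨_ (Bool.∧-comm (does (x Fin.≟ u)) (does (y Fin.≟ v))) (Bool.∧-comm (does (x Fin.≟ v)) (does (y Fin.≟ u)))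
  ⨾ Bool.∨-comm (does (y Fin.≟ v) ∧ does (x Fin.≟ u)) (does (y Fin.≟ u) ∧ does (x Fin.≟ v))

 isuv-off : ∀ {x y} → x ≢ u → y ≢ u → isuv x y ≡ false
 isuv-off {x} {y} hx hy = f (x Fin.≟ u) (y Fin.≟ u) (does (y Fin.≟ v)) (does (x Fin.≟ v))
  where f : (a : Dec (x ≡ u)) (b : Dec (y ≡ u)) → ∀ c d → (does a ∧ c) ∨ (d ∧ does b) ≡ false
        f (yes r) _ c d = ⊥-elim (hx r)
        f (no _) (yes r) c d = ⊥-elim (hy r)
        f (no _) (no _) c true = refl
        f (no _) (no _) c false = refl

 isuv-irr : ∀ x → isuv x x ≡ false
 isuv-irr x = f (x Fin.≟ u) (x Fin.≟ v)
  where f : (a : Dec (x ≡ u)) (b : Dec (x ≡ v)) → (does a ∧ does b) ∨ (does b ∧ does a) ≡ false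
        f (yes p) (yes q) = ⊥-elim (u≢v (sym p ⨾ q))
        f (yes _) (no _) = refl
        f (no _) (yes _) = refl
        f (no _) (no _) = refl

 isuv-uv : isuv u v ≡ true
 isuv-uv = f (u Fin.≟ u) (v Fin.≟ v) (does (u Fin.≟ v) ∧ does (v Fin.≟ u))
  where f : (a : Dec (u ≡ u)) (b : Dec (v ≡ v)) → ∀ c → (does a ∧ does b) ∨ c ≡ true
        f (yes _) (yes _) c = refl
        f (no h) _ c = ⊥-elim (h refl)
        f (yes _) (no h) c = ⊥-elim (h refl)

 G⁺ : Graph n
 G⁺ = record { E = λ x y → E G x y ∨ isuv x y ; E-sym = λ x y → cong₂ _∨_ (E-sym G x y) (isuv-sym x y) ; E-irr = λ x → cong₂ _∨_ (E-irr G x) (isuv-irr x) }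

 E⊆ : ∀ x y → E G x y ≡ true → E G⁺ x y ≡ true
 E⊆ x y h = cong (_∨ isuv x y) h

 E⁻ : ∀ x y → E G⁺ x y ≡ false → E G x y ≡ false
 E⁻ x y h = f (E G x y) h
  where f : ∀ a → a ∨ isuv x y ≡ false → a ≡ false
        f false h = refl

 E-off : ∀ {x y} → x ≢ u → y ≢ u → E G⁺ x y ≡ E G x y
 E-off {x} {y} hx hy = cong (E G x y ∨_) (isuv-off hx hy) ⨾ f (E G x y)
  where f : ∀ a → a ∨ false ≡ a
        f true = refl
        f false = refl

 E-uv : E G⁺ u v ≡ true
 E-uv = cong (E G u v ∨_) isuv-uv ⨾ f (E G u v)
  where f : ∀ a → a ∨ true ≡ true
        f true = refl
        f false = refl

 deg≤ : ∀ x → deg G x ≤ deg G⁺ x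
 deg≤ x = subst₂ _≤_ (sym (deg≡cnt G x)) (sym (deg≡cnt G⁺ x)) (cntL-mono (E G x) (E G⁺ x) (allFin n) (λ {y} _ h → E⊆ x y h))

 Ore⁺ : ∀ {k'} → Ore G k' → Ore G⁺ k'
 Ore⁺ σ x y ne h = ≤-trans (σ x y ne (E⁻ x y h)) (+-mono-≤ (deg≤ x) (deg≤ y))

 walk⁻ : ∀ {a l b} → Hub.Walk G⁺ a l b → (∀ {x} → x ∈ l → x ≢ u) → Hub.Walk G a l b
 walk⁻ Hub.one h = Hub.one
 walk⁻ (g Hub.∷ w) h = (sym (E-off (h i1) (h (there (Hub.w-head∈ G⁺ w)))) ⨾ g) Hub.∷ walk⁻ w (h ∘ there)

 -- A chorded cycle that avoids `u` does not use the new edge.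
 CC⁻ : (C : Hub.CC G⁺) → (∀ {x} → x ∈ Hub.CC.vs C → x ≢ u) → Σ[ C' ∈ Hub.CC G ] Hub.CC.vs C' ≡ Hub.CC.vs C
 CC⁻ C h = record { cwk = walk⁻ (Hub.CC.cwk C) (h ∘ there) ; cuq = Hub.CC.cuq C ; cnb = ≤-trans (Hub.CC.cnb C) (≡⇒≤ (cntL-cong _ _ (Hub.CC.Q C) (λ m → E-off (h i1) (h (there m))))) } , refl

cntL-strict : ∀ {A : Set} (p q : A → Bool) l → (∀ {x} → x ∈ l → p x ≡ true → q x ≡ true) → ∀ {x} → x ∈ l → p x ≡ false → q x ≡ true → suc (cntL p l) ≤ cntL q l
cntL-strict p q (x ∷ l) h i1 px qx = subst₂ (λ a b → suc (b2n a + cntL p l) ≤ b2n b + cntL q l) (sym px) (sym qx) (s≤s (cntL-mono p q l (h ∘ there)))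
cntL-strict p q (y ∷ l) h (there m) px qx = ≤-trans (≡⇒≤ (sym (+-suc (b2n (p y)) (cntL p l)))) (+-mono-≤ (subst₂ _≤_ (+-identityʳ _) (+-identityʳ _) (cntL-mono p q (y ∷ []) (λ { i1 → h i1 }))) (cntL-strict p q l (h ∘ there) m px qx))

cnt-not : ∀ {A : Set} (p : A → Bool) l → cntL p l + cntL (not ∘ p) l ≡ length l
cnt-not p [] = refl
cnt-not p (x ∷ l) = +-inter (b2n (p x)) (cntL p l) (b2n (not (p x))) (cntL (not ∘ p) l) ⨾ cong₂ _+_ (f (p x)) (cnt-not p l)
 where f : ∀ b → b2n b + b2n (not b) ≡ 1
       f true = refl
       f false = refl

length-allFin : ∀ n → length (allFin n) ≡ n
length-allFin n = length-tabulate {n = n} id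

module Complete {n : ℕ} (G : Graph n) {K : ℕ} (le : K * 4 ≤ n) (full : ∀ x y → x ≢ y → E G x y ≡ true) (c₀ : Fin K) where
 open Hub G

 -- Consecutive blocks of four vertices form K₄'s. Vertices beyond the blocks go to `c₀`, as a class
 -- may contain more than its cycle.
 decode : ∀ {y : V} → Dec (toℕ y < K * 4) → Fin K × Fin 4
 decode (yes h) = remQuot 4 (fromℕ< h)
 decode (no _) = c₀ , fz

 code : V → Fin K × Fin 4
 code y = decode {y} (suc (toℕ y) ≤? K * 4)

 f : Fin K → Fin 4 → V
 f c j = inject≤ (combine c j) le

 code-f : ∀ c j → code (f c j) ≡ (c , j)
 code-f c j = go (suc (toℕ (f c j)) ≤? K * 4)
  where
  eq : toℕ (f c j) ≡ toℕ (combine c j)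
  eq = Fin.toℕ-inject≤ (combine c j) le
  go : (h : Dec (toℕ (f c j) < K * 4)) → decode {f c j} h ≡ (c , j)
  go (yes h) = cong (remQuot 4) (Fin.toℕ-injective (Fin.toℕ-fromℕ< h ⨾ eq)) ⨾ Fin.remQuot-combine c j
  go (no h) = ⊥-elim (h (subst (_< K * 4) (sym eq) (Fin.toℕ<n (combine c j))))

 f-≢ : ∀ c {i j} → i ≢ j → f c i ≢ f c j
 f-≢ c {i} {j} ne q = ne (cong snd (sym (code-f c i) ⨾ cong code q ⨾ code-f c j))

 kcc : KCC (fst ∘ code)
 kcc c = mkCC {hub = f c fz} {Q = f c (fs fz) ∷ f c (fs (fs fz)) ∷ f c (fs (fs (fs fz))) ∷ []}
  (ad (λ ()) ∷ ad (λ ()) ∷ one) ((f-≢ c (λ ()) ∷ f-≢ c (λ ()) ∷ f-≢ c (λ ()) ∷ []) ∷ (f-≢ c (λ ()) ∷ f-≢ c (λ ()) ∷ []) ∷ (f-≢ c (λ ()) ∷ []) ∷ [] ∷ [])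
  (≡⇒≤ (sym (cong₂ _+_ (cong b2n (ad {fz} {fs fz} (λ ()))) (cong₂ _+_ (cong b2n (ad {fz} {fs (fs fz)} (λ ()))) (cong (λ t → b2n t + 0) (ad {fz} {fs (fs (fs fz))} (λ ())))))))
  , λ { i1 → cl fz ; i2 → cl (fs fz) ; i3 → cl (fs (fs fz)) ; i4 → cl (fs (fs (fs fz))) }
  where
  ad : ∀ {i j} → i ≢ j → (f c i) ~ (f c j)
  ad ne = full _ _ (f-≢ c ne)
  cl : ∀ j → fst (code (f c j)) ≡ c
  cl j = cong fst (code-f c j)

transpose-first : ∀ {m} (i j : Fin m) → PC.transpose i j i ≡ j
transpose-first i j = go (i Fin.≟ i)
 where go : Dec (i ≡ i) → PC.transpose i j i ≡ j
       go _ with i Fin.≟ i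
       ... | yes _ = refl
       ... | no h = ⊥-elim (h refl)

module Start {n : ℕ} (G : Graph n) (k' : ℕ) (1≤k : 1 ≤ k') (n≥ : 4 * suc k' ≤ n) (σ : Ore G k') (u v : Fin n) (u≢v : u ≢ v) (uv : E G u v ≡ false) where
 open AddEdge G u v u≢v

 -- the class through u is dissolved; the others do not use the new edge
 dissolve : NoKCC G k' → (c₀ : Fin k') → ∀ κ → Hub.KCC G⁺ κ → (IsBip G k' ⊎ IsTri G k' → ⊥) → ⊥
 dissolve noK c₀ κ kc kont = Main.finish (record { G = G ; k' = k' ; noK = noK ; σ = σ ; c₀ = c₀ }) κ₁ cf s4 kont
  where
  open Col G k' using (Config; size; cls; cls-L; l⇐)
  c = κ u
  κ₁ : Fin n → Fin (suc k')
  κ₁ = PC.transpose c fz ∘ κ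
  u0 : κ₁ u ≡ fz
  u0 = transpose-first c fz
  cf : Config κ₁
  cf d = fst r , λ m → col (cast∈ (snd r) m)
   where
   d' = PC.transpose fz c (fs d)
   col : ∀ {y} → y ∈ Hub.CC.vs (fst (kc d')) → κ₁ y ≡ fs d
   col m = cong (PC.transpose c fz) (snd (kc d') m) ⨾ PC.transpose-inverse c fz
   r = CC⁻ (fst (kc d')) (λ { m refl → Fin.0≢1+n (sym u0 ⨾ col m) })
  -- The vertices of the dissolved cycle stay in the remainder: a hub and at least three neighbours.
  s4 : 4 ≤ size κ₁ fz
  s4 = ≤-trans (s≤s (≤-trans (Hub.CC.cnb C) (cntL≤length (E G⁺ (Hub.CC.hub C)) (Hub.CC.Q C))))
   (U-⊆-length (Hub.CC.cuq C) (λ m → l⇐ (cls-L κ₁ fz) (cong (PC.transpose c fz) (snd (kc c) m) ⨾ u0)))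
   where C = fst (kc c)

 deg-less : ∀ {w} → w ≡ u ⊎ w ≡ v → suc (deg G w) ≤ deg G⁺ w
 deg-less (inj₁ refl) = subst₂ (λ a b → suc a ≤ b) (sym (deg≡cnt G u)) (sym (deg≡cnt G⁺ u)) (cntL-strict (E G u) (E G⁺ u) (allFin n) (λ {y} _ → E⊆ u y) (∈-allFin v) uv E-uv)
 deg-less (inj₂ refl) = subst₂ (λ a b → suc a ≤ b) (sym (deg≡cnt G v)) (sym (deg≡cnt G⁺ v)) (cntL-strict (E G v) (E G⁺ v) (allFin n) (λ {y} _ → E⊆ v y) (∈-allFin u) (E-sym G v u ⨾ uv) (E-sym G⁺ v u ⨾ E-uv))

 -- `w` and `t` have degree at most half of the required sum in the enlarged graph, and `w` loses
 -- the edge `uv`, so the pair violates the degree condition in `G`.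
 contra : ∀ {w t} → w ≡ u ⊎ w ≡ v → t ≢ w → E G⁺ w t ≡ false → deg G⁺ w ≤ 3 * k' + 2 → deg G⁺ t ≤ 3 * k' + 2 → ⊥
 contra {w} {t} h ne nwt dw dt = ar k' (deg G w) (deg G t) (σ w t (ne ∘ sym) (E⁻ w t nwt)) (≤-trans (deg-less h) dw) (≤-trans (deg≤ t) dt)
  where
  ar : ∀ k a b → 6 * k + 4 ≤ a + b → suc a ≤ 3 * k + 2 → b ≤ 3 * k + 2 → ⊥
  ar k a b h p q = <-irrefl refl (≤-trans (s≤s h) (≤-trans (+-mono-≤ p q) (≡⇒≤ (lem k))))
   where lem : ∀ k → (3 * k + 2) + (3 * k + 2) ≡ 6 * k + 4
         lem = solve-∀

 few : ∀ (p : Fin n → Bool) (l : List (Fin n)) → (∀ t → p t ≡ true → t ∉ l → ⊥) → cntL p (allFin n) ≤ length l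
 few p l h = ≤-trans (cntL-⊆' p (Uniq.allFin⁺ n) (λ {t} _ pt → g pt (t ∈? l))) (cntL≤length p l)
  where
  g : ∀ {t} → p t ≡ true → Dec (t ∈ l) → t ∈ l
  g pt (yes m) = m
  g {t} pt (no nm) = ⊥-elim (h t pt nm)

 not-f : ∀ {b} → not b ≡ true → b ≡ false
 not-f {false} h = refl

 -- One end of the new edge lies in the part of `y`, whose vertices have degree 3k - 1. Since n ≥
 -- 4k, this part has a second vertex, and `contra` applies.
 no-bip : IsBip G⁺ k' → ⊥
 no-bip (y , f , dy) = pick (E G⁺ y u) (E G⁺ y v) refl refl (sym (f u v) ⨾ E-uv)
  where
  χ = E G⁺ y
  cχ : cntL χ (allFin n) ≡ 3 * k' + 2
  cχ = sym (deg≡cnt G⁺ y) ⨾ dy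
  dW : ∀ {w} → χ w ≡ false → deg G⁺ w ≤ 3 * k' + 2
  dW {w} h = ≡⇒≤ (deg≡cnt G⁺ w ⨾ cntL-cong (E G⁺ w) χ (allFin n) (λ {t} _ → f w t ⨾ cong (_xor χ t) h) ⨾ cχ)
  at' : ∀ {w} → w ≡ u ⊎ w ≡ v → χ w ≡ false → ⊥
  at' {w} h cw = ar
   (few (not ∘ χ) (w ∷ []) (λ t ct nt → contra h (λ { refl → nt i1 }) (f w t ⨾ cong₂ _xor_ cw (not-f ct)) (dW cw) (dW (not-f ct))))
   where
   ar : cntL (not ∘ χ) (allFin n) ≤ 1 → ⊥
   ar h4 = <-irrefl refl (≤-trans (s≤s (≤-trans n≥ (≤-trans (≡⇒≤ (sym (length-allFin n) ⨾ sym (cnt-not χ (allFin n)))) (+-mono-≤ (≡⇒≤ cχ) h4)))) (lem k'))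
    where lem : ∀ k → suc ((3 * k + 2) + 1) ≤ 4 * suc k
          lem k = ≤-trans (≡⇒≤ (l1 k)) (≤-trans (m≤m+n (3 * k + 4) k) (≡⇒≤ (l2 k)))
           where l1 : ∀ k → suc ((3 * k + 2) + 1) ≡ 3 * k + 4
                 l1 = solve-∀
                 l2 : ∀ k → 3 * k + 4 + k ≡ 4 * suc k
                 l2 = solve-∀
  pick : ∀ a b → χ u ≡ a → χ v ≡ b → χ u xor χ v ≡ true → ⊥
  pick false b p q h = at' (inj₁ refl) p
  pick true false p q h = at' (inj₂ refl) q
  pick true true p q h = true≢false (sym h ⨾ cong₂ _xor_ p q)

 -- One end of the new edge differs from `z`. Its part contains another vertex, and both have degree
 -- at most 3k - 1, as `contra` needs.
 no-tri : IsTri G⁺ k' → ⊥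
 no-tri (z , y , y≢z , zall , f , dy , n≡) = pick (u Fin.≟ z)
  where
  χ = E G⁺ y
  cχ : cntL χ (allFin n) ≡ 3 * k' + 2
  cχ = sym (deg≡cnt G⁺ y) ⨾ dy
  χz : χ z ≡ true
  χz = E-sym G⁺ y z ⨾ zall y y≢z
  isz : Fin n → Bool
  isz t = does (t Fin.≟ z)
  z1 : cntL isz (allFin n) ≤ 1
  z1 = few isz (z ∷ []) (λ t h nt → g (t Fin.≟ z) h nt)
   where g : ∀ {t} (d : Dec (t ≡ z)) → does d ≡ true → t ∉ z ∷ [] → ⊥
         g (yes r) _ nt = nt (here r)
  len : length (allFin n) ≡ 6 * k' + 3
  len = length-allFin n ⨾ n≡
  dT : ∀ {w} → w ≢ z → deg G⁺ w ≤ 3 * k' + 2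
  dT {w} nw = ≤-trans (≡⇒≤ (deg≡cnt G⁺ w)) (go (χ w) refl)
   where
   go : ∀ b → χ w ≡ b → cntL (E G⁺ w) (allFin n) ≤ 3 * k' + 2
   go false cw = ≡⇒≤ (cntL-cong (E G⁺ w) χ (allFin n) (λ {t} _ → pt t (t Fin.≟ z)) ⨾ cχ)
    where
    pt : ∀ t → Dec (t ≡ z) → E G⁺ w t ≡ χ t
    pt t (yes refl) = E-sym G⁺ w z ⨾ zall w nw ⨾ sym χz
    pt t (no nt) = f w t nw nt ⨾ cong (_xor χ t) cw
   go true cw = ≤-trans (≤-trans (sum′ (allFin n)) (+-monoʳ-≤ (cntL (not ∘ χ) (allFin n)) z1)) (≡⇒≤ (cong (_+ 1) c' ⨾ lem k'))
    where
    lem : ∀ k → 3 * k + 1 + 1 ≡ 3 * k + 2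
    lem = solve-∀
    c' : cntL (not ∘ χ) (allFin n) ≡ 3 * k' + 1
    c' = +-cancelˡ-≡ (3 * k' + 2) _ _ (cong (_+ cntL (not ∘ χ) (allFin n)) (sym cχ) ⨾ cnt-not χ (allFin n) ⨾ len ⨾ l k')
     where l : ∀ k → 6 * k + 3 ≡ (3 * k + 2) + (3 * k + 1)
           l = solve-∀
    pt : ∀ t → b2n (E G⁺ w t) ≤ b2n (not (χ t)) + b2n (isz t)
    pt t = h (t Fin.≟ z)
     where h : (d : Dec (t ≡ z)) → b2n (E G⁺ w t) ≤ b2n (not (χ t)) + b2n (does d)
           h (yes _) = ≤-trans (b2n≤1 (E G⁺ w t)) (m≤n+m 1 (b2n (not (χ t))))
           h (no nt) = ≤-trans (≡⇒≤ (cong b2n (f w t nw nt ⨾ cong (_xor χ t) cw))) (m≤m+n _ 0)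
    sum′ : ∀ l → cntL (E G⁺ w) l ≤ cntL (not ∘ χ) l + cntL isz l
    sum′ [] = z≤n
    sum′ (t ∷ l) = ≤-trans (+-mono-≤ (pt t) (sum′ l)) (≡⇒≤ (+-inter (b2n (not (χ t))) (b2n (isz t)) _ _))
  at' : ∀ {w} → w ≡ u ⊎ w ≡ v → w ≢ z → ⊥
  at' {w} h nw = go (χ w) refl
   where
   other : ∀ t → t ≢ z → t ≢ w → χ t ≡ χ w → ⊥
   other t tz tw eq = contra h tw (f w t nw tz ⨾ cong (χ w xor_) eq ⨾ xx (χ w)) (dT nw) (dT tz)
    where xx : ∀ b → b xor b ≡ false
          xx true = refl
          xx false = refl
   go : ∀ b → χ w ≡ b → ⊥
   go false cw = <-irrefl refl (≤-trans (s≤s (≤-trans (≡⇒≤ (sym len ⨾ sym (cnt-not χ (allFin n)))) (+-mono-≤ (≡⇒≤ cχ)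
    (few (not ∘ χ) (w ∷ []) (λ t ct nt → other t (λ { refl → true≢false (sym χz ⨾ not-f ct) }) (λ { refl → nt i1 }) (not-f ct ⨾ sym cw)))))) (lem k' 1≤k))
    where lem : ∀ k → 1 ≤ k → suc ((3 * k + 2) + 1) ≤ 6 * k + 3
          lem (suc k) _ = ≤-trans (m≤m+n (suc ((3 * suc k + 2) + 1)) (3 * k + 2)) (≡⇒≤ (l k))
           where l : ∀ k → suc ((3 * suc k + 2) + 1) + (3 * k + 2) ≡ 6 * suc k + 3
                 l = solve-∀
   go true cw = <-irrefl refl (≤-trans (s≤s (≤-trans (≡⇒≤ (sym cχ)) (few χ (w ∷ z ∷ []) (λ t ct nt → other t (λ { refl → nt i2 }) (λ { refl → nt i1 }) (ct ⨾ sym cw))))) (lem k' 1≤k))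
    where lem : ∀ k → 1 ≤ k → 3 ≤ 3 * k + 2
          lem (suc k) _ = ≤-trans (m≤m+n 3 (3 * k + 2)) (≡⇒≤ (l k))
           where l : ∀ k → 3 + (3 * k + 2) ≡ 3 * suc k + 2
                 l = solve-∀
  pick : Dec (u ≡ z) → ⊥
  pick (no h) = at' (inj₁ refl) h
  pick (yes refl) = at' (inj₂ refl) (u≢v ∘ sym)

-- Adding the missing edges one by one leads to the complete graph; at the first graph with enough chorded cycles
-- one of them contains the new edge, and the others leave enough vertices.
structure : ∀ {n} k'' (L : List (Fin n × Fin n)) (G : Graph n) → 4 * suc (suc k'') ≤ n → Ore G (suc k'') → (∀ x y → x ≢ y → E G x y ≡ false → (x , y) ∈ L) →
 NoKCC G (suc k'') → (IsBip G (suc k'') ⊎ IsTri G (suc k'') → ⊥) → ⊥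
structure k'' [] G n≥ σ miss noK kont = noK _ (Complete.kcc G (≤-trans (≡⇒≤ (*-comm (suc (suc k'')) 4)) n≥) (λ x y ne → ¬f→t (λ h → none (miss x y ne h))) fz)
 where
 none : ∀ {A : Set} {x : A} → x ∈ [] → ⊥
 none ()
 ¬f→t : ∀ {b : Bool} → (b ≡ false → ⊥) → b ≡ true
 ¬f→t {true} h = refl
 ¬f→t {false} h = ⊥-elim (h refl)
structure k'' ((u , v) ∷ L) G n≥ σ miss noK kont = go (u Fin.≟ v) (E G u v) refl
 where
 rest : (u ≢ v → E G u v ≡ false → ⊥) → ∀ x y → x ≢ y → E G x y ≡ false → (x , y) ∈ L
 rest h x y ne xy = f (miss x y ne xy)
  where f : (x , y) ∈ (u , v) ∷ L → (x , y) ∈ L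
        f i1 = ⊥-elim (h ne xy)
        f (there m) = m
 go : Dec (u ≡ v) → ∀ b → E G u v ≡ b → ⊥
 go (yes q) _ _ = structure k'' L G n≥ σ (rest (λ ne _ → ne q)) noK kont
 go (no ne) true uv = structure k'' L G n≥ σ (rest (λ _ h → true≢false (sym uv ⨾ h))) noK kont
 -- The case distinction on k disjoint cycles in the enlarged graph is not decided but made under
 -- `⊥`. In the second case that graph would itself be one of the two exceptions, which the degree
 -- condition in `G` rules out.
 go (no ne) false uv = em⊥ (Σ[ κ ∈ (Fin _ → Fin (suc (suc k''))) ] Hub.KCC G⁺ κ) λ where
   (inj₁ (κ , kc)) → S.dissolve noK fz κ kc kont
   (inj₂ none) → structure k'' L G⁺ n≥ (Ore⁺ {suc k''} σ) miss⁺ (λ κ kc → none (κ , kc)) [ S.no-bip , S.no-tri ]′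
  where
  open AddEdge G u v ne
  module S = Start G (suc k'') (s≤s z≤n) n≥ σ u v ne uv
  miss⁺ : ∀ x y → x ≢ y → E G⁺ x y ≡ false → (x , y) ∈ L
  miss⁺ x y nxy h = f (miss x y nxy (E⁻ x y h))
   where f : (x , y) ∈ (u , v) ∷ L → (x , y) ∈ L
         f i1 = ⊥-elim (true≢false (sym E-uv ⨾ h))
         f (there m) = m

-- Decidability, and isomorphisms from enumerations

IsBip? : ∀ {n} (G : Graph n) k' → Dec (IsBip G k')
IsBip? G k' = Fin.any? λ y → Fin.all? (λ u → Fin.all? (λ w → E G u w Bool.≟ (E G y u xor E G y w))) ×-dec (deg G y ≟ 3 * k' + 2)

IsTri? : ∀ {n} (G : Graph n) k' → Dec (IsTri G k')
IsTri? {n} G k' = Fin.any? λ z → Fin.any? λ y → ¬? (y Fin.≟ z) ×-dec (Fin.all? (λ u → ¬? (u Fin.≟ z) →-dec (E G z u Bool.≟ true)) ×-dec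
 (Fin.all? (λ u → Fin.all? (λ w → ¬? (u Fin.≟ z) →-dec (¬? (w Fin.≟ z) →-dec (E G u w Bool.≟ (E G y u xor E G y w))))) ×-dec ((deg G y ≟ 3 * k' + 2) ×-dec (n ≟ 6 * k' + 3))))

if-yes : ∀ {P A : Set} (d : Dec P) {x y : A} → P → (if does d then x else y) ≡ x
if-yes (yes _) p = refl
if-yes (no h) p = ⊥-elim (h p)

if-no : ∀ {P A : Set} (d : Dec P) {x y : A} → ¬ P → (if does d then x else y) ≡ y
if-no (yes p) h = ⊥-elim (h p)
if-no (no _) h = refl

-- An enumeration of the vertices in the order of the parts is itself the isomorphism: a vertex goes
-- to its position.
enum-≅ : ∀ {n m} (G : Graph n) (L : List (Fin n)) → Unique L → (all : ∀ x → x ∈ L) → length L ≡ m → (col : ℕ → ℕ) →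
 (∀ (i j : Fin (length L)) → E G (lookup L i) (lookup L j) ≡ not (col (toℕ i) ≡ᵇ col (toℕ j))) → G ≅ multipartite {m} (λ x → col (toℕ x))
enum-≅ G L u all refl col ok = record
 { to = λ x → index (all x)
 ; from = lookup L
 ; to-from = λ y → Hub.lookup-inj G u _ _ (sym (lookup-index (all (lookup L y))))
 ; from-to = λ x → sym (lookup-index (all x))
 ; pres = λ x y → cong₂ (E G) (lookup-index (all x)) (lookup-index (all y)) ⨾ ok (index (all x)) (index (all y)) }

lookup-++ : ∀ {A : Set} (l m : List A) (i : Fin (length (l ++ m))) → (toℕ i < length l × lookup (l ++ m) i ∈ l) ⊎ (Σ[ j ∈ Fin (length m) ] (toℕ i ≡ length l + toℕ j × lookup (l ++ m) i ≡ lookup m j))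
lookup-++ [] m i = inj₂ (i , refl , refl)
lookup-++ (x ∷ l) m fz = inj₁ (s≤s z≤n , here refl)
lookup-++ (x ∷ l) m (fs i) = go (lookup-++ l m i)
 where
 go : (toℕ i < length l × lookup (l ++ m) i ∈ l) ⊎ (Σ[ j ∈ Fin (length m) ] (toℕ i ≡ length l + toℕ j × lookup (l ++ m) i ≡ lookup m j)) → _
 go (inj₁ (h , r)) = inj₁ (s≤s h , there r)
 go (inj₂ (j , h , r)) = inj₂ (j , cong suc h , r)

module _ {n : ℕ} where

 fl : (Fin n → Bool) → List (Fin n)
 fl p = filter (λ x → p x Bool.≟ true) (allFin n)

 fl-U : ∀ p → Unique (fl p)
 fl-U p = Uniq.filter⁺ (λ x → p x Bool.≟ true) (Uniq.allFin⁺ n)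

 fl-∈ : ∀ p {x} → x ∈ fl p → p x ≡ true
 fl-∈ p m = snd (∈-filter⁻ (λ x → p x Bool.≟ true) {xs = allFin n} m)

 fl-in : ∀ p {x} → p x ≡ true → x ∈ fl p
 fl-in p h = ∈-filter⁺ (λ x → p x Bool.≟ true) (∈-allFin _) h

 fl-length : ∀ p → length (fl p) ≡ cntL p (allFin n)
 fl-length p = go (allFin n)
  where
  go : ∀ l → length (filter (λ x → p x Bool.≟ true) l) ≡ cntL p l
  go [] = refl
  go (x ∷ l) = h (p x) refl
   where
   h : ∀ b → p x ≡ b → length (filter (λ x → p x Bool.≟ true) (x ∷ l)) ≡ b2n (p x) + cntL p l
   h true q = cong length (filter-cons-yes (λ x → p x Bool.≟ true) x l q) ⨾ cong suc (go l) ⨾ cong (λ b → b2n b + cntL p l) (sym q)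
   h false q = cong length (filter-cons-no (λ x → p x Bool.≟ true) x l (λ r → true≢false (sym r ⨾ q))) ⨾ go l ⨾ cong (λ b → b2n b + cntL p l) (sym q)

 U-all-length : ∀ {L : List (Fin n)} → Unique L → (∀ x → x ∈ L) → length L ≡ n
 U-all-length u all = Perm.↭-length (U-same-↭ u (Uniq.allFin⁺ n) (λ _ → ∈-allFin _) (λ {x} _ → all x)) ⨾ length-allFin n

 bound-by-index : ∀ (p : Fin n → Bool) (f : Fin n → ℕ) {s} → (∀ {x y} → f x ≡ f y → x ≡ y) → (∀ x → p x ≡ true → f x < s) → cntL p (allFin n) ≤ s
 bound-by-index p f {s} inj lt = ≤-trans (≡⇒≤ (sym (fl-length p) ⨾ sym (length-map f (fl p)))) (≤-trans (U-⊆-length (Uniq.map⁺ inj (fl-U p)) sub) (≡⇒≤ (length-upTo s)))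
  where sub : ∀ {a} → a ∈ map f (fl p) → a ∈ upTo s
        sub m with ∈-map⁻ f m
        ... | x , x∈ , refl = ∈-upTo⁺ (lt x (fl-∈ p x∈))

 disj-cnt : ∀ (p : Fin n → Bool) {k} (l : Fin k → List (Fin n)) → (∀ i → Unique (l i)) → (∀ i j → i ≢ j → ∀ {x} → x ∈ l i → x ∈ l j → ⊥) → ΣF (λ i → cntL p (l i)) ≤ cntL p (allFin n)
 disj-cnt p {k} l ul dj = ≤-trans (≡⇒≤ (sym (snd (snd (snd (cat k l ul dj)))))) (cntL-⊆ p (fst (snd (cat k l ul dj))) (λ _ → ∈-allFin _))
  where
  cat : ∀ k (l : Fin k → List (Fin n)) → (∀ i → Unique (l i)) → (∀ i j → i ≢ j → ∀ {x} → x ∈ l i → x ∈ l j → ⊥) →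
   Σ[ L ∈ List (Fin n) ] (Unique L × (∀ {x} → x ∈ L → Σ[ i ∈ Fin k ] x ∈ l i) × cntL p L ≡ ΣF (λ i → cntL p (l i)))
  cat zero l ul dj = [] , [] , (λ ()) , refl
  cat (suc k) l ul dj = go (cat k (l ∘ fs) (ul ∘ fs) (λ i j ne → dj (fs i) (fs j) (ne ∘ Fin.suc-injective)))
   where
   go : Σ[ L ∈ List (Fin n) ] (Unique L × (∀ {x} → x ∈ L → Σ[ i ∈ Fin k ] x ∈ l (fs i)) × cntL p L ≡ ΣF (λ i → cntL p (l (fs i)))) →
    Σ[ L ∈ List (Fin n) ] (Unique L × (∀ {x} → x ∈ L → Σ[ i ∈ Fin (suc k) ] x ∈ l i) × cntL p L ≡ ΣF (λ i → cntL p (l i)))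
   go (L , u , f , q) = l fz ++ L , U-++ (ul fz) u (λ a b → dj fz (fs (fst (f b))) (λ ()) a (snd (f b))) ,
    (λ {x} m → [ (λ r → fz , r) , (λ r → fs (fst (f r)) , snd (f r)) ]′ (∈-++⁻ (l fz) m)) , (cntL-++ p (l fz) L ⨾ cong (cntL p (l fz) +_) q)

true≢xor : ∀ a b → a ≡ true → a xor b ≡ true → b ≡ false
true≢xor true false refl h = refl

-- The two graphs have no k disjoint chorded cycles

-- In a bipartite graph a path alternates, so a chorded cycle has three vertices on each side.
module Bipartite {n : ℕ} (G : Graph n) (χ : Fin n → Bool) where
 open Hub G

 On : List V → Set
 On l = ∀ {x y} → x ∈ l → y ∈ l → e x y ≡ χ x xor χ y

 flip-χ : ∀ a b → a xor b ≡ true → b ≡ not a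
 flip-χ true false h = refl
 flip-χ false true h = refl

 alternate : ∀ {a Q b} → Walk a Q b → On Q → cntL χ Q ≤ b2n (χ a) + cntL (not ∘ χ) Q × cntL (not ∘ χ) Q ≤ b2n (not (χ a)) + cntL χ Q
 alternate {a} one on = +-monoʳ-≤ (b2n (χ a)) z≤n , +-monoʳ-≤ (b2n (not (χ a))) z≤n
 alternate {a} (_∷_ {b = a'} {l = Q} g w) on = +-monoʳ-≤ (b2n (χ a)) (≤-trans (fst r) (≡⇒≤ (cong (λ t → b2n t + cntL (not ∘ χ) Q) alt)))
  , +-monoʳ-≤ (b2n (not (χ a))) (≤-trans (snd r) (≡⇒≤ (cong (λ t → b2n t + cntL χ Q) (cong not alt ⨾ nn (χ a)))))
  where
  r = alternate w (λ p q → on (there p) (there q))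
  alt : χ a' ≡ not (χ a)
  alt = flip-χ (χ a) (χ a') (sym (on i1 (there (w-head∈ w))) ⨾ g)
  nn : ∀ b → not (not b) ≡ b
  nn true = refl
  nn false = refl

 cc≥3 : (C : CC) → On (vs C) → 3 ≤ cntL χ (vs C) × 3 ≤ cntL (not ∘ χ) (vs C)
 cc≥3 (mkCC {hub = h} {Q = Q} w u nb) on = go (χ h) refl
  where
  r = alternate w (λ p q → on (there p) (there q))
  nbr : ∀ {y} → y ∈ Q → h ~ y → χ h xor χ y ≡ true
  nbr m hy = sym (on i1 (there m)) ⨾ hy
  go : ∀ b → χ h ≡ b → 3 ≤ cntL χ (h ∷ Q) × 3 ≤ cntL (not ∘ χ) (h ∷ Q)
  go true q = ≤-trans (s≤s (≤-pred (≤-trans c3 (≤-trans (snd r) (+-monoˡ-≤ (cntL χ Q) (b2n≤1 _)))))) (≡⇒≤ (cong (λ t → b2n t + cntL χ Q) (sym q)))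
   , ≤-trans c3 (m≤n+m _ (b2n (not (χ h))))
   where c3 : 3 ≤ cntL (not ∘ χ) Q
         c3 = ≤-trans nb (cntL-mono (e h) (not ∘ χ) Q (λ {y} m hy → cong not (true≢xor (χ h) (χ y) q (nbr m hy))))
  go false q = ≤-trans c3 (m≤n+m _ (b2n (χ h)))
   , ≤-trans (s≤s (≤-pred (≤-trans c3 (≤-trans (fst r) (+-monoˡ-≤ (cntL (not ∘ χ) Q) (b2n≤1 _)))))) (≡⇒≤ (cong (λ t → b2n (not t) + cntL (not ∘ χ) Q) (sym q)))
   where c3 : 3 ≤ cntL χ Q
         c3 = ≤-trans nb (cntL-mono (e h) χ Q (λ {y} m hy → cong (_xor χ y) (sym q) ⨾ nbr m hy))

module Cycles {n k : ℕ} (G : Graph n) (has : HasDisjointChordedCycles G k) where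
 open Hub G
 abstract
  chordedCC : (C : ChordedCycle G) → Σ[ D ∈ CC ] (∀ {y} → y ∈ vs D → Σ[ i ∈ Fin (suc (m C)) ] y ≡ verts C i)
  chordedCC = fromChorded
 Cy : Fin k → CC
 Cy i = fst (chordedCC (fst has i))
 apart : ∀ i j → i ≢ j → ∀ {x} → x ∈ vs (Cy i) → x ∈ vs (Cy j) → ⊥
 apart i j ne p q = snd has i j ne (fst a) (fst b) (sym (snd a) ⨾ snd b)
  where a = snd (chordedCC (fst has i)) p
        b = snd (chordedCC (fst has j)) q
 total : ∀ p → ΣF (λ i → cntL p (vs (Cy i))) ≤ cntL p (allFin n)
 total p = disj-cnt p (λ i → vs (Cy i)) (λ i → cuq (Cy i)) apart

ΣF-lower : ∀ {m} {f : Fin m → ℕ} {K} → (∀ c → K ≤ f c) → K * m ≤ ΣF f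
ΣF-lower {m} {K = K} h = ≤-trans (≡⇒≤ (sym (ΣF-const m K))) (ΣF-mono h)

zero-one : ∀ b b' → let c = if b then 0 else 1 ; c' = if b' then 0 else 1 in not (c ≡ᵇ c') ≡ (c ≡ᵇ 0) xor (c' ≡ᵇ 0)
zero-one true true = refl
zero-one true false = refl
zero-one false true = refl
zero-one false false = refl

-- Each cycle takes three vertices of the part of size 3k - 1.
G₁-none : ∀ {n} (G : Graph n) k → 1 ≤ k → G ≅ G₁ n k → ¬ HasDisjointChordedCycles G k
G₁-none {n} G (suc k') _ iso has = <-irrefl {3 * suc k'} refl (≤-trans (s≤s (≤-trans (ΣF-lower {f = λ i → cntL χ (Hub.CC.vs (Cy i))} (λ i → fst (Bipartite.cc≥3 G χ (Cy i) (λ {x} {y} _ _ → on x y)))) (≤-trans (total χ) cχ))) ≤-refl)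
 where
 open _≅_ iso
 open Cycles G has
 s = 3 * suc k' ∸ 1
 b : Fin n → Bool
 b x = does (toℕ (to x) <? s)
 χ : Fin n → Bool
 χ x = (if b x then 0 else 1) ≡ᵇ 0
 on : ∀ x y → E G x y ≡ χ x xor χ y
 on x y = pres x y ⨾ zero-one (b x) (b y)
 cχ : cntL χ (allFin n) ≤ s
 cχ = bound-by-index χ (toℕ ∘ to) (λ {x} {y} h → sym (from-to x) ⨾ cong from (Fin.toℕ-injective h) ⨾ from-to y) (λ x h → g (toℕ (to x) <? s) h)
  where g : ∀ {a} (d : Dec (a < s)) → ((if does d then 0 else 1) ≡ᵇ 0) ≡ true → a < s
        g (yes r) _ = r

six₀ : ∀ k S → 6 * suc k ≤ S → S ≤ suc (6 * k + 2) → ⊥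
six₀ k S h1 h2 = absurd (+-cancelˡ-≤ (6 * k) 6 3 (≤-trans (≡⇒≤ (l1 k)) (≤-trans h1 (≤-trans h2 (≡⇒≤ (sym (+-suc (6 * k) 2)))))))
 where
 l1 : ∀ k → 6 * k + 6 ≡ 6 * suc k
 l1 = solve-∀
 absurd : 6 ≤ 3 → ⊥
 absurd (s≤s (s≤s (s≤s ())))

six₁ : ∀ k F H c → 6 * suc k ≤ H → 4 ≤ c → F + 6 ≡ H + c → F ≤ suc (6 * k + 2) → ⊥
six₁ k F H c h1 h2 q h3 = <-irrefl {9 + 6 * k} refl (≤-trans (≡⇒≤ (l1 k)) (≤-trans (+-mono-≤ h1 h2) (≤-trans (≡⇒≤ (sym q)) (≤-trans (+-monoˡ-≤ 6 h3) (≡⇒≤ (l2 k))))))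
 where
 l1 : ∀ k → suc (9 + 6 * k) ≡ 6 * suc k + 4
 l1 = solve-∀
 l2 : ∀ k → suc (6 * k + 2) + 6 ≡ 9 + 6 * k
 l2 = solve-∀

-- At most one cycle contains the apex, and the others lie in a bipartite graph and have six
-- vertices or more. So at least 6(k - 1) + 4 vertices would be needed, one more than there are.
G₂-none : ∀ {n} (G : Graph n) k → 1 ≤ k → G ≅ G₂ k → ¬ HasDisjointChordedCycles G k
G₂-none {n} G (suc k') _ iso has = go (choose (λ i → apex? i))
 where
 open _≅_ iso
 open Cycles G has
 k = suc k'
 s = 3 * k ∸ 2
 t = 6 * k ∸ 4
 col : ℕ → ℕ
 col a = if does (a <? s) then 0 else if does (a <? t) then 1 else 2
 at : Fin n → ℕ
 at x = toℕ (to x)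
 at-inj : ∀ {x y} → at x ≡ at y → x ≡ y
 at-inj {x} {y} h = sym (from-to x) ⨾ cong from (Fin.toℕ-injective h) ⨾ from-to y
 isz χ : Fin n → Bool
 isz x = not (does (at x <? t))
 χ x = col (at x) ≡ᵇ 0
 n≤ : n ≤ 6 * k ∸ 3
 n≤ = ≤-trans (≡⇒≤ (sym (length-allFin n) ⨾ length≡cnt (allFin n))) (bound-by-index (λ _ → true) at at-inj (λ x _ → Fin.toℕ<n (to x)))
 6k : ∀ k → 6 * suc k ≡ 4 + (6 * k + 2)
 6k = solve-∀
 t≡ : t ≡ 6 * k' + 2
 t≡ = cong (_∸ 4) (6k k')
 t+1 : 6 * k ∸ 3 ≡ suc t
 t+1 = cong (_∸ 3) (6k k') ⨾ cong suc (sym t≡)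
 z-uniq : ∀ {x y} → isz x ≡ true → isz y ≡ true → x ≡ y
 z-uniq {x} {y} p q = at-inj (top x p ⨾ sym (top y q))
  where
  g : ∀ {a} (d : Dec (a < t)) → not (does d) ≡ true → t ≤ a
  g (no h) _ = ≮⇒≥ h
  top : ∀ x → isz x ≡ true → at x ≡ t
  top x p = ≤-antisym (≤-pred (≤-trans (Fin.toℕ<n (to x)) (≡⇒≤ t+1))) (g (at x <? t) p)
 f : Fin k → ℕ
 f i = cntL (λ _ → true) (Hub.CC.vs (Cy i))
 f≥4 : ∀ i → 4 ≤ f i
 f≥4 i = ≤-trans (s≤s (≤-trans (Hub.CC.cnb (Cy i)) (cntL≤length _ (Hub.CC.Q (Cy i))))) (≡⇒≤ (length≡cnt (Hub.CC.vs (Cy i))))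
 flat-col : ∀ b b' c c' → b' ≡ true → c' ≡ true → let p = if b then 0 else if b' then 1 else 2 ; q = if c then 0 else if c' then 1 else 2 in
  not (p ≡ᵇ q) ≡ (p ≡ᵇ 0) xor (q ≡ᵇ 0)
 flat-col b _ c _ refl refl = zero-one b c
 f≥6 : ∀ i → (∀ {x} → x ∈ Hub.CC.vs (Cy i) → isz x ≡ false) → 6 ≤ f i
 f≥6 i h = ≤-trans (+-mono-≤ (fst r) (snd r)) (≡⇒≤ (cnt-not χ (Hub.CC.vs (Cy i)) ⨾ length≡cnt (Hub.CC.vs (Cy i))))
  where
  nn : ∀ {b} → not b ≡ false → b ≡ true
  nn {true} h = refl
  r = Bipartite.cc≥3 G χ (Cy i) (λ {x} {y} p q → pres x y ⨾ flat-col (does (at x <? s)) (does (at x <? t)) (does (at y <? s)) (does (at y <? t)) (nn (h p)) (nn (h q)))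
 apex? : ∀ i → (∀ {x} → x ∈ Hub.CC.vs (Cy i) → isz x ≡ false) ⊎ (Σ[ x ∈ Fin n ] (x ∈ Hub.CC.vs (Cy i) × isz x ≡ true))
 apex? i = g (1 ≤? cntL isz (Hub.CC.vs (Cy i)))
  where g : Dec (1 ≤ cntL isz (Hub.CC.vs (Cy i))) → (∀ {x} → x ∈ Hub.CC.vs (Cy i) → isz x ≡ false) ⊎ (Σ[ x ∈ Fin n ] (x ∈ Hub.CC.vs (Cy i) × isz x ≡ true))
        g (yes h) = inj₂ (cntL-any isz _ h)
        g (no h) = inj₁ (λ {x} → cntL-zero⁻ isz (Hub.CC.vs (Cy i)) (n≤0⇒n≡0 (≤-pred (≰⇒> h))))
 Σf≤ : ΣF f ≤ suc t
 Σf≤ = ≤-trans (total (λ _ → true)) (≤-trans (≡⇒≤ (sym (length≡cnt (allFin n)) ⨾ length-allFin n)) (≤-trans n≤ (≡⇒≤ t+1)))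
 go : (∀ i {x} → x ∈ Hub.CC.vs (Cy i) → isz x ≡ false) ⊎ (Σ[ i ∈ Fin k ] Σ[ x ∈ Fin n ] (x ∈ Hub.CC.vs (Cy i) × isz x ≡ true)) → ⊥
 go (inj₁ h) = six₀ k' (ΣF f) (ΣF-lower {f = f} {K = 6} (λ i → f≥6 i (h i))) (≤-trans Σf≤ (≡⇒≤ (cong suc t≡)))
 go (inj₂ (c , x , x∈ , zx)) = six₁ k' (ΣF f) (ΣF h) (f c) (ΣF-lower {f = h} {K = 6} h≥6) (f≥4 c) (cong (ΣF f +_) (sym hc) ⨾ ΣF-replace {f = f} {g = h} c hf) (≤-trans Σf≤ (≡⇒≤ (cong suc t≡)))
  where
  -- The cycle through the apex is counted as six, which makes the lower bound uniform; the
  -- correction by `f c` is made through `ΣF-replace`.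
  h : Fin k → ℕ
  h d = if does (d Fin.≟ c) then 6 else f d
  hc : h c ≡ 6
  hc = if-yes (c Fin.≟ c) refl
  hf : ∀ d → d ≢ c → f d ≡ h d
  hf d ne = sym (if-no (d Fin.≟ c) ne)
  h≥6 : ∀ d → 6 ≤ h d
  h≥6 d = g (d Fin.≟ c)
   where
   g : (r : Dec (d ≡ c)) → 6 ≤ (if does r then 6 else f d)
   g (yes _) = ≤-refl
   g (no ne) = f≥6 d (λ m → ¬t→f λ zy → apart d c ne m (subst (_∈ Hub.CC.vs (Cy c)) (z-uniq zx zy) x∈))

-- Isomorphisms with G₁ and G₂

3k-1 : ∀ k' → 3 * k' + 2 ≡ 3 * suc k' ∸ 1
3k-1 k' = sym (cong (_∸ 1) (l k'))
 where l : ∀ k → 3 * suc k ≡ 1 + (3 * k + 2)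
       l = solve-∀

3k-2 : ∀ k' → 3 * k' + 1 ≡ 3 * suc k' ∸ 2
3k-2 k' = sym (cong (_∸ 2) (l k'))
 where l : ∀ k → 3 * suc k ≡ 2 + (3 * k + 1)
       l = solve-∀

6k-2 : ∀ k' → 6 * k' + 4 ≡ 6 * suc k' ∸ 2
6k-2 k' = sym (cong (_∸ 2) (l k'))
 where l : ∀ k → 6 * suc k ≡ 2 + (6 * k + 4)
       l = solve-∀

6k-3 : ∀ k' → 6 * k' + 3 ≡ 6 * suc k' ∸ 3
6k-3 k' = sym (cong (_∸ 3) (l k'))
 where l : ∀ k → 6 * suc k ≡ 3 + (6 * k + 3)
       l = solve-∀

6k-4 : ∀ k' → (3 * k' + 1) + (3 * k' + 1) ≡ 6 * suc k' ∸ 4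
6k-4 k' = sym (cong (_∸ 4) (l k'))
 where l : ∀ k → 6 * suc k ≡ 4 + ((3 * k + 1) + (3 * k + 1))
       l = solve-∀

not-true : ∀ {b} → not b ≡ true → b ≡ false
not-true {false} h = refl

module FromBip {n : ℕ} (G : Graph n) (k' : ℕ) (σ : Ore G k') (y : Fin n) (f : ∀ u w → E G u w ≡ E G y u xor E G y w) (dy : deg G y ≡ 3 * k' + 2) where

 χ : Fin n → Bool
 χ = E G y
 lA lW L : List (Fin n)
 lA = fl χ
 lW = fl (not ∘ χ)
 L = lA ++ lW
 s = 3 * suc k' ∸ 1
 col : ℕ → ℕ
 col a = if does (a <? s) then 0 else 1

 lenA : length lA ≡ 3 * k' + 2
 lenA = fl-length χ ⨾ sym (deg≡cnt G y) ⨾ dy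

 uL : Unique L
 uL = U-++ (fl-U χ) (fl-U (not ∘ χ)) (λ p q → true≢false (sym (fl-∈ χ p) ⨾ not-true (fl-∈ (not ∘ χ) q)))

 all : ∀ x → x ∈ L
 all x = go (χ x) refl
  where go : ∀ b → χ x ≡ b → x ∈ L
        go true h = ∈-++⁺ˡ (fl-in χ h)
        go false h = ∈-++⁺ʳ lA (fl-in (not ∘ χ) (cong not h))

 side : ∀ (i : Fin (length L)) → (χ (lookup L i) ≡ true × col (toℕ i) ≡ 0) ⊎ (χ (lookup L i) ≡ false × col (toℕ i) ≡ 1)
 side i = go (lookup-++ lA lW i)
  where
  go : (toℕ i < length lA × lookup L i ∈ lA) ⊎ (Σ[ j ∈ Fin (length lW) ] (toℕ i ≡ length lA + toℕ j × lookup L i ≡ lookup lW j)) → _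
  go (inj₁ (h , m)) = inj₁ (fl-∈ χ m , if-yes (toℕ i <? s) (≤-trans h (≡⇒≤ (lenA ⨾ 3k-1 k'))))
  go (inj₂ (j , h , q)) = inj₂ (not-true (fl-∈ (not ∘ χ) (subst (_∈ lW) (sym q) (∈-lookup {xs = lW} j))) ,
   if-no (toℕ i <? s) (≤⇒≯ (≤-trans (≡⇒≤ (sym (3k-1 k') ⨾ sym lenA)) (≤-trans (m≤m+n _ (toℕ j)) (≡⇒≤ (sym h))))))

 iso : G ≅ G₁ n (suc k')
 iso = enum-≅ G L uL all (U-all-length uL all) col (λ i j → f _ _ ⨾ go (side i) (side j))
  where
  go : ∀ {p q a b} → (p ≡ true × a ≡ 0) ⊎ (p ≡ false × a ≡ 1) → (q ≡ true × b ≡ 0) ⊎ (q ≡ false × b ≡ 1) → p xor q ≡ not (a ≡ᵇ b)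
  go (inj₁ (refl , refl)) (inj₁ (refl , refl)) = refl
  go (inj₁ (refl , refl)) (inj₂ (refl , refl)) = refl
  go (inj₂ (refl , refl)) (inj₁ (refl , refl)) = refl
  go (inj₂ (refl , refl)) (inj₂ (refl , refl)) = refl

 degA : ∀ {x} → χ x ≡ true → deg G x ≡ cntL (not ∘ χ) (allFin n)
 degA {x} h = deg≡cnt G x ⨾ cntL-cong (E G x) (not ∘ χ) (allFin n) (λ {t} _ → f x t ⨾ cong (_xor χ t) h)

 -- Two vertices of the part of size 3k - 1 are nonadjacent, and their degrees are the size of the
 -- other part, which is therefore at least 3k - 1 too.
 size≥ : 6 * suc k' ∸ 2 ≤ n
 size≥ = go lA (fl-U χ) (fl-∈ χ) (≤-trans (m≤n+m 2 (3 * k')) (≡⇒≤ (sym lenA)))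
  where
  W = cntL (not ∘ χ) (allFin n)
  go : ∀ l → Unique l → (∀ {x} → x ∈ l → χ x ≡ true) → 2 ≤ length l → 6 * suc k' ∸ 2 ≤ n
  go (x ∷ []) u h (s≤s ())
  go (x ∷ x' ∷ l) ((ne ∷ _) ∷ _) h _ = ≤-trans (≡⇒≤ (sym (6k-2 k'))) (*-cancelˡ-≤ 2 (≤-trans (≡⇒≤ (l1 k')) (≤-trans (+-monoʳ-≤ (6 * k' + 4) big) (≡⇒≤ (l2 k' W ⨾ cong (2 *_) W+)))))
   where
   big : 6 * k' + 4 ≤ W + W
   big = ≤-trans (σ x x' ne (f x x' ⨾ cong₂ _xor_ (h i1) (h i2))) (≡⇒≤ (cong₂ _+_ (degA (h i1)) (degA (h i2))))
   W+ : (3 * k' + 2) + W ≡ n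
   W+ = cong (_+ W) (sym (sym (deg≡cnt G y) ⨾ dy)) ⨾ cnt-not χ (allFin n) ⨾ length-allFin n
   l1 : ∀ k → 2 * (6 * k + 4) ≡ (6 * k + 4) + (6 * k + 4)
   l1 = solve-∀
   l2 : ∀ k w → (6 * k + 4) + (w + w) ≡ 2 * ((3 * k + 2) + w)
   l2 = solve-∀

module FromTri {n : ℕ} (G : Graph n) (k' : ℕ) (z y : Fin n) (y≢z : y ≢ z) (zall : ∀ u → u ≢ z → E G z u ≡ true)
 (f : ∀ u w → u ≢ z → w ≢ z → E G u w ≡ E G y u xor E G y w) (dy : deg G y ≡ 3 * k' + 2) (n≡ : n ≡ 6 * k' + 3) where

 χ p : Fin n → Bool
 χ = E G y
 p t = χ t ∧ not (does (t Fin.≟ z))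
 lA lW L : List (Fin n)
 lA = fl p
 lW = fl (not ∘ χ)
 -- The parts other than z have equal size 3k - 2; z comes last because its index in G₂ is the
 -- largest.
 L = lW ++ (lA ++ z ∷ [])
 s = 3 * suc k' ∸ 2
 t = 6 * suc k' ∸ 4
 col : ℕ → ℕ
 col a = if does (a <? s) then 0 else if does (a <? t) then 1 else 2

 χz : χ z ≡ true
 χz = E-sym G y z ⨾ zall y y≢z

 p-≢ : ∀ {x} → p x ≡ true → x ≢ z
 p-≢ {x} h q = g (x Fin.≟ z) (∧-r {χ x} h)
  where g : (d : Dec (x ≡ z)) → not (does d) ≡ true → ⊥
        g (yes _) ()
        g (no ne) _ = ne q

 W-≢ : ∀ {x} → not (χ x) ≡ true → x ≢ z
 W-≢ h refl = true≢false (sym χz ⨾ not-true h)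

 uL : Unique L
 uL = U-++ (fl-U (not ∘ χ)) (U-++ (fl-U p) ([] ∷ []) (λ { m i1 → p-≢ (fl-∈ p m) refl })) (λ a b → [ (λ r → true≢false (sym (∧-l (fl-∈ p r)) ⨾ not-true (fl-∈ (not ∘ χ) a))) , (λ { i1 → W-≢ (fl-∈ (not ∘ χ) a) refl }) ]′ (∈-++⁻ lA b))

 all : ∀ x → x ∈ L
 all x = go (χ x) refl (x Fin.≟ z) refl
  where
  go : ∀ b → χ x ≡ b → (d : Dec (x ≡ z)) → d ≡ (x Fin.≟ z) → x ∈ L
  go false h _ _ = ∈-++⁺ˡ (fl-in (not ∘ χ) (cong not h))
  go true h (yes refl) _ = ∈-++⁺ʳ lW (∈-++⁺ʳ lA i1)
  go true h (no ne) q = ∈-++⁺ʳ lW (∈-++⁺ˡ (fl-in p (∧-i h (cong (not ∘ does) (sym q)))))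

 lenL : length L ≡ 6 * k' + 3
 lenL = U-all-length uL all ⨾ n≡

 lenW : length lW ≡ 3 * k' + 1
 lenW = fl-length (not ∘ χ) ⨾ +-cancelˡ-≡ (3 * k' + 2) _ _ (cong (_+ cntL (not ∘ χ) (allFin n)) (sym (sym (deg≡cnt G y) ⨾ dy)) ⨾ cnt-not χ (allFin n) ⨾ length-allFin n ⨾ n≡ ⨾ l k')
  where l : ∀ k → 6 * k + 3 ≡ (3 * k + 2) + (3 * k + 1)
        l = solve-∀

 lenA : length lA ≡ 3 * k' + 1
 lenA = +-cancelʳ-≡ 1 _ _ (sym (length-++ lA) ⨾ +-cancelˡ-≡ (3 * k' + 1) _ _ (cong (_+ length (lA ++ z ∷ [])) (sym lenW) ⨾ sym (length-++ lW) ⨾ lenL ⨾ l k'))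
  where l : ∀ k → 6 * k + 3 ≡ (3 * k + 1) + (3 * k + 1 + 1)
        l = solve-∀

 data Side (x : Fin n) (c : ℕ) : Set where
  inW : χ x ≡ false → x ≢ z → c ≡ 0 → Side x c
  inA : χ x ≡ true → x ≢ z → c ≡ 1 → Side x c
  top : x ≡ z → c ≡ 2 → Side x c

 side : ∀ (i : Fin (length L)) → Side (lookup L i) (col (toℕ i))
 side i = go (lookup-++ lW (lA ++ z ∷ []) i)
  where
  ≥s : ∀ {j : ℕ} → toℕ i ≡ length lW + j → ¬ (toℕ i < s)
  ≥s {j} h = ≤⇒≯ (≤-trans (≡⇒≤ (sym (3k-2 k') ⨾ sym lenW)) (≤-trans (m≤m+n _ j) (≡⇒≤ (sym h))))
  go : (toℕ i < length lW × lookup L i ∈ lW) ⊎ (Σ[ j ∈ Fin (length (lA ++ z ∷ [])) ] (toℕ i ≡ length lW + toℕ j × lookup L i ≡ lookup (lA ++ z ∷ []) j)) → Side (lookup L i) (col (toℕ i))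
  go (inj₁ (h , m)) = inW (not-true (fl-∈ (not ∘ χ) m)) (W-≢ (fl-∈ (not ∘ χ) m)) (if-yes (toℕ i <? s) (≤-trans h (≡⇒≤ (lenW ⨾ 3k-2 k'))))
  go (inj₂ (j , h , q)) = go' (lookup-++ lA (z ∷ []) j)
   where
   go' : (toℕ j < length lA × lookup (lA ++ z ∷ []) j ∈ lA) ⊎ (Σ[ l ∈ Fin 1 ] (toℕ j ≡ length lA + toℕ l × lookup (lA ++ z ∷ []) j ≡ lookup (z ∷ []) l)) → Side (lookup L i) (col (toℕ i))
   go' (inj₁ (h' , m)) = inA (∧-l (fl-∈ p m')) (p-≢ (fl-∈ p m')) (if-no (toℕ i <? s) (≥s h) ⨾ if-yes (toℕ i <? t) (≤-trans (s≤s (≡⇒≤ h)) (≤-trans (≡⇒≤ (sym (+-suc _ _))) (≤-trans (+-mono-≤ (≡⇒≤ lenW) (≤-trans h' (≡⇒≤ lenA))) (≡⇒≤ (6k-4 k'))))))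
    where m' : lookup L i ∈ lA
          m' = subst (_∈ lA) (sym q) m
   go' (inj₂ (fz , h' , q')) = top (q ⨾ q') (if-no (toℕ i <? s) (≥s h) ⨾ if-no (toℕ i <? t) (≤⇒≯ (≡⇒≤ (sym (h ⨾ cong₂ _+_ lenW (h' ⨾ +-identityʳ _ ⨾ lenA) ⨾ 6k-4 k')))))

 iso : G ≅ G₂ (suc k')
 iso = enum-≅ G L uL all (lenL ⨾ 6k-3 k') col (λ i j → go (side i) (side j))
  where
  xr : ∀ {x x' b b'} → x ≢ z → x' ≢ z → χ x ≡ b → χ x' ≡ b' → E G x x' ≡ b xor b'
  xr nx nx' p q = f _ _ nx nx' ⨾ cong₂ _xor_ p q
  go : ∀ {x x' c c'} → Side x c → Side x' c' → E G x x' ≡ not (c ≡ᵇ c')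
  go (inW p nx refl) (inW q nx' refl) = xr nx nx' p q
  go (inW p nx refl) (inA q nx' refl) = xr nx nx' p q
  go (inA p nx refl) (inW q nx' refl) = xr nx nx' p q
  go (inA p nx refl) (inA q nx' refl) = xr nx nx' p q
  go (top refl refl) (inW q nx' refl) = zall _ nx'
  go (top refl refl) (inA q nx' refl) = zall _ nx'
  go (inW p nx refl) (top refl refl) = E-sym G _ z ⨾ zall _ nx
  go (inA p nx refl) (top refl refl) = E-sym G _ z ⨾ zall _ nx
  go (top refl refl) (top refl refl) = E-irr G z

theorem9 : (k n : ℕ) → 2 ≤ k → 4 * k ≤ n → (G : Graph n) → σ₂≥ G (6 * k ∸ 2) →
 ((¬ HasDisjointChordedCycles G k) ⇔ ((6 * k ∸ 2 ≤ n × G ≅ G₁ n k) ⊎ G ≅ G₂ k))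
theorem9 (suc (suc k'')) n (s≤s (s≤s z≤n)) n≥ G σ = mk⇔ forward [ (λ r → G₁-none G k (s≤s z≤n) (snd r)) , G₂-none G k (s≤s z≤n) ]′
 where
 k k' : ℕ
 k = suc (suc k'')
 k' = suc k''
 σ' : Ore G k'
 σ' x y ne xy = ≤-trans (≡⇒≤ (6k-2 k')) (σ x y ne xy)
 forward : ¬ HasDisjointChordedCycles G k → (6 * k ∸ 2 ≤ n × G ≅ G₁ n k) ⊎ G ≅ G₂ k
 forward none = go (decidable-stable (IsBip? G k' ⊎-dec IsTri? G k') (structure k'' (cartesianProduct (allFin n) (allFin n)) G n≥ σ'
  (λ x y _ _ → ∈-cartesianProduct⁺ (∈-allFin x) (∈-allFin y)) (λ κ kc → none (Hub.KCC→Has G kc))))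
  where
  go : IsBip G k' ⊎ IsTri G k' → (6 * k ∸ 2 ≤ n × G ≅ G₁ n k) ⊎ G ≅ G₂ k
  go (inj₁ (y , f , dy)) = inj₁ (FromBip.size≥ G k' σ' y f dy , FromBip.iso G k' σ' y f dy)
  go (inj₂ (z , y , yz , zall , f , dy , n≡)) = inj₂ (FromTri.iso G k' z y yz zall f dy n≡)
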